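{- Modulo $11$ (coefficientwise): \begin{align*} T^{C}_{2,0}\equiv T^{C}_{4,0}\equiv T^{C}_{6,0}\equiv T^{C}_{8,0}&\equiv 0,\\ T^{C}_{2,1}\equiv T^{C}_{4,1}\equiv T^{C}_{6,1}\equiv T^{C}_{8,1}&\equiv 2\tfrac{J_{11}^2P_5}{P_2P_3},\\ 7T^{C}_{2,2}\equiv 10T^{C}_{4,2}\equiv 8T^{C}_{6,2}\equiv 2T^{C}_{8,2}&\equiv \tfrac{J_{11}^2P_3}{P_1P_4},\\ 8T^{C}_{2,3}\equiv 7T^{C}_{4,3}\equiv 2T^{C}_{6,3}\equiv 10T^{C}_{8,3}&\equiv \tfrac{J_{11}^2P_2}{P_1P_3},\\ 8T^{C}_{2,4}\equiv 9T^{C}_{4,4}\equiv 3T^{C}_{6,4}\equiv 6T^{C}_{8,4}&\equiv \tfrac{J_{11}^2}{P_2},\\ 3T^{C}_{2,5}\equiv 2T^{C}_{4,5}\equiv 8T^{C}_{6,5}\equiv 5T^{C}_{8,5}&\equiv \tfrac{J_{11}^2P_4}{P_2P_5},\\ T^{C}_{2,7}\equiv 7T^{C}_{4,7}\equiv 10T^{C}_{6,7}\equiv 5T^{C}_{8,7}&\equiv \tfrac{J_{11}^2}{P_3},\\ 7T^{C}_{2,8}\equiv 9T^{C}_{4,8}\equiv 9T^{C}_{6,8}\equiv 7T^{C}_{8,8}&\equiv \tfrac{qJ_{11}^2P_1}{P_4P_5},\\ T^{C}_{2,9}\equiv 9T^{C}_{4,9}\equiv 4T^{C}_{6,9}\equiv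 3T^{C}_{8,9}&\equiv \tfrac{J_{11}^2}{P_4},\\ 3T^{C}_{2,10}\equiv 4T^{C}_{4,10}\equiv 9T^{C}_{6,10}\equiv T^{C}_{8,10}&\equiv \tfrac{J_{11}^2}{P_5}. \end{align*}
   Context: The crank of a partition $\pi$: let $\lambda(\pi)$ be its largest part, $\omega(\pi)$ its number of parts equal to $1$, $\mu(\pi)$ its number of parts larger than $\omega(\pi)$; the crank is $\lambda(\pi)$ if $\omega(\pi)=0$ and $\mu(\pi)-\omega(\pi)$ otherwise. For $n\ge2$, $M(m,n)$ is the number of partitions of $n$ with crank $m$; for $n\le1$ set $M(0,0)=1$, $M(0,1)=-1$, $M(1,1)=M(-1,1)=1$, $M(m,n)=0$ otherwise. For even $k\ge2$, $M_k(n):=\sum_{m\in\mathbb Z}m^kM(m,n)$ and $T^C_{k,r}(q):=\sum_{n\ge0}M_k(11n+r)q^n$. $(x;q)_\infty=\prod_{i\ge0}(1-xq^i)$; $J_{a,m}:=(q^a;q^m)_\infty(q^{m-a};q^m)_\infty(q^m;q^m)_\infty$, $J_m:=(q^m;q^m)_\infty$, $P_i:=J_{i,11}$. -}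

module Defs where

open import Data.Nat as ℕ using (ℕ; zero; suc; _≥_; _≟_; _<?_; _∸_; _⊔_; z≤n; s≤s)
import Data.Nat.Properties as ℕₚ
open import Data.Integer as ℤ using (ℤ; +_; -[1+_]; -_; _⊖_; ∣_∣)
import Data.Integer.Properties as ℤₚ
open import Data.Integer.Divisibility using (_∣_)
open import Data.Fin using (Fin; zero; suc; toℕ)
import Data.Fin.Properties as Finₚ
open import Data.Vec as Vec using (Vec; []; _∷_; lookup)
open import Data.List using (List; []; _∷_; _++_; map; filter; foldr; length)
open import Data.Nat.ListAction using (sum)
open import Data.List.Properties using (filter-none; length-filter; ∷-injective)
open import Data.List.Membership.Propositional using (_∈_)
open import Data.List.Membership.Propositional.Properties
  using (∈-map⁺; ∈-map⁻; ∈-++⁺ˡ; ∈-++⁺ʳ; ∈-++⁻; ∈-filter⁺; ∈-filter⁻)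
open import Data.List.Relation.Unary.Any using (here)
open import Data.List.Relation.Unary.All as All using (All; []; _∷_)
open import Data.List.Relation.Unary.AllPairs using ([]; _∷_)
open import Data.List.Relation.Unary.Linked using (Linked; linked?)
open import Data.List.Relation.Unary.Unique.Propositional using (Unique)
import Data.List.Relation.Unary.Unique.Propositional.Properties as Uniqueₚ
open import Data.Product using (_×_; _,_; proj₂)
open import Data.Sum using (inj₁; inj₂)
open import Data.Bool using (if_then_else_)
open import Function using (_∘_)
open import Relation.Nullary using (does; ¬_)
open import Relation.Nullary.Decidable using (dec-false)
open import Relation.Binary.PropositionalEquality hiding (J)
open import Algebra.Properties.CommutativeMonoid.Sum ℤₚ.+-0-commutativeMonoid
  using (sum-syntax; sum-cong-≗; sum-replicate-zero)

IsComposition : ℕ → List ℕ → Set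
IsComposition n ps = All (0 ℕ.<_) ps × sum ps ≡ n

IsPartition : ℕ → List ℕ → Set
IsPartition n ps = Linked _≥_ ps × IsComposition n ps

incrementHead : List ℕ → List ℕ
incrementHead []       = []
incrementHead (p ∷ ps) = suc p ∷ ps

-- A composition of n ≥ 2 either starts with 1, or arises by incrementing the
-- first part of a composition of n - 1.
compositions : ℕ → List (List ℕ)
compositions 0             = [] ∷ []
compositions 1             = (1 ∷ []) ∷ []
compositions (suc (suc n)) =
  map (1 ∷_) (compositions (suc n)) ++ map incrementHead (compositions (suc n))

-- By ∈-partitions⁻, ∈-partitions⁺ and partitions-unique below, partitions n
-- lists every partition of n exactly once.
partitions : ℕ → List (List ℕ)
partitions n = filter (linked? ℕₚ._≥?_) (compositions n)

largestPart : List ℕ → ℕ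
largestPart = foldr _⊔_ 0

ω : List ℕ → ℕ
ω ps = length (filter (_≟ 1) ps)

μ : List ℕ → ℕ
μ ps = length (filter (ω ps <?_) ps)

crankFrom : (largest ones larger : ℕ) → ℤ
crankFrom l zero      u = + l
crankFrom l w@(suc _) u = u ⊖ w

crank : List ℕ → ℤ
crank ps = crankFrom (largestPart ps) (ω ps) (μ ps)

M : ℤ → ℕ → ℤ
M m          n@(suc (suc _)) = + length (filter (λ ps → crank ps ℤ.≟ m) (partitions n))
M (+ 0)      0               = + 1
M _          0               = + 0
M (+ 0)      1               = - (+ 1)
M (+ 1)      1               = + 1
M (-[1+ 0 ]) 1               = + 1
M _          1               = + 0

-- The sum over m ∈ ℤ is taken over -n ≤ m ≤ n, which contains the support of
-- M(·,n) by M-support below.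
Mₖ : ℕ → ℕ → ℤ
Mₖ k n = ∑[ i < suc (n ℕ.+ n) ] ((toℕ i ⊖ n) ℤ.^ k ℤ.* M (toℕ i ⊖ n) n)

-- Formal power series in q over ℤ, given by their coefficients.
Series : Set
Series = ℕ → ℤ

0ₛ : Series
0ₛ _ = + 0

q^_ : ℕ → Series
(q^ e) n = if does (n ≟ e) then + 1 else + 0

infix  9 q^_
infixl 7 _⊛_ _⊘_
infixr 7 _·_
infixl 6 _⊝_

_⊝_ : Series → Series → Series
(f ⊝ g) n = f n ℤ.- g n

_·_ : ℤ → Series → Series
(c · f) n = c ℤ.* f n

_⊛_ : Series → Series → Series
(f ⊛ g) n = ∑[ i < suc n ] (f (toℕ i) ℤ.* g (n ∸ toℕ i))

-- The coefficients n, n-1, …, 0, in this order, of 1/f for f with constant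
-- term 1.
invCoeffs : Series → (n : ℕ) → Vec ℤ (suc n)
invCoeffs f zero    = + 1 ∷ []
invCoeffs f (suc n) =
  - (∑[ i < suc n ] (f (suc (toℕ i)) ℤ.* lookup (invCoeffs f n) i)) ∷ invCoeffs f n

inv : Series → Series
inv f n = Vec.head (invCoeffs f n)

-- Meaningful only when g has constant term 1; see ⊛-inv below.
_⊘_ : Series → Series → Series
f ⊘ g = f ⊛ inv g

∏< : ℕ → (ℕ → Series) → Series
∏< zero    F = q^ 0
∏< (suc N) F = F N ⊛ ∏< N F

-- poch a m is (q^a; q^m)_∞ for a, m ≥ 1.  The factors with i > n do not affect
-- the coefficient of q^n, so it is read off from a finite product; see
-- poch-stable below.
pochFactor : ℕ → ℕ → ℕ → Series
pochFactor a m i = q^ 0 ⊝ q^ (a ℕ.+ i ℕ.* m)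

poch : ℕ → ℕ → Series
poch a m n = ∏< (suc n) (pochFactor a m) n

J : ℕ → ℕ → Series
J a m = poch a m ⊛ poch (m ∸ a) m ⊛ poch m m

J∞ : ℕ → Series
J∞ m = poch m m

P : ℕ → Series
P i = J i 11

J₁₁² : Series
J₁₁² = J∞ 11 ⊛ J∞ 11

Tᶜ : ℕ → ℕ → Series
Tᶜ k r n = Mₖ k (11 ℕ.* n ℕ.+ r)

CongruentMod : ℤ → Series → Series → Set
CongruentMod m f g = ∀ n → m ∣ (f n ℤ.- g n)

-- f₁ ≡ f₂ ≡ … ≡ fₖ (mod 11)
Chain₁₁ : List Series → Set
Chain₁₁ = Linked (CongruentMod (+ 11))

private
  cons-1 : ∀ {n ps} → IsComposition n ps → IsComposition (suc n) (1 ∷ ps)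
  cons-1 (pos , eq) = s≤s z≤n ∷ pos , cong suc eq

  increment : ∀ {n ps} → IsComposition (suc n) ps →
              IsComposition (suc (suc n)) (incrementHead ps)
  increment {ps = _ ∷ _} (_ ∷ pos , eq) = s≤s z≤n ∷ pos , cong suc eq

  ∈-step⁻ : ∀ {n} css → (∀ {qs} → qs ∈ css → IsComposition (suc n) qs) →
            ∀ {ps} → ps ∈ map (1 ∷_) css ++ map incrementHead css →
            IsComposition (suc (suc n)) ps
  ∈-step⁻ css ih ps∈ with ∈-++⁻ (map (1 ∷_) css) ps∈
  ... | inj₁ p with ∈-map⁻ (1 ∷_) p
  ...   | _ , qs∈ , refl = cons-1 (ih qs∈)
  ∈-step⁻ css ih ps∈ | inj₂ p with ∈-map⁻ incrementHead p
  ...   | _ , qs∈ , refl = increment (ih qs∈)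

  ∈-compositions⁻ : ∀ n {ps} → ps ∈ compositions n → IsComposition n ps
  ∈-compositions⁻ 0 (here refl) = [] , refl
  ∈-compositions⁻ 1 (here refl) = s≤s z≤n ∷ [] , refl
  ∈-compositions⁻ (suc (suc n)) =
    ∈-step⁻ (compositions (suc n)) (∈-compositions⁻ (suc n))

  ∈-compositions⁺ : ∀ n {ps} → IsComposition n ps → ps ∈ compositions n
  ∈-compositions⁺ 0 {[]} _ = here refl
  ∈-compositions⁺ 0 {suc _ ∷ _} (_ , ())
  ∈-compositions⁺ 0 {zero ∷ _} (() ∷ _ , _)
  ∈-compositions⁺ 1 {[]} (_ , ())
  ∈-compositions⁺ 1 {zero ∷ _} (() ∷ _ , _)
  ∈-compositions⁺ 1 {1 ∷ []} _ = here refl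
  ∈-compositions⁺ 1 {1 ∷ zero ∷ _} (_ ∷ () ∷ _ , _)
  ∈-compositions⁺ 1 {1 ∷ suc _ ∷ _} (_ , ())
  ∈-compositions⁺ 1 {suc (suc _) ∷ _} (_ , ())
  ∈-compositions⁺ (suc (suc n)) {[]} (_ , ())
  ∈-compositions⁺ (suc (suc n)) {zero ∷ _} (() ∷ _ , _)
  ∈-compositions⁺ (suc (suc n)) {1 ∷ ps} (_ ∷ pos , eq) =
    ∈-++⁺ˡ (∈-map⁺ (1 ∷_) (∈-compositions⁺ (suc n) (pos , ℕₚ.suc-injective eq)))
  ∈-compositions⁺ (suc (suc n)) {suc (suc p) ∷ ps} (_ ∷ pos , eq) =
    ∈-++⁺ʳ (map (1 ∷_) (compositions (suc n)))
      (∈-map⁺ incrementHead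
        (∈-compositions⁺ (suc n) {suc p ∷ ps} (s≤s z≤n ∷ pos , ℕₚ.suc-injective eq)))

  incrementHead-injective : ∀ {ps qs} → incrementHead ps ≡ incrementHead qs → ps ≡ qs
  incrementHead-injective {[]}    {[]}    _    = refl
  incrementHead-injective {_ ∷ _} {_ ∷ _} refl = refl

  compositions-unique : ∀ n → Unique (compositions n)
  compositions-unique 0 = [] ∷ []
  compositions-unique 1 = [] ∷ []
  compositions-unique (suc (suc n)) =
    Uniqueₚ.++⁺ (Uniqueₚ.map⁺ (proj₂ ∘ ∷-injective) (compositions-unique (suc n)))
                (Uniqueₚ.map⁺ incrementHead-injective (compositions-unique (suc n)))
                disjoint
    where
    disjoint : ∀ {ps} → ¬ (ps ∈ map (1 ∷_) (compositions (suc n)) ×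
                           ps ∈ map incrementHead (compositions (suc n)))
    disjoint (p , q) with ∈-map⁻ (1 ∷_) p | ∈-map⁻ incrementHead q
    ... | _ , _ , refl | (zero ∷ _) , q∈ , refl with ∈-compositions⁻ (suc n) q∈
    ...   | () ∷ _ , _

∈-partitions⁻ : ∀ n {ps} → ps ∈ partitions n → IsPartition n ps
∈-partitions⁻ n ps∈ with ∈-filter⁻ (linked? ℕₚ._≥?_) {xs = compositions n} ps∈
... | c∈ , dec = dec , ∈-compositions⁻ n c∈

∈-partitions⁺ : ∀ n {ps} → IsPartition n ps → ps ∈ partitions n
∈-partitions⁺ n (dec , c) = ∈-filter⁺ (linked? ℕₚ._≥?_) (∈-compositions⁺ n c) dec

partitions-unique : ∀ n → Unique (partitions n)
partitions-unique n = Uniqueₚ.filter⁺ (linked? ℕₚ._≥?_) (compositions-unique n)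

private
  largestPart≤sum : ∀ ps → largestPart ps ℕ.≤ sum ps
  largestPart≤sum []       = z≤n
  largestPart≤sum (p ∷ ps) =
    ℕₚ.⊔-lub (ℕₚ.m≤m+n p _) (ℕₚ.≤-trans (largestPart≤sum ps) (ℕₚ.m≤n+m _ p))

  length≤sum : ∀ {ps} → All (0 ℕ.<_) ps → length ps ℕ.≤ sum ps
  length≤sum []          = z≤n
  length≤sum (0<p ∷ pos) = ℕₚ.+-mono-≤ 0<p (length≤sum pos)

  crankFrom-bound : ∀ {l w u n} → l ℕ.≤ n → w ℕ.≤ n → u ℕ.≤ n → ∣ crankFrom l w u ∣ ℕ.≤ n
  crankFrom-bound {w = zero}          l≤n _   _   = l≤n
  crankFrom-bound {w = w@(suc _)} {u} _   w≤n u≤n =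
    ℕₚ.≤-trans (ℤₚ.∣m⊝n∣≤m⊔n u w) (ℕₚ.⊔-lub u≤n w≤n)

crank-bound : ∀ {n ps} → IsPartition n ps → ∣ crank ps ∣ ℕ.≤ n
crank-bound {ps = ps} (_ , pos , refl) = crankFrom-bound
  (largestPart≤sum ps)
  (ℕₚ.≤-trans (length-filter (_≟ 1) ps) (length≤sum pos))
  (ℕₚ.≤-trans (length-filter (ω ps <?_) ps) (length≤sum pos))

M-support : ∀ m n → n ℕ.< ∣ m ∣ → M m n ≡ + 0
M-support m n@(suc (suc _)) n<∣m∣ =
  cong (+_ ∘ length) (filter-none (λ ps → crank ps ℤ.≟ m) (All.tabulate ≢m))
  where
  ≢m : ∀ {ps} → ps ∈ partitions n → ¬ (crank ps ≡ m)
  ≢m ps∈ refl = ℕₚ.<⇒≱ n<∣m∣ (crank-bound (∈-partitions⁻ n ps∈))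
M-support (+ suc _)       0 _ = refl
M-support -[1+ _ ]        0 _ = refl
M-support (+ suc (suc _)) 1 _ = refl
M-support (+ 1)           1 (s≤s ())
M-support -[1+ suc _ ]    1 _ = refl
M-support -[1+ 0 ]        1 (s≤s ())

private
  lookup-invCoeffs : ∀ f n (i : Fin (suc n)) → lookup (invCoeffs f n) i ≡ inv f (n ∸ toℕ i)
  lookup-invCoeffs f zero    zero    = refl
  lookup-invCoeffs f (suc n) zero    = refl
  lookup-invCoeffs f (suc n) (suc i) = lookup-invCoeffs f n i

⊛-inv : ∀ f → f 0 ≡ + 1 → ∀ n → (f ⊛ inv f) n ≡ (q^ 0) n
⊛-inv f f0 zero rewrite f0 = refl
⊛-inv f f0 (suc n) rewrite f0 = begin
  + 1 ℤ.* - s ℤ.+ s′  ≡⟨ cong₂ ℤ._+_ (ℤₚ.*-identityˡ (- s)) (sym s≡s′) ⟩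
  - s ℤ.+ s           ≡⟨ ℤₚ.+-inverseˡ s ⟩
  + 0                 ∎
  where
  open ≡-Reasoning
  s  = ∑[ i < suc n ] (f (suc (toℕ i)) ℤ.* lookup (invCoeffs f n) i)
  s′ = ∑[ i < suc n ] (f (suc (toℕ i)) ℤ.* inv f (n ∸ toℕ i))
  s≡s′ : s ≡ s′
  s≡s′ = sum-cong-≗ {suc n} (λ i → cong (f (suc (toℕ i)) ℤ.*_) (lookup-invCoeffs f n i))

private
  q^-off : ∀ {n e} → n ≢ e → (q^ e) n ≡ + 0
  q^-off {n} {e} n≢e rewrite dec-false (n ≟ e) n≢e = refl

  1-q^e-⊛ : ∀ e g n → n ℕ.< e → ((q^ 0 ⊝ q^ e) ⊛ g) n ≡ g n
  1-q^e-⊛ e g n n<e = begin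
    h 0 ℤ.* g n ℤ.+ (∑[ i < n ] (h (suc (toℕ i)) ℤ.* g (n ∸ suc (toℕ i))))
      ≡⟨ cong₂ ℤ._+_ (cong (ℤ._* g n) h0) tail≡0 ⟩
    + 1 ℤ.* g n ℤ.+ + 0
      ≡⟨ ℤₚ.+-identityʳ _ ⟩
    + 1 ℤ.* g n
      ≡⟨ ℤₚ.*-identityˡ (g n) ⟩
    g n ∎
    where
    open ≡-Reasoning
    h = q^ 0 ⊝ q^ e
    h0 : h 0 ≡ + 1
    h0 = cong (λ x → + 1 ℤ.- x) (q^-off (ℕₚ.<⇒≢ (ℕₚ.≤-<-trans z≤n n<e)))
    h-suc : ∀ (i : Fin n) → h (suc (toℕ i)) ≡ + 0
    h-suc i = cong (λ x → + 0 ℤ.- x)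
      (q^-off (ℕₚ.<⇒≢ (ℕₚ.≤-<-trans (Finₚ.toℕ<n i) n<e)))
    tail≡0 : (∑[ i < n ] (h (suc (toℕ i)) ℤ.* g (n ∸ suc (toℕ i)))) ≡ + 0
    tail≡0 = trans (sum-cong-≗ {n} (λ i → cong (ℤ._* g (n ∸ suc (toℕ i))) (h-suc i)))
                   (sum-replicate-zero n)

poch-stable : ∀ a m → 1 ℕ.≤ a → 1 ℕ.≤ m → ∀ n d →
              ∏< (d ℕ.+ suc n) (pochFactor a m) n ≡ poch a m n
poch-stable a m 1≤a 1≤m n zero    = refl
poch-stable a m 1≤a 1≤m n (suc d) =
  trans (1-q^e-⊛ (a ℕ.+ i ℕ.* m) (∏< i (pochFactor a m)) n n<e)
        (poch-stable a m 1≤a 1≤m n d)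
  where
  i = d ℕ.+ suc n
  n<e : n ℕ.< a ℕ.+ i ℕ.* m
  n<e = ℕₚ.≤-trans (ℕₚ.m≤n+m (suc n) d)
       (ℕₚ.≤-trans (ℕₚ.≤-reflexive (sym (ℕₚ.*-identityʳ i)))
       (ℕₚ.≤-trans (ℕₚ.*-monoʳ-≤ i 1≤m) (ℕₚ.m≤n+m (i ℕ.* m) a)))

P-constant : ∀ {i} → 1 ℕ.≤ i → i ℕ.≤ 5 → P i 0 ≡ + 1
P-constant {1} _ _ = refl
P-constant {2} _ _ = refl
P-constant {3} _ _ = refl
P-constant {4} _ _ = refl
P-constant {5} _ _ = refl
P-constant {suc (suc (suc (suc (suc (suc _)))))} _ (s≤s (s≤s (s≤s (s≤s (s≤s ())))))

{-# OPTIONS --safe #-}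
module Submission where

-- Work in ℤ[x]/(x¹¹ - 1).  The crank generating function is
-- ∏ (1 - qᵏ) / ((1 - x qᵏ) (1 - x⁻¹ qᵏ)); after multiplication by ∏ (1 - q¹¹ᵏ), the identity
-- (1 - x) ∏_{t < 11} (1 - xᵗ y) = (1 - x) (1 - y¹¹) turns it, up to a factor
-- D = (1 - x⁵) (1 - x²) (1 - x⁷) (1 - x³), into a product of theta functions to which Winquist's
-- identity applies.  Winquist's identity writes it as a 2×2 determinant of theta series in one
-- variable; splitting these by the residue modulo 11 of the summation index and expanding the
-- determinant leaves ten 2×2 determinants, one for each residue r ≠ 6 of the exponent of q.  By
-- Winquist's identity in base q¹²¹, read backwards, each of them is again an infinite product in q¹¹,
-- and its coefficient is x² D uᵣ for an explicit uᵣ.  The annihilator of x² D consists of the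
-- multiples of 1 + x + ⋯ + x¹⁰, which the moments f ↦ ∑ cᵏ f_c with k = 2, 4, 6, 8 send to 0
-- modulo 11, while they send the crank generating function to the crank moments.  Hence, modulo 11,
-- (q; q)_∞ T_{k,r} is the k-th moment of uᵣ times an explicit product, and dividing by (q; q)_∞
-- gives the theta quotients.

open import Algebra.Bundles using (CommutativeRing)
open import Data.Integer as ℤ using (ℤ; +_; -[1+_]; ∣_∣; _⊖_)
import Data.Integer.Properties as ℤₚ
open import Data.List using (List)
open import Data.Nat as ℕ using (ℕ; zero; suc; _≤_; _<_; z≤n; s≤s)
import Data.Nat.Properties as ℕₚ
open import Data.Product using (_×_; _,_; proj₁; proj₂)
open import Data.Vec as Vec using (Vec; []; _∷_)
open import Level using (0ℓ)
open import Relation.Binary.PropositionalEquality as ≡ using (_≡_)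
open import Relation.Nullary using (Dec; yes; no; ¬_; does; contradiction)

-- The points x⁵ and x² of Winquist's identity are chosen so that its four theta functions carry
-- x^±5, x^±2, x^±7 and x^±3; modulo 11 these are all nonzero exponents except ±1. The missing ±1
-- are the denominators of the crank product, and the exponent 0 comes from (q; q)_∞, so that all
-- eleven factors 1 - xᵗ y become available. The obstacle that shapes the proof is that the moments
-- are additive but not multiplicative. On ℤ[x]/(x¹¹ - 1) they are honest linear maps, whereas a
-- primitive root of unity would carry them only modulo 11. The price is zero divisors: x² D cannot
-- be cancelled, and its annihilator has to be determined. For the same reason products in q are
-- finally applied as sequences of shifts and subtractions, which commute with every additive map.
-- Limits are avoided: q is nilpotent, q^(N+1) = 0, so an infinite product is a finite one with
-- enough factors, and negative powers are replaced by auxiliary variables such as w = q / v².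

module RingSolver where
  open import Algebra.Bundles using (RawRing)
  open import Algebra.Solver.Ring.AlmostCommutativeRing using (AlmostCommutativeRing; fromCommutativeRing; _-Raw-AlmostCommutative⟶_)
  open import Data.Maybe using (Maybe; just; nothing)

  -- Coefficients are taken in ℤ and sent to R by `fromℤ`: equality of integers is decidable, so
  -- numerals cancel during normalisation although R itself has no decidable equality.
  module IntegerCoefficients (R : CommutativeRing 0ℓ 0ℓ) where
    open CommutativeRing R
    open import Algebra.Properties.Ring ring
    open import Algebra.Properties.Semiring.Mult.TCOptimised semiring using (×-homo-+; ×1-homo-*; 1+×) renaming (_×_ to _·_)
    open import Relation.Binary.Reasoning.Setoid setoid

    fromℤ : ℤ → Carrier
    fromℤ (+ n)    = n · 1#
    fromℤ -[1+ n ] = - (suc n · 1#)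

    fromℤ-⊖ : ∀ m n → fromℤ (m ⊖ n) ≈ m · 1# - n · 1#
    fromℤ-⊖ zero    zero    = sym (-‿inverseʳ 0#)
    fromℤ-⊖ zero    (suc n) = sym (+-identityˡ _)
    fromℤ-⊖ (suc m) zero    = sym (trans (+-congˡ -0#≈0#) (+-identityʳ _))
    fromℤ-⊖ (suc m) (suc n) = begin
      fromℤ (suc m ⊖ suc n)               ≡⟨ ≡.cong fromℤ (ℤₚ.[1+m]⊖[1+n]≡m⊖n m n) ⟩
      fromℤ (m ⊖ n)                       ≈⟨ fromℤ-⊖ m n ⟩
      a - b                               ≈⟨ +-congʳ (sym (trans (+-congʳ (-‿inverseʳ 1#)) (+-identityˡ a))) ⟩
      ((1# - 1#) + a) - b                 ≈⟨ +-congʳ (trans (+-assoc 1# (- 1#) a) (trans (+-congˡ (+-comm (- 1#) a)) (sym (+-assoc 1# a (- 1#))))) ⟩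
      ((1# + a) - 1#) - b                 ≈⟨ +-assoc _ _ _ ⟩
      (1# + a) + (- 1# - b)               ≈⟨ +-congˡ (-‿+-comm 1# b) ⟩
      (1# + a) - (1# + b)                 ≈⟨ +-cong (1+× m 1#) (-‿cong (1+× n 1#)) ⟨
      suc m · 1# - suc n · 1#             ∎
      where
      a = m · 1#
      b = n · 1#

    fromℤ-neg : ∀ i → fromℤ (ℤ.- i) ≈ - fromℤ i
    fromℤ-neg (+ zero)  = sym -0#≈0#
    fromℤ-neg (+ suc n) = refl
    fromℤ-neg -[1+ n ]  = sym (-‿involutive _)

    fromℤ-+ : ∀ i j → fromℤ (i ℤ.+ j) ≈ fromℤ i + fromℤ j
    fromℤ-+ (+ m)    (+ n)    = ×-homo-+ 1# m n
    fromℤ-+ (+ m)    -[1+ n ] = fromℤ-⊖ m (suc n)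
    fromℤ-+ -[1+ m ] (+ n)    = trans (fromℤ-⊖ n (suc m)) (+-comm _ _)
    fromℤ-+ -[1+ m ] -[1+ n ] = begin
      - (suc (suc (m ℕ.+ n)) · 1#)       ≡⟨ ≡.cong (λ k → - (suc k · 1#)) (ℕₚ.+-suc m n) ⟨
      - ((suc m ℕ.+ suc n) · 1#)         ≈⟨ -‿cong (×-homo-+ 1# (suc m) (suc n)) ⟩
      - (suc m · 1# + suc n · 1#)        ≈⟨ -‿+-comm _ _ ⟨
      - (suc m · 1#) - (suc n · 1#)      ∎

    fromℤ-*⁺ : ∀ i n → fromℤ (i ℤ.* + n) ≈ fromℤ i * (n · 1#)
    fromℤ-*⁺ (+ m) n = trans (reflexive (≡.cong fromℤ (≡.sym (ℤₚ.pos-* m n)))) (×1-homo-* m n)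
    fromℤ-*⁺ -[1+ m ] n = begin
      fromℤ (ℤ.- (+ suc m) ℤ.* + n)   ≡⟨ ≡.cong fromℤ (ℤₚ.neg-distribˡ-* (+ suc m) (+ n)) ⟨
      fromℤ (ℤ.- (+ suc m ℤ.* + n))   ≈⟨ fromℤ-neg (+ suc m ℤ.* + n) ⟩
      - fromℤ (+ suc m ℤ.* + n)       ≈⟨ -‿cong (fromℤ-*⁺ (+ suc m) n) ⟩
      - (suc m · 1# * (n · 1#))       ≈⟨ -‿distribˡ-* _ _ ⟩
      - (suc m · 1#) * (n · 1#)       ∎

    fromℤ-* : ∀ i j → fromℤ (i ℤ.* j) ≈ fromℤ i * fromℤ j
    fromℤ-* i (+ n) = fromℤ-*⁺ i n
    fromℤ-* i -[1+ n ] = begin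
      fromℤ (i ℤ.* ℤ.- (+ suc n))  ≡⟨ ≡.cong fromℤ (ℤₚ.neg-distribʳ-* i (+ suc n)) ⟨
      fromℤ (ℤ.- (i ℤ.* + suc n))  ≈⟨ fromℤ-neg (i ℤ.* + suc n) ⟩
      - fromℤ (i ℤ.* + suc n)      ≈⟨ -‿cong (fromℤ-*⁺ i (suc n)) ⟩
      - (fromℤ i * (suc n · 1#))   ≈⟨ -‿distribʳ-* _ _ ⟩
      fromℤ i * - (suc n · 1#)     ∎

    almostRing : AlmostCommutativeRing 0ℓ 0ℓ
    almostRing = fromCommutativeRing R

    ℤ-raw : RawRing 0ℓ 0ℓ
    ℤ-raw = record { _≈_ = _≡_ ; _+_ = ℤ._+_ ; _*_ = ℤ._*_ ; -_ = ℤ.-_ ; 0# = + 0 ; 1# = + 1 }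

    morphism : ℤ-raw -Raw-AlmostCommutative⟶ almostRing
    morphism = record
      { ⟦_⟧ = fromℤ ; +-homo = fromℤ-+ ; *-homo = fromℤ-* ; -‿homo = fromℤ-neg
      ; 0-homo = refl ; 1-homo = refl }

    _coeff≟_ : ∀ i j → Maybe (fromℤ i ≈ fromℤ j)
    i coeff≟ j with i ℤ.≟ j
    ... | yes i≡j = just (reflexive (≡.cong fromℤ i≡j))
    ... | no _    = nothing

    open import Algebra.Solver.Ring ℤ-raw almostRing morphism _coeff≟_ public
      using (Polynomial; solve; con; _:=_; _:+_; _:*_; _:-_; :-_; _:^_)

open RingSolver

-- Finite sums over lists and bilateral sums of bounded support.

module FiniteSums where
  open import Data.Fin using (Fin)
  import Data.Fin.Properties as Finₚ
  open import Data.List using ([]; _∷_; _++_; map; foldr; filter; upTo; allFin; cartesianProduct)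
  open import Data.List.Membership.Propositional using (_∈_; _∉_)
  open import Data.List.Membership.Propositional.Properties using (∈-map⁺; ∈-map⁻; ∈-++⁺ˡ; ∈-++⁺ʳ; ∈-filter⁺; ∈-filter⁻; ∈-upTo⁺; ∈-allFin; ∈-cartesianProduct⁺)
  open import Data.List.Membership.Propositional.Properties.WithK using (unique∧set⇒bag)
  import Data.List.Membership.DecPropositional as DecMembership
  open import Data.List.Relation.Binary.BagAndSetEquality using (∼bag⇒↭)
  open import Data.List.Relation.Binary.Permutation.Propositional as Perm using (_↭_)
  open import Data.List.Relation.Unary.Any using (here; there)
  open import Data.List.Relation.Unary.Unique.Propositional using (Unique)
  import Data.List.Relation.Unary.Unique.Propositional.Properties as Uniqueₚ
  import Data.Product.Properties as Productₚ
  open import Function using (_∘_; mk⇔)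
  open import Relation.Binary.Definitions using (DecidableEquality)
  open import Relation.Unary using (Decidable)

  window : ℕ → List ℤ
  window B = map +_ (upTo (suc B)) ++ map -[1+_] (upTo B)

  window-unique : ∀ B → Unique (window B)
  window-unique B = Uniqueₚ.++⁺ (Uniqueₚ.map⁺ ℤₚ.+-injective (Uniqueₚ.upTo⁺ (suc B)))
                                (Uniqueₚ.map⁺ ℤₚ.-[1+-injective (Uniqueₚ.upTo⁺ B)) disjoint
    where
    disjoint : ∀ {i} → ¬ (i ∈ map +_ (upTo (suc B)) × i ∈ map -[1+_] (upTo B))
    disjoint (p , q) with ∈-map⁻ +_ p | ∈-map⁻ -[1+_] q
    ... | _ , _ , ≡.refl | _ , _ , ()

  ∈-window : ∀ B i → ∣ i ∣ ≤ B → i ∈ window B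
  ∈-window B (+ n)    n≤B = ∈-++⁺ˡ (∈-map⁺ +_ (∈-upTo⁺ (s≤s n≤B)))
  ∈-window B -[1+ n ] n<B = ∈-++⁺ʳ (map +_ (upTo (suc B))) (∈-map⁺ -[1+_] (∈-upTo⁺ n<B))

  ∉-window : ∀ B i → i ∉ window B → B < ∣ i ∣
  ∉-window B i i∉ with suc B ℕ.≤? ∣ i ∣
  ... | yes B<i = B<i
  ... | no ¬B<i = contradiction (∈-window B i (ℕₚ.≤-pred (ℕₚ.≰⇒> ¬B<i))) i∉

  module ListSum (R : CommutativeRing 0ℓ 0ℓ) where
    open CommutativeRing R
    open IntegerCoefficients R
    open import Algebra.Properties.Ring ring using (-0#≈0#; -‿+-comm)
    open import Relation.Binary.Reasoning.Setoid setoid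

    ∑ : {I : Set} → List I → (I → Carrier) → Carrier
    ∑ L f = foldr (λ i s → f i + s) 0# L

    module _ {I : Set} where

      ∑-cong∈ : ∀ (L : List I) {f g} → (∀ i → i ∈ L → f i ≈ g i) → ∑ L f ≈ ∑ L g
      ∑-cong∈ []      f≈g = refl
      ∑-cong∈ (i ∷ L) f≈g = +-cong (f≈g i (here ≡.refl)) (∑-cong∈ L (λ j j∈ → f≈g j (there j∈)))

      ∑-cong : ∀ (L : List I) {f g} → (∀ i → f i ≈ g i) → ∑ L f ≈ ∑ L g
      ∑-cong L f≈g = ∑-cong∈ L (λ i _ → f≈g i)

      ∑-zero : ∀ (L : List I) {f} → (∀ i → f i ≈ 0#) → ∑ L f ≈ 0#
      ∑-zero []      f≈0 = refl
      ∑-zero (i ∷ L) f≈0 = trans (+-cong (f≈0 i) (∑-zero L f≈0)) (+-identityˡ 0#)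

      ∑-+ : ∀ (L : List I) f g → ∑ L (λ i → f i + g i) ≈ ∑ L f + ∑ L g
      ∑-+ []      f g = sym (+-identityˡ 0#)
      ∑-+ (i ∷ L) f g = trans (+-congˡ (∑-+ L f g))
        (solve 4 (λ a b c d → a :+ b :+ (c :+ d) := a :+ c :+ (b :+ d)) refl (f i) (g i) (∑ L f) (∑ L g))

      ∑-*ˡ : ∀ (L : List I) c f → ∑ L (λ i → c * f i) ≈ c * ∑ L f
      ∑-*ˡ []      c f = sym (zeroʳ c)
      ∑-*ˡ (i ∷ L) c f = trans (+-congˡ (∑-*ˡ L c f)) (sym (distribˡ c (f i) (∑ L f)))

      ∑-*ʳ : ∀ (L : List I) c f → ∑ L (λ i → f i * c) ≈ ∑ L f * c
      ∑-*ʳ L c f = trans (∑-cong L (λ i → *-comm (f i) c)) (trans (∑-*ˡ L c f) (*-comm c _))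

      ∑-neg : ∀ (L : List I) f → ∑ L (λ i → - f i) ≈ - ∑ L f
      ∑-neg []      f = sym -0#≈0#
      ∑-neg (i ∷ L) f = trans (+-congˡ (∑-neg L f)) (-‿+-comm (f i) (∑ L f))

      ∑-++ : ∀ (L L′ : List I) f → ∑ (L ++ L′) f ≈ ∑ L f + ∑ L′ f
      ∑-++ []      L′ f = sym (+-identityˡ _)
      ∑-++ (i ∷ L) L′ f = trans (+-congˡ (∑-++ L L′ f)) (sym (+-assoc _ _ _))

      ∑-↭ : ∀ {L L′ : List I} f → L ↭ L′ → ∑ L f ≈ ∑ L′ f
      ∑-↭ f Perm.refl         = refl
      ∑-↭ f (Perm.prep i p)   = +-congˡ (∑-↭ f p)
      ∑-↭ f (Perm.swap {L} {L′} i j p) = trans (+-congˡ (+-congˡ (∑-↭ f p)))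
        (solve 3 (λ a b c → a :+ (b :+ c) := b :+ (a :+ c)) refl (f i) (f j) (∑ L′ f))
      ∑-↭ f (Perm.trans p q)  = trans (∑-↭ f p) (∑-↭ f q)

      ∑-filter : ∀ {P : I → Set} (P? : Decidable P) L f → (∀ i → ¬ P i → f i ≈ 0#) → ∑ L f ≈ ∑ (filter P? L) f
      ∑-filter P? []      f f≈0 = refl
      ∑-filter P? (i ∷ L) f f≈0 with P? i
      ... | yes _ = +-congˡ (∑-filter P? L f f≈0)
      ... | no ¬p = trans (+-cong (f≈0 i ¬p) (∑-filter P? L f f≈0)) (+-identityˡ _)

      -- Both sums reduce to the common part of the two lists: the other entries contribute 0, and
      -- the two filtered lists have the same elements without repetition, hence are permutations of
      -- each other.
      ∑-support : DecidableEquality I → ∀ {L L′ : List I} f → Unique L → Unique L′ →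
                  (∀ i → i ∉ L → f i ≈ 0#) → (∀ i → i ∉ L′ → f i ≈ 0#) → ∑ L f ≈ ∑ L′ f
      ∑-support _≟_ {L} {L′} f L! L′! f≈0 f≈0′ = begin
        ∑ L f                       ≈⟨ ∑-filter (_∈? L′) L f f≈0′ ⟩
        ∑ (filter (_∈? L′) L) f     ≈⟨ ∑-↭ f (∼bag⇒↭ (unique∧set⇒bag (Uniqueₚ.filter⁺ (_∈? L′) L!) (Uniqueₚ.filter⁺ (_∈? L) L′!) (mk⇔ (swap∈ L L′) (swap∈ L′ L)))) ⟩
        ∑ (filter (_∈? L) L′) f     ≈⟨ ∑-filter (_∈? L) L′ f f≈0 ⟨
        ∑ L′ f                      ∎
        where
        open DecMembership _≟_ using (_∈?_)
        swap∈ : ∀ L₁ L₂ {i} → i ∈ filter (_∈? L₂) L₁ → i ∈ filter (_∈? L₁) L₂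
        swap∈ L₁ L₂ i∈ with ∈-filter⁻ (_∈? L₂) {xs = L₁} i∈
        ... | i∈₁ , i∈₂ = ∈-filter⁺ (_∈? L₁) i∈₂ i∈₁

    module _ {I J : Set} where

      ∑-map : ∀ (φ : I → J) L f → ∑ (map φ L) f ≈ ∑ L (f ∘ φ)
      ∑-map φ []      f = refl
      ∑-map φ (i ∷ L) f = +-congˡ (∑-map φ L f)

    module _ {I J : Set} where

      ∑-cartesianProduct : ∀ (L : List I) (L′ : List J) (f : I × J → Carrier) →
                           ∑ (cartesianProduct L L′) f ≈ ∑ L (λ i → ∑ L′ (λ j → f (i , j)))
      ∑-cartesianProduct []      L′ f = refl
      ∑-cartesianProduct (i ∷ L) L′ f =
        trans (∑-++ (map (i ,_) L′) (cartesianProduct L L′) f)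
              (+-cong (∑-map (i ,_) L′ f) (∑-cartesianProduct L L′ f))

      ∑-*-∑ : ∀ (L : List I) (L′ : List J) f g → ∑ L f * ∑ L′ g ≈ ∑ L (λ i → ∑ L′ (λ j → f i * g j))
      ∑-*-∑ L L′ f g = trans (sym (∑-*ʳ L (∑ L′ g) f)) (∑-cong L (λ i → sym (∑-*ˡ L′ (f i) g)))

      -- The bijection need not carry `L` onto `L′`. Since every j is φ (ψ j), the function `g`
      -- vanishes off the image of `L` as well, and `∑-support` compares this image with `L′`.
      ∑-reindex : DecidableEquality J → ∀ {L L′} → Unique L → Unique L′ →
                  (φ : I → J) (ψ : J → I) → (∀ i → ψ (φ i) ≡ i) → (∀ j → φ (ψ j) ≡ j) →
                  ∀ {f g} → (∀ i → i ∉ L → f i ≈ 0#) → (∀ j → j ∉ L′ → g j ≈ 0#) →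
                  (∀ i → f i ≈ g (φ i)) → ∑ L f ≈ ∑ L′ g
      ∑-reindex _≟_ {L} {L′} L! L′! φ ψ ψφ φψ {f} {g} f≈0 g≈0 f≈gφ = begin
        ∑ L f           ≈⟨ ∑-cong L f≈gφ ⟩
        ∑ L (g ∘ φ)     ≈⟨ ∑-map φ L g ⟨
        ∑ (map φ L) g   ≈⟨ ∑-support _≟_ g (Uniqueₚ.map⁺ φ-injective L!) L′! g≈0′ g≈0 ⟩
        ∑ L′ g          ∎
        where
        φ-injective : ∀ {i i′} → φ i ≡ φ i′ → i ≡ i′
        φ-injective {i} {i′} e = ≡.trans (≡.sym (ψφ i)) (≡.trans (≡.cong ψ e) (ψφ i′))
        g≈0′ : ∀ j → j ∉ map φ L → g j ≈ 0#
        g≈0′ j j∉ = trans (reflexive (≡.cong g (≡.sym (φψ j)))) (trans (sym (f≈gφ (ψ j)))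
          (f≈0 (ψ j) (λ ψj∈ → j∉ (≡.subst (_∈ map φ L) (φψ j) (∈-map⁺ φ ψj∈)))))

    -- A bilateral series is represented by its sum over |i| ≤ B. The condition `Supported` lets
    -- bijections of ℤ act on such sums although they do not preserve the window.
    module Bilateral (B : ℕ) where

      Supported : (ℤ → Carrier) → Set
      Supported f = ∀ i → B < ∣ i ∣ → f i ≈ 0#

      ∑ℤ : (ℤ → Carrier) → Carrier
      ∑ℤ = ∑ (window B)

      ∉⇒0 : ∀ {f} → Supported f → ∀ i → i ∉ window B → f i ≈ 0#
      ∉⇒0 supp i i∉ = supp i (∉-window B i i∉)

      ∑ℤ-reindex : (φ ψ : ℤ → ℤ) → (∀ i → ψ (φ i) ≡ i) → (∀ j → φ (ψ j) ≡ j) →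
                   ∀ {f g} → Supported f → Supported g → (∀ i → f i ≈ g (φ i)) → ∑ℤ f ≈ ∑ℤ g
      ∑ℤ-reindex φ ψ ψφ φψ f-supp g-supp =
        ∑-reindex ℤ._≟_ (window-unique B) (window-unique B) φ ψ ψφ φψ (∉⇒0 f-supp) (∉⇒0 g-supp)

      ∑ℤ-residues : ∀ {d} (φ : Fin d × ℤ → ℤ) (ψ : ℤ → Fin d × ℤ) →
                    (∀ i → ψ (φ i) ≡ i) → (∀ j → φ (ψ j) ≡ j) →
                    ∀ {f} {g : Fin d → ℤ → Carrier} → Supported f → (∀ c → Supported (g c)) →
                    (∀ c i → g c i ≈ f (φ (c , i))) → ∑ℤ f ≈ ∑ (allFin d) (λ c → ∑ℤ (g c))
      ∑ℤ-residues {d} φ ψ ψφ φψ {f} {g} f-supp g-supp g≈fφ = begin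
        ∑ℤ f                                                              ≈⟨ ∑-reindex ℤ._≟_ (Uniqueₚ.cartesianProduct⁺ (Uniqueₚ.allFin⁺ d) (window-unique B))
                                                                               (window-unique B) φ ψ ψφ φψ off (∉⇒0 f-supp) (λ (c , i) → g≈fφ c i) ⟨
        ∑ (cartesianProduct (allFin d) (window B)) (λ (c , i) → g c i)    ≈⟨ ∑-cartesianProduct (allFin d) (window B) _ ⟩
        ∑ (allFin d) (λ c → ∑ℤ (g c))                                     ∎
        where
        off : ∀ ((c , i) : Fin d × ℤ) → (c , i) ∉ cartesianProduct (allFin d) (window B) → g c i ≈ 0#
        off (c , i) ∉prod = ∉⇒0 (g-supp c) i (λ i∈ → ∉prod (∈-cartesianProduct⁺ (∈-allFin c) i∈))

      -- The common mechanism of all multiplications of theta series below: ℤ × ℤ is cut into d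
      -- cosets of a sublattice, with coordinates s and t in which the summand separates on each
      -- coset.
      ∑ℤ-*-∑ℤ : ∀ {d} (φ : Fin d × ℤ × ℤ → ℤ × ℤ) (ψ : ℤ × ℤ → Fin d × ℤ × ℤ) →
                (∀ p → ψ (φ p) ≡ p) → (∀ p → φ (ψ p) ≡ p) →
                ∀ {f g} {a b : Fin d → ℤ → Carrier} → Supported f → Supported g →
                (∀ c → Supported (a c)) → (∀ c → Supported (b c)) →
                (∀ c s t → a c s * b c t ≈ f (proj₁ (φ (c , s , t))) * g (proj₂ (φ (c , s , t)))) →
                ∑ℤ f * ∑ℤ g ≈ ∑ (allFin d) (λ c → ∑ℤ (a c) * ∑ℤ (b c))
      ∑ℤ-*-∑ℤ {d} φ ψ ψφ φψ {f} {g} {a} {b} f-supp g-supp a-supp b-supp ab≈fg = begin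
        ∑ℤ f * ∑ℤ g                                        ≈⟨ ∑-*-∑ (window B) (window B) f g ⟩
        ∑ℤ (λ i → ∑ℤ (λ j → f i * g j))                    ≈⟨ ∑-cartesianProduct (window B) (window B) _ ⟨
        ∑ W² (λ (i , j) → f i * g j)                       ≈⟨ ∑-reindex (Productₚ.≡-dec Finₚ._≟_ (Productₚ.≡-dec ℤ._≟_ ℤ._≟_)) W²! dW²! ψ φ φψ ψφ off² off
                                                                (λ (i , j) → sym (trans (ab≈fg _ _ _) (reflexive (≡.cong (λ (i , j) → f i * g j) (φψ (i , j)))))) ⟩
        ∑ (cartesianProduct (allFin d) W²) (λ (c , s , t) → a c s * b c t)
                                                           ≈⟨ ∑-cartesianProduct (allFin d) W² _ ⟩
        ∑ (allFin d) (λ c → ∑ W² (λ (s , t) → a c s * b c t))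
                                                           ≈⟨ ∑-cong (allFin d) (λ c → trans (∑-cartesianProduct (window B) (window B) _) (sym (∑-*-∑ (window B) (window B) (a c) (b c)))) ⟩
        ∑ (allFin d) (λ c → ∑ℤ (a c) * ∑ℤ (b c))           ∎
        where
        W² = cartesianProduct (window B) (window B)
        W²! = Uniqueₚ.cartesianProduct⁺ (window-unique B) (window-unique B)
        dW²! = Uniqueₚ.cartesianProduct⁺ (Uniqueₚ.allFin⁺ d) W²!
        off-product : ∀ {f g} → Supported f → Supported g → ∀ i j → (i , j) ∉ W² → f i * g j ≈ 0#
        off-product f-supp g-supp i j ij∉ with suc B ℕ.≤? ∣ i ∣ | suc B ℕ.≤? ∣ j ∣
        ... | yes B<i | _ = trans (*-congʳ (f-supp i B<i)) (zeroˡ _)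
        ... | no _ | yes B<j = trans (*-congˡ (g-supp j B<j)) (zeroʳ _)
        ... | no ¬B<i | no ¬B<j = contradiction
          (∈-cartesianProduct⁺ (∈-window B i (ℕₚ.≤-pred (ℕₚ.≰⇒> ¬B<i))) (∈-window B j (ℕₚ.≤-pred (ℕₚ.≰⇒> ¬B<j)))) ij∉
        off² : ∀ ((i , j) : ℤ × ℤ) → (i , j) ∉ W² → f i * g j ≈ 0#
        off² (i , j) = off-product f-supp g-supp i j
        off : ∀ ((c , s , t) : Fin d × ℤ × ℤ) → (c , s , t) ∉ cartesianProduct (allFin d) W² → a c s * b c t ≈ 0#
        off (c , s , t) ∉prod = off-product (a-supp c) (b-supp c) s t (λ st∈ → ∉prod (∈-cartesianProduct⁺ (∈-allFin c) st∈))

open FiniteSums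

-- Triangular and square exponents, and a decision procedure for identities between them.

module QuadraticExponents where
  import Data.Nat.Tactic.RingSolver as ℕ-Solver
  open import Data.Integer.Solver using (module +-*-Solver)
  open import Data.Vec.N-ary using (N-ary; curryⁿ; _$ⁿ_; Eq; Eqʰ; Eqʰ-to-Eq; curryⁿ-cong; curryⁿ-cong⁻¹)
  open import Relation.Binary.PropositionalEquality using (refl; cong; cong₂; sym; trans)

  open +-*-Solver using (Polynomial; con; var; _:+_; _:*_; _:-_; :-_; ⟦_⟧; prove; ⟦_⟧↓)

  triangle : ℕ → ℕ
  triangle zero    = 0
  triangle (suc n) = n ℕ.+ triangle n

  -- tri i = i (i - 1) / 2
  tri : ℤ → ℕ
  tri (+ n)    = triangle n
  tri -[1+ n ] = triangle (suc (suc n))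

  sq : ℤ → ℕ
  sq i = ∣ i ∣ ℕ.* ∣ i ∣

  2triangle : ∀ n → 2 ℕ.* triangle n ℕ.+ n ≡ n ℕ.* n
  2triangle zero    = refl
  2triangle (suc n) = begin
    2 ℕ.* (n ℕ.+ triangle n) ℕ.+ suc n               ≡⟨ lhs n (triangle n) ⟩
    suc (n ℕ.+ n ℕ.+ (2 ℕ.* triangle n ℕ.+ n))       ≡⟨ cong (λ x → suc (n ℕ.+ n ℕ.+ x)) (2triangle n) ⟩
    suc (n ℕ.+ n ℕ.+ n ℕ.* n)                        ≡⟨ rhs n ⟩
    suc n ℕ.* suc n                                  ∎
    where
    open ≡.≡-Reasoning
    lhs : ∀ n t → 2 ℕ.* (n ℕ.+ t) ℕ.+ suc n ≡ suc (n ℕ.+ n ℕ.+ (2 ℕ.* t ℕ.+ n))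
    lhs = ℕ-Solver.solve-∀
    rhs : ∀ n → suc (n ℕ.+ n ℕ.+ n ℕ.* n) ≡ suc n ℕ.* suc n
    rhs = ℕ-Solver.solve-∀

  2tri : ∀ i → + 2 ℤ.* + tri i ≡ i ℤ.* i ℤ.- i
  2tri (+ n) = begin
    + 2 ℤ.* + t                ≡⟨ +-*-Solver.solve 2 (λ t n → con (+ 2) :* t +-*-Solver.:= (con (+ 2) :* t :+ n) :- n) refl (+ t) (+ n) ⟩
    (+ 2 ℤ.* + t ℤ.+ + n) ℤ.- + n  ≡⟨ cong (λ x → (x ℤ.+ + n) ℤ.- + n) (sym (ℤₚ.pos-* 2 t)) ⟩
    + (2 ℕ.* t ℕ.+ n) ℤ.- + n  ≡⟨ cong (λ x → + x ℤ.- + n) (2triangle n) ⟩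
    + (n ℕ.* n) ℤ.- + n        ≡⟨ cong (ℤ._- + n) (ℤₚ.pos-* n n) ⟩
    + n ℤ.* + n ℤ.- + n        ∎
    where
    open ≡.≡-Reasoning
    t = triangle n
  2tri -[1+ n ] = begin
    + 2 ℤ.* + t                                     ≡⟨ +-*-Solver.solve 2 (λ t n → con (+ 2) :* t +-*-Solver.:= (con (+ 2) :* t :+ n) :- n) refl (+ t) (+ m) ⟩
    (+ 2 ℤ.* + t ℤ.+ + m) ℤ.- + m                   ≡⟨ cong (λ x → (x ℤ.+ + m) ℤ.- + m) (sym (ℤₚ.pos-* 2 t)) ⟩
    + (2 ℕ.* t ℕ.+ m) ℤ.- + m                       ≡⟨ cong (λ x → + x ℤ.- + m) (2triangle m) ⟩
    + (m ℕ.* m) ℤ.- + m                             ≡⟨ cong (ℤ._- + m) (ℤₚ.pos-* m m) ⟩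
    + m ℤ.* + m ℤ.- + m                             ≡⟨ +-*-Solver.solve 1 (λ n → (con (+ 2) :+ n) :* (con (+ 2) :+ n) :- (con (+ 2) :+ n) +-*-Solver.:=
                                                         (:- (con (+ 1) :+ n)) :* (:- (con (+ 1) :+ n)) :- (:- (con (+ 1) :+ n))) refl (+ n) ⟩
    -[1+ n ] ℤ.* -[1+ n ] ℤ.- -[1+ n ]              ∎
    where
    open ≡.≡-Reasoning
    m = suc (suc n)
    t = triangle m

  +sq : ∀ i → + sq i ≡ i ℤ.* i
  +sq (+ n)    = ℤₚ.pos-* n n
  +sq -[1+ n ] = refl

  infixl 6 _⊕_
  infixl 7 _⊗_

  -- Exponents built from triangular numbers and squares of integer polynomials:
  -- an identity between them is proved by comparing their doubles over ℤ.
  data Exponent (n : ℕ) : Set where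
    △ □     : Polynomial n → Exponent n
    ♯       : ℕ → Exponent n
    _⊕_     : Exponent n → Exponent n → Exponent n
    _⊗_     : ℕ → Exponent n → Exponent n

  ⟪_⟫ : ∀ {n} → Exponent n → Vec ℤ n → ℕ
  ⟪ △ p ⟫ ρ   = tri (⟦ p ⟧ ρ)
  ⟪ □ p ⟫ ρ   = sq (⟦ p ⟧ ρ)
  ⟪ ♯ k ⟫ ρ   = k
  ⟪ e ⊕ f ⟫ ρ = ⟪ e ⟫ ρ ℕ.+ ⟪ f ⟫ ρ
  ⟪ k ⊗ e ⟫ ρ = k ℕ.* ⟪ e ⟫ ρ

  double : ∀ {n} → Exponent n → Polynomial n
  double (△ p)   = p :* p :- p
  double (□ p)   = con (+ 2) :* (p :* p)
  double (♯ k)   = con (+ 2 ℤ.* + k)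
  double (e ⊕ f) = double e :+ double f
  double (k ⊗ e) = con (+ k) :* double e

  double-correct : ∀ {n} (e : Exponent n) ρ → + 2 ℤ.* + ⟪ e ⟫ ρ ≡ ⟦ double e ⟧ ρ
  double-correct (△ p)   ρ = 2tri (⟦ p ⟧ ρ)
  double-correct (□ p)   ρ = cong (+ 2 ℤ.*_) (+sq (⟦ p ⟧ ρ))
  double-correct (♯ k)   ρ = refl
  double-correct (e ⊕ f) ρ = trans (ℤₚ.*-distribˡ-+ (+ 2) (+ ⟪ e ⟫ ρ) (+ ⟪ f ⟫ ρ))
                                   (cong₂ ℤ._+_ (double-correct e ρ) (double-correct f ρ))
  double-correct (k ⊗ e) ρ = begin
    + 2 ℤ.* + (k ℕ.* x)     ≡⟨ cong (+ 2 ℤ.*_) (ℤₚ.pos-* k x) ⟩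
    + 2 ℤ.* (+ k ℤ.* + x)   ≡⟨ +-*-Solver.solve 2 (λ k x → con (+ 2) :* (k :* x) +-*-Solver.:= k :* (con (+ 2) :* x)) refl (+ k) (+ x) ⟩
    + k ℤ.* (+ 2 ℤ.* + x)   ≡⟨ cong (+ k ℤ.*_) (double-correct e ρ) ⟩
    + k ℤ.* ⟦ double e ⟧ ρ  ∎
    where
    open ≡.≡-Reasoning
    x = ⟪ e ⟫ ρ

  infix 4 _≐_

  _≐_ : ∀ {n} → Exponent n → Exponent n → Exponent n × Exponent n
  _≐_ = _,_

  -- Doubling removes the division by 2 in `tri`; the doubles are integer polynomials, and 2 can be
  -- cancelled again. The hypothesis compares normal forms, so `refl` discharges it whenever the
  -- identity is true as a polynomial identity.
  exponents : ∀ n (f : N-ary n (Polynomial n) (Exponent n × Exponent n)) →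
              let p = f $ⁿ Vec.map var (Vec.allFin n) in
              Eqʰ n _≡_ (curryⁿ ⟦ double (proj₁ p) ⟧↓) (curryⁿ ⟦ double (proj₂ p) ⟧↓) →
              Eq n _≡_ (curryⁿ ⟪ proj₁ p ⟫) (curryⁿ ⟪ proj₂ p ⟫)
  exponents n f hyp = curryⁿ-cong _≡_ ⟪ e₁ ⟫ ⟪ e₂ ⟫ (λ ρ → ℤₚ.+-injective (ℤₚ.*-cancelˡ-≡ (+ 2) _ _ (begin
    + 2 ℤ.* + ⟪ e₁ ⟫ ρ  ≡⟨ double-correct e₁ ρ ⟩
    ⟦ double e₁ ⟧ ρ     ≡⟨ prove ρ (double e₁) (double e₂) (curryⁿ-cong⁻¹ _≡_ ⟦ double e₁ ⟧↓ ⟦ double e₂ ⟧↓ (Eqʰ-to-Eq n _≡_ hyp) ρ) ⟩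
    ⟦ double e₂ ⟧ ρ     ≡⟨ double-correct e₂ ρ ⟨
    + 2 ℤ.* + ⟪ e₂ ⟫ ρ  ∎)))
    where
    open ≡.≡-Reasoning
    e₁ = proj₁ (f $ⁿ Vec.map var (Vec.allFin n))
    e₂ = proj₂ (f $ⁿ Vec.map var (Vec.allFin n))

  triangle-bound : ∀ n → n ≤ suc (triangle n)
  triangle-bound zero    = z≤n
  triangle-bound (suc n) = s≤s (ℕₚ.m≤m+n n (triangle n))

  tri-bound : ∀ i → ∣ i ∣ ≤ suc (tri i)
  tri-bound (+ n)    = triangle-bound n
  tri-bound -[1+ n ] = ℕₚ.≤-trans (triangle-bound (suc n)) (s≤s (ℕₚ.m≤n+m _ (suc n)))

  sq-bound : ∀ i → ∣ i ∣ ≤ sq i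
  sq-bound i = go ∣ i ∣
    where
    go : ∀ n → n ≤ n ℕ.* n
    go zero    = z≤n
    go (suc n) = ℕₚ.m≤m+n (suc n) _

  shift-bound : ∀ i j → ∣ i ∣ ≤ ∣ i ℤ.+ j ∣ ℕ.+ ∣ j ∣
  shift-bound i j = begin
    ∣ i ∣                          ≡⟨ cong ∣_∣ (+-*-Solver.solve 2 (λ i j → i +-*-Solver.:= (i :+ j) :- j) refl i j) ⟩
    ∣ (i ℤ.+ j) ℤ.- j ∣            ≤⟨ ℤₚ.∣i-j∣≤∣i∣+∣j∣ (i ℤ.+ j) j ⟩
    ∣ i ℤ.+ j ∣ ℕ.+ ∣ j ∣          ∎
    where open ℕₚ.≤-Reasoning

  sq-bound′ : ∀ i → ∣ i ∣ ≤ suc (sq i)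
  sq-bound′ i = ℕₚ.m≤n⇒m≤1+n (sq-bound i)

  -- The origin of the window size N + 4: an index shift by at most 3 and the loss of 1 in |k| ≤ 1 +
  -- f k still leave an exponent larger than N.
  far : ∀ {N} (f : ℤ → ℕ) → (∀ k → ∣ k ∣ ≤ suc (f k)) → ∀ i j → ∣ j ∣ ≤ 3 → N ℕ.+ 4 < ∣ i ∣ → N < f (j ℤ.+ i)
  far {N} f bound i j j≤3 N<i = ℕₚ.≤-pred (ℕₚ.≤-trans (ℕₚ.+-cancelʳ-≤ 3 _ _ (begin
    suc (suc N) ℕ.+ 3         ≡⟨ cong suc (sym (ℕₚ.+-suc N 3)) ⟩
    suc (N ℕ.+ 4)             ≤⟨ N<i ⟩
    ∣ i ∣                     ≤⟨ shift-bound i j ⟩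
    ∣ i ℤ.+ j ∣ ℕ.+ ∣ j ∣     ≤⟨ ℕₚ.+-monoʳ-≤ _ j≤3 ⟩
    ∣ i ℤ.+ j ∣ ℕ.+ 3         ≡⟨ cong (λ k → ∣ k ∣ ℕ.+ 3) (ℤₚ.+-comm i j) ⟩
    ∣ j ℤ.+ i ∣ ℕ.+ 3         ∎)) (bound (j ℤ.+ i)))
    where open ℕₚ.≤-Reasoning

  module _ {N} (i : ℤ) (N<i : N ℕ.+ 4 < ∣ i ∣) where

    tri-far : ∀ j → ∣ j ∣ ≤ 3 → N < tri (j ℤ.+ i)
    tri-far j j≤3 = far tri tri-bound i j j≤3 N<i

    sq-far : ∀ j → ∣ j ∣ ≤ 3 → N < sq (j ℤ.+ i)
    sq-far j j≤3 = far sq sq-bound′ i j j≤3 N<i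

    tri-far₀ : N < tri i
    tri-far₀ = ≡.subst (λ k → N < tri k) (ℤₚ.+-identityˡ i) (tri-far (+ 0) z≤n)

    sq-far₀ : N < sq i
    sq-far₀ = ≡.subst (λ k → N < sq k) (ℤₚ.+-identityˡ i) (sq-far (+ 0) z≤n)

open QuadraticExponents

-- Monomials, signs and finite products in a ring with nilpotent q.

module RingMonomials where
  open import Data.Integer.Solver using (module +-*-Solver)

  module Monomials (R : CommutativeRing 0ℓ 0ℓ) where
    open CommutativeRing R
    open IntegerCoefficients R
    open import Algebra.Properties.Ring ring using (-‿involutive; -‿distribˡ-*)
    open import Algebra.Properties.CommutativeSemiring.Exp commutativeSemiring public
    open import Relation.Binary.Reasoning.Setoid setoid

    1^ : ∀ n → 1# ^ n ≈ 1#
    1^ zero    = refl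
    1^ (suc n) = trans (*-identityˡ _) (1^ n)

    ^-≡ : ∀ x {m n} → m ≡ n → x ^ m ≈ x ^ n
    ^-≡ x e = reflexive (≡.cong (x ^_) e)

    mon : ∀ {k} → Vec Carrier k → Vec ℕ k → Carrier
    mon []       []       = 1#
    mon (g ∷ gs) (e ∷ es) = g ^ e * mon gs es

    mon-* : ∀ {k} (gs : Vec Carrier k) es fs → mon gs es * mon gs fs ≈ mon gs (Vec.zipWith ℕ._+_ es fs)
    mon-* []       []       []       = *-identityˡ 1#
    mon-* (g ∷ gs) (e ∷ es) (f ∷ fs) = begin
      (g ^ e * mon gs es) * (g ^ f * mon gs fs)  ≈⟨ solve 4 (λ a b c d → (a :* b) :* (c :* d) := (a :* c) :* (b :* d)) refl _ _ _ _ ⟩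
      (g ^ e * g ^ f) * (mon gs es * mon gs fs)  ≈⟨ *-cong (sym (^-homo-* g e f)) (mon-* gs es fs) ⟩
      g ^ (e ℕ.+ f) * mon gs (Vec.zipWith ℕ._+_ es fs) ∎

    mon-≡ : ∀ {k} (gs : Vec Carrier k) {es fs} → es ≡ fs → mon gs es ≈ mon gs fs
    mon-≡ gs e = reflexive (≡.cong (mon gs) e)

    sgn : ℤ → Carrier
    sgn i = (- 1#) ^ ∣ i ∣

    sgnℕ-suc : ∀ n → sgn (+ suc n) ≈ - sgn (+ n)
    sgnℕ-suc n = trans (sym (-‿distribˡ-* 1# _)) (-‿cong (*-identityˡ _))

    sgn-suc : ∀ i → sgn (+ 1 ℤ.+ i) ≈ - sgn i
    sgn-suc (+ n)          = sgnℕ-suc n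
    sgn-suc -[1+ zero ]    = sym (trans (-‿cong (sgnℕ-suc 0)) (-‿involutive 1#))
    sgn-suc -[1+ suc n ]   = sym (trans (-‿cong (sgnℕ-suc (suc n))) (-‿involutive _))

    sgn-neg : ∀ i → sgn (ℤ.- i) ≈ sgn i
    sgn-neg i = ^-≡ (- 1#) (ℤₚ.∣-i∣≡∣i∣ i)

    sgn-+ℕ : ∀ n j → sgn (+ n ℤ.+ j) ≈ sgn (+ n) * sgn j
    sgn-+ℕ zero    j = trans (reflexive (≡.cong sgn (ℤₚ.+-identityˡ j))) (sym (*-identityˡ _))
    sgn-+ℕ (suc n) j = begin
      sgn (+ suc n ℤ.+ j)          ≡⟨ ≡.cong sgn (ℤₚ.+-assoc (+ 1) (+ n) j) ⟩
      sgn (+ 1 ℤ.+ (+ n ℤ.+ j))    ≈⟨ sgn-suc (+ n ℤ.+ j) ⟩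
      - sgn (+ n ℤ.+ j)            ≈⟨ -‿cong (sgn-+ℕ n j) ⟩
      - (sgn (+ n) * sgn j)        ≈⟨ -‿distribˡ-* _ _ ⟩
      - sgn (+ n) * sgn j          ≈⟨ *-congʳ (sgnℕ-suc n) ⟨
      sgn (+ suc n) * sgn j        ∎

    sgn-+ : ∀ i j → sgn (i ℤ.+ j) ≈ sgn i * sgn j
    sgn-+ (+ n)    j = sgn-+ℕ n j
    sgn-+ -[1+ n ] j = begin
      sgn (-[1+ n ] ℤ.+ j)              ≡⟨ ≡.cong sgn (+-*-Solver.solve 2 (λ m j → +-*-Solver.:- m +-*-Solver.:+ j +-*-Solver.:= +-*-Solver.:- (m +-*-Solver.:+ +-*-Solver.:- j)) ≡.refl (+ suc n) j) ⟩
      sgn (ℤ.- (+ suc n ℤ.+ ℤ.- j))     ≈⟨ sgn-neg (+ suc n ℤ.+ ℤ.- j) ⟩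
      sgn (+ suc n ℤ.+ ℤ.- j)           ≈⟨ sgn-+ℕ (suc n) (ℤ.- j) ⟩
      sgn (+ suc n) * sgn (ℤ.- j)       ≈⟨ *-congˡ (sgn-neg j) ⟩
      sgn (+ suc n) * sgn j             ∎

    sgn² : ∀ i → sgn i * sgn i ≈ 1#
    sgn² i = begin
      sgn i * sgn i        ≈⟨ *-congˡ (sgn-neg i) ⟨
      sgn i * sgn (ℤ.- i)  ≈⟨ sgn-+ i (ℤ.- i) ⟨
      sgn (i ℤ.- i)        ≡⟨ ≡.cong sgn (ℤₚ.+-inverseʳ i) ⟩
      1#                   ∎

    -- With l as a witness that i and j have the same parity, identities between signs become linear
    -- identities over ℤ.
    sgn-parity : ∀ i j l → i ≡ j ℤ.+ (l ℤ.+ l) → sgn i ≈ sgn j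
    sgn-parity i j l ≡.refl = begin
      sgn (j ℤ.+ (l ℤ.+ l))      ≈⟨ sgn-+ j (l ℤ.+ l) ⟩
      sgn j * sgn (l ℤ.+ l)      ≈⟨ *-congˡ (trans (sgn-+ l l) (sgn² l)) ⟩
      sgn j * 1#                 ≈⟨ *-identityʳ _ ⟩
      sgn j                      ∎

    ∏ : ℕ → (ℕ → Carrier) → Carrier
    ∏ zero    f = 1#
    ∏ (suc n) f = f n * ∏ n f

    ∏-cong : ∀ n {f g} → (∀ k → f k ≈ g k) → ∏ n f ≈ ∏ n g
    ∏-cong zero    f≈g = refl
    ∏-cong (suc n) f≈g = *-cong (f≈g n) (∏-cong n f≈g)

    ∏-* : ∀ n f g → ∏ n (λ k → f k * g k) ≈ ∏ n f * ∏ n g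
    ∏-* zero    f g = sym (*-identityˡ 1#)
    ∏-* (suc n) f g = trans (*-congˡ (∏-* n f g))
      (solve 4 (λ a b c d → (a :* b) :* (c :* d) := (a :* c) :* (b :* d)) refl (f n) (g n) (∏ n f) (∏ n g))

    ∏-1 : ∀ n {f} → (∀ k → f k ≈ 1#) → ∏ n f ≈ 1#
    ∏-1 zero    f≈1 = refl
    ∏-1 (suc n) f≈1 = trans (*-cong (f≈1 n) (∏-1 n f≈1)) (*-identityˡ 1#)

    ∏-stable : ∀ {f} n → (∀ k → n ≤ k → f k ≈ 1#) → ∀ d → ∏ (d ℕ.+ n) f ≈ ∏ n f
    ∏-stable n f≈1 zero    = refl
    ∏-stable n f≈1 (suc d) = trans (*-cong (f≈1 _ (ℕₚ.m≤n+m n d)) (∏-stable n f≈1 d)) (*-identityˡ _)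

    ∏-head : ∀ n f → ∏ (suc n) f ≈ f 0 * ∏ n (λ k → f (suc k))
    ∏-head zero    f = refl
    ∏-head (suc n) f = trans (*-congˡ (∏-head n f)) (solve 3 (λ a b c → a :* (b :* c) := b :* (a :* c)) refl _ _ _)

    ⨁ : ℕ → (ℕ → Carrier) → Carrier
    ⨁ zero    f = 0#
    ⨁ (suc n) f = f n + ⨁ n f

    ⨁-cong : ∀ n {f g} → (∀ k → f k ≈ g k) → ⨁ n f ≈ ⨁ n g
    ⨁-cong zero    f≈g = refl
    ⨁-cong (suc n) f≈g = +-cong (f≈g n) (⨁-cong n f≈g)

    ⨁-head : ∀ n f → ⨁ (suc n) f ≈ f 0 + ⨁ n (λ k → f (suc k))
    ⨁-head zero    f = refl
    ⨁-head (suc n) f = trans (+-congˡ (⨁-head n f)) (solve 3 (λ a b c → a :+ (b :+ c) := b :+ (a :+ c)) refl (f (suc n)) (f 0) (⨁ n (λ k → f (suc k))))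

    -- Here x² is a unit, with inverse x⁹.
    cancel-x² : ∀ x a b c d f → x ^ 11 ≈ 1# → (x ^ 2 * (a * b * c * d)) * f ≈ 0# → a * (b * (c * (d * f))) ≈ 0#
    cancel-x² x a b c d f x^11≈1 e = begin
      a * (b * (c * (d * f)))                         ≈⟨ trans (*-congʳ x^11≈1) (*-identityˡ _) ⟨
      x ^ 11 * (a * (b * (c * (d * f))))              ≈⟨ solve 6 (λ x a b c d f → x :^ 11 :* (a :* (b :* (c :* (d :* f)))) := x :^ 9 :* ((x :^ 2 :* (a :* b :* c :* d)) :* f)) refl x a b c d f ⟩
      x ^ 9 * ((x ^ 2 * (a * b * c * d)) * f)         ≈⟨ trans (*-congˡ e) (zeroʳ _) ⟩
      0#                                              ∎

  module _ (R : CommutativeRing 0ℓ 0ℓ) where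
    open CommutativeRing R
    open Monomials R

    TruncatedAt : Carrier → ℕ → Set
    TruncatedAt q N = q ^ suc N ≈ 0#

    NoTwoTorsion : Set
    NoTwoTorsion = ∀ f → f + f ≈ 0# → f ≈ 0#

    EleventhRootOfUnity : Carrier → Set
    EleventhRootOfUnity x = x ^ 11 ≈ 1#

    Inverses : Carrier → Carrier → Set
    Inverses x y = x * y ≈ 1#

    -- The formula C = (q; q)_∞ / ((x q; q)_∞ (x⁻¹ q; q)_∞) with denominators cleared. Any number L
    -- ≥ N of factors represents the infinite products once q^(N+1) = 0.
    CrankGeneratingFunction : Carrier → Carrier → Carrier → ℕ → Carrier → Set
    CrankGeneratingFunction x x⁻¹ q N C = ∀ L → N ≤ L →
      ∏ L (λ k → 1# - x * q ^ suc k) * ∏ L (λ k → 1# - x⁻¹ * q ^ suc k) * C ≈ ∏ L (λ k → 1# - q ^ suc k)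

  -- In the applications q is the variable of power series truncated at degree N.
  module Nilpotent (R : CommutativeRing 0ℓ 0ℓ) (q : CommutativeRing.Carrier R) (N : ℕ) (q^≈0 : TruncatedAt R q N) where
    open CommutativeRing R
    open Monomials R
    open IntegerCoefficients R
    open import Algebra.Properties.Ring ring using (-0#≈0#)
    open import Relation.Binary.Reasoning.Setoid setoid

    vanish : ∀ {k} → N < k → q ^ k ≈ 0#
    vanish {k} N<k = begin
      q ^ k                                 ≈⟨ ^-≡ q (ℕₚ.m+[n∸m]≡n N<k) ⟨
      q ^ (suc N ℕ.+ (k ℕ.∸ suc N))         ≈⟨ ^-homo-* q (suc N) (k ℕ.∸ suc N) ⟩
      q ^ suc N * q ^ (k ℕ.∸ suc N)         ≈⟨ *-congʳ q^≈0 ⟩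
      0# * q ^ (k ℕ.∸ suc N)                ≈⟨ zeroˡ _ ⟩
      0#                                    ∎

    factor≈1 : ∀ {k} → N < k → 1# - q ^ k ≈ 1#
    factor≈1 N<k = trans (+-congˡ (trans (-‿cong (vanish N<k)) -0#≈0#)) (+-identityʳ 1#)

    geometric : Carrier → ℕ → Carrier
    geometric y zero    = 0#
    geometric y (suc n) = y ^ n + geometric y n

    geometric-* : ∀ y n → geometric y n * (1# - y) ≈ 1# - y ^ n
    geometric-* y zero    = trans (zeroˡ _) (sym (-‿inverseʳ 1#))
    geometric-* y (suc n) = begin
      (y ^ n + geometric y n) * (1# - y)         ≈⟨ distribʳ _ _ _ ⟩
      y ^ n * (1# - y) + geometric y n * (1# - y) ≈⟨ +-congˡ (geometric-* y n) ⟩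
      y ^ n * (1# - y) + (1# - y ^ n)            ≈⟨ solve 2 (λ y z → z :* (con (+ 1) :- y) :+ (con (+ 1) :- z) := con (+ 1) :- y :* z) refl y (y ^ n) ⟩
      1# - y ^ suc n                             ∎

    -- The inverse of 1 - q^(k+1): its geometric series stops after N + 1 terms because q is
    -- nilpotent.
    factor⁻¹ : ℕ → Carrier
    factor⁻¹ k = geometric (q ^ suc k) (suc N)

    factor⁻¹-* : ∀ k → factor⁻¹ k * (1# - q ^ suc k) ≈ 1#
    factor⁻¹-* k = begin
      factor⁻¹ k * (1# - q ^ suc k)     ≈⟨ geometric-* (q ^ suc k) (suc N) ⟩
      1# - (q ^ suc k) ^ suc N          ≈⟨ +-congˡ (-‿cong (^-assocʳ q (suc k) (suc N))) ⟩
      1# - q ^ (suc k ℕ.* suc N)        ≈⟨ factor≈1 (ℕₚ.m≤m+n (suc N) (k ℕ.* suc N)) ⟩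
      1#                                ∎

    poch : ℕ → Carrier
    poch n = ∏ n (λ k → 1# - q ^ suc k)

    poch⁻¹ : ℕ → Carrier
    poch⁻¹ n = ∏ n factor⁻¹

    poch⁻¹-* : ∀ n → poch⁻¹ n * poch n ≈ 1#
    poch⁻¹-* n = trans (sym (∏-* n _ _)) (∏-1 n factor⁻¹-*)

    poch-suc : ∀ n → poch⁻¹ (suc n) * (1# - q ^ suc n) ≈ poch⁻¹ n
    poch-suc n = begin
      factor⁻¹ n * poch⁻¹ n * (1# - q ^ suc n)    ≈⟨ solve 3 (λ a b c → a :* b :* c := (a :* c) :* b) refl _ _ _ ⟩
      factor⁻¹ n * (1# - q ^ suc n) * poch⁻¹ n    ≈⟨ *-congʳ (factor⁻¹-* n) ⟩
      1# * poch⁻¹ n                               ≈⟨ *-identityˡ _ ⟩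
      poch⁻¹ n                                    ∎

    poch-stable : ∀ {m n} → N ≤ m → N ≤ n → poch m ≈ poch n
    poch-stable N≤m N≤n = trans (to N≤m) (sym (to N≤n))
      where
      to : ∀ {m} → N ≤ m → poch m ≈ poch N
      to {m} N≤m = trans (reflexive (≡.cong poch (≡.sym (ℕₚ.m∸n+n≡m N≤m))))
                         (∏-stable N (λ k N≤k → factor≈1 (s≤s N≤k)) (m ℕ.∸ N))

    poch⁻¹-stable : ∀ {m n} → N ≤ m → N ≤ n → poch⁻¹ m * poch n ≈ 1#
    poch⁻¹-stable {m} N≤m N≤n = trans (*-congˡ (poch-stable N≤n N≤m)) (poch⁻¹-* m)

open RingMonomials

-- The Jacobi triple product, proved through a finite form.

module TripleProduct where
  open import Data.Integer.Solver renaming (module +-*-Solver to ℤ-Solver)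
  open import Data.List as List using (upTo; applyUpTo)
  open import Data.List.Membership.Propositional using (_∈_; _∉_)
  open import Data.List.Membership.Propositional.Properties using (∈-map⁺; ∈-upTo⁺)
  import Data.List.Relation.Unary.Unique.Propositional.Properties as Uniqueₚ
  open import Function using (_∘_)

  +tri-suc : ∀ i → + tri (+ 1 ℤ.+ i) ≡ + tri i ℤ.+ i
  +tri-suc i = ℤₚ.*-cancelˡ-≡ (+ 2) _ _ (begin
    + 2 ℤ.* + tri (+ 1 ℤ.+ i)                       ≡⟨ 2tri (+ 1 ℤ.+ i) ⟩
    (+ 1 ℤ.+ i) ℤ.* (+ 1 ℤ.+ i) ℤ.- (+ 1 ℤ.+ i)     ≡⟨ solve 1 (λ i → (con (+ 1) :+ i) :* (con (+ 1) :+ i) :- (con (+ 1) :+ i) := (i :* i :- i) :+ con (+ 2) :* i) ≡.refl i ⟩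
    (i ℤ.* i ℤ.- i) ℤ.+ + 2 ℤ.* i                   ≡⟨ ≡.cong (ℤ._+ (+ 2 ℤ.* i)) (2tri i) ⟨
    + 2 ℤ.* + tri i ℤ.+ + 2 ℤ.* i                   ≡⟨ ℤₚ.*-distribˡ-+ (+ 2) (+ tri i) i ⟨
    + 2 ℤ.* (+ tri i ℤ.+ i)                         ∎)
    where
    open ≡.≡-Reasoning
    open ℤ-Solver

  tri-step : ∀ l n i → + l ℤ.+ i ≡ + n → l ℕ.+ tri (+ 1 ℤ.+ i) ≡ n ℕ.+ tri i
  tri-step l n i e = ℤₚ.+-injective (begin
    + l ℤ.+ + tri (+ 1 ℤ.+ i)     ≡⟨ ≡.cong (λ z → + l ℤ.+ z) (+tri-suc i) ⟩
    + l ℤ.+ (+ tri i ℤ.+ i)       ≡⟨ solve 3 (λ l t i → l :+ (t :+ i) := (l :+ i) :+ t) ≡.refl (+ l) (+ tri i) i ⟩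
    + l ℤ.+ i ℤ.+ + tri i         ≡⟨ ≡.cong (ℤ._+ (+ tri i)) e ⟩
    + n ℤ.+ + tri i               ∎)
    where
    open ≡.≡-Reasoning
    open ℤ-Solver

  m≤n+∣n⊖m∣ : ∀ m n → m ≤ n ℕ.+ ∣ n ⊖ m ∣
  m≤n+∣n⊖m∣ zero    n       = z≤n
  m≤n+∣n⊖m∣ (suc m) zero    = ℕₚ.≤-refl
  m≤n+∣n⊖m∣ (suc m) (suc n) = s≤s (≡.subst (λ i → m ≤ n ℕ.+ ∣ i ∣) (≡.sym (ℤₚ.[1+m]⊖[1+n]≡m⊖n n m)) (m≤n+∣n⊖m∣ m n))

  complement : ∀ K k l b → k ℕ.+ l ≡ K ℕ.+ K → k ≤ K ℕ.+ b → K ℕ.+ K ≤ K ℕ.+ (l ℕ.+ b)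
  complement K k l b k+l k≤ = begin
    K ℕ.+ K              ≡⟨ k+l ⟨
    k ℕ.+ l              ≤⟨ ℕₚ.+-monoˡ-≤ l k≤ ⟩
    K ℕ.+ b ℕ.+ l        ≡⟨ ≡.trans (ℕₚ.+-assoc K b l) (≡.cong (K ℕ.+_) (ℕₚ.+-comm b l)) ⟩
    K ℕ.+ (l ℕ.+ b)      ∎
    where open ℕₚ.≤-Reasoning

  suc⊖ : ∀ k m → suc k ⊖ m ≡ + 1 ℤ.+ (k ⊖ m)
  suc⊖ k m = ≡.sym (ℤₚ.distribʳ-⊖-+-pos 1 k m)

  module JacobiTripleProduct (R : CommutativeRing 0ℓ 0ℓ) (q : CommutativeRing.Carrier R) (N : ℕ) (q^≈0 : TruncatedAt R q N) where
    open CommutativeRing R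
    open Monomials R
    open IntegerCoefficients R
    open import Relation.Binary.Reasoning.Setoid setoid
    open Nilpotent R q N q^≈0 public
    open ListSum R public
    open Bilateral (N ℕ.+ 4) public

    antidiagonal : (ℕ → ℕ → Carrier) → ℕ → Carrier
    antidiagonal f zero    = f 0 0
    antidiagonal f (suc M) = f 0 (suc M) + antidiagonal (f ∘ suc) M

    antidiagonal-cong : ∀ M {f g} → (∀ k l → k ℕ.+ l ≡ M → f k l ≈ g k l) → antidiagonal f M ≈ antidiagonal g M
    antidiagonal-cong zero    f≈g = f≈g 0 0 ≡.refl
    antidiagonal-cong (suc M) f≈g = +-cong (f≈g 0 (suc M) ≡.refl)
      (antidiagonal-cong M (λ k l e → f≈g (suc k) l (≡.cong suc e)))

    antidiagonal-+ : ∀ M f g → antidiagonal (λ k l → f k l + g k l) M ≈ antidiagonal f M + antidiagonal g M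
    antidiagonal-+ zero    f g = refl
    antidiagonal-+ (suc M) f g = trans (+-congˡ (antidiagonal-+ M (f ∘ suc) (g ∘ suc)))
      (solve 4 (λ a b c d → a :+ b :+ (c :+ d) := a :+ c :+ (b :+ d)) refl _ _ _ _)

    antidiagonal-*ˡ : ∀ M c f → antidiagonal (λ k l → c * f k l) M ≈ c * antidiagonal f M
    antidiagonal-*ˡ zero    c f = refl
    antidiagonal-*ˡ (suc M) c f = trans (+-congˡ (antidiagonal-*ˡ M c (f ∘ suc))) (sym (distribˡ c _ _))

    antidiagonal-last : ∀ M f → antidiagonal f (suc M) ≈ antidiagonal (λ k l → f k (suc l)) M + f (suc M) 0
    antidiagonal-last zero    f = refl
    antidiagonal-last (suc M) f = trans (+-congˡ (antidiagonal-last M (f ∘ suc))) (sym (+-assoc _ _ _))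

    antidiagonal-∑ : ∀ M (f : ℕ → Carrier) → antidiagonal (λ k _ → f k) M ≈ ∑ (applyUpTo (λ k → k) (suc M)) f
    antidiagonal-∑ M f = go M (λ k → k)
      where
      go : ∀ M (e : ℕ → ℕ) → antidiagonal (λ k _ → f (e k)) M ≈ ∑ (applyUpTo e (suc M)) f
      go zero    e = sym (+-identityʳ _)
      go (suc M) e = +-congˡ (go M (e ∘ suc))

    module _ (u v : Carrier) where

      -- The variables u and v stand for q / z and z. Keeping both, with u v = q, gives the
      -- symmetric term (-1)^i u^(i(i-1)/2) v^(i(i+1)/2) and requires no inverse of z.
      θ-term : ℤ → Carrier
      θ-term i = sgn i * mon (u Vec.∷ v Vec.∷ Vec.[]) (tri i Vec.∷ tri (+ 1 ℤ.+ i) Vec.∷ Vec.[])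
        where import Data.Vec as Vec

      θ : Carrier
      θ = ∑ℤ θ-term

    module _ (u v : Carrier) (uv≈q : u * v ≈ q) where

      private
        t = θ-term u v

      u^v^ : ∀ k → q ^ k ≈ u ^ k * v ^ k
      u^v^ k = trans (^-congˡ k (sym uv≈q)) (^-distrib-* u v k)

      mixed-vanish : ∀ {k l} → N < k → N < l → u ^ k * v ^ l ≈ 0#
      mixed-vanish {k} {l} N<k N<l = begin
        u ^ k * v ^ l                               ≈⟨ *-cong (^-≡ u (≡.sym (ℕₚ.m+[n∸m]≡n N<k))) (^-≡ v (≡.sym (ℕₚ.m+[n∸m]≡n N<l))) ⟩
        u ^ (suc N ℕ.+ a) * v ^ (suc N ℕ.+ b)       ≈⟨ *-cong (^-homo-* u (suc N) a) (^-homo-* v (suc N) b) ⟩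
        u ^ suc N * u ^ a * (v ^ suc N * v ^ b)     ≈⟨ solve 4 (λ x y z w → x :* y :* (z :* w) := (x :* z) :* (y :* w)) refl _ _ _ _ ⟩
        u ^ suc N * v ^ suc N * (u ^ a * v ^ b)     ≈⟨ *-congʳ (trans (sym (u^v^ (suc N))) q^≈0) ⟩
        0# * (u ^ a * v ^ b)                        ≈⟨ zeroˡ _ ⟩
        0#                                          ∎
        where
        a = k ℕ.∸ suc N
        b = l ℕ.∸ suc N

      θ-supported : Supported t
      θ-supported i far = begin
        sgn i * (u ^ tri i * (v ^ tri (+ 1 ℤ.+ i) * 1#))  ≈⟨ *-congˡ (trans (*-congˡ (*-identityʳ _)) (mixed-vanish N<tri N<tri′)) ⟩
        sgn i * 0#                                        ≈⟨ zeroʳ _ ⟩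
        0#                                                ∎
        where
        N<tri : N < tri i
        N<tri = tri-far₀ i far
        N<tri′ : N < tri (+ 1 ℤ.+ i)
        N<tri′ = tri-far i far (+ 1) (s≤s z≤n)

      -- The ratio of consecutive terms is - u^i v^(i+1). Multiplication by q^l = u^l v^l turns it
      -- into - v q^(l+i), with no negative exponent left when l + i = n.
      t-up : ∀ l n i → + l ℤ.+ i ≡ + n → q ^ l * t (+ 1 ℤ.+ i) ≈ - (v * q ^ n * t i)
      t-up l n i e = begin
        q ^ l * t (+ 1 ℤ.+ i)
          ≈⟨ *-cong (u^v^ l) (*-congʳ (sgn-suc i)) ⟩
        u ^ l * v ^ l * (- sgn i * (u ^ T₁ * (v ^ T₂ * 1#)))
          ≈⟨ solve 5 (λ a b s c d → a :* b :* (:- s :* (c :* (d :* con (+ 1)))) := :- (s :* ((a :* c) :* (b :* d)))) refl _ _ _ _ _ ⟩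
        - (sgn i * (u ^ l * u ^ T₁ * (v ^ l * v ^ T₂)))
          ≈⟨ -‿cong (*-congˡ (*-cong (trans (sym (^-homo-* u l T₁)) (^-≡ u (tri-step l n i e))) (trans (sym (^-homo-* v l T₂)) (^-≡ v e₂)))) ⟩
        - (sgn i * (u ^ (n ℕ.+ T₀) * v ^ (suc n ℕ.+ T₁)))
          ≈⟨ -‿cong (*-congˡ (*-cong (^-homo-* u n T₀) (^-homo-* v (suc n) T₁))) ⟩
        - (sgn i * (u ^ n * u ^ T₀ * (v * v ^ n * v ^ T₁)))
          ≈⟨ solve 6 (λ s a b c d e → :- (s :* (a :* b :* (c :* d :* e))) := :- (c :* (a :* d) :* (s :* (b :* (e :* con (+ 1)))))) refl _ _ _ _ _ _ ⟩
        - (v * (u ^ n * v ^ n) * t i)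
          ≈⟨ -‿cong (*-congʳ (*-congˡ (sym (u^v^ n)))) ⟩
        - (v * q ^ n * t i) ∎
        where
        T₀ = tri i
        T₁ = tri (+ 1 ℤ.+ i)
        T₂ = tri (+ 1 ℤ.+ (+ 1 ℤ.+ i))
        e₂ : l ℕ.+ T₂ ≡ suc n ℕ.+ T₁
        e₂ = tri-step l (suc n) (+ 1 ℤ.+ i) (≡.trans (ℤ-Solver.solve 2 (λ l i → l ℤ-Solver.:+ (ℤ-Solver.con (+ 1) ℤ-Solver.:+ i) ℤ-Solver.:= ℤ-Solver.con (+ 1) ℤ-Solver.:+ (l ℤ-Solver.:+ i)) ≡.refl (+ l) i) (≡.cong (λ z → + 1 ℤ.+ z) e))

      t-down : ∀ k m i → + k ≡ + suc m ℤ.+ i → q ^ k * t i ≈ - (u * q ^ m * t (+ 1 ℤ.+ i))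
      t-down k m i e = begin
        q ^ k * t i
          ≈⟨ *-congʳ (u^v^ k) ⟩
        u ^ k * v ^ k * (sgn i * (u ^ T₀ * (v ^ T₁ * 1#)))
          ≈⟨ solve 5 (λ a b s c d → a :* b :* (s :* (c :* (d :* con (+ 1)))) := s :* ((a :* c) :* (b :* d))) refl _ _ _ _ _ ⟩
        sgn i * (u ^ k * u ^ T₀ * (v ^ k * v ^ T₁))
          ≈⟨ *-congˡ (*-cong (trans (sym (^-homo-* u k T₀)) (^-≡ u (≡.sym (tri-step (suc m) k i (≡.sym e))))) (trans (sym (^-homo-* v k T₁)) (^-≡ v (≡.sym e₁)))) ⟩
        sgn i * (u ^ (suc m ℕ.+ T₁) * v ^ (m ℕ.+ T₂))
          ≈⟨ *-congˡ (*-cong (^-homo-* u (suc m) T₁) (^-homo-* v m T₂)) ⟩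
        sgn i * (u * u ^ m * u ^ T₁ * (v ^ m * v ^ T₂))
          ≈⟨ solve 6 (λ s a b c d e → s :* (a :* b :* c :* (d :* e)) := :- (a :* (b :* d) :* (:- s :* (c :* (e :* con (+ 1)))))) refl _ _ _ _ _ _ ⟩
        - (u * (u ^ m * v ^ m) * (- sgn i * (u ^ T₁ * (v ^ T₂ * 1#))))
          ≈⟨ -‿cong (*-cong (*-congˡ (sym (u^v^ m))) (*-congʳ (sym (sgn-suc i)))) ⟩
        - (u * q ^ m * t (+ 1 ℤ.+ i)) ∎
        where
        T₀ = tri i
        T₁ = tri (+ 1 ℤ.+ i)
        T₂ = tri (+ 1 ℤ.+ (+ 1 ℤ.+ i))
        e₁ : m ℕ.+ T₂ ≡ k ℕ.+ T₁
        e₁ = tri-step m k (+ 1 ℤ.+ i) (≡.trans (ℤ-Solver.solve 2 (λ m i → m ℤ-Solver.:+ (ℤ-Solver.con (+ 1) ℤ-Solver.:+ i) ℤ-Solver.:= (ℤ-Solver.con (+ 1) ℤ-Solver.:+ m) ℤ-Solver.:+ i) ≡.refl (+ m) i) (≡.sym e))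

      -- The sum side of the finite triple product: the sum of t(k - m) / ((q; q)_k (q; q)_l) over k
      -- + l = M.
      partial : ℕ → ℕ → Carrier
      partial M m = antidiagonal (λ k l → poch⁻¹ k * poch⁻¹ l * t (k ⊖ m)) M

      private
        h = poch⁻¹
        f : ℕ → Carrier
        f k = 1# - q ^ k

        f0≈0 : f 0 ≈ 0#
        f0≈0 = -‿inverseʳ 1#

        h-suc : ∀ n → h (suc n) * f (suc n) ≈ h n
        h-suc = poch-suc

        cancel-factor : ∀ {x y} M → x * f (suc M) ≈ y → x ≈ factor⁻¹ M * y
        cancel-factor {x} {y} M e = begin
          x                                    ≈⟨ *-identityʳ x ⟨
          x * 1#                               ≈⟨ *-congˡ (factor⁻¹-* M) ⟨
          x * (factor⁻¹ M * f (suc M))         ≈⟨ solve 3 (λ x g f → x :* (g :* f) := g :* (x :* f)) refl x (factor⁻¹ M) (f (suc M)) ⟩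
          factor⁻¹ M * (x * f (suc M))         ≈⟨ *-congˡ e ⟩
          factor⁻¹ M * y                       ∎

        summand : ℕ → ℕ → ℕ → Carrier
        summand m k l = h k * h l * t (k ⊖ m)

      -- For k + l = M + 1 one has 1 - q^(M+1) = (1 - q^l) + q^l (1 - q^k). The first half lowers l,
      -- the second lowers k, and `t-up` recombines the two into the new factor 1 - v q^n.
      grow-v : ∀ n m M → M ≡ n ℕ.+ m → partial (suc M) m ≈ factor⁻¹ M * ((1# - v * q ^ n) * partial M m)
      grow-v n m M M≡ = cancel-factor M (begin
        partial (suc M) m * f (suc M)
          ≈⟨ trans (*-comm _ _) (sym (antidiagonal-*ˡ (suc M) (f (suc M)) (summand m))) ⟩
        antidiagonal (λ k l → f (suc M) * summand m k l) (suc M)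
          ≈⟨ antidiagonal-cong (suc M) (λ k l k+l → trans (*-congʳ (trans (+-congˡ (-‿cong (trans (^-≡ q (≡.sym k+l)) (^-homo-* q k l)))) refl))
               (solve 5 (λ a b x y z → (con (+ 1) :- a :* b) :* (x :* y :* z) := (con (+ 1) :- b) :* (x :* y :* z) :+ b :* ((con (+ 1) :- a) :* (x :* y :* z))) refl (q ^ k) (q ^ l) (h k) (h l) (t (k ⊖ m)))) ⟩
        antidiagonal (λ k l → f l * summand m k l + q ^ l * (f k * summand m k l)) (suc M)
          ≈⟨ antidiagonal-+ (suc M) (λ k l → f l * summand m k l) (λ k l → q ^ l * (f k * summand m k l)) ⟩
        antidiagonal (λ k l → f l * summand m k l) (suc M) + antidiagonal (λ k l → q ^ l * (f k * summand m k l)) (suc M)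
          ≈⟨ +-cong (trans (antidiagonal-last M (λ k l → f l * summand m k l)) (trans (+-congˡ (trans (*-congʳ f0≈0) (zeroˡ _))) (+-identityʳ _)))
                    (trans (+-congʳ (trans (*-congˡ (trans (*-congʳ f0≈0) (zeroˡ _))) (zeroʳ _))) (+-identityˡ _)) ⟩
        antidiagonal (λ k l → f (suc l) * summand m k (suc l)) M + antidiagonal (λ k l → q ^ l * (f (suc k) * summand m (suc k) l)) M
          ≈⟨ antidiagonal-+ M (λ k l → f (suc l) * summand m k (suc l)) (λ k l → q ^ l * (f (suc k) * summand m (suc k) l)) ⟨
        antidiagonal (λ k l → f (suc l) * summand m k (suc l) + q ^ l * (f (suc k) * summand m (suc k) l)) M
          ≈⟨ antidiagonal-cong M step ⟩
        antidiagonal (λ k l → (1# - v * q ^ n) * summand m k l) M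
          ≈⟨ antidiagonal-*ˡ M _ (summand m) ⟩
        (1# - v * q ^ n) * partial M m ∎)
        where
        step : ∀ k l → k ℕ.+ l ≡ M → f (suc l) * summand m k (suc l) + q ^ l * (f (suc k) * summand m (suc k) l) ≈ (1# - v * q ^ n) * summand m k l
        step k l k+l = begin
          f (suc l) * (h k * h (suc l) * t (k ⊖ m)) + q ^ l * (f (suc k) * (h (suc k) * h l * t (suc k ⊖ m)))
            ≈⟨ solve 9 (λ fl hk hsl tk ql fk hsk hl ts → fl :* (hk :* hsl :* tk) :+ ql :* (fk :* (hsk :* hl :* ts)) :=
                 hk :* (hsl :* fl) :* tk :+ (hsk :* fk) :* hl :* (ql :* ts)) refl _ _ _ _ _ _ _ _ _ ⟩
          h k * (h (suc l) * f (suc l)) * t (k ⊖ m) + (h (suc k) * f (suc k)) * h l * (q ^ l * t (suc k ⊖ m))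
            ≈⟨ +-cong (*-congʳ (*-congˡ (h-suc l))) (*-cong (*-congʳ (h-suc k)) (trans (*-congˡ (reflexive (≡.cong t (suc⊖ k m)))) (t-up l n (k ⊖ m) l+i))) ⟩
          h k * h l * t (k ⊖ m) + h k * h l * - (v * q ^ n * t (k ⊖ m))
            ≈⟨ solve 4 (λ hk hl tk x → hk :* hl :* tk :+ hk :* hl :* :- (x :* tk) := (con (+ 1) :- x) :* (hk :* hl :* tk)) refl _ _ _ _ ⟩
          (1# - v * q ^ n) * summand m k l ∎
          where
          l+i : + l ℤ.+ (k ⊖ m) ≡ + n
          l+i = ≡.trans (ℤₚ.distribʳ-⊖-+-pos l k m) (≡.trans (≡.cong (_⊖ m) (≡.trans (ℕₚ.+-comm l k) (≡.trans k+l M≡)))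
                  (≡.trans (≡.sym (ℤₚ.distribʳ-⊖-+-pos n m m)) (≡.trans (≡.cong (λ z → + n ℤ.+ z) (ℤₚ.n⊖n≡0 m)) (ℤₚ.+-identityʳ (+ n)))))

      -- The mirror image of `grow-v`: 1 - q^(M+1) = (1 - q^k) + q^k (1 - q^l), and `t-down`
      -- recombines the halves into 1 - u q^m.
      grow-u : ∀ m M → partial (suc M) (suc m) ≈ factor⁻¹ M * ((1# - u * q ^ m) * partial M m)
      grow-u m M = cancel-factor M (begin
        partial (suc M) (suc m) * f (suc M)
          ≈⟨ trans (*-comm _ _) (sym (antidiagonal-*ˡ (suc M) (f (suc M)) (summand (suc m)))) ⟩
        antidiagonal (λ k l → f (suc M) * summand (suc m) k l) (suc M)
          ≈⟨ antidiagonal-cong (suc M) (λ k l k+l → trans (*-congʳ (trans (+-congˡ (-‿cong (trans (^-≡ q (≡.sym k+l)) (^-homo-* q k l)))) refl))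
               (solve 5 (λ a b x y z → (con (+ 1) :- a :* b) :* (x :* y :* z) := (con (+ 1) :- a) :* (x :* y :* z) :+ a :* ((con (+ 1) :- b) :* (x :* y :* z))) refl (q ^ k) (q ^ l) (h k) (h l) (t (k ⊖ suc m)))) ⟩
        antidiagonal (λ k l → f k * summand (suc m) k l + q ^ k * (f l * summand (suc m) k l)) (suc M)
          ≈⟨ antidiagonal-+ (suc M) (λ k l → f k * summand (suc m) k l) (λ k l → q ^ k * (f l * summand (suc m) k l)) ⟩
        antidiagonal (λ k l → f k * summand (suc m) k l) (suc M) + antidiagonal (λ k l → q ^ k * (f l * summand (suc m) k l)) (suc M)
          ≈⟨ +-cong (trans (+-congʳ (trans (*-congʳ f0≈0) (zeroˡ _))) (+-identityˡ _))
                    (trans (antidiagonal-last M (λ k l → q ^ k * (f l * summand (suc m) k l))) (trans (+-congˡ (trans (*-congˡ (trans (*-congʳ f0≈0) (zeroˡ _))) (zeroʳ _))) (+-identityʳ _))) ⟩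
        antidiagonal (λ k l → f (suc k) * summand (suc m) (suc k) l) M + antidiagonal (λ k l → q ^ k * (f (suc l) * summand (suc m) k (suc l))) M
          ≈⟨ antidiagonal-+ M (λ k l → f (suc k) * summand (suc m) (suc k) l) (λ k l → q ^ k * (f (suc l) * summand (suc m) k (suc l))) ⟨
        antidiagonal (λ k l → f (suc k) * summand (suc m) (suc k) l + q ^ k * (f (suc l) * summand (suc m) k (suc l))) M
          ≈⟨ antidiagonal-cong M (λ k l _ → step k l) ⟩
        antidiagonal (λ k l → (1# - u * q ^ m) * summand m k l) M
          ≈⟨ antidiagonal-*ˡ M _ (summand m) ⟩
        (1# - u * q ^ m) * partial M m ∎)
        where
        step : ∀ k l → f (suc k) * summand (suc m) (suc k) l + q ^ k * (f (suc l) * summand (suc m) k (suc l)) ≈ (1# - u * q ^ m) * summand m k l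
        step k l = begin
          f (suc k) * (h (suc k) * h l * t (suc k ⊖ suc m)) + q ^ k * (f (suc l) * (h k * h (suc l) * t (k ⊖ suc m)))
            ≈⟨ solve 9 (λ fk hsk hl ts qk fl hk hsl tk → fk :* (hsk :* hl :* ts) :+ qk :* (fl :* (hk :* hsl :* tk)) :=
                 (hsk :* fk) :* hl :* ts :+ hk :* (hsl :* fl) :* (qk :* tk)) refl _ _ _ _ _ _ _ _ _ ⟩
          (h (suc k) * f (suc k)) * h l * t (suc k ⊖ suc m) + h k * (h (suc l) * f (suc l)) * (q ^ k * t (k ⊖ suc m))
            ≈⟨ +-cong (*-cong (*-congʳ (h-suc k)) (reflexive (≡.cong t (ℤₚ.[1+m]⊖[1+n]≡m⊖n k m))))
                      (*-cong (*-congˡ (h-suc l)) (trans (t-down k m (k ⊖ suc m) k≡) (-‿cong (*-congˡ (reflexive (≡.cong t up)))))) ⟩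
          h k * h l * t (k ⊖ m) + h k * h l * - (u * q ^ m * t (k ⊖ m))
            ≈⟨ solve 4 (λ hk hl tk x → hk :* hl :* tk :+ hk :* hl :* :- (x :* tk) := (con (+ 1) :- x) :* (hk :* hl :* tk)) refl _ _ _ _ ⟩
          (1# - u * q ^ m) * summand m k l ∎
          where
          k≡ : + k ≡ + suc m ℤ.+ (k ⊖ suc m)
          k≡ = ≡.sym (≡.trans (ℤₚ.distribʳ-⊖-+-pos (suc m) k (suc m)) (≡.trans (≡.cong (_⊖ suc m) (ℕₚ.+-comm (suc m) k))
                 (≡.trans (≡.sym (ℤₚ.distribʳ-⊖-+-pos k (suc m) (suc m))) (≡.trans (≡.cong (λ z → + k ℤ.+ z) (ℤₚ.n⊖n≡0 (suc m))) (ℤₚ.+-identityʳ (+ k))))))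
          up : + 1 ℤ.+ (k ⊖ suc m) ≡ k ⊖ m
          up = ≡.trans (≡.sym (suc⊖ k (suc m))) (ℤₚ.[1+m]⊖[1+n]≡m⊖n k m)

      finite-jtp-v : ∀ n → ∏ n (λ k → 1# - v * q ^ k) * poch⁻¹ n ≈ partial n 0
      finite-jtp-v zero    = solve 0 (con (+ 1) :* con (+ 1) := con (+ 1) :* con (+ 1) :* (con (+ 1) :* (con (+ 1) :* (con (+ 1) :* con (+ 1))))) refl
      finite-jtp-v (suc n) = begin
        (1# - v * q ^ n) * ∏ n (λ k → 1# - v * q ^ k) * (factor⁻¹ n * poch⁻¹ n)
          ≈⟨ solve 4 (λ a b c d → a :* b :* (c :* d) := c :* (a :* (b :* d))) refl _ _ _ _ ⟩
        factor⁻¹ n * ((1# - v * q ^ n) * (∏ n (λ k → 1# - v * q ^ k) * poch⁻¹ n))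
          ≈⟨ *-congˡ (*-congˡ (finite-jtp-v n)) ⟩
        factor⁻¹ n * ((1# - v * q ^ n) * partial n 0)
          ≈⟨ grow-v n 0 n (≡.sym (ℕₚ.+-identityʳ n)) ⟨
        partial (suc n) 0 ∎

      -- The numbers of v-factors and of u-factors grow independently: `grow-v` has produced the
      -- case m = 0, and each further u-factor shifts the centre of the sum by one.
      finite-jtp : ∀ n m → ∏ n (λ k → 1# - v * q ^ k) * ∏ m (λ k → 1# - u * q ^ k) * poch⁻¹ (m ℕ.+ n) ≈ partial (m ℕ.+ n) m
      finite-jtp n zero    = trans (*-congʳ (*-identityʳ _)) (finite-jtp-v n)
      finite-jtp n (suc m) = begin
        V * ((1# - u * q ^ m) * U) * (factor⁻¹ (m ℕ.+ n) * poch⁻¹ (m ℕ.+ n))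
          ≈⟨ solve 5 (λ v a b c d → v :* (a :* b) :* (c :* d) := c :* (a :* (v :* b :* d))) refl _ _ _ _ _ ⟩
        factor⁻¹ (m ℕ.+ n) * ((1# - u * q ^ m) * (V * U * poch⁻¹ (m ℕ.+ n)))
          ≈⟨ *-congˡ (*-congˡ (finite-jtp n m)) ⟩
        factor⁻¹ (m ℕ.+ n) * ((1# - u * q ^ m) * partial (m ℕ.+ n) m)
          ≈⟨ grow-u m (m ℕ.+ n) ⟨
        partial (suc (m ℕ.+ n)) (suc m) ∎
        where
        V = ∏ n (λ k → 1# - v * q ^ k)
        U = ∏ m (λ k → 1# - u * q ^ k)

      -- The limit is exact. Terms with |k - K| > N + 4 vanish; for the others K ≥ N + (N + 4)
      -- forces k ≥ N and l ≥ N, so that 1 / ((q; q)_k (q; q)_l) cancels against the square of (q;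
      -- q)_K.
      θ-product : ∀ K → N ℕ.+ (N ℕ.+ 4) ≤ K →
                  ∏ K (λ k → 1# - v * q ^ k) * ∏ K (λ k → 1# - u * q ^ k) * poch K ≈ θ u v
      θ-product K big = begin
        V * U * p                                                   ≈⟨ *-identityʳ _ ⟨
        -- The factor 1 / (q; q)_2K required by the finite form is inserted as part of 1; the
        -- accompanying (q; q)_K makes up the square that the limit needs.
        V * U * p * 1#                                              ≈⟨ *-congˡ (poch⁻¹-stable (ℕₚ.≤-trans N≤K (ℕₚ.m≤m+n K K)) N≤K) ⟨
        V * U * p * (h (K ℕ.+ K) * p)                               ≈⟨ solve 4 (λ v u p h → v :* u :* p :* (h :* p) := p :* p :* (v :* u :* h)) refl _ _ _ _ ⟩
        p * p * (V * U * h (K ℕ.+ K))                               ≈⟨ *-congˡ (finite-jtp K K) ⟩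
        p * p * partial (K ℕ.+ K) K                                 ≈⟨ antidiagonal-*ˡ (K ℕ.+ K) (p * p) (summand K) ⟨
        antidiagonal (λ k l → p * p * summand K k l) (K ℕ.+ K)      ≈⟨ antidiagonal-cong (K ℕ.+ K) limit ⟩
        antidiagonal (λ k _ → t (k ⊖ K)) (K ℕ.+ K)                  ≈⟨ antidiagonal-∑ (K ℕ.+ K) (λ k → t (k ⊖ K)) ⟩
        ∑ (upTo (suc (K ℕ.+ K))) (λ k → t (k ⊖ K))                  ≈⟨ ∑-map (_⊖ K) (upTo (suc (K ℕ.+ K))) t ⟨
        ∑ (List.map (_⊖ K) (upTo (suc (K ℕ.+ K)))) t                ≈⟨ ∑-support ℤ._≟_ t (Uniqueₚ.map⁺ ⊖-injective (Uniqueₚ.upTo⁺ _)) (window-unique (N ℕ.+ 4)) off (∉⇒0 θ-supported) ⟩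
        θ u v                                                       ∎
        where
        V = ∏ K (λ k → 1# - v * q ^ k)
        U = ∏ K (λ k → 1# - u * q ^ k)
        p = poch K
        N≤K : N ≤ K
        N≤K = ℕₚ.≤-trans (ℕₚ.m≤m+n N _) big
        +K : ∀ k → (k ⊖ K) ℤ.+ + K ≡ + k
        +K k = ≡.trans (≡.cong (ℤ._+ (+ K)) (≡.sym (ℤₚ.m-n≡m⊖n k K))) (ℤ-Solver.solve 2 (λ a b → (a ℤ-Solver.:- b) ℤ-Solver.:+ b ℤ-Solver.:= a) ≡.refl (+ k) (+ K))
        ⊖-injective : ∀ {k k′} → k ⊖ K ≡ k′ ⊖ K → k ≡ k′
        ⊖-injective {k} {k′} e = ℤₚ.+-injective (≡.trans (≡.sym (+K k)) (≡.trans (≡.cong (ℤ._+ (+ K)) e) (+K k′)))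
        B≤K : N ℕ.+ 4 ≤ K
        B≤K = ℕₚ.≤-trans (ℕₚ.m≤n+m _ N) big
        off : ∀ i → i ∉ List.map (_⊖ K) (upTo (suc (K ℕ.+ K))) → t i ≈ 0#
        off i i∉ with suc (N ℕ.+ 4) ℕ.≤? ∣ i ∣
        ... | yes far = θ-supported i far
        ... | no near = contradiction (hit i (ℕₚ.≤-trans (ℕₚ.≤-pred (ℕₚ.≰⇒> near)) B≤K)) i∉
          where
          hit : ∀ i → ∣ i ∣ ≤ K → i ∈ List.map (_⊖ K) (upTo (suc (K ℕ.+ K)))
          hit (+ n) n≤K = ≡.subst (_∈ List.map (_⊖ K) (upTo (suc (K ℕ.+ K)))) eq (∈-map⁺ (_⊖ K) (∈-upTo⁺ (s≤s (ℕₚ.+-monoˡ-≤ K n≤K))))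
            where
            eq : (n ℕ.+ K) ⊖ K ≡ + n
            eq = ≡.trans (≡.sym (ℤₚ.distribʳ-⊖-+-pos n K K)) (≡.trans (≡.cong (λ z → + n ℤ.+ z) (ℤₚ.n⊖n≡0 K)) (ℤₚ.+-identityʳ (+ n)))
          hit -[1+ n ] n<K = ≡.subst (_∈ List.map (_⊖ K) (upTo (suc (K ℕ.+ K)))) eq (∈-map⁺ (_⊖ K) (∈-upTo⁺ (s≤s (ℕₚ.≤-trans (ℕₚ.m∸n≤m K (suc n)) (ℕₚ.m≤m+n K K)))))
            where
            eq : (K ℕ.∸ suc n) ⊖ K ≡ -[1+ n ]
            eq = ≡.trans (ℤₚ.⊖-≤ (ℕₚ.m∸n≤m K (suc n))) (≡.cong (λ x → ℤ.- + x) (ℕₚ.m∸[m∸n]≡n n<K))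
        limit : ∀ k l → k ℕ.+ l ≡ K ℕ.+ K → p * p * summand K k l ≈ t (k ⊖ K)
        limit k l k+l with suc (N ℕ.+ 4) ℕ.≤? ∣ k ⊖ K ∣
        ... | yes far = trans (*-congˡ (trans (*-congˡ (θ-supported (k ⊖ K) far)) (zeroʳ _))) (trans (zeroʳ _) (sym (θ-supported (k ⊖ K) far)))
        ... | no near = begin
          p * p * (h k * h l * t (k ⊖ K))      ≈⟨ solve 4 (λ p a b c → p :* p :* (a :* b :* c) := (a :* p) :* (b :* p) :* c) refl p (h k) (h l) (t (k ⊖ K)) ⟩
          h k * p * (h l * p) * t (k ⊖ K)      ≈⟨ *-congʳ (*-cong (poch⁻¹-stable N≤k N≤K) (poch⁻¹-stable N≤l N≤K)) ⟩
          1# * 1# * t (k ⊖ K)                  ≈⟨ trans (*-congʳ (*-identityˡ 1#)) (*-identityˡ _) ⟩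
          t (k ⊖ K)                            ∎
          where
          near′ : ∣ k ⊖ K ∣ ≤ N ℕ.+ 4
          near′ = ℕₚ.≤-pred (ℕₚ.≰⇒> near)
          K≤k+ : K ≤ k ℕ.+ (N ℕ.+ 4)
          K≤k+ = ℕₚ.≤-trans (m≤n+∣n⊖m∣ K k) (ℕₚ.+-monoʳ-≤ k near′)
          N≤k : N ≤ k
          N≤k = ℕₚ.+-cancelʳ-≤ (N ℕ.+ 4) N k (ℕₚ.≤-trans big K≤k+)
          N≤l : N ≤ l
          N≤l = ℕₚ.+-cancelʳ-≤ (N ℕ.+ 4) N l (ℕₚ.≤-trans big (ℕₚ.+-cancelˡ-≤ K _ _ (complement K k l (N ℕ.+ 4) k+l
                  (ℕₚ.≤-trans (m≤n+∣n⊖m∣ k K) (ℕₚ.+-monoʳ-≤ K (ℕₚ.≤-trans (ℕₚ.≤-reflexive (ℤₚ.∣m⊖n∣≡∣n⊖m∣ K k)) near′))))))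

open TripleProduct

-- Residue classes of ℤ, and cosets of sublattices of index 2 and 3 in ℤ².

module ResidueClasses where
  open import Data.Nat using (NonZero)
  open import Data.Integer.DivMod using (_/ℕ_; a≡a%ℕn+[a/ℕn]*n; n%ℕd<d)
  open import Data.Integer.Solver renaming (module +-*-Solver to ℤ-Solver)
  open import Data.Fin using (Fin; toℕ; fromℕ<)
  import Data.Fin.Properties as Finₚ
  open import Relation.Binary.PropositionalEquality using (refl; cong; cong₂; sym; trans)

  module _ (d : ℕ) .{{_ : NonZero d}} where

    joinResidue : Fin d × ℤ → ℤ
    joinResidue (c , j) = + toℕ c ℤ.+ j ℤ.* + d

    splitResidue : ℤ → Fin d × ℤ
    splitResidue i = fromℕ< (n%ℕd<d i d) , i /ℕ d

    join-split : ∀ i → joinResidue (splitResidue i) ≡ i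
    join-split i = trans (cong (λ r → + r ℤ.+ (i /ℕ d) ℤ.* + d) (Finₚ.toℕ-fromℕ< (n%ℕd<d i d))) (sym (a≡a%ℕn+[a/ℕn]*n i d))

    private
      small : ∀ k c c′ → c < d → c′ < d → k ℤ.* + d ≡ + c ℤ.- + c′ → k ≡ + 0
      small k c c′ c<d c′<d e with ∣ k ∣ ℕ.≟ 0
      ... | yes k≡0 = ℤₚ.∣i∣≡0⇒i≡0 k≡0
      ... | no  k≢0 = contradiction (begin-strict
        d                    ≤⟨ ℕₚ.m≤n*m d ∣ k ∣ ⦃ ℕ.≢-nonZero k≢0 ⦄ ⟩
        ∣ k ∣ ℕ.* d          ≡⟨ ℤₚ.abs-* k (+ d) ⟨
        ∣ k ℤ.* + d ∣        ≡⟨ cong ∣_∣ (trans e (ℤₚ.m-n≡m⊖n c c′)) ⟩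
        ∣ c ⊖ c′ ∣           ≤⟨ ℤₚ.∣m⊝n∣≤m⊔n c c′ ⟩
        c ℕ.⊔ c′             <⟨ ℕₚ.⊔-lub c<d c′<d ⟩
        d                    ∎) (ℕₚ.<-irrefl refl)
        where open ℕₚ.≤-Reasoning

    join-injective : ∀ {p p′} → joinResidue p ≡ joinResidue p′ → p ≡ p′
    join-injective {c , j} {c′ , j′} e = cong₂ _,_ (Finₚ.toℕ-injective (ℤₚ.+-injective c≡c′)) j≡j′
      where
      open ≡.≡-Reasoning
      open ℤ-Solver
      j-j′≡0 : j ℤ.- j′ ≡ + 0
      j-j′≡0 = small (j ℤ.- j′) (toℕ c′) (toℕ c) (Finₚ.toℕ<n c′) (Finₚ.toℕ<n c) (begin
        (j ℤ.- j′) ℤ.* + d                                   ≡⟨ solve 4 (λ j j′ c d → (j :- j′) :* d := (c :+ j :* d) :- c :- j′ :* d) refl j j′ (+ toℕ c) (+ d) ⟩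
        (+ toℕ c ℤ.+ j ℤ.* + d) ℤ.- + toℕ c ℤ.- j′ ℤ.* + d   ≡⟨ cong (λ x → x ℤ.- + toℕ c ℤ.- j′ ℤ.* + d) e ⟩
        (+ toℕ c′ ℤ.+ j′ ℤ.* + d) ℤ.- + toℕ c ℤ.- j′ ℤ.* + d ≡⟨ solve 4 (λ c′ j′ c d → (c′ :+ j′ :* d) :- c :- j′ :* d := c′ :- c) refl (+ toℕ c′) j′ (+ toℕ c) (+ d) ⟩
        + toℕ c′ ℤ.- + toℕ c                                 ∎)
      j≡j′ : j ≡ j′
      j≡j′ = ℤₚ.i-j≡0⇒i≡j j j′ j-j′≡0
      c≡c′ : + toℕ c ≡ + toℕ c′
      c≡c′ = begin
        + toℕ c                                      ≡⟨ solve 3 (λ c j d → c := (c :+ j :* d) :- j :* d) refl (+ toℕ c) j (+ d) ⟩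
        (+ toℕ c ℤ.+ j ℤ.* + d) ℤ.- j ℤ.* + d        ≡⟨ cong₂ (λ x y → x ℤ.- y ℤ.* + d) e j≡j′ ⟩
        (+ toℕ c′ ℤ.+ j′ ℤ.* + d) ℤ.- j′ ℤ.* + d     ≡⟨ solve 3 (λ c j d → c := (c :+ j :* d) :- j :* d) refl (+ toℕ c′) j′ (+ d) ⟨
        + toℕ c′                                     ∎

    split-join : ∀ p → splitResidue (joinResidue p) ≡ p
    split-join p = join-injective (join-split (joinResidue p))

  -- Here c is the parity of the sum of the two indices. The sum of their squares becomes 2 s² + 2
  -- t² on the even coset.
  parity : Fin 2 × ℤ × ℤ → ℤ × ℤ
  parity (c , s , t) = s ℤ.+ t , s ℤ.- t ℤ.+ + toℕ c

  parity⁻¹ : ℤ × ℤ → Fin 2 × ℤ × ℤ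
  parity⁻¹ (m , n) = let c , s = splitResidue 2 (m ℤ.+ n) in c , s , m ℤ.- s

  parity-inverseʳ : ∀ p → parity (parity⁻¹ p) ≡ p
  parity-inverseʳ (m , n) = cong₂ _,_
    (solve 2 (λ m s → s :+ (m :- s) := m) refl m s)
    (begin
      s ℤ.- (m ℤ.- s) ℤ.+ c         ≡⟨ solve 3 (λ m s c → s :- (m :- s) :+ c := (c :+ s :* con (+ 2)) :- m) refl m s c ⟩
      (c ℤ.+ s ℤ.* + 2) ℤ.- m       ≡⟨ cong (ℤ._- m) (join-split 2 (m ℤ.+ n)) ⟩
      (m ℤ.+ n) ℤ.- m               ≡⟨ solve 2 (λ m n → (m :+ n) :- m := n) refl m n ⟩
      n                             ∎)
    where
    open ≡.≡-Reasoning
    open ℤ-Solver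
    s = proj₂ (splitResidue 2 (m ℤ.+ n))
    c = + toℕ (proj₁ (splitResidue 2 (m ℤ.+ n)))

  parity-inverseˡ : ∀ p → parity⁻¹ (parity p) ≡ p
  parity-inverseˡ (c , s , t) = trans (cong back split)
    (cong (λ x → c , s , x) (solve 2 (λ s t → (s :+ t) :- s := t) refl s t))
    where
    open ℤ-Solver
    back : Fin 2 × ℤ → Fin 2 × ℤ × ℤ
    back (c′ , s′) = c′ , s′ , (s ℤ.+ t) ℤ.- s′
    split : splitResidue 2 ((s ℤ.+ t) ℤ.+ (s ℤ.- t ℤ.+ + toℕ c)) ≡ (c , s)
    split = trans (cong (splitResidue 2) (solve 3 (λ s t c → (s :+ t) :+ (s :- t :+ c) := c :+ s :* con (+ 2)) refl s t (+ toℕ c))) (split-join 2 (c , s))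

  offset : Fin 3 → ℤ
  offset c = + toℕ c ℤ.- + 1

  -- For the image (n, t), n + 2 t = 3 j + `offset c`, so c records n + 2 t modulo 3. On the coset
  -- with offset 0 the quadratic form n² + 2 t² becomes 3 j² + 6 s².
  ternary : Fin 3 × ℤ × ℤ → ℤ × ℤ
  ternary (c , j , s) = j ℤ.+ offset c ℤ.- (s ℤ.+ s) , s ℤ.+ j

  ternary⁻¹ : ℤ × ℤ → Fin 3 × ℤ × ℤ
  ternary⁻¹ (n , t) = let c , j = splitResidue 3 (n ℤ.+ (t ℤ.+ t) ℤ.+ + 1) in c , j , t ℤ.- j

  ternary-inverseʳ : ∀ p → ternary (ternary⁻¹ p) ≡ p
  ternary-inverseʳ (n , t) = cong₂ _,_
    (begin
      j ℤ.+ (c ℤ.- + 1) ℤ.- ((t ℤ.- j) ℤ.+ (t ℤ.- j))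
        ≡⟨ solve 3 (λ j c t → j :+ (c :- con (+ 1)) :- ((t :- j) :+ (t :- j)) := (c :+ j :* con (+ 3)) :- con (+ 1) :- (t :+ t)) refl j c t ⟩
      (c ℤ.+ j ℤ.* + 3) ℤ.- + 1 ℤ.- (t ℤ.+ t)
        ≡⟨ cong (λ x → x ℤ.- + 1 ℤ.- (t ℤ.+ t)) (join-split 3 e) ⟩
      e ℤ.- + 1 ℤ.- (t ℤ.+ t)
        ≡⟨ solve 2 (λ n t → (n :+ (t :+ t) :+ con (+ 1)) :- con (+ 1) :- (t :+ t) := n) refl n t ⟩
      n ∎)
    (solve 2 (λ t j → (t :- j) :+ j := t) refl t j)
    where
    open ≡.≡-Reasoning
    open ℤ-Solver
    e = n ℤ.+ (t ℤ.+ t) ℤ.+ + 1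
    j = proj₂ (splitResidue 3 e)
    c = + toℕ (proj₁ (splitResidue 3 e))

  ternary-inverseˡ : ∀ p → ternary⁻¹ (ternary p) ≡ p
  ternary-inverseˡ (c , j , s) = trans (cong back split)
    (cong (λ x → c , j , x) (solve 2 (λ s j → (s :+ j) :- j := s) refl s j))
    where
    open ℤ-Solver
    back : Fin 3 × ℤ → Fin 3 × ℤ × ℤ
    back (c′ , j′) = c′ , j′ , (s ℤ.+ j) ℤ.- j′
    split : splitResidue 3 (j ℤ.+ offset c ℤ.- (s ℤ.+ s) ℤ.+ ((s ℤ.+ j) ℤ.+ (s ℤ.+ j)) ℤ.+ + 1) ≡ (c , j)
    split = trans (cong (splitResidue 3) (solve 3 (λ j s c → j :+ (c :- con (+ 1)) :- (s :+ s) :+ ((s :+ j) :+ (s :+ j)) :+ con (+ 1) := c :+ j :* con (+ 3)) refl j s (+ toℕ c))) (split-join 3 (c , j))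

open ResidueClasses

-- Winquist's identity.

module WinquistIdentity where
  open import Data.Integer.Solver renaming (module +-*-Solver to ℤ-Solver)
  open import Data.Fin using (Fin; zero; suc)

  open ℤ-Solver using () renaming (_:+_ to infixl 6 _+ᴾ_; _:-_ to infixl 6 _-ᴾ_; :-_ to infix 8 -ᴾ_; _:=_ to infix 4 _=ᴾ_; con to #ᴾ)

  vec₂ : ∀ {a b c d : ℕ} → a ≡ c → b ≡ d → a ∷ b ∷ [] ≡ c ∷ d ∷ []
  vec₂ ≡.refl ≡.refl = ≡.refl

  vec₃ : ∀ {a b c d e f : ℕ} → a ≡ d → b ≡ e → c ≡ f → a ∷ b ∷ c ∷ [] ≡ d ∷ e ∷ f ∷ []
  vec₃ ≡.refl ≡.refl ≡.refl = ≡.refl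

  -- The terms (-1)^(sign i) g₁^e₁ ⋯ gₖ^eₖ of a bilateral series, with exponents e = expts i.
  record Family (k : ℕ) : Set where
    constructor _▹_
    field
      sign  : ℤ → ℤ
      expts : ℤ → Vec ℕ k

  open Family

  unsigned : ∀ {k} → (ℤ → Vec ℕ k) → Family k
  unsigned e = (λ _ → + 0) ▹ e

  module Winquist (R : CommutativeRing 0ℓ 0ℓ) (q : CommutativeRing.Carrier R) (N : ℕ) (q^≈0 : TruncatedAt R q N) where
    open CommutativeRing R
    open Monomials R
    open IntegerCoefficients R
    open import Algebra.Properties.Ring ring using (-0#≈0#; -‿distribˡ-*)
    open import Relation.Binary.Reasoning.Setoid setoid
    open JacobiTripleProduct R q N q^≈0

    W : _
    W = window (N ℕ.+ 4)

    q^-far : ∀ {e} → N < e → 1# * mon (q ∷ []) (e ∷ []) ≈ 0#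
    q^-far N<e = trans (*-congˡ (trans (*-congʳ (vanish N<e)) (zeroˡ _))) (zeroʳ _)

    term : ∀ {k} → Vec Carrier k → Family k → ℤ → Carrier
    term gs F i = sgn (sign F i) * mon gs (expts F i)

    -- A product of two terms depends only on the parity of the total sign and on the total
    -- exponents. Each coset therefore costs one linear identity, with l as parity witness, and one
    -- exponent identity per variable.
    match : ∀ {k} (gs : Vec Carrier k) (F G F′ G′ : Family k) i j i′ j′ l →
            sign F i ℤ.+ sign G j ≡ (sign F′ i′ ℤ.+ sign G′ j′) ℤ.+ (l ℤ.+ l) →
            Vec.zipWith ℕ._+_ (expts F i) (expts G j) ≡ Vec.zipWith ℕ._+_ (expts F′ i′) (expts G′ j′) →
            term gs F i * term gs G j ≈ term gs F′ i′ * term gs G′ j′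
    match gs F G F′ G′ i j i′ j′ l signs exps = begin
      term gs F i * term gs G j                                    ≈⟨ combine F G i j ⟩
      sgn (sign F i ℤ.+ sign G j) * mon gs (Vec.zipWith ℕ._+_ (expts F i) (expts G j))
                                                                   ≈⟨ *-cong (sgn-parity _ (sign F′ i′ ℤ.+ sign G′ j′) l signs) (mon-≡ gs exps) ⟩
      sgn (sign F′ i′ ℤ.+ sign G′ j′) * mon gs (Vec.zipWith ℕ._+_ (expts F′ i′) (expts G′ j′))
                                                                   ≈⟨ combine F′ G′ i′ j′ ⟨
      term gs F′ i′ * term gs G′ j′                                ∎
      where
      combine : ∀ F G i j → term gs F i * term gs G j ≈ sgn (sign F i ℤ.+ sign G j) * mon gs (Vec.zipWith ℕ._+_ (expts F i) (expts G j))
      combine F G i j = trans (solve 4 (λ a b c d → (a :* b) :* (c :* d) := (a :* c) :* (b :* d)) refl _ _ _ _)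
                              (*-cong (sym (sgn-+ (sign F i) (sign G j))) (mon-* gs (expts F i) (expts G j)))

    ∑ℤ-reflect : ∀ {f g} → Supported f → Supported g → (∀ i → f i ≈ g (ℤ.- i)) → ∑ℤ f ≈ ∑ℤ g
    ∑ℤ-reflect = ∑ℤ-reindex ℤ.-_ ℤ.-_ ℤₚ.neg-involutive ℤₚ.neg-involutive

    ∑ℤ-reflect₁ : ∀ {f g} → Supported f → Supported g → (∀ i → f i ≈ g (-[1+ 0 ] ℤ.- i)) → ∑ℤ f ≈ ∑ℤ g
    ∑ℤ-reflect₁ = ∑ℤ-reindex (λ i → -[1+ 0 ] ℤ.- i) (λ i → -[1+ 0 ] ℤ.- i) inv inv
      where
      inv : ∀ i → -[1+ 0 ] ℤ.- (-[1+ 0 ] ℤ.- i) ≡ i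
      inv i = ℤ-Solver.solve 1 (λ i → #ᴾ -[1+ 0 ] -ᴾ (#ᴾ -[1+ 0 ] -ᴾ i) =ᴾ i) ≡.refl i

    ∑ℤ-shift : ∀ {f g} → Supported f → Supported g → (∀ i → f i ≈ g (-[1+ 0 ] ℤ.+ i)) → ∑ℤ f ≈ ∑ℤ g
    ∑ℤ-shift = ∑ℤ-reindex (λ i → -[1+ 0 ] ℤ.+ i) (λ i → + 1 ℤ.+ i)
      (λ i → ℤ-Solver.solve 1 (λ i → #ᴾ (+ 1) +ᴾ (#ᴾ -[1+ 0 ] +ᴾ i) =ᴾ i) ≡.refl i)
      (λ i → ℤ-Solver.solve 1 (λ i → #ᴾ -[1+ 0 ] +ᴾ (#ᴾ (+ 1) +ᴾ i) =ᴾ i) ≡.refl i)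

    q-term : (ℤ → ℕ) → ℤ → Carrier
    q-term e = term (q ∷ []) (unsigned (λ s → e s ∷ []))

    -- Theta constants: q^(3 s²), q^(3 s² + 2 s), q^(3 s² + 3 s) and q^(3 s² + s).
    X-exp Y-exp Z-exp V-exp : ℤ → ℕ
    X-exp s = 3 ℕ.* sq s
    Y-exp s = sq s ℕ.+ 4 ℕ.* tri (+ 1 ℤ.+ s)
    Z-exp s = 6 ℕ.* tri (+ 1 ℤ.+ s)
    V-exp s = 2 ℕ.* sq s ℕ.+ 2 ℕ.* tri (+ 1 ℤ.+ s)

    X Y Z V : Carrier
    X = ∑ℤ (q-term X-exp)
    Y = ∑ℤ (q-term Y-exp)
    Z = ∑ℤ (q-term Z-exp)
    V = ∑ℤ (q-term V-exp)

    X-supported : Supported (q-term X-exp)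
    X-supported s N<s = q^-far (ℕₚ.≤-trans (sq-far₀ s N<s) (ℕₚ.m≤m+n _ _))

    Y-supported : Supported (q-term Y-exp)
    Y-supported s N<s = q^-far (ℕₚ.≤-trans (sq-far₀ s N<s) (ℕₚ.m≤m+n _ _))

    Z-supported : Supported (q-term Z-exp)
    Z-supported s N<s = q^-far (ℕₚ.≤-trans (tri-far s N<s (+ 1) (s≤s z≤n)) (ℕₚ.m≤m+n _ _))

    V-supported : Supported (q-term V-exp)
    V-supported s N<s = q^-far (ℕₚ.≤-trans (sq-far₀ s N<s) (ℕₚ.≤-trans (ℕₚ.m≤m+n _ _) (ℕₚ.m≤m+n _ _)))

    -- Y reflected at 0 and at -1/2, V and Z reflected at 0
    Y⁻-exp Y⁻₁-exp V⁻-exp Z⁻-exp : ℤ → ℕ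
    Y⁻-exp  s = sq s ℕ.+ 4 ℕ.* tri s
    Y⁻₁-exp s = sq (+ 1 ℤ.+ s) ℕ.+ 4 ℕ.* tri (+ 1 ℤ.+ s)
    V⁻-exp  s = 2 ℕ.* sq s ℕ.+ 2 ℕ.* tri s
    Z⁻-exp  s = 6 ℕ.* tri s

    Y⁻-supported : Supported (q-term Y⁻-exp)
    Y⁻-supported s N<s = q^-far (ℕₚ.≤-trans (sq-far₀ s N<s) (ℕₚ.m≤m+n _ _))

    Y⁻₁-supported : Supported (q-term Y⁻₁-exp)
    Y⁻₁-supported s N<s = q^-far (ℕₚ.≤-trans (sq-far s N<s (+ 1) (s≤s z≤n)) (ℕₚ.m≤m+n _ _))

    V⁻-supported : Supported (q-term V⁻-exp)
    V⁻-supported s N<s = q^-far (ℕₚ.≤-trans (sq-far₀ s N<s) (ℕₚ.≤-trans (ℕₚ.m≤m+n _ _) (ℕₚ.m≤m+n _ _)))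

    Z⁻-supported : Supported (q-term Z⁻-exp)
    Z⁻-supported s N<s = q^-far (ℕₚ.≤-trans (tri-far₀ s N<s) (ℕₚ.m≤m+n _ _))

    q-term-≡ : ∀ {e f} i j → e i ≡ f j → q-term e i ≈ q-term f j
    q-term-≡ i j eq = *-congˡ (mon-≡ (q ∷ []) (≡.cong (_∷ []) eq))

    Y⁻≈Y : ∑ℤ (q-term Y⁻-exp) ≈ Y
    Y⁻≈Y = ∑ℤ-reflect Y⁻-supported Y-supported (λ s → q-term-≡ {Y⁻-exp} {Y-exp} s (ℤ.- s)
      (exponents 1 (λ s → □ s ⊕ 4 ⊗ △ s ≐ □ (-ᴾ s) ⊕ 4 ⊗ △ (#ᴾ (+ 1) +ᴾ (-ᴾ s))) ≡.refl s))

    Y⁻₁≈Y : ∑ℤ (q-term Y⁻₁-exp) ≈ Y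
    Y⁻₁≈Y = ∑ℤ-reflect₁ Y⁻₁-supported Y-supported (λ s → q-term-≡ {Y⁻₁-exp} {Y-exp} s (-[1+ 0 ] ℤ.- s)
      (exponents 1 (λ s → □ (#ᴾ (+ 1) +ᴾ s) ⊕ 4 ⊗ △ (#ᴾ (+ 1) +ᴾ s) ≐ □ (#ᴾ -[1+ 0 ] -ᴾ s) ⊕ 4 ⊗ △ (#ᴾ (+ 1) +ᴾ (#ᴾ -[1+ 0 ] -ᴾ s))) ≡.refl s))

    V⁻≈V : ∑ℤ (q-term V⁻-exp) ≈ V
    V⁻≈V = ∑ℤ-reflect V⁻-supported V-supported (λ s → q-term-≡ {V⁻-exp} {V-exp} s (ℤ.- s)
      (exponents 1 (λ s → 2 ⊗ □ s ⊕ 2 ⊗ △ s ≐ 2 ⊗ □ (-ᴾ s) ⊕ 2 ⊗ △ (#ᴾ (+ 1) +ᴾ (-ᴾ s))) ≡.refl s))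

    Z⁻≈Z : ∑ℤ (q-term Z⁻-exp) ≈ Z
    Z⁻≈Z = ∑ℤ-reflect Z⁻-supported Z-supported (λ s → q-term-≡ {Z⁻-exp} {Z-exp} s (ℤ.- s)
      (exponents 1 (λ s → 6 ⊗ △ s ≐ 6 ⊗ △ (#ᴾ (+ 1) +ᴾ (-ᴾ s))) ≡.refl s))

    -- With v = z and w = q / z² the families are: θ with (-1)^i z^i q^(i(i-1)/2), α with z^(2s)
    -- q^(s²-s), β with z^(2t) q^(t²), A with (-1)^j z^(3j) q^(3j(j-1)/2), and B with (-1)^j (z^(3j)
    -- q^((3j²-j)/2) - z^(3j+1) q^((3j²+j)/2)). In v and w all exponents are nonnegative.
    module OneVariable (v w : Carrier) (v²w≈q : v ^ 2 * w ≈ q) where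

      gs = v ∷ w ∷ []

      θᶠ αᶠ βᶠ Aᶠ B₁ᶠ B₂ᶠ : Family 2
      θᶠ  = (λ i → i) ▹ (λ i → sq i ∷ tri i ∷ [])
      αᶠ  = unsigned (λ s → 2 ℕ.* sq s ∷ 2 ℕ.* tri s ∷ [])
      βᶠ  = unsigned (λ t → 4 ℕ.* tri (+ 1 ℤ.+ t) ∷ sq t ∷ [])
      Aᶠ  = (λ j → j) ▹ (λ j → 3 ℕ.* sq j ∷ 3 ℕ.* tri j ∷ [])
      B₁ᶠ = (λ j → j) ▹ (λ j → sq j ℕ.+ 4 ℕ.* tri (+ 1 ℤ.+ j) ∷ tri j ℕ.+ sq j ∷ [])
      B₂ᶠ = (λ j → j) ▹ (λ j → sq (+ 1 ℤ.+ j) ℕ.+ 4 ℕ.* tri (+ 1 ℤ.+ j) ∷ tri (+ 1 ℤ.+ j) ℕ.+ sq j ∷ [])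

      α β A B : Carrier
      α = ∑ℤ (term gs αᶠ)
      β = ∑ℤ (term gs βᶠ)
      A = ∑ℤ (term gs Aᶠ)
      B = ∑ℤ (term gs B₁ᶠ) - ∑ℤ (term gs B₂ᶠ)

      -- The monomial contains (v² w)^(N+1) = q^(N+1) = 0.
      vw-vanish : ∀ {σ k l} → 2 ℕ.* suc N ≤ k → suc N ≤ l → σ * mon gs (k ∷ l ∷ []) ≈ 0#
      vw-vanish {σ} {k} {l} N<k N<l = trans (*-congˡ (begin
        v ^ k * (w ^ l * 1#)
          ≈⟨ *-cong (^-≡ v (≡.sym (ℕₚ.m+[n∸m]≡n N<k))) (*-congʳ (^-≡ w (≡.sym (ℕₚ.m+[n∸m]≡n N<l)))) ⟩
        v ^ (2 ℕ.* suc N ℕ.+ a) * (w ^ (suc N ℕ.+ b) * 1#)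
          ≈⟨ *-cong (trans (^-homo-* v (2 ℕ.* suc N) a) (*-congʳ (sym (^-assocʳ v 2 (suc N))))) (*-congʳ (^-homo-* w (suc N) b)) ⟩
        (v ^ 2) ^ suc N * v ^ a * (w ^ suc N * w ^ b * 1#)
          ≈⟨ solve 4 (λ x y z w → x :* y :* (z :* w :* con (+ 1)) := (x :* z) :* (y :* w)) refl _ _ _ _ ⟩
        (v ^ 2) ^ suc N * w ^ suc N * (v ^ a * w ^ b)
          ≈⟨ *-congʳ (trans (sym (^-distrib-* (v ^ 2) w (suc N))) (trans (^-congˡ (suc N) v²w≈q) q^≈0)) ⟩
        0# * (v ^ a * w ^ b)
          ≈⟨ zeroˡ _ ⟩
        0# ∎)) (zeroʳ σ)
        where
        a = k ℕ.∸ 2 ℕ.* suc N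
        b = l ℕ.∸ suc N

      q^-as-vw : ∀ e → mon (q ∷ []) (e ∷ []) ≈ mon gs (2 ℕ.* e ∷ e ∷ [])
      q^-as-vw e = begin
        q ^ e * 1#                  ≈⟨ *-congʳ (^-congˡ e (sym v²w≈q)) ⟩
        (v ^ 2 * w) ^ e * 1#        ≈⟨ *-congʳ (^-distrib-* (v ^ 2) w e) ⟩
        (v ^ 2) ^ e * w ^ e * 1#    ≈⟨ *-assoc _ _ _ ⟩
        (v ^ 2) ^ e * (w ^ e * 1#)  ≈⟨ *-congʳ (^-assocʳ v 2 e) ⟩
        v ^ (2 ℕ.* e) * (w ^ e * 1#) ∎

      θ-as-vw : ∀ i → θ-term (v * w) v i ≈ term gs θᶠ i
      θ-as-vw i = *-congˡ (begin
        (v * w) ^ T * (v ^ T′ * 1#)     ≈⟨ *-congʳ (^-distrib-* v w T) ⟩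
        v ^ T * w ^ T * (v ^ T′ * 1#)   ≈⟨ solve 3 (λ a b c → a :* b :* (c :* con (+ 1)) := (a :* c) :* (b :* con (+ 1))) refl _ _ _ ⟩
        v ^ T * v ^ T′ * (w ^ T * 1#)   ≈⟨ *-congʳ (trans (sym (^-homo-* v T T′)) (^-≡ v (exponents 1 (λ i → △ i ⊕ △ (#ᴾ (+ 1) +ᴾ i) ≐ □ i) ≡.refl i))) ⟩
        v ^ sq i * (w ^ T * 1#)         ∎)
        where
        T = tri i
        T′ = tri (+ 1 ℤ.+ i)

      private
        twofold : ∀ {c x} → 2 ≤ c → suc N ≤ x → 2 ℕ.* suc N ≤ c ℕ.* x
        twofold = ℕₚ.*-mono-≤

      α-supported : Supported (term gs αᶠ)
      α-supported s N<s = vw-vanish (twofold ℕₚ.≤-refl (sq-far₀ s N<s)) (ℕₚ.≤-trans (tri-far₀ s N<s) (ℕₚ.m≤m+n _ _))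

      β-supported : Supported (term gs βᶠ)
      β-supported s N<s = vw-vanish (twofold {4} (s≤s (s≤s z≤n)) (tri-far s N<s (+ 1) (s≤s z≤n))) (sq-far₀ s N<s)

      A-supported : Supported (term gs Aᶠ)
      A-supported s N<s = vw-vanish (twofold {3} (s≤s (s≤s z≤n)) (sq-far₀ s N<s)) (ℕₚ.≤-trans (tri-far₀ s N<s) (ℕₚ.m≤m+n _ _))

      B₁-supported : Supported (term gs B₁ᶠ)
      B₁-supported s N<s = vw-vanish (ℕₚ.≤-trans (twofold {4} (s≤s (s≤s z≤n)) (tri-far s N<s (+ 1) (s≤s z≤n))) (ℕₚ.m≤n+m _ (sq s)))
                                     (ℕₚ.≤-trans (tri-far₀ s N<s) (ℕₚ.m≤m+n _ _))

      B₂-supported : Supported (term gs B₂ᶠ)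
      B₂-supported s N<s = vw-vanish (ℕₚ.≤-trans (twofold {4} (s≤s (s≤s z≤n)) (tri-far s N<s (+ 1) (s≤s z≤n))) (ℕₚ.m≤n+m _ (sq (+ 1 ℤ.+ s))))
                                     (ℕₚ.≤-trans (sq-far₀ s N<s) (ℕₚ.m≤n+m _ (tri (+ 1 ℤ.+ s))))

      θ-supported′ : Supported (term gs θᶠ)
      θ-supported′ i N<i = trans (sym (θ-as-vw i)) (θ-supported (v * w) v (trans (solve 2 (λ v w → v :* w :* v := v :* (v :* con (+ 1)) :* w) refl v w) v²w≈q) i N<i)

      qᶠ : (ℤ → ℕ) → Family 2
      qᶠ e = unsigned (λ s → 2 ℕ.* e s ∷ e s ∷ [])

      qᶠ≈q : ∀ e s → term gs (qᶠ e) s ≈ q-term e s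
      qᶠ≈q e s = *-congˡ (sym (q^-as-vw (e s)))

      qᶠ-supported : ∀ {e} → Supported (q-term e) → Supported (term gs (qᶠ e))
      qᶠ-supported {e} supp s N<s = trans (qᶠ≈q e s) (supp s N<s)

      ∑-qᶠ : ∀ e → ∑ℤ (term gs (qᶠ e)) ≈ ∑ℤ (q-term e)
      ∑-qᶠ e = ∑-cong W (qᶠ≈q e)

      private
        vB₂⁻ᶠ vB₁⁻ᶠ vwA⁻ᶠ B₂⁻ᶠ : Family 2
        vB₂⁻ᶠ = (λ j → -[1+ 0 ] ℤ.+ j) ▹ (λ j → suc (sq (+ 1 ℤ.+ (-[1+ 0 ] ℤ.+ j)) ℕ.+ 4 ℕ.* tri (+ 1 ℤ.+ (-[1+ 0 ] ℤ.+ j))) ∷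
                                                tri (+ 1 ℤ.+ (-[1+ 0 ] ℤ.+ j)) ℕ.+ sq (-[1+ 0 ] ℤ.+ j) ∷ [])
        vB₁⁻ᶠ = (λ j → + 1 ℤ.+ j) ▹ (λ j → suc (sq j ℕ.+ 4 ℕ.* tri (+ 1 ℤ.+ j)) ∷ tri j ℕ.+ sq j ∷ [])
        vwA⁻ᶠ = (λ j → + 1 ℤ.+ j) ▹ (λ j → suc (3 ℕ.* sq j) ∷ suc (3 ℕ.* tri j) ∷ [])
        B₂⁻ᶠ  = (λ j → + 1 ℤ.+ j) ▹ (λ j → sq (+ 1 ℤ.+ j) ℕ.+ 4 ℕ.* tri (+ 1 ℤ.+ j) ∷ tri (+ 1 ℤ.+ j) ℕ.+ sq j ∷ [])

        vB₂⁻≈ : ∀ j → term gs vB₂⁻ᶠ j ≈ v * term gs B₂ᶠ (-[1+ 0 ] ℤ.+ j)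
        vB₂⁻≈ j = solve 4 (λ s v a b → s :* (v :* a :* b) := v :* (s :* (a :* b))) refl _ v _ _

        vB₁⁻≈ : ∀ j → term gs vB₁⁻ᶠ j ≈ - v * term gs B₁ᶠ j
        vB₁⁻≈ j = trans (*-congʳ (sgn-suc j)) (solve 4 (λ s v a b → :- s :* (v :* a :* b) := :- v :* (s :* (a :* b))) refl _ v _ _)

        vwA⁻≈ : ∀ j → term gs vwA⁻ᶠ j ≈ - (v * w) * term gs Aᶠ j
        vwA⁻≈ j = trans (*-congʳ (sgn-suc j)) (solve 5 (λ s v w a b → :- s :* (v :* a :* (w :* b :* con (+ 1))) := :- (v :* w) :* (s :* (a :* (b :* con (+ 1))))) refl _ v w _ _)

        B₂⁻≈ : ∀ j → term gs B₂⁻ᶠ j ≈ - term gs B₂ᶠ j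
        B₂⁻≈ j = trans (*-congʳ (sgn-suc j)) (sym (-‿distribˡ-* _ _))

        B₂-shift-supported : Supported (λ j → term gs B₂ᶠ (-[1+ 0 ] ℤ.+ j))
        B₂-shift-supported s N<s = vw-vanish
          (ℕₚ.≤-trans (twofold {4} (s≤s (s≤s z≤n)) (≡.subst (λ k → N < tri k) (≡.sym back) (tri-far₀ s N<s))) (ℕₚ.m≤n+m _ (sq (+ 1 ℤ.+ (-[1+ 0 ] ℤ.+ s)))))
          (ℕₚ.≤-trans (sq-far s N<s -[1+ 0 ] (s≤s z≤n)) (ℕₚ.m≤n+m _ (tri (+ 1 ℤ.+ (-[1+ 0 ] ℤ.+ s)))))
          where
          back : + 1 ℤ.+ (-[1+ 0 ] ℤ.+ s) ≡ s
          back = ℤ-Solver.solve 1 (λ s → #ᴾ (+ 1) +ᴾ (#ᴾ -[1+ 0 ] +ᴾ s) =ᴾ s) ≡.refl s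

        ∑-vB₂⁻ : ∑ℤ (term gs vB₂⁻ᶠ) ≈ v * ∑ℤ (term gs B₂ᶠ)
        ∑-vB₂⁻ = trans (∑-cong W vB₂⁻≈) (trans (∑-*ˡ W v _)
          (*-congˡ (∑ℤ-shift B₂-shift-supported B₂-supported (λ _ → refl))))

      -- Under `ternary` the coset with offset 0 gives X A, while the offsets -1 and 1 give Y times
      -- the two halves of - v B.
      θ*α : θ (v * w) v * α ≈ X * A - Y * (v * B)
      θ*α = begin
        θ (v * w) v * α
          ≈⟨ *-congʳ (∑-cong W θ-as-vw) ⟩
        ∑ℤ (term gs θᶠ) * α
          ≈⟨ ∑ℤ-*-∑ℤ ternary ternary⁻¹ ternary-inverseˡ ternary-inverseʳ {a = λ c → term gs (a c)} {b = λ c → term gs (b c)} θ-supported′ α-supported a-supported b-supported pointwise ⟩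
        ∑ℤ (term gs vB₂⁻ᶠ) * ∑ℤ (term gs (qᶠ Y-exp)) + (A * ∑ℤ (term gs (qᶠ X-exp)) + (∑ℤ (term gs vB₁⁻ᶠ) * ∑ℤ (term gs (qᶠ Y⁻-exp)) + 0#))
          ≈⟨ +-cong (*-cong ∑-vB₂⁻ (∑-qᶠ Y-exp)) (+-cong (*-congˡ (∑-qᶠ X-exp))
               (+-congʳ (*-cong (trans (∑-cong W vB₁⁻≈) (∑-*ˡ W (- v) _)) (trans (∑-qᶠ Y⁻-exp) Y⁻≈Y)))) ⟩
        v * ∑ℤ (term gs B₂ᶠ) * Y + (A * X + (- v * ∑ℤ (term gs B₁ᶠ) * Y + 0#))
          ≈⟨ solve 6 (λ v b₂ y a x b₁ → v :* b₂ :* y :+ (a :* x :+ (:- v :* b₁ :* y :+ con (+ 0))) := x :* a :- y :* (v :* (b₁ :- b₂))) refl _ _ _ _ _ _ ⟩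
        X * A - Y * (v * B) ∎
        where
        a b : Fin 3 → Family 2
        a zero             = vB₂⁻ᶠ
        a (suc zero)       = Aᶠ
        a (suc (suc zero)) = vB₁⁻ᶠ
        b zero             = qᶠ Y-exp
        b (suc zero)       = qᶠ X-exp
        b (suc (suc zero)) = qᶠ Y⁻-exp
        a-supported : ∀ c → Supported (term gs (a c))
        a-supported zero             i N<i = trans (vB₂⁻≈ i) (trans (*-congˡ (B₂-shift-supported i N<i)) (zeroʳ v))
        a-supported (suc zero)             = A-supported
        a-supported (suc (suc zero)) i N<i = trans (vB₁⁻≈ i) (trans (*-congˡ (B₁-supported i N<i)) (zeroʳ _))
        b-supported : ∀ c → Supported (term gs (b c))
        b-supported zero             = qᶠ-supported {Y-exp} Y-supported
        b-supported (suc zero)       = qᶠ-supported {X-exp} X-supported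
        b-supported (suc (suc zero)) = qᶠ-supported {Y⁻-exp} Y⁻-supported
        pointwise : ∀ c j s → term gs (a c) j * term gs (b c) s ≈ term gs θᶠ (proj₁ (ternary (c , j , s))) * term gs αᶠ (proj₂ (ternary (c , j , s)))
        pointwise c@zero j s = match gs (a c) (b c) θᶠ αᶠ j s (proj₁ (ternary (c , j , s))) (proj₂ (ternary (c , j , s))) s
          (ℤ-Solver.solve 2 (λ j s → #ᴾ -[1+ 0 ] +ᴾ j +ᴾ #ᴾ (+ 0) =ᴾ (j +ᴾ #ᴾ -[1+ 0 ] -ᴾ (s +ᴾ s) +ᴾ #ᴾ (+ 0)) +ᴾ (s +ᴾ s)) ≡.refl j s)
          (vec₂ (exponents 2 (λ j s → ♯ 1 ⊕ (□ (#ᴾ (+ 1) +ᴾ (#ᴾ -[1+ 0 ] +ᴾ j)) ⊕ 4 ⊗ △ (#ᴾ (+ 1) +ᴾ (#ᴾ -[1+ 0 ] +ᴾ j))) ⊕ 2 ⊗ (□ s ⊕ 4 ⊗ △ (#ᴾ (+ 1) +ᴾ s))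
                        ≐ □ (j +ᴾ #ᴾ -[1+ 0 ] -ᴾ (s +ᴾ s)) ⊕ 2 ⊗ □ (s +ᴾ j)) ≡.refl j s)
                (exponents 2 (λ j s → △ (#ᴾ (+ 1) +ᴾ (#ᴾ -[1+ 0 ] +ᴾ j)) ⊕ □ (#ᴾ -[1+ 0 ] +ᴾ j) ⊕ (□ s ⊕ 4 ⊗ △ (#ᴾ (+ 1) +ᴾ s))
                        ≐ △ (j +ᴾ #ᴾ -[1+ 0 ] -ᴾ (s +ᴾ s)) ⊕ 2 ⊗ △ (s +ᴾ j)) ≡.refl j s))
        pointwise c@(suc zero) j s = match gs (a c) (b c) θᶠ αᶠ j s (proj₁ (ternary (c , j , s))) (proj₂ (ternary (c , j , s))) s
          (ℤ-Solver.solve 2 (λ j s → j +ᴾ #ᴾ (+ 0) =ᴾ (j +ᴾ #ᴾ (+ 0) -ᴾ (s +ᴾ s) +ᴾ #ᴾ (+ 0)) +ᴾ (s +ᴾ s)) ≡.refl j s)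
          (vec₂ (exponents 2 (λ j s → 3 ⊗ □ j ⊕ 2 ⊗ (3 ⊗ □ s)
                        ≐ □ (j +ᴾ #ᴾ (+ 0) -ᴾ (s +ᴾ s)) ⊕ 2 ⊗ □ (s +ᴾ j)) ≡.refl j s)
                (exponents 2 (λ j s → 3 ⊗ △ j ⊕ 3 ⊗ □ s
                        ≐ △ (j +ᴾ #ᴾ (+ 0) -ᴾ (s +ᴾ s)) ⊕ 2 ⊗ △ (s +ᴾ j)) ≡.refl j s))
        pointwise c@(suc (suc zero)) j s = match gs (a c) (b c) θᶠ αᶠ j s (proj₁ (ternary (c , j , s))) (proj₂ (ternary (c , j , s))) s
          (ℤ-Solver.solve 2 (λ j s → #ᴾ (+ 1) +ᴾ j +ᴾ #ᴾ (+ 0) =ᴾ (j +ᴾ #ᴾ (+ 1) -ᴾ (s +ᴾ s) +ᴾ #ᴾ (+ 0)) +ᴾ (s +ᴾ s)) ≡.refl j s)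
          (vec₂ (exponents 2 (λ j s → ♯ 1 ⊕ (□ j ⊕ 4 ⊗ △ (#ᴾ (+ 1) +ᴾ j)) ⊕ 2 ⊗ (□ s ⊕ 4 ⊗ △ s)
                        ≐ □ (j +ᴾ #ᴾ (+ 1) -ᴾ (s +ᴾ s)) ⊕ 2 ⊗ □ (s +ᴾ j)) ≡.refl j s)
                (exponents 2 (λ j s → △ j ⊕ □ j ⊕ (□ s ⊕ 4 ⊗ △ s)
                        ≐ △ (j +ᴾ #ᴾ (+ 1) -ᴾ (s +ᴾ s)) ⊕ 2 ⊗ △ (s +ᴾ j)) ≡.refl j s))

      -- Here offset -1 gives the term with A, and the offsets 0 and 1 give V times the two halves
      -- of B. Together with `θ*α` this expresses (θ α, θ β) by a matrix of theta constants applied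
      -- to (A, B), with determinant V X - v² w Y Z = V X - q Y Z.
      θ*β : θ (v * w) v * β ≈ V * B - v * w * (Z * A)
      θ*β = begin
        θ (v * w) v * β
          ≈⟨ *-congʳ (∑-cong W θ-as-vw) ⟩
        ∑ℤ (term gs θᶠ) * β
          ≈⟨ ∑ℤ-*-∑ℤ ternary ternary⁻¹ ternary-inverseˡ ternary-inverseʳ {a = λ c → term gs (a c)} {b = λ c → term gs (b c)} θ-supported′ β-supported a-supported b-supported pointwise ⟩
        ∑ℤ (term gs vwA⁻ᶠ) * ∑ℤ (term gs (qᶠ Z-exp)) + (∑ℤ (term gs B₁ᶠ) * ∑ℤ (term gs (qᶠ V-exp)) + (∑ℤ (term gs B₂⁻ᶠ) * ∑ℤ (term gs (qᶠ V⁻-exp)) + 0#))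
          ≈⟨ +-cong (*-cong (trans (∑-cong W vwA⁻≈) (∑-*ˡ W (- (v * w)) (term gs Aᶠ))) (∑-qᶠ Z-exp))
              (+-cong (*-congˡ (∑-qᶠ V-exp)) (+-congʳ (*-cong (trans (∑-cong W B₂⁻≈) (∑-neg W (term gs B₂ᶠ))) (trans (∑-qᶠ V⁻-exp) V⁻≈V)))) ⟩
        - (v * w) * A * Z + (∑ℤ (term gs B₁ᶠ) * V + (- ∑ℤ (term gs B₂ᶠ) * V + 0#))
          ≈⟨ solve 6 (λ x a z b₁ b₂ u → :- x :* a :* z :+ (b₁ :* u :+ (:- b₂ :* u :+ con (+ 0))) := u :* (b₁ :- b₂) :- x :* (z :* a)) refl _ _ _ _ _ _ ⟩
        V * B - v * w * (Z * A) ∎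
        where
        a b : Fin 3 → Family 2
        a zero             = vwA⁻ᶠ
        a (suc zero)       = B₁ᶠ
        a (suc (suc zero)) = B₂⁻ᶠ
        b zero             = qᶠ Z-exp
        b (suc zero)       = qᶠ V-exp
        b (suc (suc zero)) = qᶠ V⁻-exp
        a-supported : ∀ c → Supported (term gs (a c))
        a-supported zero             i N<i = trans (vwA⁻≈ i) (trans (*-congˡ (A-supported i N<i)) (zeroʳ _))
        a-supported (suc zero)             = B₁-supported
        a-supported (suc (suc zero)) i N<i = trans (B₂⁻≈ i) (trans (-‿cong (B₂-supported i N<i)) -0#≈0#)
        b-supported : ∀ c → Supported (term gs (b c))
        b-supported zero             = qᶠ-supported {Z-exp} Z-supported
        b-supported (suc zero)       = qᶠ-supported {V-exp} V-supported
        b-supported (suc (suc zero)) = qᶠ-supported {V⁻-exp} V⁻-supported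
        pointwise : ∀ c j s → term gs (a c) j * term gs (b c) s ≈ term gs θᶠ (proj₁ (ternary (c , j , s))) * term gs βᶠ (proj₂ (ternary (c , j , s)))
        pointwise c@zero j s = match gs (a c) (b c) θᶠ βᶠ j s (proj₁ (ternary (c , j , s))) (proj₂ (ternary (c , j , s))) (+ 1 ℤ.+ s)
          (ℤ-Solver.solve 2 (λ j s → #ᴾ (+ 1) +ᴾ j +ᴾ #ᴾ (+ 0) =ᴾ (j +ᴾ #ᴾ -[1+ 0 ] -ᴾ (s +ᴾ s) +ᴾ #ᴾ (+ 0)) +ᴾ ((#ᴾ (+ 1) +ᴾ s) +ᴾ (#ᴾ (+ 1) +ᴾ s))) ≡.refl j s)
          (vec₂ (exponents 2 (λ j s → ♯ 1 ⊕ 3 ⊗ □ j ⊕ 2 ⊗ (6 ⊗ △ (#ᴾ (+ 1) +ᴾ s))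
                        ≐ □ (j +ᴾ #ᴾ -[1+ 0 ] -ᴾ (s +ᴾ s)) ⊕ 4 ⊗ △ (#ᴾ (+ 1) +ᴾ (s +ᴾ j))) ≡.refl j s)
                (exponents 2 (λ j s → ♯ 1 ⊕ 3 ⊗ △ j ⊕ 6 ⊗ △ (#ᴾ (+ 1) +ᴾ s)
                        ≐ △ (j +ᴾ #ᴾ -[1+ 0 ] -ᴾ (s +ᴾ s)) ⊕ □ (s +ᴾ j)) ≡.refl j s))
        pointwise c@(suc zero) j s = match gs (a c) (b c) θᶠ βᶠ j s (proj₁ (ternary (c , j , s))) (proj₂ (ternary (c , j , s))) s
          (ℤ-Solver.solve 2 (λ j s → j +ᴾ #ᴾ (+ 0) =ᴾ (j +ᴾ #ᴾ (+ 0) -ᴾ (s +ᴾ s) +ᴾ #ᴾ (+ 0)) +ᴾ (s +ᴾ s)) ≡.refl j s)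
          (vec₂ (exponents 2 (λ j s → □ j ⊕ 4 ⊗ △ (#ᴾ (+ 1) +ᴾ j) ⊕ 2 ⊗ (2 ⊗ □ s ⊕ 2 ⊗ △ (#ᴾ (+ 1) +ᴾ s))
                        ≐ □ (j +ᴾ #ᴾ (+ 0) -ᴾ (s +ᴾ s)) ⊕ 4 ⊗ △ (#ᴾ (+ 1) +ᴾ (s +ᴾ j))) ≡.refl j s)
                (exponents 2 (λ j s → △ j ⊕ □ j ⊕ (2 ⊗ □ s ⊕ 2 ⊗ △ (#ᴾ (+ 1) +ᴾ s))
                        ≐ △ (j +ᴾ #ᴾ (+ 0) -ᴾ (s +ᴾ s)) ⊕ □ (s +ᴾ j)) ≡.refl j s))
        pointwise c@(suc (suc zero)) j s = match gs (a c) (b c) θᶠ βᶠ j s (proj₁ (ternary (c , j , s))) (proj₂ (ternary (c , j , s))) s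
          (ℤ-Solver.solve 2 (λ j s → #ᴾ (+ 1) +ᴾ j +ᴾ #ᴾ (+ 0) =ᴾ (j +ᴾ #ᴾ (+ 1) -ᴾ (s +ᴾ s) +ᴾ #ᴾ (+ 0)) +ᴾ (s +ᴾ s)) ≡.refl j s)
          (vec₂ (exponents 2 (λ j s → □ (#ᴾ (+ 1) +ᴾ j) ⊕ 4 ⊗ △ (#ᴾ (+ 1) +ᴾ j) ⊕ 2 ⊗ (2 ⊗ □ s ⊕ 2 ⊗ △ s)
                        ≐ □ (j +ᴾ #ᴾ (+ 1) -ᴾ (s +ᴾ s)) ⊕ 4 ⊗ △ (#ᴾ (+ 1) +ᴾ (s +ᴾ j))) ≡.refl j s)
                (exponents 2 (λ j s → △ (#ᴾ (+ 1) +ᴾ j) ⊕ □ j ⊕ (2 ⊗ □ s ⊕ 2 ⊗ △ s)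
                        ≐ △ (j +ᴾ #ᴾ (+ 1) -ᴾ (s +ᴾ s)) ⊕ □ (s +ᴾ j)) ≡.refl j s))

    pentagonalᶠ : Family 1
    pentagonalᶠ = (λ i → i) ▹ (λ i → tri i ℕ.+ 2 ℕ.* tri (+ 1 ℤ.+ i) ∷ [])

    pentagonal : Carrier
    pentagonal = ∑ℤ (term (q ∷ []) pentagonalᶠ)

    pentagonal-supported : Supported (term (q ∷ []) pentagonalᶠ)
    pentagonal-supported i N<i = trans (*-congˡ (trans (*-congʳ (vanish (ℕₚ.≤-trans (tri-far₀ i N<i) (ℕₚ.m≤m+n _ _)))) (zeroˡ _))) (zeroʳ _)

    -- This evaluates the determinant of theta constants: splitting the square of the pentagonal
    -- series by `parity`, the even coset is V X and the odd one is - q Y Z.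
    pentagonal² : pentagonal * pentagonal ≈ V * X - q * (Y * Z)
    pentagonal² = begin
      pentagonal * pentagonal
        ≈⟨ ∑ℤ-*-∑ℤ parity parity⁻¹ parity-inverseˡ parity-inverseʳ {a = λ c → term (q ∷ []) (a c)} {b = λ c → term (q ∷ []) (b c)}
             pentagonal-supported pentagonal-supported a-supported b-supported pointwise ⟩
      V * X + (∑ℤ (term (q ∷ []) -Y⁻₁ᶠ) * ∑ℤ (term (q ∷ []) qZ⁻ᶠ) + 0#)
        ≈⟨ +-congˡ (+-congʳ (*-cong (trans (trans (∑-cong W -Y⁻₁≈) (∑-neg W (q-term Y⁻₁-exp))) (-‿cong Y⁻₁≈Y))
                                    (trans (trans (∑-cong W qZ⁻≈) (∑-*ˡ W q (q-term Z⁻-exp))) (*-congˡ Z⁻≈Z)))) ⟩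
      V * X + (- Y * (q * Z) + 0#)
        ≈⟨ solve 5 (λ v x y q z → v :* x :+ (:- y :* (q :* z) :+ con (+ 0)) := v :* x :- q :* (y :* z)) refl V X Y q Z ⟩
      V * X - q * (Y * Z) ∎
      where
      -Y⁻₁ᶠ qZ⁻ᶠ : Family 1
      -Y⁻₁ᶠ = (λ _ → + 1) ▹ (λ s → Y⁻₁-exp s ∷ [])
      qZ⁻ᶠ  = unsigned (λ t → suc (Z⁻-exp t) ∷ [])
      -Y⁻₁≈ : ∀ s → term (q ∷ []) -Y⁻₁ᶠ s ≈ - q-term Y⁻₁-exp s
      -Y⁻₁≈ s = solve 1 (λ a → (:- con (+ 1) :* con (+ 1)) :* a := :- (con (+ 1) :* a)) refl _
      qZ⁻≈ : ∀ s → term (q ∷ []) qZ⁻ᶠ s ≈ q * q-term Z⁻-exp s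
      qZ⁻≈ s = solve 3 (λ q a b → con (+ 1) :* (q :* a :* b) := q :* (con (+ 1) :* (a :* b))) refl q _ _
      a b : Fin 2 → Family 1
      a zero       = unsigned (λ s → V-exp s ∷ [])
      a (suc zero) = -Y⁻₁ᶠ
      b zero       = unsigned (λ s → X-exp s ∷ [])
      b (suc zero) = qZ⁻ᶠ
      a-supported : ∀ c → Supported (term (q ∷ []) (a c))
      a-supported zero       = V-supported
      a-supported (suc zero) i N<i = trans (-Y⁻₁≈ i) (trans (-‿cong (Y⁻₁-supported i N<i)) -0#≈0#)
      b-supported : ∀ c → Supported (term (q ∷ []) (b c))
      b-supported zero       = X-supported
      b-supported (suc zero) i N<i = trans (qZ⁻≈ i) (trans (*-congˡ (Z⁻-supported i N<i)) (zeroʳ q))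
      pointwise : ∀ c s t → term (q ∷ []) (a c) s * term (q ∷ []) (b c) t ≈
                  term (q ∷ []) pentagonalᶠ (proj₁ (parity (c , s , t))) * term (q ∷ []) pentagonalᶠ (proj₂ (parity (c , s , t)))
      pointwise c@zero s t = match (q ∷ []) (a c) (b c) pentagonalᶠ pentagonalᶠ s t (proj₁ (parity (c , s , t))) (proj₂ (parity (c , s , t))) (ℤ.- s)
        (ℤ-Solver.solve 2 (λ s t → #ᴾ (+ 0) =ᴾ (s +ᴾ t +ᴾ (s -ᴾ t +ᴾ #ᴾ (+ 0))) +ᴾ (-ᴾ s +ᴾ -ᴾ s)) ≡.refl s t)
        (≡.cong (_∷ []) (exponents 2 (λ s t → 2 ⊗ □ s ⊕ 2 ⊗ △ (#ᴾ (+ 1) +ᴾ s) ⊕ 3 ⊗ □ t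
          ≐ △ (s +ᴾ t) ⊕ 2 ⊗ △ (#ᴾ (+ 1) +ᴾ (s +ᴾ t)) ⊕ (△ (s -ᴾ t +ᴾ #ᴾ (+ 0)) ⊕ 2 ⊗ △ (#ᴾ (+ 1) +ᴾ (s -ᴾ t +ᴾ #ᴾ (+ 0))))) ≡.refl s t))
      pointwise c@(suc zero) s t = match (q ∷ []) (a c) (b c) pentagonalᶠ pentagonalᶠ s t (proj₁ (parity (c , s , t))) (proj₂ (parity (c , s , t))) (ℤ.- s)
        (ℤ-Solver.solve 2 (λ s t → #ᴾ (+ 1) =ᴾ (s +ᴾ t +ᴾ (s -ᴾ t +ᴾ #ᴾ (+ 1))) +ᴾ (-ᴾ s +ᴾ -ᴾ s)) ≡.refl s t)
        (≡.cong (_∷ []) (exponents 2 (λ s t → □ (#ᴾ (+ 1) +ᴾ s) ⊕ 4 ⊗ △ (#ᴾ (+ 1) +ᴾ s) ⊕ (♯ 1 ⊕ 6 ⊗ △ t)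
          ≐ △ (s +ᴾ t) ⊕ 2 ⊗ △ (#ᴾ (+ 1) +ᴾ (s +ᴾ t)) ⊕ (△ (s -ᴾ t +ᴾ #ᴾ (+ 1)) ⊕ 2 ⊗ △ (#ᴾ (+ 1) +ᴾ (s -ᴾ t +ᴾ #ᴾ (+ 1))))) ≡.refl s t))

    ∏-triple : ∀ n f → ∏ n (λ k → f (2 ℕ.+ k ℕ.* 3)) * ∏ n (λ k → f (1 ℕ.+ k ℕ.* 3)) * ∏ n (λ k → f (k ℕ.* 3)) ≈ ∏ (n ℕ.* 3) f
    ∏-triple zero    f = solve 0 (con (+ 1) :* con (+ 1) :* con (+ 1) := con (+ 1)) refl
    ∏-triple (suc n) f = trans
      (solve 6 (λ a b c x y z → (a :* x) :* (b :* y) :* (c :* z) := a :* (b :* (c :* (x :* y :* z)))) refl _ _ _ _ _ _)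
      (*-congˡ (*-congˡ (*-congˡ (∏-triple n f))))

    q³^≈0 : (q ^ 3) ^ suc N ≈ 0#
    q³^≈0 = trans (^-assocʳ q 3 (suc N)) (vanish (ℕₚ.m≤m+n (suc N) _))

    -- Euler's pentagonal number theorem
    poch≈pentagonal : ∀ K → N ≤ K → poch K ≈ pentagonal
    poch≈pentagonal K N≤K = begin
      poch K                      ≈⟨ poch-stable N≤K (ℕₚ.≤-trans (ℕₚ.≤-trans (ℕₚ.m≤m+n N (N ℕ.+ 4)) (ℕₚ.m≤m*n L 3)) ℕₚ.≤-refl) ⟩
      poch (L ℕ.* 3)              ≈⟨ ∏-triple L (λ k → 1# - q ^ suc k) ⟨
      ∏ L (λ k → 1# - q ^ (3 ℕ.+ k ℕ.* 3)) * ∏ L (λ k → 1# - q ^ (2 ℕ.+ k ℕ.* 3)) * ∏ L (λ k → 1# - q ^ (1 ℕ.+ k ℕ.* 3))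
                                  ≈⟨ solve 3 (λ a b c → a :* b :* c := b :* c :* a) refl _ _ _ ⟩
      ∏ L (λ k → 1# - q ^ (2 ℕ.+ k ℕ.* 3)) * ∏ L (λ k → 1# - q ^ (1 ℕ.+ k ℕ.* 3)) * ∏ L (λ k → 1# - q ^ (3 ℕ.+ k ℕ.* 3))
                                  ≈⟨ *-cong (*-cong (∏-cong L (λ k → +-congˡ (-‿cong (split 2 k)))) (∏-cong L (λ k → +-congˡ (-‿cong (trans (split 1 k) (*-congʳ (*-identityʳ q))))))) (∏-cong L (λ k → +-congˡ (-‿cong (split 3 k)))) ⟩
      ∏ L (λ k → 1# - q ^ 2 * (q ^ 3) ^ k) * ∏ L (λ k → 1# - q * (q ^ 3) ^ k) * Cubed.poch L
                                  -- The triple product in base q³ with u = q and v = q².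
                                  ≈⟨ Cubed.θ-product q (q ^ 2) refl L ℕₚ.≤-refl ⟩
      Cubed.θ q (q ^ 2)           ≈⟨ ∑-cong W (λ i → *-congˡ (as-q i)) ⟩
      pentagonal                  ∎
      where
      module Cubed = JacobiTripleProduct R (q ^ 3) N q³^≈0
      L = N ℕ.+ (N ℕ.+ 4)
      split : ∀ m k → q ^ (m ℕ.+ k ℕ.* 3) ≈ q ^ m * (q ^ 3) ^ k
      split m k = trans (^-homo-* q m (k ℕ.* 3)) (*-congˡ (trans (^-≡ q (ℕₚ.*-comm k 3)) (sym (^-assocʳ q 3 k))))
      as-q : ∀ i → q ^ tri i * ((q ^ 2) ^ tri (+ 1 ℤ.+ i) * 1#) ≈ q ^ (tri i ℕ.+ 2 ℕ.* tri (+ 1 ℤ.+ i)) * 1#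
      as-q i = trans (sym (*-assoc _ _ _)) (*-congʳ (trans (*-congˡ (^-assocʳ q 2 (tri (+ 1 ℤ.+ i)))) (sym (^-homo-* q (tri i) _))))

    -- The two points are a = b c and b, with w = q / a² and hence c² w = q / b². Taking the
    -- quotient c = a / b as a variable keeps the theta function at a / b free of inverses.
    module TwoVariables (b c w : Carrier) (bcw≈q : b ^ 2 * (c ^ 2 * w) ≈ q) where

      w-bc : (b * c) ^ 2 * w ≈ q
      w-bc = trans (solve 3 (λ b c w → ((b :* c) :* ((b :* c) :* con (+ 1))) :* w := (b :* (b :* con (+ 1))) :* ((c :* (c :* con (+ 1))) :* w)) refl b c w) bcw≈q

      module a = OneVariable (b * c) w w-bc
      module b = OneVariable b (c ^ 2 * w) bcw≈q

      gs = b ∷ c ∷ w ∷ []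

      inA inB : Family 2 → Family 3
      inA F = sign F ▹ (λ i → Vec.head (expts F i) ∷ Vec.head (expts F i) ∷ Vec.head (Vec.tail (expts F i)) ∷ [])
      inB F = sign F ▹ (λ i → Vec.head (expts F i) ∷ 2 ℕ.* Vec.head (Vec.tail (expts F i)) ∷ Vec.head (Vec.tail (expts F i)) ∷ [])

      inA≈ : ∀ F i → term gs (inA F) i ≈ term a.gs F i
      inA≈ F i with expts F i
      ... | k ∷ l ∷ [] = *-congˡ (trans (sym (*-assoc _ _ _)) (*-congʳ (sym (^-distrib-* b c k))))

      inB≈ : ∀ F i → term gs (inB F) i ≈ term b.gs F i
      inB≈ F i with expts F i
      ... | k ∷ l ∷ [] = *-congˡ (*-congˡ (trans (sym (*-assoc _ _ _)) (*-congʳ (trans (*-congʳ (sym (^-assocʳ c 2 l))) (sym (^-distrib-* (c ^ 2) w l))))))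

      θ₊ᶠ θ₋ᶠ : Family 3
      θ₊ᶠ = (λ i → i) ▹ (λ i → 2 ℕ.* tri (+ 1 ℤ.+ i) ∷ tri i ℕ.+ tri (+ 1 ℤ.+ i) ∷ tri i ∷ [])
      θ₋ᶠ = (λ i → i) ▹ (λ i → 2 ℕ.* tri i ∷ tri i ℕ.+ tri (+ 1 ℤ.+ i) ∷ tri i ∷ [])

      θ₊≈ : ∀ i → θ-term (c * w) (b ^ 2 * c) i ≈ term gs θ₊ᶠ i
      θ₊≈ i = *-congˡ (begin
        (c * w) ^ T * ((b ^ 2 * c) ^ T′ * 1#)        ≈⟨ *-cong (^-distrib-* c w T) (*-congʳ (trans (^-distrib-* (b ^ 2) c T′) (*-congʳ (^-assocʳ b 2 T′)))) ⟩
        c ^ T * w ^ T * (b ^ (2 ℕ.* T′) * c ^ T′ * 1#) ≈⟨ solve 4 (λ x y z u → x :* y :* (z :* u :* con (+ 1)) := z :* ((x :* u) :* (y :* con (+ 1)))) refl _ _ _ _ ⟩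
        b ^ (2 ℕ.* T′) * (c ^ T * c ^ T′ * (w ^ T * 1#)) ≈⟨ *-congˡ (*-congʳ (sym (^-homo-* c T T′))) ⟩
        b ^ (2 ℕ.* T′) * (c ^ (T ℕ.+ T′) * (w ^ T * 1#)) ∎)
        where
        T = tri i
        T′ = tri (+ 1 ℤ.+ i)

      θ₋≈ : ∀ i → θ-term (b ^ 2 * (c * w)) c i ≈ term gs θ₋ᶠ i
      θ₋≈ i = *-congˡ (begin
        (b ^ 2 * (c * w)) ^ T * (c ^ T′ * 1#)           ≈⟨ *-congʳ (trans (^-distrib-* (b ^ 2) (c * w) T) (*-cong (^-assocʳ b 2 T) (^-distrib-* c w T))) ⟩
        b ^ (2 ℕ.* T) * (c ^ T * w ^ T) * (c ^ T′ * 1#) ≈⟨ solve 4 (λ z x y u → z :* (x :* y) :* (u :* con (+ 1)) := z :* ((x :* u) :* (y :* con (+ 1)))) refl _ _ _ _ ⟩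
        b ^ (2 ℕ.* T) * (c ^ T * c ^ T′ * (w ^ T * 1#)) ≈⟨ *-congˡ (*-congʳ (sym (^-homo-* c T T′))) ⟩
        b ^ (2 ℕ.* T) * (c ^ (T ℕ.+ T′) * (w ^ T * 1#)) ∎)
        where
        T = tri i
        T′ = tri (+ 1 ℤ.+ i)

      uv₊ : (c * w) * (b ^ 2 * c) ≈ q
      uv₊ = trans (solve 3 (λ b c w → (c :* w) :* (b :* (b :* con (+ 1)) :* c) := (b :* (b :* con (+ 1))) :* ((c :* (c :* con (+ 1))) :* w)) refl b c w) bcw≈q

      uv₋ : (b ^ 2 * (c * w)) * c ≈ q
      uv₋ = trans (solve 3 (λ b c w → (b :* (b :* con (+ 1)) :* (c :* w)) :* c := (b :* (b :* con (+ 1))) :* ((c :* (c :* con (+ 1))) :* w)) refl b c w) bcw≈q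

      -- The arguments are a b = b² c and a / b = c. In the coordinates of `parity` the variables
      -- separate: one index carries all of a, the other all of b.
      θ₊*θ₋ : θ (c * w) (b ^ 2 * c) * θ (b ^ 2 * (c * w)) c ≈ a.α * b.β - c * (a.β * b.α)
      θ₊*θ₋ = begin
        θ (c * w) (b ^ 2 * c) * θ (b ^ 2 * (c * w)) c
          ≈⟨ *-cong (∑-cong W θ₊≈) (∑-cong W θ₋≈) ⟩
        ∑ℤ (term gs θ₊ᶠ) * ∑ℤ (term gs θ₋ᶠ)
          ≈⟨ ∑ℤ-*-∑ℤ parity parity⁻¹ parity-inverseˡ parity-inverseʳ {a = λ i → term gs (l i)} {b = λ i → term gs (r i)}
               (λ i N<i → trans (sym (θ₊≈ i)) (θ-supported (c * w) (b ^ 2 * c) uv₊ i N<i))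
               (λ i N<i → trans (sym (θ₋≈ i)) (θ-supported (b ^ 2 * (c * w)) c uv₋ i N<i)) l-supported r-supported pointwise ⟩
        ∑ℤ (term gs (inA a.αᶠ)) * ∑ℤ (term gs (inB b.βᶠ)) + (∑ℤ (term gs -cβᶠ) * ∑ℤ (term gs (inB b.αᶠ)) + 0#)
          ≈⟨ +-cong (*-cong (∑-cong W (inA≈ a.αᶠ)) (∑-cong W (inB≈ b.βᶠ)))
                    (+-congʳ (*-cong (trans (∑-cong W -cβ≈) (∑-*ˡ W (- c) _)) (∑-cong W (inB≈ b.αᶠ)))) ⟩
        a.α * b.β + (- c * a.β * b.α + 0#)
          ≈⟨ solve 5 (λ x y c z u → x :* y :+ (:- c :* z :* u :+ con (+ 0)) := x :* y :- c :* (z :* u)) refl _ _ _ _ _ ⟩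
        a.α * b.β - c * (a.β * b.α) ∎
        where
        -cβᶠ : Family 3
        -cβᶠ = (λ _ → + 1) ▹ (λ s → 4 ℕ.* tri (+ 1 ℤ.+ s) ∷ suc (4 ℕ.* tri (+ 1 ℤ.+ s)) ∷ sq s ∷ [])
        -cβ≈ : ∀ s → term gs -cβᶠ s ≈ - c * term a.gs a.βᶠ s
        -cβ≈ s = trans (solve 4 (λ x c y z → (:- con (+ 1) :* con (+ 1)) :* (x :* (c :* y :* z)) := :- c :* (con (+ 1) :* (x :* (y :* z)))) refl _ c _ _)
                       (*-congˡ (inA≈ a.βᶠ s))
        l r : Fin 2 → Family 3
        l zero       = inA a.αᶠ
        l (suc zero) = -cβᶠ
        r zero       = inB b.βᶠ
        r (suc zero) = inB b.αᶠ
        l-supported : ∀ i → Supported (term gs (l i))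
        l-supported zero       i N<i = trans (inA≈ a.αᶠ i) (a.α-supported i N<i)
        l-supported (suc zero) i N<i = trans (-cβ≈ i) (trans (*-congˡ (a.β-supported i N<i)) (zeroʳ _))
        r-supported : ∀ i → Supported (term gs (r i))
        r-supported zero       i N<i = trans (inB≈ b.βᶠ i) (b.β-supported i N<i)
        r-supported (suc zero) i N<i = trans (inB≈ b.αᶠ i) (b.α-supported i N<i)
        pointwise : ∀ i s t → term gs (l i) s * term gs (r i) t ≈ term gs θ₊ᶠ (proj₁ (parity (i , s , t))) * term gs θ₋ᶠ (proj₂ (parity (i , s , t)))
        pointwise i@zero s t = match gs (l i) (r i) θ₊ᶠ θ₋ᶠ s t (proj₁ (parity (i , s , t))) (proj₂ (parity (i , s , t))) (ℤ.- s)
          (ℤ-Solver.solve 2 (λ s t → #ᴾ (+ 0) =ᴾ (s +ᴾ t +ᴾ (s -ᴾ t +ᴾ #ᴾ (+ 0))) +ᴾ (-ᴾ s +ᴾ -ᴾ s)) ≡.refl s t)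
          (vec₃ (exponents 2 (λ s t → 2 ⊗ □ s ⊕ 4 ⊗ △ (#ᴾ (+ 1) +ᴾ t) ≐ 2 ⊗ △ (#ᴾ (+ 1) +ᴾ (s +ᴾ t)) ⊕ 2 ⊗ △ (s -ᴾ t +ᴾ #ᴾ (+ 0))) ≡.refl s t)
                (exponents 2 (λ s t → 2 ⊗ □ s ⊕ 2 ⊗ □ t ≐ △ (s +ᴾ t) ⊕ △ (#ᴾ (+ 1) +ᴾ (s +ᴾ t)) ⊕ (△ (s -ᴾ t +ᴾ #ᴾ (+ 0)) ⊕ △ (#ᴾ (+ 1) +ᴾ (s -ᴾ t +ᴾ #ᴾ (+ 0))))) ≡.refl s t)
                (exponents 2 (λ s t → 2 ⊗ △ s ⊕ □ t ≐ △ (s +ᴾ t) ⊕ △ (s -ᴾ t +ᴾ #ᴾ (+ 0))) ≡.refl s t))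
        pointwise i@(suc zero) s t = match gs (l i) (r i) θ₊ᶠ θ₋ᶠ s t (proj₁ (parity (i , s , t))) (proj₂ (parity (i , s , t))) (ℤ.- s)
          (ℤ-Solver.solve 2 (λ s t → #ᴾ (+ 1) =ᴾ (s +ᴾ t +ᴾ (s -ᴾ t +ᴾ #ᴾ (+ 1))) +ᴾ (-ᴾ s +ᴾ -ᴾ s)) ≡.refl s t)
          (vec₃ (exponents 2 (λ s t → 4 ⊗ △ (#ᴾ (+ 1) +ᴾ s) ⊕ 2 ⊗ □ t ≐ 2 ⊗ △ (#ᴾ (+ 1) +ᴾ (s +ᴾ t)) ⊕ 2 ⊗ △ (s -ᴾ t +ᴾ #ᴾ (+ 1))) ≡.refl s t)
                (exponents 2 (λ s t → ♯ 1 ⊕ 4 ⊗ △ (#ᴾ (+ 1) +ᴾ s) ⊕ 2 ⊗ (2 ⊗ △ t) ≐ △ (s +ᴾ t) ⊕ △ (#ᴾ (+ 1) +ᴾ (s +ᴾ t)) ⊕ (△ (s -ᴾ t +ᴾ #ᴾ (+ 1)) ⊕ △ (#ᴾ (+ 1) +ᴾ (s -ᴾ t +ᴾ #ᴾ (+ 1))))) ≡.refl s t)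
                (exponents 2 (λ s t → □ s ⊕ 2 ⊗ △ t ≐ △ (s +ᴾ t) ⊕ △ (s -ᴾ t +ᴾ #ᴾ (+ 1))) ≡.refl s t))

      -- After multiplication by θ(a) θ(b), the determinant α(a) β(b) - c β(a) α(b) is the
      -- determinant of a product of matrices. The matrix of theta constants contributes V X - q Y
      -- Z, which is the square of (q; q)_∞, and A, B contribute the remaining determinant.
      winquist : ∀ K → N ≤ K →
        θ (b * c * w) (b * c) * θ (b * (c ^ 2 * w)) b * (θ (c * w) (b ^ 2 * c) * θ (b ^ 2 * (c * w)) c) ≈
        poch K * poch K * (a.A * b.B - c * (a.B * b.A))
      winquist K N≤K = begin
        θa * θb * (θ (c * w) (b ^ 2 * c) * θ (b ^ 2 * (c * w)) c)
          ≈⟨ *-congˡ θ₊*θ₋ ⟩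
        θa * θb * (a.α * b.β - c * (a.β * b.α))
          ≈⟨ solve 7 (λ x y p q c r s → x :* y :* (p :* q :- c :* (r :* s)) := (x :* p) :* (y :* q) :- c :* ((x :* r) :* (y :* s))) refl _ _ _ _ _ _ _ ⟩
        (θa * a.α) * (θb * b.β) - c * ((θa * a.β) * (θb * b.α))
          ≈⟨ +-cong (*-cong a.θ*α b.θ*β) (-‿cong (*-congˡ (*-cong a.θ*β b.θ*α))) ⟩
        (X * a.A - Y * (b * c * a.B)) * (V * b.B - b * (c ^ 2 * w) * (Z * b.A)) -
          c * ((V * a.B - b * c * w * (Z * a.A)) * (X * b.A - Y * (b * b.B)))
          ≈⟨ solve 11 (λ X Y Z V Aa Ba Ab Bb b c w →
               (X :* Aa :- Y :* (b :* c :* Ba)) :* (V :* Bb :- b :* ((c :* (c :* con (+ 1))) :* w) :* (Z :* Ab)) :-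
                 c :* ((V :* Ba :- b :* c :* w :* (Z :* Aa)) :* (X :* Ab :- Y :* (b :* Bb)))
               := (V :* X :- (b :* (b :* con (+ 1))) :* ((c :* (c :* con (+ 1))) :* w) :* (Y :* Z)) :* (Aa :* Bb :- c :* (Ba :* Ab))) refl
               X Y Z V a.A a.B b.A b.B b c w ⟩
        (V * X - b ^ 2 * (c ^ 2 * w) * (Y * Z)) * (a.A * b.B - c * (a.B * b.A))
          ≈⟨ *-congʳ (+-congˡ (-‿cong (*-congʳ bcw≈q))) ⟩
        (V * X - q * (Y * Z)) * (a.A * b.B - c * (a.B * b.A))
          ≈⟨ *-congʳ (trans (*-cong (poch≈pentagonal K N≤K) (poch≈pentagonal K N≤K)) pentagonal²) ⟨
        poch K * poch K * (a.A * b.B - c * (a.B * b.A)) ∎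
        where
        θa = θ (b * c * w) (b * c)
        θb = θ (b * (c ^ 2 * w)) b

open WinquistIdentity

-- Power series over a ring, truncated at degree N.

module SeriesRings where
  open import Data.Fin using (toℕ)
  open import Data.List using ([]; _∷_; foldr)
  open import Function using (_∘_)

  module PowerSeries (R : CommutativeRing 0ℓ 0ℓ) where
    open CommutativeRing R
    open IntegerCoefficients R
    open import Algebra.Properties.Ring ring using (-0#≈0#; -‿distribˡ-*)
    open import Algebra.Properties.CommutativeMonoid.Sum +-commutativeMonoid using (sum)
    open import Relation.Binary.Reasoning.Setoid setoid

    PS : Set
    PS = ℕ → Carrier

    infixl 7 _⊛_
    infix 4 _≋_

    _≋_ : PS → PS → Set
    f ≋ g = ∀ n → f n ≈ g n

    _⊛_ : PS → PS → PS
    (f ⊛ g) n = sum {suc n} (λ i → f (toℕ i) * g (n ℕ.∸ toℕ i))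

    _⊞_ : PS → PS → PS
    (f ⊞ g) n = f n + g n

    _∙_ : Carrier → PS → PS
    (c ∙ f) n = c * f n

    const : Carrier → PS
    const c zero    = c
    const c (suc n) = 0#

    X : PS
    X zero          = 0#
    X (suc zero)    = 1#
    X (suc (suc n)) = 0#

    ⊛-cong≤ : ∀ n {f f′ g g′} → (∀ k → k ≤ n → f k ≈ f′ k) → (∀ k → k ≤ n → g k ≈ g′ k) → (f ⊛ g) n ≈ (f′ ⊛ g′) n
    ⊛-cong≤ zero    f≈ g≈ = +-congʳ (*-cong (f≈ 0 z≤n) (g≈ 0 z≤n))
    ⊛-cong≤ (suc n) f≈ g≈ = +-cong (*-cong (f≈ 0 z≤n) (g≈ (suc n) ℕₚ.≤-refl))
      (⊛-cong≤ n (λ k k≤n → f≈ (suc k) (s≤s k≤n)) (λ k k≤n → g≈ k (ℕₚ.m≤n⇒m≤1+n k≤n)))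

    ⊛-cong : ∀ {f f′ g g′} → f ≋ f′ → g ≋ g′ → f ⊛ g ≋ f′ ⊛ g′
    ⊛-cong f≈ g≈ n = ⊛-cong≤ n (λ k _ → f≈ k) (λ k _ → g≈ k)

    ⊛-distribʳ : ∀ f g h → (f ⊞ g) ⊛ h ≋ (f ⊛ h) ⊞ (g ⊛ h)
    ⊛-distribʳ f g h zero    = solve 3 (λ f g h → (f :+ g) :* h :+ con (+ 0) := (f :* h :+ con (+ 0)) :+ (g :* h :+ con (+ 0))) refl _ _ _
    ⊛-distribʳ f g h (suc n) = trans (+-congˡ (⊛-distribʳ (f ∘ suc) (g ∘ suc) h n))
      (solve 5 (λ f g h x y → (f :+ g) :* h :+ (x :+ y) := (f :* h :+ x) :+ (g :* h :+ y)) refl _ _ _ _ _)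

    ⊛-∙ : ∀ c f h → (c ∙ f) ⊛ h ≋ c ∙ (f ⊛ h)
    ⊛-∙ c f h zero    = solve 3 (λ c f h → c :* f :* h :+ con (+ 0) := c :* (f :* h :+ con (+ 0))) refl _ _ _
    ⊛-∙ c f h (suc n) = trans (+-congˡ (⊛-∙ c (f ∘ suc) h n))
      (solve 4 (λ c f h x → c :* f :* h :+ c :* x := c :* (f :* h :+ x)) refl _ _ _ _)

    ⊛-zeroˡ : ∀ f g → (∀ n → f n ≈ 0#) → ∀ n → (f ⊛ g) n ≈ 0#
    ⊛-zeroˡ f g f≈0 zero    = trans (+-congʳ (trans (*-congʳ (f≈0 0)) (zeroˡ _))) (+-identityˡ 0#)
    ⊛-zeroˡ f g f≈0 (suc n) = trans (+-cong (trans (*-congʳ (f≈0 0)) (zeroˡ _)) (⊛-zeroˡ (f ∘ suc) g (f≈0 ∘ suc) n)) (+-identityˡ 0#)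

    ⊛-last : ∀ f g n → (f ⊛ g) (suc n) ≈ (f ⊛ (g ∘ suc)) n + f (suc n) * g 0
    ⊛-last f g zero    = solve 4 (λ a b c d → a :* b :+ (c :* d :+ con (+ 0)) := (a :* b :+ con (+ 0)) :+ c :* d) refl _ _ _ _
    ⊛-last f g (suc n) = trans (+-congˡ (⊛-last (f ∘ suc) g n)) (sym (+-assoc _ _ _))

    ⊛-comm : ∀ f g → f ⊛ g ≋ g ⊛ f
    ⊛-comm f g zero    = +-congʳ (*-comm _ _)
    ⊛-comm f g (suc n) = trans (+-cong (*-comm _ _) (⊛-comm (f ∘ suc) g n)) (trans (+-comm _ _) (sym (⊛-last g f n)))

    ⊛-assoc : ∀ f g h → (f ⊛ g) ⊛ h ≋ f ⊛ (g ⊛ h)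
    ⊛-assoc f g h zero    = solve 3 (λ f g h → (f :* g :+ con (+ 0)) :* h :+ con (+ 0) := f :* (g :* h :+ con (+ 0)) :+ con (+ 0)) refl _ _ _
    ⊛-assoc f g h (suc n) = begin
      (f ⊛ g) 0 * h (suc n) + (((f 0 ∙ (g ∘ suc)) ⊞ ((f ∘ suc) ⊛ g)) ⊛ h) n
        ≈⟨ +-cong (*-congʳ (+-identityʳ _)) (⊛-distribʳ (f 0 ∙ (g ∘ suc)) ((f ∘ suc) ⊛ g) h n) ⟩
      f 0 * g 0 * h (suc n) + (((f 0 ∙ (g ∘ suc)) ⊛ h) n + (((f ∘ suc) ⊛ g) ⊛ h) n)
        ≈⟨ +-congˡ (+-cong (⊛-∙ (f 0) (g ∘ suc) h n) (⊛-assoc (f ∘ suc) g h n)) ⟩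
      f 0 * g 0 * h (suc n) + (f 0 * ((g ∘ suc) ⊛ h) n + ((f ∘ suc) ⊛ (g ⊛ h)) n)
        ≈⟨ solve 5 (λ f g h x y → f :* g :* h :+ (f :* x :+ y) := f :* (g :* h :+ x) :+ y) refl _ _ _ _ _ ⟩
      f 0 * (g ⊛ h) (suc n) + ((f ∘ suc) ⊛ (g ⊛ h)) n ∎

    const-⊛ : ∀ c f → const c ⊛ f ≋ c ∙ f
    const-⊛ c f zero    = +-identityʳ _
    const-⊛ c f (suc n) = trans (+-congˡ (⊛-zeroˡ _ f (λ _ → refl) n)) (+-identityʳ _)

    ⊛-identityˡ : ∀ f → const 1# ⊛ f ≋ f
    ⊛-identityˡ f n = trans (const-⊛ 1# f n) (*-identityˡ _)

    X-⊛-zero : ∀ f → (X ⊛ f) 0 ≈ 0#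
    X-⊛-zero f = trans (+-identityʳ _) (zeroˡ _)

    X-⊛-suc : ∀ f n → (X ⊛ f) (suc n) ≈ f n
    X-⊛-suc f n = begin
      0# * f (suc n) + ((X ∘ suc) ⊛ f) n   ≈⟨ trans (+-congʳ (zeroˡ _)) (+-identityˡ _) ⟩
      ((X ∘ suc) ⊛ f) n                    ≈⟨ ⊛-cong {X ∘ suc} {const 1#} {f} {f} (λ { zero → refl ; (suc k) → refl }) (λ _ → refl) n ⟩
      (const 1# ⊛ f) n                     ≈⟨ ⊛-identityˡ f n ⟩
      f n                                  ∎

    shift : ℕ → PS → PS
    shift zero    f n       = f n
    shift (suc e) f zero    = 0#
    shift (suc e) f (suc n) = shift e f n

    shift-cong : ∀ e {f g} → f ≋ g → shift e f ≋ shift e g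
    shift-cong zero    f≈g n       = f≈g n
    shift-cong (suc e) f≈g zero    = refl
    shift-cong (suc e) f≈g (suc n) = shift-cong e f≈g n

    shift-below : ∀ e f n → n < e → shift e f n ≈ 0#
    shift-below (suc e) f zero    _         = refl
    shift-below (suc e) f (suc n) (s≤s n<e) = shift-below e f n n<e

    -- Multiplication by 1 - X^e in a form that involves only addition of coefficients. It therefore
    -- commutes with additive maps such as the moments, which do not respect products of series.
    times : ℕ → PS → PS
    times e f n = f n - shift e f n

    times-all : ℕ → (ℕ → ℕ) → PS → PS
    times-all zero    e f = f
    times-all (suc L) e f = times (e L) (times-all L e f)

    times-eulers : ℕ → ℕ → List (ℕ × ℕ) → PS → PS
    times-eulers L t []            f = f
    times-eulers L t ((a , m) ∷ l) f = times-all L (λ k → t ℕ.* (a ℕ.+ k ℕ.* m)) (times-eulers L t l f)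

    times-cong : ∀ e {f g} → f ≋ g → times e f ≋ times e g
    times-cong e f≈g n = +-cong (f≈g n) (-‿cong (shift-cong e f≈g n))

    times-all-cong : ∀ L e {f g} → f ≋ g → times-all L e f ≋ times-all L e g
    times-all-cong zero    e f≈g = f≈g
    times-all-cong (suc L) e f≈g = times-cong (e L) (times-all-cong L e f≈g)

    times-eulers-cong : ∀ L t l {f g} → f ≋ g → times-eulers L t l f ≋ times-eulers L t l g
    times-eulers-cong L t []            f≈g = f≈g
    times-eulers-cong L t ((a , m) ∷ l) f≈g = times-all-cong L _ (times-eulers-cong L t l f≈g)

    -- Truncation lies only in the equality: the elements are full power series, so one and the same
    -- series can be considered at every order N.
    truncated : ℕ → CommutativeRing 0ℓ 0ℓ
    truncated N = record
      { Carrier = PS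
      ; _≈_ = λ f g → ∀ n → n ≤ N → f n ≈ g n
      ; _+_ = _⊞_
      ; _*_ = _⊛_
      ; -_  = λ f n → - f n
      ; 0#  = λ _ → 0#
      ; 1#  = const 1#
      ; isCommutativeRing = record
        { isRing = record
          { +-isAbelianGroup = record
            { isGroup = record
              { isMonoid = record
                { isSemigroup = record
                  { isMagma = record
                    { isEquivalence = record
                      { refl = λ _ _ → refl ; sym = λ e n n≤ → sym (e n n≤) ; trans = λ e e′ n n≤ → trans (e n n≤) (e′ n n≤) }
                    ; ∙-cong = λ e e′ n n≤ → +-cong (e n n≤) (e′ n n≤) }
                  ; assoc = λ f g h n _ → +-assoc _ _ _ }
                ; identity = (λ f n _ → +-identityˡ _) , (λ f n _ → +-identityʳ _) }
              ; inverse = (λ f n _ → -‿inverseˡ _) , (λ f n _ → -‿inverseʳ _)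
              ; ⁻¹-cong = λ e n n≤ → -‿cong (e n n≤) }
            ; comm = λ f g n _ → +-comm _ _ }
          ; *-cong = λ e e′ n n≤ → ⊛-cong≤ n (λ k k≤n → e k (ℕₚ.≤-trans k≤n n≤)) (λ k k≤n → e′ k (ℕₚ.≤-trans k≤n n≤))
          ; *-assoc = λ f g h n _ → ⊛-assoc f g h n
          ; *-identity = (λ f n _ → ⊛-identityˡ f n) , (λ f n _ → trans (⊛-comm f (const 1#) n) (⊛-identityˡ f n))
          ; distrib = (λ f g h n _ → trans (⊛-comm f (g ⊞ h) n) (trans (⊛-distribʳ g h f n) (+-cong (⊛-comm g f n) (⊛-comm h f n))))
                    , (λ h f g n _ → ⊛-distribʳ f g h n) }
        ; *-comm = λ f g n _ → ⊛-comm f g n } }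

    module Truncated (N : ℕ) where
      module S = CommutativeRing (truncated N)
      open Monomials (truncated N) using (_^_; ∏)

      X^-⊛-low : ∀ k f n → n < k → (X ^ k ⊛ f) n ≈ 0#
      X^-⊛-low (suc k) f zero    _         = trans (⊛-assoc X (X ^ k) f 0) (X-⊛-zero (X ^ k ⊛ f))
      X^-⊛-low (suc k) f (suc n) (s≤s n<k) = trans (⊛-assoc X (X ^ k) f (suc n)) (trans (X-⊛-suc (X ^ k ⊛ f) n) (X^-⊛-low k f n n<k))

      X^-⊛-shift : ∀ k f n → (X ^ k ⊛ f) (k ℕ.+ n) ≈ f n
      X^-⊛-shift zero    f n = ⊛-identityˡ f n
      X^-⊛-shift (suc k) f n = trans (⊛-assoc X (X ^ k) f (suc (k ℕ.+ n))) (trans (X-⊛-suc (X ^ k ⊛ f) (k ℕ.+ n)) (X^-⊛-shift k f n))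

      X-nilpotent : X ^ suc N S.≈ S.0#
      X-nilpotent n n≤N = trans (sym (trans (⊛-comm (X ^ suc N) (const 1#) n) (⊛-identityˡ (X ^ suc N) n)))
                                (X^-⊛-low (suc N) (const 1#) n (s≤s n≤N))

      const-* : ∀ c d → const (c * d) S.≈ const c ⊛ const d
      const-* c d zero    _ = sym (const-⊛ c (const d) 0)
      const-* c d (suc n) _ = sym (trans (const-⊛ c (const d) (suc n)) (zeroʳ c))

      const-cong : ∀ {c d} → c ≈ d → const c S.≈ const d
      const-cong e zero    _ = e
      const-cong e (suc n) _ = refl

      const-+ : ∀ c d → const (c + d) S.≈ const c ⊞ const d
      const-+ c d zero    _ = refl
      const-+ c d (suc n) _ = sym (+-identityˡ 0#)

      const-neg : ∀ c → const (- c) S.≈ S.- const c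
      const-neg c zero    _ = refl
      const-neg c (suc n) _ = sym -0#≈0#

      X^-⊛ : ∀ e f n → (X ^ e ⊛ f) n ≈ shift e f n
      X^-⊛ zero    f n       = ⊛-identityˡ f n
      X^-⊛ (suc e) f zero    = trans (⊛-assoc X (X ^ e) f 0) (X-⊛-zero (X ^ e ⊛ f))
      X^-⊛ (suc e) f (suc n) = trans (⊛-assoc X (X ^ e) f (suc n)) (trans (X-⊛-suc (X ^ e ⊛ f) n) (X^-⊛ e f n))

      factor-⊛ : ∀ e f n → ((S.1# S.- X ^ e) ⊛ f) n ≈ times e f n
      factor-⊛ e f n = begin
        ((S.1# S.- X ^ e) ⊛ f) n                      ≈⟨ ⊛-distribʳ S.1# (S.- X ^ e) f n ⟩
        (S.1# ⊛ f) n + ((S.- X ^ e) ⊛ f) n            ≈⟨ +-cong (⊛-identityˡ f n) (neg-⊛ (X ^ e)) ⟩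
        f n - (X ^ e ⊛ f) n                           ≈⟨ +-congˡ (-‿cong (X^-⊛ e f n)) ⟩
        f n - shift e f n                             ∎
        where
        neg-⊛ : ∀ g → ((S.- g) ⊛ f) n ≈ - (g ⊛ f) n
        neg-⊛ g = trans (⊛-cong {S.- g} {(- 1#) ∙ g} {f} {f} (λ k → sym (trans (sym (-‿distribˡ-* 1# (g k))) (-‿cong (*-identityˡ (g k))))) (λ _ → refl) n)
                        (trans (⊛-∙ (- 1#) g f n) (trans (sym (-‿distribˡ-* 1# _)) (-‿cong (*-identityˡ _))))

      ∏-⊛ : ∀ L (e : ℕ → ℕ) f → (∏ L (λ k → S.1# S.- X ^ e k) ⊛ f) ≋ times-all L e f
      ∏-⊛ zero    e f n = ⊛-identityˡ f n
      ∏-⊛ (suc L) e f n = begin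
        (((S.1# S.- X ^ e L) ⊛ P) ⊛ f) n     ≈⟨ ⊛-assoc (S.1# S.- X ^ e L) P f n ⟩
        ((S.1# S.- X ^ e L) ⊛ (P ⊛ f)) n     ≈⟨ factor-⊛ (e L) (P ⊛ f) n ⟩
        times (e L) (P ⊛ f) n                ≈⟨ times-cong (e L) (∏-⊛ L e f) n ⟩
        times (e L) (times-all L e f) n      ∎
        where P = ∏ L (λ k → S.1# S.- X ^ e k)

      eulers-⊛ : ∀ L t l f → (foldr (λ (a , m) r → ∏ L (λ k → S.1# S.- X ^ (t ℕ.* (a ℕ.+ k ℕ.* m))) ⊛ r) S.1# l ⊛ f) ≋ times-eulers L t l f
      eulers-⊛ L t []            f n = ⊛-identityˡ f n
      eulers-⊛ L t ((a , m) ∷ l) f n = begin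
        ((P ⊛ r) ⊛ f) n                       ≈⟨ ⊛-assoc P r f n ⟩
        (P ⊛ (r ⊛ f)) n                       ≈⟨ ∏-⊛ L e (r ⊛ f) n ⟩
        times-all L e (r ⊛ f) n               ≈⟨ times-all-cong L e (eulers-⊛ L t l f) n ⟩
        times-all L e (times-eulers L t l f) n ∎
        where
        e : ℕ → ℕ
        e k = t ℕ.* (a ℕ.+ k ℕ.* m)
        P = ∏ L (λ k → S.1# S.- X ^ e k)
        r = foldr (λ (a , m) r → ∏ L (λ k → S.1# S.- X ^ (t ℕ.* (a ℕ.+ k ℕ.* m))) ⊛ r) S.1# l

open SeriesRings

-- The group ring of the cyclic group of order 11 over ℤ.

module GroupRing where
  open import Data.Nat.DivMod using (_mod_)
  open import Data.Fin using (Fin; zero; suc; toℕ; _≟_)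
  open import Data.Fin.Properties using (all?)
  open import Data.Fin.Permutation using (Permutation′; permutation)
  open import Data.Bool using (if_then_else_)
  open import Relation.Binary.PropositionalEquality using (refl; cong; cong₂; sym; trans)
  open import Relation.Nullary.Decidable using (from-yes)
  open import Algebra.Properties.Semiring.Sum ℤₚ.+-*-semiring using (sum; sum-cong-≗; ∑-comm; ∑-distrib-+; sum-permute; *-distribˡ-sum; *-distribʳ-sum; sum-replicate-zero)

  ℤ/11 : Set
  ℤ/11 = Fin 11

  infixl 6 _⊟_

  _⊟_ : ℤ/11 → ℤ/11 → ℤ/11
  i ⊟ j = (toℕ i ℕ.+ (11 ℕ.∸ toℕ j)) mod 11

  ⊟-self-inverse : ∀ k i → k ⊟ (k ⊟ i) ≡ i
  ⊟-self-inverse = from-yes (all? λ k → all? λ i → k ⊟ (k ⊟ i) ≟ i)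

  ⊟-inverseˡ : ∀ j i → (i ⊟ j) ⊟ (zero ⊟ j) ≡ i
  ⊟-inverseˡ = from-yes (all? λ j → all? λ i → (i ⊟ j) ⊟ (zero ⊟ j) ≟ i)

  ⊟-inverseʳ : ∀ j i → (i ⊟ (zero ⊟ j)) ⊟ j ≡ i
  ⊟-inverseʳ = from-yes (all? λ j → all? λ i → (i ⊟ (zero ⊟ j)) ⊟ j ≟ i)

  ⊟-cancel : ∀ k j i → (k ⊟ j) ⊟ (i ⊟ j) ≡ k ⊟ i
  ⊟-cancel = from-yes (all? λ k → all? λ j → all? λ i → (k ⊟ j) ⊟ (i ⊟ j) ≟ k ⊟ i)

  ⊟-identity : ∀ k → k ⊟ zero ≡ k
  ⊟-identity = from-yes (all? λ k → k ⊟ zero ≟ k)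

  reflection : ℤ/11 → Permutation′ 11
  reflection k = permutation (k ⊟_) (k ⊟_) (⊟-self-inverse k) (⊟-self-inverse k)

  translation : ℤ/11 → Permutation′ 11
  translation j = permutation (_⊟ j) (_⊟ (zero ⊟ j)) (⊟-inverseʳ j) (⊟-inverseˡ j)

  -- The function f stands for the sum of f_c x^c in ℤ[x]/(x¹¹ - 1).
  Element : Set
  Element = ℤ/11 → ℤ

  infixl 7 _✶_

  opaque
    _✶_ : Element → Element → Element
    (f ✶ g) k = sum (λ i → f i ℤ.* g (k ⊟ i))

  basis : ℤ/11 → Element
  basis c k = if does (k ≟ c) then + 1 else + 0

  sum-pick : ∀ {n} (c : Fin n) (g : Fin n → ℤ) → sum (λ i → (if does (i ≟ c) then + 1 else + 0) ℤ.* g i) ≡ g c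
  sum-pick {suc n} zero g = trans (cong₂ ℤ._+_ (ℤₚ.*-identityˡ (g zero)) (trans (sum-cong-≗ {n} (λ i → ℤₚ.*-zeroˡ (g (suc i)))) (sum-replicate-zero n))) (ℤₚ.+-identityʳ _)
  sum-pick {suc n} (suc c) g = trans (cong₂ ℤ._+_ (ℤₚ.*-zeroˡ (g zero)) (sum-pick c (λ i → g (suc i)))) (ℤₚ.+-identityˡ _)

  opaque
    unfolding _✶_

    ✶-cong : ∀ {f f′ g g′} → (∀ k → f k ≡ f′ k) → (∀ k → g k ≡ g′ k) → ∀ k → (f ✶ g) k ≡ (f′ ✶ g′) k
    ✶-cong f≈ g≈ k = sum-cong-≗ (λ i → cong₂ ℤ._*_ (f≈ i) (g≈ (k ⊟ i)))

    ✶-comm : ∀ f g k → (f ✶ g) k ≡ (g ✶ f) k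
    ✶-comm f g k = begin
      sum (λ i → f i ℤ.* g (k ⊟ i))                  ≡⟨ sum-permute (λ i → f i ℤ.* g (k ⊟ i)) (reflection k) ⟩
      sum (λ i → f (k ⊟ i) ℤ.* g (k ⊟ (k ⊟ i)))      ≡⟨ sum-cong-≗ (λ i → trans (ℤₚ.*-comm (f (k ⊟ i)) (g (k ⊟ (k ⊟ i)))) (cong (λ j → g j ℤ.* f (k ⊟ i)) (⊟-self-inverse k i))) ⟩
      sum (λ i → g i ℤ.* f (k ⊟ i))                  ∎
      where open ≡.≡-Reasoning

    -- The two sums are interchanged and the inner index is translated by j.
    ✶-assoc : ∀ f g h k → ((f ✶ g) ✶ h) k ≡ (f ✶ (g ✶ h)) k
    ✶-assoc f g h k = begin
      sum (λ i → sum (λ j → f j ℤ.* g (i ⊟ j)) ℤ.* h (k ⊟ i))         ≡⟨ sum-cong-≗ (λ i → *-distribʳ-sum (h (k ⊟ i)) (λ j → f j ℤ.* g (i ⊟ j))) ⟩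
      sum (λ i → sum (λ j → f j ℤ.* g (i ⊟ j) ℤ.* h (k ⊟ i)))         ≡⟨ ∑-comm (λ i j → f j ℤ.* g (i ⊟ j) ℤ.* h (k ⊟ i)) ⟩
      sum (λ j → sum (λ i → f j ℤ.* g (i ⊟ j) ℤ.* h (k ⊟ i)))         ≡⟨ sum-cong-≗ inner ⟩
      sum (λ j → f j ℤ.* sum (λ i → g i ℤ.* h ((k ⊟ j) ⊟ i)))         ∎
      where
      open ≡.≡-Reasoning
      inner : ∀ j → sum (λ i → f j ℤ.* g (i ⊟ j) ℤ.* h (k ⊟ i)) ≡ f j ℤ.* sum (λ i → g i ℤ.* h ((k ⊟ j) ⊟ i))
      inner j = begin
        sum (λ i → f j ℤ.* g (i ⊟ j) ℤ.* h (k ⊟ i))                   ≡⟨ sum-cong-≗ (λ i → trans (ℤₚ.*-assoc (f j) (g (i ⊟ j)) (h (k ⊟ i))) (cong (λ l → f j ℤ.* (g (i ⊟ j) ℤ.* h l)) (sym (⊟-cancel k j i)))) ⟩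
        sum (λ i → f j ℤ.* (g (i ⊟ j) ℤ.* h ((k ⊟ j) ⊟ (i ⊟ j))))     ≡⟨ sum-permute (λ i → f j ℤ.* (g i ℤ.* h ((k ⊟ j) ⊟ i))) (translation j) ⟨
        sum (λ i → f j ℤ.* (g i ℤ.* h ((k ⊟ j) ⊟ i)))                 ≡⟨ *-distribˡ-sum (f j) (λ i → g i ℤ.* h ((k ⊟ j) ⊟ i)) ⟨
        f j ℤ.* sum (λ i → g i ℤ.* h ((k ⊟ j) ⊟ i))                   ∎

    ✶-distribʳ : ∀ h f g k → ((λ i → f i ℤ.+ g i) ✶ h) k ≡ (f ✶ h) k ℤ.+ (g ✶ h) k
    ✶-distribʳ h f g k = trans (sum-cong-≗ (λ i → ℤₚ.*-distribʳ-+ (h (k ⊟ i)) (f i) (g i)))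
                               (∑-distrib-+ (λ i → f i ℤ.* h (k ⊟ i)) (λ i → g i ℤ.* h (k ⊟ i)))

    scalar-✶ : ∀ c f k → ((λ i → c ℤ.* basis zero i) ✶ f) k ≡ c ℤ.* f k
    scalar-✶ c f k = begin
      c ℤ.* + 1 ℤ.* f (k ⊟ zero) ℤ.+ sum {10} (λ i → c ℤ.* + 0 ℤ.* f (k ⊟ suc i))   ≡⟨ cong₂ ℤ._+_ (cong₂ ℤ._*_ (ℤₚ.*-identityʳ c) (cong f (⊟-identity k)))
                                                                                       (sum-cong-≗ {10} (λ i → trans (cong (ℤ._* f (k ⊟ suc i)) (ℤₚ.*-zeroʳ c)) (ℤₚ.*-zeroˡ (f (k ⊟ suc i))))) ⟩
      c ℤ.* f k ℤ.+ + 0                                                               ≡⟨ ℤₚ.+-identityʳ _ ⟩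
      c ℤ.* f k                                                                       ∎
      where open ≡.≡-Reasoning

    basis-✶ : ∀ c f k → (basis c ✶ f) k ≡ f (k ⊟ c)
    basis-✶ c f k = sum-pick c (λ i → f (k ⊟ i))

  ✶-identityˡ : ∀ f k → (basis zero ✶ f) k ≡ f k
  ✶-identityˡ f k = trans (✶-cong {g = f} (λ i → sym (ℤₚ.*-identityˡ (basis zero i))) (λ _ → refl) k)
                          (trans (scalar-✶ (+ 1) f k) (ℤₚ.*-identityˡ (f k)))

  groupRing : CommutativeRing 0ℓ 0ℓ
  groupRing = record
    { Carrier = Element
    ; _≈_ = λ f g → ∀ k → f k ≡ g k
    ; _+_ = λ f g k → f k ℤ.+ g k
    ; _*_ = _✶_
    ; -_  = λ f k → ℤ.- f k
    ; 0#  = λ _ → + 0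
    ; 1#  = basis zero
    ; isCommutativeRing = record
      { isRing = record
        { +-isAbelianGroup = record
          { isGroup = record
            { isMonoid = record
              { isSemigroup = record
                { isMagma = record
                  { isEquivalence = record { refl = λ _ → refl ; sym = λ e k → sym (e k) ; trans = λ e e′ k → trans (e k) (e′ k) }
                  ; ∙-cong = λ e e′ k → cong₂ ℤ._+_ (e k) (e′ k) }
                ; assoc = λ f g h k → ℤₚ.+-assoc (f k) (g k) (h k) }
              ; identity = (λ f k → ℤₚ.+-identityˡ (f k)) , (λ f k → ℤₚ.+-identityʳ (f k)) }
            ; inverse = (λ f k → ℤₚ.+-inverseˡ (f k)) , (λ f k → ℤₚ.+-inverseʳ (f k))
            ; ⁻¹-cong = λ e k → cong ℤ.-_ (e k) }
          ; comm = λ f g k → ℤₚ.+-comm (f k) (g k) }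
        ; *-cong = ✶-cong
        ; *-assoc = ✶-assoc
        ; *-identity = ✶-identityˡ , (λ f k → trans (✶-comm f (basis zero) k) (✶-identityˡ f k))
        ; distrib = (λ f g h k → trans (✶-comm f (λ i → g i ℤ.+ h i) k) (trans (✶-distribʳ f g h k) (cong₂ ℤ._+_ (✶-comm g f k) (✶-comm h f k))))
                  , ✶-distribʳ }
      ; *-comm = ✶-comm } }

-- Partitions with bounded parts.

module BoundedPartitions where
  open import Defs
  open import Data.Nat using (_≥_; _≟_; _<?_)
  open import Data.Bool using (if_then_else_; true; false)
  open import Data.List as List using ([]; _∷_; _++_; map; filter; length; replicate)
  import Data.List.Properties as Listₚ
  open import Data.Nat.ListAction using (sum)
  open import Data.List.Membership.Propositional using (_∈_)
  open import Data.List.Membership.Propositional.Properties using (∈-map⁺; ∈-map⁻; ∈-++⁺ˡ; ∈-++⁺ʳ; ∈-++⁻; ∈-filter⁺; ∈-filter⁻)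
  open import Data.List.Membership.Propositional.Properties.WithK using (unique∧set⇒bag)
  open import Data.List.Relation.Binary.BagAndSetEquality using (∼bag⇒↭)
  open import Data.List.Relation.Binary.Permutation.Propositional using (_↭_)
  open import Data.List.Relation.Unary.All as All using (All; []; _∷_; all?)
  open import Data.List.Relation.Unary.Any using (here)
  open import Data.List.Relation.Unary.AllPairs using ([]; _∷_)
  open import Data.List.Relation.Unary.Linked as Linked using (Linked; []; [-]; _∷_)
  open import Data.List.Relation.Unary.Linked.Properties using (Linked⇒All)
  open import Data.List.Relation.Unary.Unique.Propositional using (Unique)
  import Data.List.Relation.Unary.Unique.Propositional.Properties as Uniqueₚ
  open import Data.Sum using (inj₁; inj₂)
  open import Function using (mk⇔)
  open import Relation.Binary.PropositionalEquality using (refl; trans; cong)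

  unique-set-↭ : ∀ {A : Set} {xs ys : List A} → Unique xs → Unique ys →
                 (∀ {x} → x ∈ xs → x ∈ ys) → (∀ {x} → x ∈ ys → x ∈ xs) → xs ↭ ys
  unique-set-↭ xs! ys! to from = ∼bag⇒↭ (unique∧set⇒bag xs! ys! (mk⇔ to from))

  bounded : ℕ → ℕ → List (List ℕ)
  bounded k n = filter (all? (ℕ._≤? k)) (partitions n)

  ∈-bounded⁺ : ∀ {k n ps} → IsPartition n ps → All (_≤ k) ps → ps ∈ bounded k n
  ∈-bounded⁺ {k} {n} π ≤k = ∈-filter⁺ (all? (ℕ._≤? k)) (∈-partitions⁺ n π) ≤k

  ∈-bounded⁻ : ∀ {k n ps} → ps ∈ bounded k n → IsPartition n ps × All (_≤ k) ps
  ∈-bounded⁻ {k} {n} ps∈ with ∈-filter⁻ (all? (ℕ._≤? k)) {xs = partitions n} ps∈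
  ... | ps∈′ , ≤k = ∈-partitions⁻ n ps∈′ , ≤k

  bounded-unique : ∀ k n → Unique (bounded k n)
  bounded-unique k n = Uniqueₚ.filter⁺ (all? (ℕ._≤? k)) (partitions-unique n)

  parts≤sum : ∀ ps → All (_≤ sum ps) ps
  parts≤sum []       = []
  parts≤sum (p ∷ ps) = ℕₚ.m≤m+n p (sum ps) ∷ All.map (λ ≤s → ℕₚ.≤-trans ≤s (ℕₚ.m≤n+m (sum ps) p)) (parts≤sum ps)

  tail-linked : ∀ {p ps} → Linked _≥_ (p ∷ ps) → Linked _≥_ ps
  tail-linked [-]     = []
  tail-linked (_ ∷ l) = l

  head-bound : ∀ {p ps} → Linked _≥_ (p ∷ ps) → All (_≤ p) (p ∷ ps)
  head-bound l = Linked⇒All (λ b≤a c≤b → ℕₚ.≤-trans c≤b b≤a) ℕₚ.≤-refl l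

  cons-linked : ∀ {p ps} → All (_≤ p) ps → Linked _≥_ ps → Linked _≥_ (p ∷ ps)
  cons-linked []        []      = [-]
  cons-linked (q≤p ∷ _) [-]     = q≤p ∷ [-]
  cons-linked (q≤p ∷ _) (r ∷ l) = q≤p ∷ (r ∷ l)

  bounded-all : ∀ k n → n ≤ k → bounded k n ↭ partitions n
  bounded-all k n n≤k = unique-set-↭ (bounded-unique k n) (partitions-unique n)
    (λ {ps} ps∈ → ∈-partitions⁺ n (proj₁ (∈-bounded⁻ {k} {n} ps∈)))
    (λ {ps} ps∈ → let π = ∈-partitions⁻ n ps∈ in
      ∈-bounded⁺ π (All.map (λ ≤s → ℕₚ.≤-trans ≤s (ℕₚ.≤-trans (ℕₚ.≤-reflexive (proj₂ (proj₂ π))) n≤k)) (parts≤sum ps)))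

  bounded-suc-small : ∀ k n → n < suc k → bounded (suc k) n ↭ bounded k n
  bounded-suc-small k n (s≤s n≤k) = unique-set-↭ (bounded-unique (suc k) n) (bounded-unique k n)
    (λ {ps} ps∈ → let π = proj₁ (∈-bounded⁻ {suc k} {n} ps∈) in
      ∈-bounded⁺ π (All.map (λ ≤s → ℕₚ.≤-trans ≤s (ℕₚ.≤-trans (ℕₚ.≤-reflexive (proj₂ (proj₂ π))) n≤k)) (parts≤sum ps)))
    (λ ps∈ → let π , ≤k = ∈-bounded⁻ {k} {n} ps∈ in ∈-bounded⁺ π (All.map ℕₚ.m≤n⇒m≤1+n ≤k))

  -- In weakly decreasing order a part k + 1 can only be present if it is the head. Removing it
  -- leaves a partition of n under the same bound, which is the source of all recurrences in the
  -- largest allowed part.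
  bounded-suc : ∀ k n → bounded (suc k) (suc k ℕ.+ n) ↭ bounded k (suc k ℕ.+ n) ++ map (suc k ∷_) (bounded (suc k) n)
  bounded-suc k n = unique-set-↭ (bounded-unique (suc k) (suc k ℕ.+ n))
    (Uniqueₚ.++⁺ (bounded-unique k (suc k ℕ.+ n)) (Uniqueₚ.map⁺ (λ e → proj₂ (Listₚ.∷-injective e)) (bounded-unique (suc k) n)) disjoint)
    to from
    where
    disjoint : ∀ {ps} → ¬ (ps ∈ bounded k (suc k ℕ.+ n) × ps ∈ map (suc k ∷_) (bounded (suc k) n))
    disjoint (l , r) with ∈-map⁻ (suc k ∷_) r
    ... | _ , _ , refl with ∈-bounded⁻ {k} {suc k ℕ.+ n} l
    ...   | _ , k<k ∷ _ = ℕₚ.<-irrefl refl k<k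
    to : ∀ {ps} → ps ∈ bounded (suc k) (suc k ℕ.+ n) → ps ∈ bounded k (suc k ℕ.+ n) ++ map (suc k ∷_) (bounded (suc k) n)
    to {ps} ps∈ with ps | ∈-bounded⁻ {suc k} {suc k ℕ.+ n} ps∈
    ... | [] | π , _ = ∈-++⁺ˡ (∈-bounded⁺ π [])
    ... | p ∷ ps′ | π@(l , _ ∷ pos , e) , p≤ ∷ ≤k with p ≟ suc k
    ...   | yes refl = ∈-++⁺ʳ (bounded k (suc k ℕ.+ n)) (∈-map⁺ (suc k ∷_) (∈-bounded⁺ (tail-linked l , pos , ℕₚ.+-cancelˡ-≡ (suc k) _ _ e) ≤k))
    ...   | no p≢ = ∈-++⁺ˡ (∈-bounded⁺ π (All.map (λ ≤p → ℕₚ.≤-trans ≤p (ℕₚ.≤-pred (ℕₚ.≤∧≢⇒< p≤ p≢))) (head-bound l)))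
    from : ∀ {ps} → ps ∈ bounded k (suc k ℕ.+ n) ++ map (suc k ∷_) (bounded (suc k) n) → ps ∈ bounded (suc k) (suc k ℕ.+ n)
    from ps∈ with ∈-++⁻ (bounded k (suc k ℕ.+ n)) ps∈
    ... | inj₁ l = let π , ≤k = ∈-bounded⁻ {k} {suc k ℕ.+ n} l in ∈-bounded⁺ π (All.map ℕₚ.m≤n⇒m≤1+n ≤k)
    ... | inj₂ r with ∈-map⁻ (suc k ∷_) r
    ...   | _ , ps′∈ , refl with ∈-bounded⁻ {suc k} {n} ps′∈
    ...     | (l , pos , e) , ≤k = ∈-bounded⁺ (cons-linked ≤k l , s≤s z≤n ∷ pos , cong (suc k ℕ.+_) e) (ℕₚ.≤-refl ∷ ≤k)

  all-ones : ∀ {ps} → All (0 <_) ps → All (_≤ 1) ps → ps ≡ replicate (sum ps) 1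
  all-ones []                  []             = refl
  all-ones (s≤s z≤n ∷ pos)     (s≤s z≤n ∷ ≤1) = cong (1 ∷_) (all-ones pos ≤1)

  ones-partition : ∀ n → IsPartition n (replicate n 1) × All (_≤ 1) (replicate n 1)
  ones-partition zero    = ([] , [] , refl) , []
  ones-partition (suc n) with ones-partition n
  ... | (l , pos , e) , ≤1 = (cons-linked ≤1 l , s≤s z≤n ∷ pos , cong suc e) , ℕₚ.≤-refl ∷ ≤1

  bounded-1 : ∀ n → bounded 1 n ↭ replicate n 1 ∷ []
  bounded-1 n = unique-set-↭ (bounded-unique 1 n) ([] ∷ [])
    (λ {ps} ps∈ → let (l , pos , e) , ≤1 = ∈-bounded⁻ {1} {n} ps∈ in here (trans (all-ones pos ≤1) (cong (λ m → replicate m 1) e)))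
    (λ { (here refl) → let π , ≤1 = ones-partition n in ∈-bounded⁺ π ≤1 })

  ω-replicate : ∀ n → ω (replicate n 1) ≡ n
  ω-replicate zero    = refl
  ω-replicate (suc n) = cong suc (ω-replicate n)

  -- This is `μ` with the number of ones as a separate parameter: for fixed w each part contributes
  -- independently of the others.
  larger : ℕ → List ℕ → ℕ
  larger w ps = length (filter (w <?_) ps)

  larger-cons : ∀ w p ps → larger w (p ∷ ps) ≡ (if does (w <? p) then suc (larger w ps) else larger w ps)
  larger-cons w p ps with does (w <? p)
  ... | true  = refl
  ... | false = refl

  larger-replicate : ∀ n → larger n (replicate n 1) ≡ 0
  larger-replicate zero    = refl
  larger-replicate (suc n) = cong length (Listₚ.filter-none (suc n <?_) (ones n (suc n)))
    where
    ones : ∀ n m → All (λ p → ¬ (suc n < p)) (replicate m 1)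
    ones n zero    = []
    ones n (suc m) = (λ { (s≤s ()) }) ∷ ones n m

  largest-bound : ∀ {k} ps → All (_≤ k) ps → largestPart ps ≤ k
  largest-bound []       []         = z≤n
  largest-bound (p ∷ ps) (p≤ ∷ ps≤) = ℕₚ.⊔-lub p≤ (largest-bound ps ps≤)

  ω-bound : ∀ {n ps} → IsPartition n ps → ω ps ≤ n
  ω-bound {n} {ps} (_ , pos , refl) = ℕₚ.≤-trans (Listₚ.length-filter (_≟ 1) ps) (len pos)
    where
    len : ∀ {ps} → All (0 <_) ps → length ps ≤ sum ps
    len []          = z≤n
    len (0<p ∷ pos) = ℕₚ.+-mono-≤ 0<p (len pos)

-- The q-binomial theorem, and recurrences for the generating functions by number of ones.

module CrankGeneratingFunctions where
  open import Defs using (partitions; crank; largestPart; ω)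
  open BoundedPartitions
  open import Data.Bool using (if_then_else_; true; false)
  open import Data.Nat using (_≟_; _<?_)
  open import Data.List using (_∷_; _++_; map; replicate)
  open import Data.List.Membership.Propositional using (_∈_)

  module QBinomial (R : CommutativeRing 0ℓ 0ℓ) (q : CommutativeRing.Carrier R) (N : ℕ) (q^≈0 : TruncatedAt R q N) where
    open CommutativeRing R
    open Monomials R
    open IntegerCoefficients R
    open Nilpotent R q N q^≈0
    open import Relation.Binary.Reasoning.Setoid setoid

    -- The hypotheses characterise a w = (x; q)_w / (q; q)_w without division.
    module _ (a : ℕ → Carrier) (x : Carrier) (a₀ : a 0 ≈ 1#)
             (a-suc : ∀ w → a (suc w) * (1# - q ^ suc w) ≈ a w * (1# - x * q ^ w)) where

      series : Carrier → ℕ → Carrier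
      series y n = ⨁ n (λ w → a w * y ^ w)

      -- f(y) - f(q y) = y (f(y) - x f(q y)) up to the last term
      series-step : ∀ y n → series y (suc n) - series (q * y) (suc n) ≈ y * (series y n - x * series (q * y) n)
      series-step y zero    = solve 3 (λ a y x → (a :* con (+ 1) :+ con (+ 0)) :- (a :* con (+ 1) :+ con (+ 0)) := y :* (con (+ 0) :- x :* con (+ 0))) refl (a 0) y x
      series-step y (suc n) = begin
        (a (suc n) * y ^ suc n + f) - (a (suc n) * (q * y) ^ suc n + g)
          ≈⟨ +-congˡ (-‿cong (+-congʳ (*-congˡ (^-distrib-* q y (suc n))))) ⟩
        (a (suc n) * y ^ suc n + f) - (a (suc n) * (q ^ suc n * y ^ suc n) + g)
          ≈⟨ solve 5 (λ a u v f g → (a :* v :+ f) :- (a :* (u :* v) :+ g) := a :* (con (+ 1) :- u) :* v :+ (f :- g)) refl (a (suc n)) (q ^ suc n) (y ^ suc n) f g ⟩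
        a (suc n) * (1# - q ^ suc n) * y ^ suc n + (f - g)
          ≈⟨ +-cong (*-congʳ (a-suc n)) (series-step y n) ⟩
        a n * (1# - x * q ^ n) * (y * y ^ n) + y * (series y n - x * series (q * y) n)
          ≈⟨ solve 7 (λ a x u y v f g → a :* (con (+ 1) :- x :* u) :* (y :* v) :+ y :* (f :- x :* g) := y :* ((a :* v :+ f) :- x :* (a :* (u :* v) :+ g))) refl (a n) x (q ^ n) y (y ^ n) _ _ ⟩
        y * ((a n * y ^ n + series y n) - x * (a n * (q ^ n * y ^ n) + series (q * y) n))
          ≈⟨ *-congˡ (+-congˡ (-‿cong (*-congˡ (+-congʳ (*-congˡ (sym (^-distrib-* q y n))))))) ⟩
        y * (series y (suc n) - x * series (q * y) (suc n)) ∎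
        where
        f = series y (suc n)
        g = series (q * y) (suc n)

      module _ (z : Carrier) where

        private
          F : ℕ → Carrier
          F k = series (z * q ^ k) (suc N)

          q^-factor : ∀ k w → N < w → (z * q ^ suc k) ^ w ≈ 0#
          q^-factor k w N<w = begin
            (z * q ^ suc k) ^ w           ≈⟨ ^-distrib-* z (q ^ suc k) w ⟩
            z ^ w * (q ^ suc k) ^ w       ≈⟨ *-congˡ (trans (^-assocʳ q (suc k) w) (vanish (ℕₚ.≤-trans N<w (ℕₚ.m≤m+n w (k ℕ.* w))))) ⟩
            z ^ w * 0#                    ≈⟨ zeroʳ _ ⟩
            0#                            ∎

          stable : ∀ k → series (z * q ^ suc k) (suc (suc N)) ≈ F (suc k)
          stable k = trans (+-congʳ (trans (*-congˡ (q^-factor k (suc N) ℕₚ.≤-refl)) (zeroʳ _))) (+-identityˡ _)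

          series-cong : ∀ {u v} n → u ≈ v → series u n ≈ series v n
          series-cong n e = ⨁-cong n (λ w → *-congˡ (^-congˡ w e))

          swap : ∀ k → q * (z * q ^ k) ≈ z * q ^ suc k
          swap k = solve 3 (λ q z u → q :* (z :* u) := z :* (q :* u)) refl q z (q ^ k)

          F-step : ∀ k → (1# - z * q ^ suc k) * F (suc k) ≈ (1# - x * (z * q ^ suc k)) * F (suc (suc k))
          F-step k = begin
            (1# - y) * f                      ≈⟨ solve 2 (λ y f → (con (+ 1) :- y) :* f := f :- y :* f) refl y f ⟩
            f - y * f                         ≈⟨ solve 5 (λ x f g y r → f :- y :* f := (f :- g) :- y :* (f :- x :* g) :+ (con (+ 1) :- x :* y) :* g) refl x f g y f ⟩
            (f - g) - y * (f - x * g) + (1# - x * y) * g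
                                              ≈⟨ +-congʳ (+-congʳ eq) ⟩
            y * (f - x * g) - y * (f - x * g) + (1# - x * y) * g
                                              ≈⟨ solve 2 (λ a b → a :- a :+ b := b) refl _ _ ⟩
            (1# - x * y) * g                  ∎
            where
            y = z * q ^ suc k
            f = F (suc k)
            g = F (suc (suc k))
            eq : f - g ≈ y * (f - x * g)
            eq = begin
              f - g                                                      ≈⟨ +-cong (stable k) (-‿cong (trans (series-cong (suc (suc N)) (swap (suc k))) (stable (suc k)))) ⟨
              series y (suc (suc N)) - series (q * y) (suc (suc N))      ≈⟨ series-step y (suc N) ⟩
              y * (f - x * series (q * y) (suc N))                       ≈⟨ *-congˡ (+-congˡ (-‿cong (*-congˡ (series-cong (suc N) (swap (suc k)))))) ⟩
              y * (f - x * g)                                            ∎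

          iterate : ∀ K → ∏ K (λ k → 1# - z * q ^ suc k) * F 1 ≈ ∏ K (λ k → 1# - x * (z * q ^ suc k)) * F (suc K)
          iterate zero    = refl
          iterate (suc K) = begin
            (1# - z * q ^ suc K) * P * F 1                       ≈⟨ *-assoc _ _ _ ⟩
            (1# - z * q ^ suc K) * (P * F 1)                     ≈⟨ *-congˡ (iterate K) ⟩
            (1# - z * q ^ suc K) * (P′ * F (suc K))              ≈⟨ solve 3 (λ a b c → a :* (b :* c) := b :* (a :* c)) refl _ _ _ ⟩
            P′ * ((1# - z * q ^ suc K) * F (suc K))              ≈⟨ *-congˡ (F-step K) ⟩
            P′ * ((1# - x * (z * q ^ suc K)) * F (suc (suc K)))  ≈⟨ solve 3 (λ a b c → a :* (b :* c) := b :* a :* c) refl _ _ _ ⟩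
            (1# - x * (z * q ^ suc K)) * P′ * F (suc (suc K))    ∎
            where
            P  = ∏ K (λ k → 1# - z * q ^ suc k)
            P′ = ∏ K (λ k → 1# - x * (z * q ^ suc k))

          constant : ∀ K → N ≤ K → ∀ n → series (z * q ^ suc K) (suc n) ≈ 1#
          constant K N≤K zero    = trans (+-identityʳ _) (trans (*-identityʳ _) a₀)
          constant K N≤K (suc n) = trans (+-cong (trans (*-congˡ (trans (*-congʳ (trans (*-congˡ (vanish (s≤s N≤K))) (zeroʳ z))) (zeroˡ _))) (zeroʳ _)) (constant K N≤K n)) (+-identityˡ 1#)

        -- Cauchy's theorem for the argument z q. The functional equation pushes the argument to z
        -- q^(K+1), where every term but the constant 1 vanishes; the factor q in the argument also
        -- makes the series stop at w = N.
        q-binomial : ∀ K → N ≤ K → ∏ K (λ k → 1# - z * q ^ suc k) * series (z * q ^ 1) (suc N) ≈ ∏ K (λ k → 1# - x * (z * q ^ suc k))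
        q-binomial K N≤K = trans (iterate K) (trans (*-congˡ (constant K N≤K N)) (*-identityʳ _))

  module CrankSeries (R : CommutativeRing 0ℓ 0ℓ) (x x⁻¹ : CommutativeRing.Carrier R) where
    open CommutativeRing R
    open ListSum R
    open PowerSeries R
    open Monomials R using (_^_; ^-≡)
    open IntegerCoefficients R

    if0 : ∀ {P : Set} → (b : Dec P) → Carrier → Carrier
    if0 b c = if does b then c else 0#

    x^ℤ : ℤ → Carrier
    x^ℤ (+ n)    = x ^ n
    x^ℤ -[1+ n ] = x⁻¹ ^ suc n

    -- Partitions with w ≥ 1 ones and parts ≤ k, weighted by x^μ.
    withOnes : ℕ → ℕ → PS
    withOnes w k n = ∑ (bounded k n) (λ ps → if0 (ω ps ≟ w) (x ^ larger w ps))

    -- Partitions with no ones and parts ≤ k, unweighted and weighted by x^λ.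
    noOnes noOnes-largest : ℕ → PS
    noOnes         k n = ∑ (bounded k n) (λ ps → if0 (ω ps ≟ 0) 1#)
    noOnes-largest k n = ∑ (bounded k n) (λ ps → if0 (ω ps ≟ 0) (x ^ largestPart ps))

    -- The coefficient of q follows the convention M(0,1) = -1, M(1,1) = M(-1,1) = 1 and not the
    -- crank of the partition of 1.
    crankSeries : PS
    crankSeries 0 = 1#
    crankSeries 1 = x + x⁻¹ - 1#
    crankSeries n@(suc (suc _)) = ∑ (partitions n) (λ ps → x^ℤ (crank ps))

    module GeneratingFunctions (N : ℕ) (x*x⁻¹≈1 : x * x⁻¹ ≈ 1#) where
      open Truncated N
      open Monomials (truncated N) public using () renaming (_^_ to _^ˢ_; ∏ to ∏ˢ; ∏-cong to ∏ˢ-cong; ∏-head to ∏ˢ-head; ^-≡ to ^ˢ-≡)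
      open import Relation.Binary.Reasoning.Setoid setoid

      private
        T : ℕ → PS
        T k = X ^ˢ k

      T-below : ∀ k f n → n < k → (T k ⊛ f) n ≈ 0#
      T-below = X^-⊛-low

      T-above : ∀ k f n → (T k ⊛ f) (k ℕ.+ n) ≈ f n
      T-above = X^-⊛-shift

      -- The common form of the three recurrences. Two weights are needed because a prepended part k
      -- + 1 is the largest one: it turns a weight by the largest part into a constant factor c
      -- times an unweighted count.
      split-largest : ∀ k (Φ : List ℕ → Carrier) (c : Carrier) (Ψ : List ℕ → Carrier) →
                      (∀ {n} ps → ps ∈ bounded (suc k) n → Φ (suc k ∷ ps) ≈ c * Ψ ps) →
                      ∀ n → ∑ (bounded (suc k) n) Φ ≈ ∑ (bounded k n) Φ + c * (T (suc k) ⊛ (λ m → ∑ (bounded (suc k) m) Ψ)) n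
      split-largest k Φ c Ψ Φ≈cΨ n with suc k ℕ.≤? n
      ... | no n<k = begin
        ∑ (bounded (suc k) n) Φ          ≈⟨ ∑-↭ Φ (bounded-suc-small k n (ℕₚ.≰⇒> n<k)) ⟩
        ∑ (bounded k n) Φ                ≈⟨ +-identityʳ _ ⟨
        ∑ (bounded k n) Φ + 0#           ≈⟨ +-congˡ (trans (*-congˡ (T-below (suc k) Z n (ℕₚ.≰⇒> n<k))) (zeroʳ c)) ⟨
        ∑ (bounded k n) Φ + c * (T (suc k) ⊛ Z) n ∎
        where
        Z : PS
        Z m = ∑ (bounded (suc k) m) Ψ
      ... | yes k<n = ≡.subst (λ n → ∑ (bounded (suc k) n) Φ ≈ ∑ (bounded k n) Φ + c * (T (suc k) ⊛ (λ m → ∑ (bounded (suc k) m) Ψ)) n) (ℕₚ.m+[n∸m]≡n k<n) (begin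
        ∑ (bounded (suc k) (suc k ℕ.+ m)) Φ
          ≈⟨ ∑-↭ Φ (bounded-suc k m) ⟩
        ∑ (bounded k (suc k ℕ.+ m) ++ map (suc k ∷_) (bounded (suc k) m)) Φ
          ≈⟨ ∑-++ (bounded k (suc k ℕ.+ m)) (map (suc k ∷_) (bounded (suc k) m)) Φ ⟩
        ∑ (bounded k (suc k ℕ.+ m)) Φ + ∑ (map (suc k ∷_) (bounded (suc k) m)) Φ
          ≈⟨ +-congˡ (trans (∑-map (suc k ∷_) (bounded (suc k) m) Φ) (trans (∑-cong∈ (bounded (suc k) m) (λ ps ps∈ → Φ≈cΨ {m} ps ps∈)) (∑-*ˡ (bounded (suc k) m) c Ψ))) ⟩
        ∑ (bounded k (suc k ℕ.+ m)) Φ + c * ∑ (bounded (suc k) m) Ψ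
          ≈⟨ +-congˡ (*-congˡ (T-above (suc k) (λ m → ∑ (bounded (suc k) m) Ψ) m)) ⟨
        ∑ (bounded k (suc k ℕ.+ m)) Φ + c * (T (suc k) ⊛ (λ m → ∑ (bounded (suc k) m) Ψ)) (suc k ℕ.+ m) ∎)
        where m = n ℕ.∸ suc k

      larger-weight : ℕ → ℕ → Carrier
      larger-weight w p = if does (w <? p) then x else 1#

      if0-* : ∀ {P : Set} (b : Dec P) c d → if0 b (c * d) ≈ c * if0 b d
      if0-* (yes _) c d = refl
      if0-* (no _)  c d = sym (zeroʳ c)

      if0-cong : ∀ {P : Set} (b : Dec P) {c d} → c ≈ d → if0 b c ≈ if0 b d
      if0-cong (yes _) e = e
      if0-cong (no _)  e = refl

      -- The recurrence starts with the part 2, so that the prepended part is never a 1 and `ω` is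
      -- unaffected.
      withOnes-suc : ∀ w k n → withOnes w (2 ℕ.+ k) n ≈ withOnes w (1 ℕ.+ k) n + larger-weight w (2 ℕ.+ k) * (T (2 ℕ.+ k) ⊛ withOnes w (2 ℕ.+ k)) n
      withOnes-suc w k = split-largest (suc k) _ (larger-weight w (2 ℕ.+ k)) _ (λ ps _ →
        trans (if0-cong (ω ps ≟ w) (weight ps)) (if0-* (ω ps ≟ w) (larger-weight w (2 ℕ.+ k)) (x ^ larger w ps)))
        where
        weight : ∀ ps → x ^ larger w (2 ℕ.+ k ∷ ps) ≈ larger-weight w (2 ℕ.+ k) * x ^ larger w ps
        weight ps = trans (^-≡ x (larger-cons w (2 ℕ.+ k) ps)) (lemma (does (w <? 2 ℕ.+ k)))
          where
          lemma : ∀ b → x ^ (if b then suc (larger w ps) else larger w ps) ≈ (if b then x else 1#) * x ^ larger w ps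
          lemma true  = refl
          lemma false = sym (*-identityˡ _)

      noOnes-suc : ∀ k n → noOnes (2 ℕ.+ k) n ≈ noOnes (1 ℕ.+ k) n + 1# * (T (2 ℕ.+ k) ⊛ noOnes (2 ℕ.+ k)) n
      noOnes-suc k = split-largest (suc k) _ 1# _ (λ ps _ → sym (*-identityˡ _))

      noOnes-largest-suc : ∀ k n → noOnes-largest (2 ℕ.+ k) n ≈ noOnes-largest (1 ℕ.+ k) n + x ^ (2 ℕ.+ k) * (T (2 ℕ.+ k) ⊛ noOnes (2 ℕ.+ k)) n
      noOnes-largest-suc k = split-largest (suc k) _ (x ^ (2 ℕ.+ k)) _ (λ {n} ps ps∈ →
        trans (if0-cong (ω ps ≟ 0) (trans (^-≡ x (ℕₚ.m≥n⇒m⊔n≡m (largest-bound ps (proj₂ (∈-bounded⁻ {2 ℕ.+ k} {n} ps∈))))) (sym (*-identityʳ _)))) (if0-* (ω ps ≟ 0) (x ^ (2 ℕ.+ k)) 1#))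

      T-diag : ∀ w n → (if does (n ≟ w) then 1# else 0#) ≈ T w n
      T-diag zero    zero    = refl
      T-diag zero    (suc n) = refl
      T-diag (suc w) zero    = sym (X-⊛-zero (T w))
      T-diag (suc w) (suc n) = trans (T-diag w n) (sym (X-⊛-suc (T w) n))

      noOnes-1 : ∀ n → noOnes 1 n ≈ T 0 n
      noOnes-1 n = trans (∑-↭ _ (bounded-1 n)) (trans (+-identityʳ _) (trans (reflexive (≡.cong (λ m → if0 (m ≟ 0) 1#) (ω-replicate n))) (T-diag 0 n)))

      noOnes-largest-1 : ∀ n → noOnes-largest 1 n ≈ T 0 n
      noOnes-largest-1 n = trans (∑-↭ _ (bounded-1 n)) (trans (+-identityʳ _) (trans (weight n) (T-diag 0 n)))
        where
        weight : ∀ n → if0 (ω (replicate n 1) ≟ 0) (x ^ largestPart (replicate n 1)) ≈ (if does (n ≟ 0) then 1# else 0#)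
        weight zero    = refl
        weight (suc n) = refl

      withOnes-1 : ∀ w n → withOnes (suc w) 1 n ≈ T (suc w) n
      withOnes-1 w n = trans (∑-↭ _ (bounded-1 n)) (trans (+-identityʳ _) (trans (reflexive (≡.cong (λ m → if0 (m ≟ suc w) (x ^ larger (suc w) (replicate n 1))) (ω-replicate n)))
        (trans (weight (n ≟ suc w)) (T-diag (suc w) n))))
        where
        weight : (d : Dec (n ≡ suc w)) → if0 d (x ^ larger (suc w) (replicate n 1)) ≈ (if does d then 1# else 0#)
        weight (yes ≡.refl) = ^-≡ x (larger-replicate (suc w))
        weight (no _)       = refl

open CrankGeneratingFunctions

-- From the recurrences to the product formula for the crank.

module CrankFunctionalEquations where
  open BoundedPartitions
  open import Data.Bool using (if_then_else_; true; false)
  open import Data.Nat using (_<?_)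
  open import Function using (_∘_)
  open import Relation.Nullary.Decidable using (dec-true; dec-false)

  -- These fields carry everything about partitions that enters the product formula; what follows is
  -- algebra in a ring with nilpotent q.
  record CrankRecurrences (S : CommutativeRing 0ℓ 0ℓ) (q cx : CommutativeRing.Carrier S) : Set where
    open CommutativeRing S
    open Monomials S
    field
      withOnes : ℕ → ℕ → Carrier
      noOnes noOnes-largest : ℕ → Carrier
      withOnes-suc : ∀ w k → withOnes w (2 ℕ.+ k) ≈ withOnes w (1 ℕ.+ k) + (if does (w <? 2 ℕ.+ k) then cx else 1#) * q ^ (2 ℕ.+ k) * withOnes w (2 ℕ.+ k)
      withOnes-1 : ∀ w → withOnes (suc w) 1 ≈ q ^ suc w
      noOnes-suc : ∀ k → noOnes (2 ℕ.+ k) ≈ noOnes (1 ℕ.+ k) + q ^ (2 ℕ.+ k) * noOnes (2 ℕ.+ k)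
      noOnes-1 : noOnes 1 ≈ 1#
      noOnes-largest-suc : ∀ k → noOnes-largest (2 ℕ.+ k) ≈ noOnes-largest (1 ℕ.+ k) + cx ^ (2 ℕ.+ k) * q ^ (2 ℕ.+ k) * noOnes (2 ℕ.+ k)
      noOnes-largest-1 : noOnes-largest 1 ≈ 1#

  module CrankAlgebra (S : CommutativeRing 0ℓ 0ℓ) (q : CommutativeRing.Carrier S) (N : ℕ) (q^≈0 : TruncatedAt S q N)
                      (cx cy : CommutativeRing.Carrier S) (cx*cy : Inverses S cx cy) (recurrences : CrankRecurrences S q cx) where
    open CommutativeRing S
    open Monomials S
    open CrankRecurrences recurrences
    open IntegerCoefficients S
    open Nilpotent S q N q^≈0
    open QBinomial S q N q^≈0
    open import Algebra.Properties.Ring ring using (-0#≈0#)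
    open import Relation.Binary.Reasoning.Setoid setoid

    A B : ℕ → Carrier
    A k = 1# - cx * q ^ suc k
    B k = 1# - q ^ suc k

    -- The denominator contributed by the part k + 1: a part exceeding the number w of ones counts
    -- for `μ` and carries x, a smaller or equal one does not.
    ite : ℕ → ℕ → Carrier
    ite w k = if does (w <? suc k) then A k else B k

    ite-weight : ∀ w k → 1# - (if does (w <? suc k) then cx else 1#) * q ^ suc k ≈ ite w k
    ite-weight w k = lemma (does (w <? suc k))
      where
      lemma : ∀ b → 1# - (if b then cx else 1#) * q ^ suc k ≈ (if b then A k else B k)
      lemma true  = refl
      lemma false = +-congˡ (-‿cong (*-identityˡ _))

    ite-A : ∀ w k → w ≤ k → ite w k ≈ A k
    ite-A w k w≤k rewrite dec-true (w <? suc k) (s≤s w≤k) = refl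

    ite-B : ∀ w k → k < w → ite w k ≈ B k
    ite-B w k k<w rewrite dec-false (w <? suc k) (λ w<sk → ℕₚ.<-irrefl ≡.refl (ℕₚ.≤-trans w<sk k<w)) = refl

    -- The mixed product consists of (q; q)_w and the factors of (x q; q)_∞ from the index w on;
    -- multiplying by (x q; q)_w completes the latter.
    ∏-ite : ∀ w d → ∏ (d ℕ.+ w) (ite w) * ∏ w A ≈ ∏ w B * ∏ (d ℕ.+ w) A
    ∏-ite w zero = *-congʳ (go w ℕₚ.≤-refl)
      where
      go : ∀ n → n ≤ w → ∏ n (ite w) ≈ ∏ n B
      go zero    _   = refl
      go (suc n) n<w = *-cong (ite-B w n n<w) (go n (ℕₚ.<⇒≤ n<w))
    ∏-ite w (suc d) = begin
      ite w (d ℕ.+ w) * I * ∏ w A       ≈⟨ *-assoc _ _ _ ⟩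
      ite w (d ℕ.+ w) * (I * ∏ w A)     ≈⟨ *-cong (ite-A w (d ℕ.+ w) (ℕₚ.m≤n+m w d)) (∏-ite w d) ⟩
      A (d ℕ.+ w) * (∏ w B * ∏ (d ℕ.+ w) A) ≈⟨ solve 3 (λ a b c → a :* (b :* c) := b :* (a :* c)) refl (A (d ℕ.+ w)) (∏ w B) (∏ (d ℕ.+ w) A) ⟩
      ∏ w B * (A (d ℕ.+ w) * ∏ (d ℕ.+ w) A) ∎
      where I = ∏ (d ℕ.+ w) (ite w)

    -- Each recurrence reads (1 - f k) Z(k+1) = Z k, so the factors are absorbed one after another.
    telescope : ∀ (f : ℕ → Carrier) (Z : ℕ → Carrier) → (∀ k → Z (suc k) ≈ Z k + f k * Z (suc k)) → ∀ L → ∏ L (λ k → 1# - f k) * Z L ≈ Z 0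
    telescope f Z step zero    = *-identityˡ _
    telescope f Z step (suc L) = begin
      (1# - f L) * P * Z (suc L)    ≈⟨ solve 3 (λ f p z → (con (+ 1) :- f) :* p :* z := p :* (z :- f :* z)) refl (f L) P (Z (suc L)) ⟩
      P * (Z (suc L) - f L * Z (suc L))  ≈⟨ *-congˡ (+-congʳ (step L)) ⟩
      P * (Z L + f L * Z (suc L) - f L * Z (suc L))  ≈⟨ *-congˡ (solve 2 (λ a b → a :+ b :- b := a) refl (Z L) (f L * Z (suc L))) ⟩
      P * Z L                       ≈⟨ telescope f Z step L ⟩
      Z 0                           ∎
      where P = ∏ L (λ k → 1# - f k)

    withOnes-product : ∀ w L → ∏ L (ite (suc w) ∘ suc) * withOnes (suc w) (suc L) ≈ q ^ suc w
    withOnes-product w L = begin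
      ∏ L (ite (suc w) ∘ suc) * withOnes (suc w) (suc L)
        ≈⟨ *-congʳ (∏-cong L (λ k → sym (ite-weight (suc w) (suc k)))) ⟩
      ∏ L (λ k → 1# - (if does (suc w <? 2 ℕ.+ k) then cx else 1#) * q ^ (2 ℕ.+ k)) * withOnes (suc w) (suc L)
        ≈⟨ telescope _ (withOnes (suc w) ∘ suc) (withOnes-suc (suc w)) L ⟩
      withOnes (suc w) 1
        ≈⟨ withOnes-1 w ⟩
      q ^ suc w ∎

    a : ℕ → Carrier
    a w = poch⁻¹ w * ∏ w A

    -- (x q)_∞ Z_w = (1 - q) a_w q^w for the generating function Z_w of partitions with w ones.
    withOnes-A : ∀ w → suc w ≤ suc N → ∏ (suc N) A * withOnes (suc w) (suc N) ≈ B 0 * (a (suc w) * q ^ suc w)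
    withOnes-A w w≤N = begin
      PA * Z                                    ≈⟨ trans (*-congʳ (sym (trans (*-congʳ (poch⁻¹-* (suc w))) (*-identityˡ PA)))) (*-congʳ (*-assoc (poch⁻¹ (suc w)) (poch (suc w)) PA)) ⟩
      poch⁻¹ (suc w) * (poch (suc w) * PA) * Z  ≈⟨ *-congʳ (*-congˡ mixed) ⟨
      poch⁻¹ (suc w) * (B 0 * I * PwA) * Z      ≈⟨ solve 5 (λ h b i p z → h :* (b :* i :* p) :* z := b :* (h :* p :* (i :* z))) refl (poch⁻¹ (suc w)) (B 0) I PwA Z ⟩
      B 0 * (a (suc w) * (I * Z))               ≈⟨ *-congˡ (*-congˡ (withOnes-product w N)) ⟩
      B 0 * (a (suc w) * q ^ suc w)             ∎
      where
      PA = ∏ (suc N) A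
      PwA = ∏ (suc w) A
      Z = withOnes (suc w) (suc N)
      I = ∏ N (ite (suc w) ∘ suc)
      mixed : B 0 * I * PwA ≈ poch (suc w) * PA
      mixed = begin
        B 0 * I * PwA                       ≈⟨ *-congʳ (*-congʳ (sym (ite-B (suc w) 0 (s≤s z≤n)))) ⟩
        ite (suc w) 0 * I * PwA             ≈⟨ *-congʳ (∏-head N (ite (suc w))) ⟨
        ∏ (suc N) (ite (suc w)) * PwA       ≡⟨ ≡.cong (λ n → ∏ n (ite (suc w)) * PwA) (ℕₚ.m∸n+n≡m w≤N) ⟨
        ∏ (suc N ℕ.∸ suc w ℕ.+ suc w) (ite (suc w)) * PwA ≈⟨ ∏-ite (suc w) (suc N ℕ.∸ suc w) ⟩
        ∏ (suc w) B * ∏ (suc N ℕ.∸ suc w ℕ.+ suc w) A ≡⟨ ≡.cong (λ n → ∏ (suc w) B * ∏ n A) (ℕₚ.m∸n+n≡m w≤N) ⟩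
        poch (suc w) * PA                   ∎

    noOnes-product : ∀ L → noOnes (suc L) ≈ B 0 * poch⁻¹ (suc L)
    noOnes-product L = begin
      Z                                        ≈⟨ trans (*-congʳ (poch⁻¹-* (suc L))) (*-identityˡ Z) ⟨
      poch⁻¹ (suc L) * poch (suc L) * Z        ≈⟨ *-congʳ (*-congˡ (∏-head L B)) ⟩
      poch⁻¹ (suc L) * (B 0 * ∏ L (B ∘ suc)) * Z ≈⟨ solve 4 (λ h b p z → h :* (b :* p) :* z := b :* h :* (p :* z)) refl (poch⁻¹ (suc L)) (B 0) (∏ L (B ∘ suc)) Z ⟩
      B 0 * poch⁻¹ (suc L) * (∏ L (B ∘ suc) * Z) ≈⟨ *-congˡ (trans (telescope _ (noOnes ∘ suc) noOnes-suc L) noOnes-1) ⟩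
      B 0 * poch⁻¹ (suc L) * 1#                ≈⟨ *-identityʳ _ ⟩
      B 0 * poch⁻¹ (suc L)                     ∎
      where Z = noOnes (suc L)

    e : ℕ → Carrier
    e w = poch⁻¹ w * (cx * q ^ 1) ^ w

    -- Partitions without ones and with largest part k ≥ 2 contribute (1 - q) (x q)^k / (q; q)_k.
    -- The terms k = 0 and k = 1 of this series are 1 - q and x q, whereas the empty partition gives
    -- 1; the difference - q + x q is exactly the correction imposed by the convention for the crank
    -- at n = 1.
    noOnes-largest-sum : ∀ L → noOnes-largest (suc L) - q ^ 1 + cx * q ^ 1 ≈ B 0 * ⨁ (2 ℕ.+ L) e
    noOnes-largest-sum zero = begin
      noOnes-largest 1 - q ^ 1 + cx * q ^ 1  ≈⟨ +-congʳ (+-congʳ noOnes-largest-1) ⟩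
      1# - q ^ 1 + cx * q ^ 1                ≈⟨ +-congˡ (trans (*-congʳ (poch⁻¹-* 1)) (*-identityˡ (cx * q ^ 1))) ⟨
      1# - q ^ 1 + poch⁻¹ 1 * poch 1 * (cx * q ^ 1)
        ≈⟨ solve 3 (λ q h c → (con (+ 1) :- q) :+ h :* ((con (+ 1) :- q) :* con (+ 1)) :* c := (con (+ 1) :- q) :* (h :* (c :* con (+ 1)) :+ (con (+ 1) :* con (+ 1) :+ con (+ 0)))) refl (q ^ 1) (poch⁻¹ 1) (cx * q ^ 1) ⟩
      B 0 * ⨁ 2 e ∎
    noOnes-largest-sum (suc L) = begin
      noOnes-largest (2 ℕ.+ L) - q ^ 1 + cx * q ^ 1
        ≈⟨ +-congʳ (+-congʳ (noOnes-largest-suc L)) ⟩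
      noOnes-largest (suc L) + cx ^ (2 ℕ.+ L) * q ^ (2 ℕ.+ L) * noOnes (2 ℕ.+ L) - q ^ 1 + cx * q ^ 1
        ≈⟨ solve 4 (λ a b c d → a :+ b :- c :+ d := b :+ (a :- c :+ d)) refl (noOnes-largest (suc L)) _ (q ^ 1) (cx * q ^ 1) ⟩
      cx ^ (2 ℕ.+ L) * q ^ (2 ℕ.+ L) * noOnes (2 ℕ.+ L) + (noOnes-largest (suc L) - q ^ 1 + cx * q ^ 1)
        ≈⟨ +-cong (*-cong power (noOnes-product (suc L))) (noOnes-largest-sum L) ⟩
      (cx * q ^ 1) ^ (2 ℕ.+ L) * (B 0 * poch⁻¹ (2 ℕ.+ L)) + B 0 * ⨁ (2 ℕ.+ L) e
        ≈⟨ solve 4 (λ p b h s → p :* (b :* h) :+ b :* s := b :* (h :* p :+ s)) refl _ (B 0) (poch⁻¹ (2 ℕ.+ L)) (⨁ (2 ℕ.+ L) e) ⟩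
      B 0 * ⨁ (3 ℕ.+ L) e ∎
      where
      power : cx ^ (2 ℕ.+ L) * q ^ (2 ℕ.+ L) ≈ (cx * q ^ 1) ^ (2 ℕ.+ L)
      power = trans (sym (^-distrib-* cx q (2 ℕ.+ L))) (^-congˡ (2 ℕ.+ L) (*-congˡ (sym (*-identityʳ q))))

    ∏-far : ∀ (c : Carrier) {m n} → N ≤ m → N ≤ n → ∏ m (λ k → 1# - c * q ^ suc k) ≈ ∏ n (λ k → 1# - c * q ^ suc k)
    ∏-far c N≤m N≤n = trans (to N≤m) (sym (to N≤n))
      where
      to : ∀ {m} → N ≤ m → ∏ m (λ k → 1# - c * q ^ suc k) ≈ ∏ N (λ k → 1# - c * q ^ suc k)
      to {m} N≤m = trans (reflexive (≡.cong (λ n → ∏ n (λ k → 1# - c * q ^ suc k)) (≡.sym (ℕₚ.m∸n+n≡m N≤m))))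
        (∏-stable {f = λ k → 1# - c * q ^ suc k} N (λ k N≤k → trans (+-congˡ (trans (-‿cong (trans (*-congˡ (vanish (s≤s N≤k))) (zeroʳ c))) -0#≈0#)) (+-identityʳ 1#)) (m ℕ.∸ N))

    -- The q-binomial theorem with parameter 0, which expands 1 / (x q; q)_∞.
    euler : ∏ (suc N) A * ⨁ (suc N) e ≈ 1#
    euler = trans (q-binomial poch⁻¹ 0# refl (λ w → trans (poch-suc w) (sym (trans (*-congˡ (trans (+-congˡ (trans (-‿cong (zeroˡ _)) -0#≈0#)) (+-identityʳ 1#))) (*-identityʳ _)))) cx (suc N) (ℕₚ.n≤1+n N))
                  (∏-1 (suc N) (λ k → trans (+-congˡ (trans (-‿cong (zeroˡ _)) -0#≈0#)) (+-identityʳ 1#)))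

    e-last : e (suc N) ≈ 0#
    e-last = trans (*-congˡ (trans (^-distrib-* cx (q ^ 1) (suc N)) (trans (*-congˡ (trans (^-assocʳ q 1 (suc N)) (vanish (ℕₚ.≤-reflexive (≡.sym (ℕₚ.*-identityˡ (suc N))))))) (zeroʳ _)))) (zeroʳ _)

    a-suc : ∀ w → a (suc w) * (1# - q ^ suc w) ≈ a w * (1# - cx * q * q ^ w)
    a-suc w = begin
      poch⁻¹ (suc w) * (A w * ∏ w A) * (1# - q ^ suc w)   ≈⟨ solve 4 (λ h a p f → h :* (a :* p) :* f := (h :* f) :* p :* a) refl (poch⁻¹ (suc w)) (A w) (∏ w A) (1# - q ^ suc w) ⟩
      poch⁻¹ (suc w) * (1# - q ^ suc w) * ∏ w A * A w     ≈⟨ *-cong (*-congʳ (poch-suc w)) (+-congˡ (-‿cong (sym (*-assoc cx q (q ^ w))))) ⟩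
      a w * (1# - cx * q * q ^ w)                         ∎

    crankSum : Carrier
    crankSum = noOnes-largest (suc N) - q ^ 1 + cx * q ^ 1 + ⨁ N (λ w → cy ^ suc w * withOnes (suc w) (suc N))

    -- Multiplication by (x q; q)_∞ turns the sum over w into (1 - q) times the q-binomial series
    -- with parameter x q at the argument x⁻¹ q; the partitions without ones supply its term w = 0.
    -- Since x x⁻¹ = 1, the theorem leaves (1 - q) (q²; q)_∞ = (q; q)_∞.
    crankSum-product : ∀ L → N ≤ L → ∏ L A * ∏ L (λ k → 1# - cy * q ^ suc k) * crankSum ≈ poch L
    crankSum-product L N≤L = begin
      ∏ L A * PC * crankSum
        ≈⟨ *-congʳ (*-congʳ (∏-far cx N≤L (ℕₚ.n≤1+n N))) ⟩
      PA * PC * crankSum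
        ≈⟨ solve 4 (λ a c l s → a :* c :* (l :+ s) := c :* (a :* l :+ a :* s)) refl PA PC _ _ ⟩
      PC * (PA * (noOnes-largest (suc N) - q ^ 1 + cx * q ^ 1) + PA * ⨁ N (λ w → cy ^ suc w * withOnes (suc w) (suc N)))
        ≈⟨ *-congˡ (+-cong part₀ part₊) ⟩
      PC * (B 0 + B 0 * ⨁ N (λ w → a (suc w) * (cy * q ^ 1) ^ suc w))
        ≈⟨ *-congˡ (trans (solve 3 (λ b s u → b :+ b :* s := b :* (con (+ 1) :* con (+ 1) :* con (+ 1) :+ s)) refl (B 0) _ 1#) (*-congˡ (sym (⨁-head N (λ w → a w * (cy * q ^ 1) ^ w))))) ⟩
      PC * (B 0 * ⨁ (suc N) (λ w → a w * (cy * q ^ 1) ^ w))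
        ≈⟨ solve 3 (λ p b s → p :* (b :* s) := b :* (p :* s)) refl PC (B 0) _ ⟩
      B 0 * (PC * ⨁ (suc N) (λ w → a w * (cy * q ^ 1) ^ w))
        ≈⟨ *-congˡ (q-binomial a (cx * q) (*-identityˡ 1#) a-suc cy L N≤L) ⟩
      B 0 * ∏ L (λ k → 1# - cx * q * (cy * q ^ suc k))
        ≈⟨ *-congˡ (∏-cong L (λ k → +-congˡ (-‿cong (trans (solve 4 (λ c q d u → c :* q :* (d :* u) := (c :* d) :* (q :* u)) refl cx q cy (q ^ suc k)) (trans (*-congʳ cx*cy) (*-identityˡ _)))))) ⟩
      B 0 * ∏ L (B ∘ suc)
        ≈⟨ ∏-head L B ⟨
      poch (suc L)
        ≈⟨ poch-stable (ℕₚ.m≤n⇒m≤1+n N≤L) N≤L ⟩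
      poch L ∎
      where
      PA = ∏ (suc N) A
      PC = ∏ L (λ k → 1# - cy * q ^ suc k)
      part₀ : PA * (noOnes-largest (suc N) - q ^ 1 + cx * q ^ 1) ≈ B 0
      part₀ = begin
        PA * (noOnes-largest (suc N) - q ^ 1 + cx * q ^ 1)  ≈⟨ *-congˡ (noOnes-largest-sum N) ⟩
        PA * (B 0 * (e (suc N) + ⨁ (suc N) e))              ≈⟨ *-congˡ (*-congˡ (trans (+-congʳ e-last) (+-identityˡ _))) ⟩
        PA * (B 0 * ⨁ (suc N) e)                            ≈⟨ solve 3 (λ p b s → p :* (b :* s) := b :* (p :* s)) refl PA (B 0) _ ⟩
        B 0 * (PA * ⨁ (suc N) e)                            ≈⟨ *-congˡ euler ⟩
        B 0 * 1#                                            ≈⟨ *-identityʳ _ ⟩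
        B 0                                                 ∎
      part₊ : PA * ⨁ N (λ w → cy ^ suc w * withOnes (suc w) (suc N)) ≈ B 0 * ⨁ N (λ w → a (suc w) * (cy * q ^ 1) ^ suc w)
      part₊ = go N ℕₚ.≤-refl
        where
        go : ∀ n → n ≤ N → PA * ⨁ n (λ w → cy ^ suc w * withOnes (suc w) (suc N)) ≈ B 0 * ⨁ n (λ w → a (suc w) * (cy * q ^ 1) ^ suc w)
        go zero    _   = trans (zeroʳ PA) (sym (zeroʳ (B 0)))
        go (suc n) n<N = begin
          PA * (cy ^ suc n * Z + s)              ≈⟨ solve 4 (λ p c z s → p :* (c :* z :+ s) := c :* (p :* z) :+ p :* s) refl PA (cy ^ suc n) Z s ⟩
          cy ^ suc n * (PA * Z) + PA * s         ≈⟨ +-cong (*-congˡ (withOnes-A n (ℕₚ.m≤n⇒m≤1+n n<N))) (go n (ℕₚ.<⇒≤ n<N)) ⟩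
          cy ^ suc n * (B 0 * (a (suc n) * q ^ suc n)) + B 0 * t
                                                 ≈⟨ solve 5 (λ c b a q t → c :* (b :* (a :* q)) :+ b :* t := b :* (a :* (c :* q) :+ t)) refl (cy ^ suc n) (B 0) (a (suc n)) (q ^ suc n) t ⟩
          B 0 * (a (suc n) * (cy ^ suc n * q ^ suc n) + t)
                                                 ≈⟨ *-congˡ (+-congʳ (*-congˡ (trans (sym (^-distrib-* cy q (suc n))) (^-congˡ (suc n) (*-congˡ (sym (*-identityʳ q))))))) ⟩
          B 0 * (a (suc n) * (cy * q ^ 1) ^ suc n + t) ∎
          where
          Z = withOnes (suc n) (suc N)
          s = ⨁ n (λ w → cy ^ suc w * withOnes (suc w) (suc N))
          t = ⨁ n (λ w → a (suc w) * (cy * q ^ 1) ^ suc w)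

open CrankFunctionalEquations

-- The crank generating function as a product.

module CrankProductFormula where
  open import Defs using (partitions; crank; crankFrom; largestPart; ω; μ; ∈-partitions⁻)
  open BoundedPartitions
  open import Data.Bool using (if_then_else_; true; false)
  open import Data.Nat using (_≟_; _<?_)
  open import Function using (_∘_)
  open import Relation.Binary.PropositionalEquality using (_≢_)

  module CrankProduct (R : CommutativeRing 0ℓ 0ℓ) (x x⁻¹ : CommutativeRing.Carrier R) (x*x⁻¹≈1 : Inverses R x x⁻¹) (N : ℕ) where
    open CommutativeRing R
    open ListSum R
    open CrankSeries R x x⁻¹
    open GeneratingFunctions N x*x⁻¹≈1
    open PowerSeries R
    open Truncated N
    open Monomials R
    open IntegerCoefficients R
    open import Relation.Binary.Reasoning.Setoid setoid

    x^ℤ-⊖ : ∀ m n → x^ℤ (m ⊖ n) ≈ x ^ m * x⁻¹ ^ n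
    x^ℤ-⊖ m       zero    = sym (*-identityʳ _)
    x^ℤ-⊖ zero    (suc n) = sym (*-identityˡ _)
    x^ℤ-⊖ (suc m) (suc n) = begin
      x^ℤ (suc m ⊖ suc n)            ≡⟨ ≡.cong x^ℤ (ℤₚ.[1+m]⊖[1+n]≡m⊖n m n) ⟩
      x^ℤ (m ⊖ n)                    ≈⟨ x^ℤ-⊖ m n ⟩
      x ^ m * x⁻¹ ^ n                ≈⟨ trans (*-congʳ x*x⁻¹≈1) (*-identityˡ _) ⟨
      x * x⁻¹ * (x ^ m * x⁻¹ ^ n)    ≈⟨ solve 4 (λ x y a b → x :* y :* (a :* b) := (x :* a) :* (y :* b)) refl x x⁻¹ (x ^ m) (x⁻¹ ^ n) ⟩
      x ^ suc m * x⁻¹ ^ suc n        ∎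

    ⨁-zero : ∀ n {f} → (∀ w → f w ≈ 0#) → ⨁ n f ≈ 0#
    ⨁-zero zero    f≈0 = refl
    ⨁-zero (suc n) f≈0 = trans (+-cong (f≈0 n) (⨁-zero n f≈0)) (+-identityˡ 0#)

    ⨁-single : ∀ n {f} w → w < n → (∀ v → v ≢ w → f v ≈ 0#) → ⨁ n f ≈ f w
    ⨁-single (suc n) {f} w w<n f≈0 with n ≟ w
    ... | yes ≡.refl = trans (+-congˡ (below n ℕₚ.≤-refl)) (+-identityʳ _)
      where
      below : ∀ m → m ≤ n → ⨁ m f ≈ 0#
      below zero    _   = refl
      below (suc m) m<n = trans (+-cong (f≈0 m (ℕₚ.<⇒≢ m<n)) (below m (ℕₚ.<⇒≤ m<n))) (+-identityˡ 0#)
    ... | no n≢w = trans (+-cong (f≈0 n n≢w) (⨁-single n w (ℕₚ.≤∧≢⇒< (ℕₚ.≤-pred w<n) (n≢w ∘ ≡.sym)) f≈0)) (+-identityˡ _)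

    -- Exactly one summand survives, the one for the actual number of ones, and there `larger`
    -- agrees with `μ`. The bound N ensures that this number occurs in the sum.
    crank-by-ones : ∀ ps → ω ps ≤ N → x^ℤ (crank ps) ≈
      if0 (ω ps ≟ 0) (x ^ largestPart ps) + ⨁ N (λ w → x⁻¹ ^ suc w * if0 (ω ps ≟ suc w) (x ^ larger (suc w) ps))
    crank-by-ones ps ω≤N = go (ω ps) ≡.refl ω≤N
      where
      go : ∀ w → ω ps ≡ w → w ≤ N → x^ℤ (crankFrom (largestPart ps) (ω ps) (μ ps)) ≈
           if0 (ω ps ≟ 0) (x ^ largestPart ps) + ⨁ N (λ w → x⁻¹ ^ suc w * if0 (ω ps ≟ suc w) (x ^ larger (suc w) ps))
      go zero e _ = trans (reflexive (≡.cong (λ w → x^ℤ (crankFrom (largestPart ps) w (μ ps))) e))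
        (trans (sym (+-identityʳ _)) (+-cong (reflexive (≡.cong (λ w → if0 (w ≟ 0) (x ^ largestPart ps)) (≡.sym e)))
          (sym (⨁-zero N (λ w → trans (*-congˡ (reflexive (≡.cong (λ v → if0 (v ≟ suc w) (x ^ larger (suc w) ps)) e))) (zeroʳ _))))))
      go (suc w) e w<N = begin
        x^ℤ (crankFrom (largestPart ps) (ω ps) (larger (ω ps) ps))  ≡⟨ ≡.cong (λ v → x^ℤ (crankFrom (largestPart ps) v (larger v ps))) e ⟩
        x^ℤ (larger (suc w) ps ⊖ suc w)                             ≈⟨ trans (x^ℤ-⊖ (larger (suc w) ps) (suc w)) (*-comm _ _) ⟩
        x⁻¹ ^ suc w * x ^ larger (suc w) ps                         ≈⟨ *-congˡ (reflexive (here (suc w ≟ suc w))) ⟨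
        x⁻¹ ^ suc w * if0 (suc w ≟ suc w) (x ^ larger (suc w) ps)   ≈⟨ ⨁-single N w w<N off ⟨
        ⨁ N (λ v → x⁻¹ ^ suc v * if0 (suc w ≟ suc v) (x ^ larger (suc v) ps))
                                                                    ≈⟨ +-identityˡ _ ⟨
        0# + ⨁ N (λ v → x⁻¹ ^ suc v * if0 (suc w ≟ suc v) (x ^ larger (suc v) ps))
                                                                    ≡⟨ ≡.cong (λ u → if0 (u ≟ 0) (x ^ largestPart ps) + ⨁ N (λ v → x⁻¹ ^ suc v * if0 (u ≟ suc v) (x ^ larger (suc v) ps))) e ⟨
        if0 (ω ps ≟ 0) (x ^ largestPart ps) + ⨁ N (λ v → x⁻¹ ^ suc v * if0 (ω ps ≟ suc v) (x ^ larger (suc v) ps)) ∎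
        where
        here : (d : Dec (suc w ≡ suc w)) → if0 d (x ^ larger (suc w) ps) ≡ x ^ larger (suc w) ps
        here (yes _)  = ≡.refl
        here (no w≢w) = contradiction ≡.refl w≢w
        off : ∀ v → v ≢ w → x⁻¹ ^ suc v * if0 (suc w ≟ suc v) (x ^ larger (suc v) ps) ≈ 0#
        off v v≢w = trans (*-congˡ (reflexive (lemma (suc w ≟ suc v)))) (zeroʳ _)
          where
          lemma : (d : Dec (suc w ≡ suc v)) → if0 d (x ^ larger (suc v) ps) ≡ 0#
          lemma (yes e) = contradiction (≡.sym (ℕₚ.suc-injective e)) v≢w
          lemma (no _)  = ≡.refl

    private
      module Sᴺ = CommutativeRing (truncated N)
      module M = Monomials (truncated N)

    const-^ : ∀ c n → const (c ^ n) Sᴺ.≈ const c ^ˢ n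
    const-^ c zero    = Sᴺ.refl
    const-^ c (suc n) = Sᴺ.trans (const-* c (c ^ n)) (Sᴺ.*-congˡ {const c} (const-^ c n))

    crank-sums : ∀ n → n ≤ N → ∑ (partitions n) (λ ps → x^ℤ (crank ps)) ≈
                 noOnes-largest (suc N) n + ⨁ N (λ w → x⁻¹ ^ suc w * withOnes (suc w) (suc N) n)
    crank-sums n n≤N = begin
      ∑ (partitions n) (λ ps → x^ℤ (crank ps))
        ≈⟨ ∑-cong∈ (partitions n) (λ ps ps∈ → crank-by-ones ps (ℕₚ.≤-trans (ω-bound (∈-partitions⁻ n ps∈)) n≤N)) ⟩
      ∑ (partitions n) (λ ps → Φ₀ ps + ⨁ N (λ w → x⁻¹ ^ suc w * Φ w ps))
        ≈⟨ ∑-+ (partitions n) Φ₀ _ ⟩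
      ∑ (partitions n) Φ₀ + ∑ (partitions n) (λ ps → ⨁ N (λ w → x⁻¹ ^ suc w * Φ w ps))
        ≈⟨ +-cong (∑-↭ Φ₀ full) (trans (⨁-cong N (λ w → *-congˡ (∑-↭ (Φ w) full))) (exchange N)) ⟨
      noOnes-largest (suc N) n + ⨁ N (λ w → x⁻¹ ^ suc w * withOnes (suc w) (suc N) n) ∎
      where
      Φ₀ : List ℕ → Carrier
      Φ₀ ps = if0 (ω ps ≟ 0) (x ^ largestPart ps)
      Φ : ℕ → List ℕ → Carrier
      Φ w ps = if0 (ω ps ≟ suc w) (x ^ larger (suc w) ps)
      full = bounded-all (suc N) n (ℕₚ.m≤n⇒m≤1+n n≤N)
      exchange : ∀ m → ⨁ m (λ w → x⁻¹ ^ suc w * ∑ (partitions n) (Φ w)) ≈ ∑ (partitions n) (λ ps → ⨁ m (λ w → x⁻¹ ^ suc w * Φ w ps))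
      exchange zero    = sym (∑-zero (partitions n) (λ _ → refl))
      exchange (suc m) = trans (+-cong (sym (∑-*ˡ (partitions n) (x⁻¹ ^ suc m) (Φ m))) (exchange m)) (sym (∑-+ (partitions n) _ _))

    private
      lift : ∀ {Z Z′ W : PS} {D : PS} c k → const c Sᴺ.≈ D → (∀ n → Z n ≈ Z′ n + c * ((X ^ˢ k) ⊛ W) n) → Z Sᴺ.≈ Z′ Sᴺ.+ D Sᴺ.* X ^ˢ k Sᴺ.* W
      lift {Z} {Z′} {W} {D} c k c≈D e n n≤N = trans (e n) (+-congˡ (trans (sym (const-⊛ c ((X ^ˢ k) ⊛ W) n))
        (trans (sym (⊛-assoc (const c) (X ^ˢ k) W n)) (Sᴺ.*-congʳ {W} {const c ⊛ (X ^ˢ k)} {D ⊛ (X ^ˢ k)} (Sᴺ.*-congʳ {X ^ˢ k} {const c} {D} c≈D) n n≤N))))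

      const-weight : ∀ w p → const (larger-weight w p) Sᴺ.≈ (if does (w <? p) then const x else Sᴺ.1#)
      const-weight w p = lemma (does (w <? p))
        where
        lemma : ∀ b → const (if b then x else 1#) Sᴺ.≈ (if b then const x else Sᴺ.1#)
        lemma true  = Sᴺ.refl
        lemma false = Sᴺ.refl

      recurrences : CrankRecurrences (truncated N) X (const x)
      recurrences = record
        { withOnes = withOnes
        ; noOnes = noOnes
        ; noOnes-largest = noOnes-largest
        ; withOnes-suc = λ w k → lift (larger-weight w (2 ℕ.+ k)) (2 ℕ.+ k) (const-weight w (2 ℕ.+ k)) (withOnes-suc w k)
        ; withOnes-1 = λ w n _ → withOnes-1 w n
        ; noOnes-suc = λ k n n≤N → trans (noOnes-suc k n) (+-congˡ (*-identityˡ _))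
        ; noOnes-1 = λ n _ → noOnes-1 n
        ; noOnes-largest-suc = λ k → lift (x ^ (2 ℕ.+ k)) (2 ℕ.+ k) (const-^ x (2 ℕ.+ k)) (noOnes-largest-suc k)
        ; noOnes-largest-1 = λ n _ → noOnes-largest-1 n }

    module Algebra = CrankAlgebra (truncated N) X N X-nilpotent (const x) (const x⁻¹)
      (Sᴺ.trans {const x ⊛ const x⁻¹} (Sᴺ.sym {const (x * x⁻¹)} (const-* x x⁻¹)) (const-cong x*x⁻¹≈1)) recurrences

    ⨁-coefficient : ∀ m n → n ≤ N → M.⨁ m (λ w → const x⁻¹ ^ˢ suc w ⊛ withOnes (suc w) (suc N)) n ≈ ⨁ m (λ w → x⁻¹ ^ suc w * withOnes (suc w) (suc N) n)
    ⨁-coefficient zero    n n≤N = refl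
    ⨁-coefficient (suc m) n n≤N = +-cong
      (trans (Sᴺ.*-congʳ {withOnes (suc m) (suc N)} {const x⁻¹ ^ˢ suc m} {const (x⁻¹ ^ suc m)} (Sᴺ.sym {const (x⁻¹ ^ suc m)} (const-^ x⁻¹ (suc m))) n n≤N) (const-⊛ (x⁻¹ ^ suc m) (withOnes (suc m) (suc N)) n))
      (⨁-coefficient m n n≤N)

    X^1 : ∀ n → (X ^ˢ 1) n ≈ X n
    X^1 n = trans (⊛-comm X (const 1#) n) (⊛-identityˡ X n)

    crankSum≈crankSeries : Algebra.crankSum Sᴺ.≈ crankSeries
    crankSum≈crankSeries n n≤N = begin
      noOnes-largest (suc N) n - (X ^ˢ 1) n + (const x ⊛ X ^ˢ 1) n + M.⨁ N (λ w → const x⁻¹ ^ˢ suc w ⊛ withOnes (suc w) (suc N)) n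
        ≈⟨ +-cong (+-cong (+-congˡ (-‿cong (X^1 n))) (trans (const-⊛ x (X ^ˢ 1) n) (*-congˡ (X^1 n)))) (⨁-coefficient N n n≤N) ⟩
      noOnes-largest (suc N) n - X n + x * X n + ⨁ N (λ w → x⁻¹ ^ suc w * withOnes (suc w) (suc N) n)
        ≈⟨ solve 4 (λ a b c d → a :- b :+ c :+ d := (a :+ d) :- b :+ c) refl _ _ _ _ ⟩
      (noOnes-largest (suc N) n + ⨁ N (λ w → x⁻¹ ^ suc w * withOnes (suc w) (suc N) n)) - X n + x * X n
        ≈⟨ +-congʳ (+-congʳ (crank-sums n n≤N)) ⟨
      ∑ (partitions n) (λ ps → x^ℤ (crank ps)) - X n + x * X n
        ≈⟨ small n ⟩
      crankSeries n ∎
      where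
      small : ∀ n → ∑ (partitions n) (λ ps → x^ℤ (crank ps)) - X n + x * X n ≈ crankSeries n
      small 0 = solve 1 (λ x → (con (+ 1) :+ con (+ 0)) :- con (+ 0) :+ x :* con (+ 0) := con (+ 1)) refl x
      -- The only partition of 1 has crank -1 and contributes x⁻¹; the corrections - q and + x q
      -- complete this to x + x⁻¹ - 1.
      small 1 = solve 2 (λ x y → (y :* con (+ 1) :+ con (+ 0)) :- con (+ 1) :+ x :* con (+ 1) := x :+ y :- con (+ 1)) refl x x⁻¹
      small (suc (suc n)) = solve 2 (λ s x → s :- con (+ 0) :+ x :* con (+ 0) := s) refl _ x

    crank-product : ∀ L → N ≤ L →
      M.∏ L (λ k → Sᴺ.1# Sᴺ.- const x ⊛ X ^ˢ suc k) ⊛ M.∏ L (λ k → Sᴺ.1# Sᴺ.- const x⁻¹ ⊛ X ^ˢ suc k) ⊛ crankSeries Sᴺ.≈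
      M.∏ L (λ k → Sᴺ.1# Sᴺ.- X ^ˢ suc k)
    crank-product L N≤L = Sᴺ.trans {P ⊛ crankSeries} {P ⊛ Algebra.crankSum} (Sᴺ.*-congˡ {P} {crankSeries} {Algebra.crankSum} (Sᴺ.sym {Algebra.crankSum} {crankSeries} crankSum≈crankSeries)) (Algebra.crankSum-product L N≤L)
      where
      P = M.∏ L (λ k → Sᴺ.1# Sᴺ.- const x ⊛ X ^ˢ suc k) ⊛ M.∏ L (λ k → Sᴺ.1# Sᴺ.- const x⁻¹ ⊛ X ^ˢ suc k)

open CrankProductFormula

-- Exponents of the theta series in residue classes modulo 11.

module ThetaExponents where
  open import Data.Integer.Solver renaming (module +-*-Solver to ℤ-Solver)
  open import Data.Fin using (Fin; suc; toℕ)
  open import Data.Fin.Patterns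
  import Data.Fin.Properties as Finₚ

  open ℤ-Solver using (Polynomial) renaming (_:+_ to infixl 6 _+ᴾ_; _:*_ to infixl 7 _*ᴾ_; _:-_ to infixl 6 _-ᴾ_; :-_ to infix 8 -ᴾ_; _:=_ to infix 4 _=ᴾ_; con to #ᴾ)

  -- The offsets used are o = 10 for A and o = 3 for B. They place at c = 5 the class containing,
  -- modulo 11, the centre of symmetry of the exponent: 1/2 ≡ 6 for 3 j (j - 1) / 2 and 1/6 ≡ 2 for
  -- (3 j² - j) / 2.
  inClass : ℕ → Fin 11 → ℤ → ℤ
  inClass o c j = joinResidue 11 (c , j) ℤ.- + o

  inClassᴾ : ℕ → Fin 11 → ∀ {n} → Polynomial n → Polynomial n
  inClassᴾ o c j = #ᴾ (+ toℕ c) +ᴾ j *ᴾ #ᴾ (+ 11) -ᴾ #ᴾ (+ o)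

  -- Outside the window |j| ≥ 1, and |o - c| ≤ 10, so |c + 11 j - o| ≥ 11 |j| - 10 ≥ |j|.
  inClass-far : ∀ {N} o c j → o ≤ 10 → N ℕ.+ 4 < ∣ j ∣ → N ℕ.+ 4 < ∣ inClass o c j ∣
  inClass-far {N} o c j o≤10 N<j with suc (N ℕ.+ 4) ℕ.≤? ∣ inClass o c j ∣
  ... | yes far = far
  ... | no near = contradiction (begin-strict
    N ℕ.+ 4 ℕ.+ 10                              <⟨ ℕₚ.+-monoˡ-< 10 N<j ⟩
    ∣ j ∣ ℕ.+ 10                                ≤⟨ ℕₚ.+-monoʳ-≤ ∣ j ∣ (ℕₚ.*-mono-≤ {10} ℕₚ.≤-refl (ℕₚ.≤-trans (s≤s z≤n) N<j)) ⟩
    11 ℕ.* ∣ j ∣                                ≡⟨ ≡.trans (ℕₚ.*-comm 11 ∣ j ∣) (≡.sym (ℤₚ.abs-* j (+ 11))) ⟩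
    ∣ j ℤ.* + 11 ∣                              ≡⟨ ≡.cong ∣_∣ (ℤ-Solver.solve 3 (λ j c o → j *ᴾ #ᴾ (+ 11) =ᴾ (c +ᴾ j *ᴾ #ᴾ (+ 11) -ᴾ o) +ᴾ (o -ᴾ c)) ≡.refl j (+ toℕ c) (+ o)) ⟩
    ∣ inClass o c j ℤ.+ (+ o ℤ.- + toℕ c) ∣     ≤⟨ ℤₚ.∣i+j∣≤∣i∣+∣j∣ (inClass o c j) (+ o ℤ.- + toℕ c) ⟩
    ∣ inClass o c j ∣ ℕ.+ ∣ + o ℤ.- + toℕ c ∣   ≤⟨ ℕₚ.+-mono-≤ (ℕₚ.≤-pred (ℕₚ.≰⇒> near)) (ℕₚ.≤-trans (ℕₚ.≤-reflexive (≡.cong ∣_∣ (ℤₚ.m-n≡m⊖n o (toℕ c))))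
                                                    (ℕₚ.≤-trans (ℤₚ.∣m⊝n∣≤m⊔n o (toℕ c)) (ℕₚ.⊔-lub o≤10 (ℕₚ.≤-pred (Finₚ.toℕ<n c))))) ⟩
    N ℕ.+ 4 ℕ.+ 10                              ∎) (ℕₚ.<-irrefl ≡.refl)
    where open ℕₚ.≤-Reasoning

  class-inverseˡ : ∀ o p → splitResidue 11 (inClass o (proj₁ p) (proj₂ p) ℤ.+ + o) ≡ p
  class-inverseˡ o p = ≡.trans (≡.cong (splitResidue 11) (ℤ-Solver.solve 2 (λ x o → (x -ᴾ o) +ᴾ o =ᴾ x) ≡.refl (joinResidue 11 p) (+ o))) (split-join 11 p)

  class-inverseʳ : ∀ o i → let c , j = splitResidue 11 (i ℤ.+ + o) in inClass o c j ≡ i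
  class-inverseʳ o i = ≡.trans (≡.cong (ℤ._- + o) (join-split 11 (i ℤ.+ + o))) (ℤ-Solver.solve 2 (λ i o → (i +ᴾ o) -ᴾ o =ᴾ i) ≡.refl i (+ o))

  A-exp B-exp : ℤ → ℕ
  A-exp j = 3 ℕ.* tri j
  B-exp j = tri j ℕ.+ sq j

  -- The exponents of y after the substitution v = y, w = y⁹ q, which solves v² w = q when y¹¹ = 1.
  -- In the third one j is replaced by - j, so that both halves of B carry the same power `B-exp j`
  -- of q.
  Aʸ-exp B₁ʸ-exp B₂ʸ-exp : ℤ → ℕ
  Aʸ-exp  j = 3 ℕ.* sq j ℕ.+ 9 ℕ.* (3 ℕ.* tri j)
  B₁ʸ-exp j = sq j ℕ.+ 4 ℕ.* tri (+ 1 ℤ.+ j) ℕ.+ 9 ℕ.* (tri j ℕ.+ sq j)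
  B₂ʸ-exp j = sq (+ 1 ℤ.+ ℤ.- j) ℕ.+ 4 ℕ.* tri (+ 1 ℤ.+ ℤ.- j) ℕ.+ 9 ℕ.* (tri (+ 1 ℤ.+ ℤ.- j) ℕ.+ sq (ℤ.- j))

  -- residues of 3 j, 3 j and 1 - 3 j modulo 11 for j in class c
  Aʸ-residue B₁ʸ-residue B₂ʸ-residue : Fin 11 → ℕ
  Aʸ-residue  c = Vec.lookup (3 ∷ 6 ∷ 9 ∷ 1 ∷ 4 ∷ 7 ∷ 10 ∷ 2 ∷ 5 ∷ 8 ∷ 0 ∷ []) c
  B₁ʸ-residue c = Vec.lookup (2 ∷ 5 ∷ 8 ∷ 0 ∷ 3 ∷ 6 ∷ 9 ∷ 1 ∷ 4 ∷ 7 ∷ 10 ∷ []) c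
  B₂ʸ-residue c = Vec.lookup (10 ∷ 7 ∷ 4 ∷ 1 ∷ 9 ∷ 6 ∷ 3 ∷ 0 ∷ 8 ∷ 5 ∷ 2 ∷ []) c

  -- Constants that turn the congruences modulo 11 into equalities of natural numbers, with
  -- multiples of 11 added on both sides in place of subtractions.
  Aʸ-offset B₁ʸ-offset B₂ʸ-offset : Fin 11 → ℕ
  Aʸ-offset  c = Vec.lookup (3 ∷ 3 ∷ 3 ∷ 2 ∷ 2 ∷ 2 ∷ 2 ∷ 1 ∷ 1 ∷ 1 ∷ 0 ∷ []) c
  B₁ʸ-offset c = Vec.lookup (0 ∷ 0 ∷ 0 ∷ 1 ∷ 1 ∷ 1 ∷ 1 ∷ 2 ∷ 2 ∷ 2 ∷ 2 ∷ []) c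
  B₂ʸ-offset c = Vec.lookup (2 ∷ 2 ∷ 2 ∷ 2 ∷ 1 ∷ 1 ∷ 1 ∷ 1 ∷ 0 ∷ 0 ∷ 0 ∷ []) c

  module _ (c : Fin 11) where
    Aʸ-identity B₁ʸ-identity B₂ʸ-identity : Polynomial 1 → Exponent 1 × Exponent 1
    Aʸ-identity j = 3 ⊗ □ J ⊕ 9 ⊗ (3 ⊗ △ J) ⊕ 11 ⊗ (3 ⊗ △ j ⊕ ♯ (Aʸ-offset c)) ≐ ♯ (Aʸ-residue c) ⊕ 11 ⊗ (3 ⊗ △ J ⊕ 3 ⊗ △ (#ᴾ (+ 1) +ᴾ j))
      where J = inClassᴾ 10 c j
    B₁ʸ-identity j = □ J ⊕ 4 ⊗ △ (#ᴾ (+ 1) +ᴾ J) ⊕ 9 ⊗ (△ J ⊕ □ J) ⊕ 11 ⊗ (3 ⊗ △ j ⊕ ♯ 1) ≐ ♯ (B₁ʸ-residue c) ⊕ 11 ⊗ (△ J ⊕ □ J ⊕ 3 ⊗ △ (#ᴾ (+ 1) +ᴾ j) ⊕ ♯ (B₁ʸ-offset c))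
      where J = inClassᴾ 3 c j
    B₂ʸ-identity j = □ (#ᴾ (+ 1) +ᴾ -ᴾ J) ⊕ 4 ⊗ △ (#ᴾ (+ 1) +ᴾ -ᴾ J) ⊕ 9 ⊗ (△ (#ᴾ (+ 1) +ᴾ -ᴾ J) ⊕ □ (-ᴾ J)) ⊕ 11 ⊗ (3 ⊗ △ (#ᴾ (+ 1) +ᴾ j) ⊕ ♯ 2)
                     ≐ ♯ (B₂ʸ-residue c) ⊕ 11 ⊗ (△ J ⊕ □ J ⊕ 3 ⊗ △ j ⊕ ♯ (B₂ʸ-offset c))
      where J = inClassᴾ 3 c j

  Aʸ-mod : ∀ c j → Aʸ-exp (inClass 10 c j) ℕ.+ 11 ℕ.* (3 ℕ.* tri j ℕ.+ Aʸ-offset c) ≡ Aʸ-residue c ℕ.+ 11 ℕ.* (3 ℕ.* tri (inClass 10 c j) ℕ.+ 3 ℕ.* tri (+ 1 ℤ.+ j))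
  Aʸ-mod 0F = exponents 1 (Aʸ-identity 0F) ≡.refl
  Aʸ-mod 1F = exponents 1 (Aʸ-identity 1F) ≡.refl
  Aʸ-mod 2F = exponents 1 (Aʸ-identity 2F) ≡.refl
  Aʸ-mod 3F = exponents 1 (Aʸ-identity 3F) ≡.refl
  Aʸ-mod 4F = exponents 1 (Aʸ-identity 4F) ≡.refl
  Aʸ-mod 5F = exponents 1 (Aʸ-identity 5F) ≡.refl
  Aʸ-mod 6F = exponents 1 (Aʸ-identity 6F) ≡.refl
  Aʸ-mod 7F = exponents 1 (Aʸ-identity 7F) ≡.refl
  Aʸ-mod 8F = exponents 1 (Aʸ-identity 8F) ≡.refl
  Aʸ-mod 9F = exponents 1 (Aʸ-identity 9F) ≡.refl
  Aʸ-mod (suc 9F) = exponents 1 (Aʸ-identity (suc 9F)) ≡.refl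

  B₁ʸ-mod : ∀ c j → B₁ʸ-exp (inClass 3 c j) ℕ.+ 11 ℕ.* (3 ℕ.* tri j ℕ.+ 1) ≡ B₁ʸ-residue c ℕ.+ 11 ℕ.* (tri (inClass 3 c j) ℕ.+ sq (inClass 3 c j) ℕ.+ 3 ℕ.* tri (+ 1 ℤ.+ j) ℕ.+ B₁ʸ-offset c)
  B₁ʸ-mod 0F = exponents 1 (B₁ʸ-identity 0F) ≡.refl
  B₁ʸ-mod 1F = exponents 1 (B₁ʸ-identity 1F) ≡.refl
  B₁ʸ-mod 2F = exponents 1 (B₁ʸ-identity 2F) ≡.refl
  B₁ʸ-mod 3F = exponents 1 (B₁ʸ-identity 3F) ≡.refl
  B₁ʸ-mod 4F = exponents 1 (B₁ʸ-identity 4F) ≡.refl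
  B₁ʸ-mod 5F = exponents 1 (B₁ʸ-identity 5F) ≡.refl
  B₁ʸ-mod 6F = exponents 1 (B₁ʸ-identity 6F) ≡.refl
  B₁ʸ-mod 7F = exponents 1 (B₁ʸ-identity 7F) ≡.refl
  B₁ʸ-mod 8F = exponents 1 (B₁ʸ-identity 8F) ≡.refl
  B₁ʸ-mod 9F = exponents 1 (B₁ʸ-identity 9F) ≡.refl
  B₁ʸ-mod (suc 9F) = exponents 1 (B₁ʸ-identity (suc 9F)) ≡.refl

  B₂ʸ-mod : ∀ c j → B₂ʸ-exp (inClass 3 c j) ℕ.+ 11 ℕ.* (3 ℕ.* tri (+ 1 ℤ.+ j) ℕ.+ 2) ≡ B₂ʸ-residue c ℕ.+ 11 ℕ.* (tri (inClass 3 c j) ℕ.+ sq (inClass 3 c j) ℕ.+ 3 ℕ.* tri j ℕ.+ B₂ʸ-offset c)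
  B₂ʸ-mod 0F = exponents 1 (B₂ʸ-identity 0F) ≡.refl
  B₂ʸ-mod 1F = exponents 1 (B₂ʸ-identity 1F) ≡.refl
  B₂ʸ-mod 2F = exponents 1 (B₂ʸ-identity 2F) ≡.refl
  B₂ʸ-mod 3F = exponents 1 (B₂ʸ-identity 3F) ≡.refl
  B₂ʸ-mod 4F = exponents 1 (B₂ʸ-identity 4F) ≡.refl
  B₂ʸ-mod 5F = exponents 1 (B₂ʸ-identity 5F) ≡.refl
  B₂ʸ-mod 6F = exponents 1 (B₂ʸ-identity 6F) ≡.refl
  B₂ʸ-mod 7F = exponents 1 (B₂ʸ-identity 7F) ≡.refl
  B₂ʸ-mod 8F = exponents 1 (B₂ʸ-identity 8F) ≡.refl
  B₂ʸ-mod 9F = exponents 1 (B₂ʸ-identity 9F) ≡.refl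
  B₂ʸ-mod (suc 9F) = exponents 1 (B₂ʸ-identity (suc 9F)) ≡.refl

  -- The index i : Fin 5 stands for i + 1 ∈ {1, …, 5}; the classes c = 5 ± (i + 1) carry the theta
  -- functions with v = q^vExp and w = q^wExp in base q^121.
  vExp wExp : Fin 5 → ℕ
  vExp i = 11 ℕ.* suc (toℕ i)
  wExp i = 11 ℕ.* (11 ℕ.∸ 2 ℕ.* suc (toℕ i))

  above below : Fin 5 → Fin 11
  above 0F = 6F
  above 1F = 7F
  above 2F = 8F
  above 3F = 9F
  above 4F = suc 9F
  below 0F = 4F
  below 1F = 3F
  below 2F = 2F
  below 3F = 1F
  below 4F = 0F

  -- The exponents at j = 0: of A in the class `above i`, and of B in the class `below i`. With i′ =
  -- i + 1 they are 3 j (j - 1) / 2 at j = i′ - 5, and (3 j² - j) / 2 at j = 2 - i′.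
  E-exp F-exp : Fin 5 → ℕ
  E-exp i = Vec.lookup (30 ∷ 18 ∷ 9 ∷ 3 ∷ 0 ∷ []) i
  F-exp i = Vec.lookup (1 ∷ 0 ∷ 2 ∷ 7 ∷ 15 ∷ []) i

  Aᵢ-exp B₁ᵢ-exp B₂ᵢ-exp : Fin 5 → ℤ → ℕ
  Aᵢ-exp  i j = vExp i ℕ.* (3 ℕ.* sq j) ℕ.+ wExp i ℕ.* (3 ℕ.* tri j)
  B₁ᵢ-exp i j = vExp i ℕ.* (sq j ℕ.+ 4 ℕ.* tri (+ 1 ℤ.+ j)) ℕ.+ wExp i ℕ.* (tri j ℕ.+ sq j)
  B₂ᵢ-exp i j = vExp i ℕ.* (sq (+ 1 ℤ.+ j) ℕ.+ 4 ℕ.* tri (+ 1 ℤ.+ j)) ℕ.+ wExp i ℕ.* (tri (+ 1 ℤ.+ j) ℕ.+ sq j)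

  module _ (i : Fin 5) where
    Aᵢ B₁ᵢ B₂ᵢ : Polynomial 1 → Exponent 1
    Aᵢ  j = vExp i ⊗ (3 ⊗ □ j) ⊕ wExp i ⊗ (3 ⊗ △ j)
    B₁ᵢ j = vExp i ⊗ (□ j ⊕ 4 ⊗ △ (#ᴾ (+ 1) +ᴾ j)) ⊕ wExp i ⊗ (△ j ⊕ □ j)
    B₂ᵢ j = vExp i ⊗ (□ (#ᴾ (+ 1) +ᴾ j) ⊕ 4 ⊗ △ (#ᴾ (+ 1) +ᴾ j)) ⊕ wExp i ⊗ (△ (#ᴾ (+ 1) +ᴾ j) ⊕ □ j)

    A-above-identity A-below-identity B-above-identity B-below-identity : Polynomial 1 → Exponent 1 × Exponent 1
    A-above-identity j = 3 ⊗ △ (inClassᴾ 10 (above i) j) ≐ ♯ (E-exp i) ⊕ Aᵢ j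
    A-below-identity j = 3 ⊗ △ (inClassᴾ 10 (below i) j) ≐ ♯ (E-exp i) ⊕ Aᵢ (#ᴾ (+ 1) +ᴾ -ᴾ j)
    B-above-identity j = △ (inClassᴾ 3 (above i) j) ⊕ □ (inClassᴾ 3 (above i) j) ≐ ♯ (F-exp i) ⊕ B₂ᵢ j
    B-below-identity j = △ (inClassᴾ 3 (below i) j) ⊕ □ (inClassᴾ 3 (below i) j) ≐ ♯ (F-exp i) ⊕ B₁ᵢ (-ᴾ j)

  A-above : ∀ i j → A-exp (inClass 10 (above i) j) ≡ E-exp i ℕ.+ Aᵢ-exp i j
  A-above 0F = exponents 1 (A-above-identity 0F) ≡.refl
  A-above 1F = exponents 1 (A-above-identity 1F) ≡.refl
  A-above 2F = exponents 1 (A-above-identity 2F) ≡.refl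
  A-above 3F = exponents 1 (A-above-identity 3F) ≡.refl
  A-above 4F = exponents 1 (A-above-identity 4F) ≡.refl

  -- The reflection j ↦ 1 - j preserves 3 j (j - 1) / 2 and exchanges the classes 5 - i′ and 5 + i′,
  -- where i′ = i + 1.
  A-below : ∀ i j → A-exp (inClass 10 (below i) j) ≡ E-exp i ℕ.+ Aᵢ-exp i (+ 1 ℤ.+ ℤ.- j)
  A-below 0F = exponents 1 (A-below-identity 0F) ≡.refl
  A-below 1F = exponents 1 (A-below-identity 1F) ≡.refl
  A-below 2F = exponents 1 (A-below-identity 2F) ≡.refl
  A-below 3F = exponents 1 (A-below-identity 3F) ≡.refl
  A-below 4F = exponents 1 (A-below-identity 4F) ≡.refl

  B-above : ∀ i j → B-exp (inClass 3 (above i) j) ≡ F-exp i ℕ.+ B₂ᵢ-exp i j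
  B-above 0F = exponents 1 (B-above-identity 0F) ≡.refl
  B-above 1F = exponents 1 (B-above-identity 1F) ≡.refl
  B-above 2F = exponents 1 (B-above-identity 2F) ≡.refl
  B-above 3F = exponents 1 (B-above-identity 3F) ≡.refl
  B-above 4F = exponents 1 (B-above-identity 4F) ≡.refl

  -- The classes on the two sides of c = 5 give the two halves of one and the same B in base q^121:
  -- the lower class its first half, reflected, the upper class its second half.
  B-below : ∀ i j → B-exp (inClass 3 (below i) j) ≡ F-exp i ℕ.+ B₁ᵢ-exp i (ℤ.- j)
  B-below 0F = exponents 1 (B-below-identity 0F) ≡.refl
  B-below 1F = exponents 1 (B-below-identity 1F) ≡.refl
  B-below 2F = exponents 1 (B-below-identity 2F) ≡.refl
  B-below 3F = exponents 1 (B-below-identity 3F) ≡.refl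
  B-below 4F = exponents 1 (B-below-identity 4F) ≡.refl

  A-middle : ∀ j → A-exp (inClass 10 5F j) ≡ A-exp (inClass 10 5F (+ 1 ℤ.+ ℤ.- j))
  A-middle = exponents 1 (λ j → 3 ⊗ △ (inClassᴾ 10 5F j) ≐ 3 ⊗ △ (inClassᴾ 10 5F (#ᴾ (+ 1) +ᴾ -ᴾ j))) ≡.refl

open ThetaExponents

-- Dissection of A and B at an eleventh root of unity.

module ThetaDissection where
  open import Data.Integer.Solver renaming (module +-*-Solver to ℤ-Solver)
  open import Data.Fin using (Fin; suc; toℕ)
  open import Data.Fin.Patterns
  open import Data.List using (allFin)
  open import Function using (_∘_)

  open ℤ-Solver using () renaming (_:+_ to infixl 6 _+ᴾ_; _:*_ to infixl 7 _*ᴾ_; _:-_ to infixl 6 _-ᴾ_; :-_ to infix 8 -ᴾ_; _:=_ to infix 4 _=ᴾ_; con to #ᴾ)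

  module Classes (S : CommutativeRing 0ℓ 0ℓ) (q : CommutativeRing.Carrier S) (N : ℕ) (q^≈0 : TruncatedAt S q N) (halve : NoTwoTorsion S) where
    open CommutativeRing S
    open Monomials S
    open IntegerCoefficients S
    open import Algebra.Properties.Ring ring using (-0#≈0#; -‿distribˡ-*)
    open import Relation.Binary.Reasoning.Setoid setoid
    open Nilpotent S q N q^≈0
    open ListSum S
    open Bilateral (N ℕ.+ 4)
    open Winquist S q N q^≈0 using (W; ∑ℤ-reflect)

    Far : (ℤ → ℕ) → Set
    Far p = ∀ j → N ℕ.+ 4 < ∣ j ∣ → N < p j

    signed : (ℤ → ℕ) → ℤ → Carrier
    signed p j = sgn j * q ^ p j

    signed-supported : ∀ {p} → Far p → Supported (signed p)
    signed-supported far j N<j = trans (*-congˡ (vanish (far j N<j))) (zeroʳ _)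

    A-exp-far : Far A-exp
    A-exp-far j N<j = ℕₚ.≤-trans (tri-far₀ j N<j) (ℕₚ.m≤m+n _ _)

    B-exp-far : Far B-exp
    B-exp-far j N<j = ℕₚ.≤-trans (tri-far₀ j N<j) (ℕₚ.m≤m+n _ _)

    class-far : ∀ {p o} c → o ≤ 10 → Far p → Far (p ∘ inClass o c)
    class-far {o = o} c o≤10 far j N<j = far (inClass o c j) (inClass-far o c j o≤10 N<j)

    ∑-signed-shift : ∀ E p → ∑ℤ (signed (λ j → E ℕ.+ p j)) ≈ q ^ E * ∑ℤ (signed p)
    ∑-signed-shift E p = trans (∑-cong W (λ j → trans (*-congˡ (^-homo-* q E (p j))) (solve 3 (λ s a b → s :* (a :* b) := a :* (s :* b)) refl _ _ _))) (∑-*ˡ W (q ^ E) (signed p))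

    ∑-signed-cong : ∀ {p p′} → (∀ j → p j ≡ p′ j) → ∑ℤ (signed p) ≈ ∑ℤ (signed p′)
    ∑-signed-cong e = ∑-cong W (λ j → *-congˡ (^-≡ q (e j)))

    -- j ↦ 1 - j changes the sign (-1)^j
    ∑-signed-flip : ∀ {p p′} → Far p → Far p′ → (∀ j → p j ≡ p′ (+ 1 ℤ.+ ℤ.- j)) → ∑ℤ (signed p) ≈ - ∑ℤ (signed p′)
    ∑-signed-flip {p} {p′} far far′ e = trans
      (∑ℤ-reindex (λ j → + 1 ℤ.+ ℤ.- j) (λ j → + 1 ℤ.+ ℤ.- j) inv inv (signed-supported far)
        (λ j N<j → trans (-‿cong (signed-supported far′ j N<j)) -0#≈0#)
        (λ j → trans (*-cong (flip j) (^-≡ q (e j))) (sym (-‿distribˡ-* _ _))))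
      (∑-neg W (signed p′))
      where
      inv : ∀ j → + 1 ℤ.+ ℤ.- (+ 1 ℤ.+ ℤ.- j) ≡ j
      inv j = ℤ-Solver.solve 1 (λ j → #ᴾ (+ 1) +ᴾ -ᴾ (#ᴾ (+ 1) +ᴾ -ᴾ j) =ᴾ j) ≡.refl j
      flip : ∀ j → sgn j ≈ - sgn (+ 1 ℤ.+ ℤ.- j)
      flip j = trans (trans (sym (sgn-neg j)) (sym (solve 1 (λ a → :- (:- a) := a) refl _))) (-‿cong (sym (sgn-suc (ℤ.- j))))

    Aᵢ-sum B₁ᵢ-sum B₂ᵢ-sum : Fin 5 → Carrier
    Aᵢ-sum  i = ∑ℤ (signed (Aᵢ-exp i))
    B₁ᵢ-sum i = ∑ℤ (signed (B₁ᵢ-exp i))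
    B₂ᵢ-sum i = ∑ℤ (signed (B₂ᵢ-exp i))

    Ω Ψ : Fin 11 → Carrier
    Ω c = ∑ℤ (signed (A-exp ∘ inClass 10 c))
    Ψ c = ∑ℤ (signed (B-exp ∘ inClass 3 c))

    10≤10 : 10 ≤ 10
    10≤10 = ℕₚ.≤-refl

    3≤10 : 3 ≤ 10
    3≤10 = s≤s (s≤s (s≤s z≤n))

    Ω-above : ∀ i → Ω (above i) ≈ q ^ E-exp i * Aᵢ-sum i
    Ω-above i = trans (∑-signed-cong (A-above i)) (∑-signed-shift (E-exp i) (Aᵢ-exp i))

    vExp-large : ∀ i {x} → x ≤ vExp i ℕ.* x
    vExp-large i {x} = ℕₚ.m≤m+n x _

    Aᵢ-far : ∀ i → Far (Aᵢ-exp i)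
    Aᵢ-far i j N<j = ℕₚ.≤-trans (sq-far₀ j N<j) (ℕₚ.≤-trans (ℕₚ.m≤m+n (sq j) _) (ℕₚ.≤-trans (vExp-large i) (ℕₚ.m≤m+n _ _)))

    B₁ᵢ-far : ∀ i → Far (B₁ᵢ-exp i)
    B₁ᵢ-far i j N<j = ℕₚ.≤-trans (sq-far₀ j N<j) (ℕₚ.≤-trans (ℕₚ.m≤m+n (sq j) _) (ℕₚ.≤-trans (vExp-large i) (ℕₚ.m≤m+n _ _)))

    Ω-below : ∀ i → Ω (below i) ≈ - (q ^ E-exp i * Aᵢ-sum i)
    Ω-below i = trans (∑-signed-flip {p′ = λ j → E-exp i ℕ.+ Aᵢ-exp i j} (class-far (below i) 10≤10 A-exp-far) (λ j N<j → ℕₚ.≤-trans (Aᵢ-far i j N<j) (ℕₚ.m≤n+m _ (E-exp i))) (A-below i))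
                      (-‿cong (∑-signed-shift (E-exp i) (Aᵢ-exp i)))

    -- This class is its own mirror image under j ↦ 1 - j, which reverses the sign (-1)^j. The sum
    -- equals its own negative, and absence of 2-torsion makes it 0.
    Ω-middle : Ω 5F ≈ 0#
    Ω-middle = halve (Ω 5F) (trans (+-congʳ (∑-signed-flip middle-far middle-far A-middle)) (-‿inverseˡ (Ω 5F)))
      where middle-far = class-far {o = 10} 5F 10≤10 A-exp-far

    Ψ-above : ∀ i → Ψ (above i) ≈ q ^ F-exp i * B₂ᵢ-sum i
    Ψ-above i = trans (∑-signed-cong (B-above i)) (∑-signed-shift (F-exp i) (B₂ᵢ-exp i))

    Ψ-below : ∀ i → Ψ (below i) ≈ q ^ F-exp i * B₁ᵢ-sum i
    Ψ-below i = trans (∑ℤ-reflect {signed (B-exp ∘ inClass 3 (below i))} {signed (λ j → F-exp i ℕ.+ B₁ᵢ-exp i j)} (signed-supported (class-far (below i) 3≤10 B-exp-far))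
        (signed-supported (λ j N<j → ℕₚ.≤-trans (B₁ᵢ-far i j N<j) (ℕₚ.m≤n+m _ (F-exp i)))) (λ j → *-cong (sym (sgn-neg j)) (^-≡ q (B-below i j))))
      (∑-signed-shift (F-exp i) (B₁ᵢ-exp i))

    module _ (y : Carrier) (y^11≈1 : y ^ 11 ≈ 1#) where

      y^-mod : ∀ e r u v → e ℕ.+ 11 ℕ.* u ≡ r ℕ.+ 11 ℕ.* v → y ^ e ≈ y ^ r
      y^-mod e r u v eq = trans (sym (period e u)) (trans (^-≡ y eq) (period r v))
        where
        period : ∀ e u → y ^ (e ℕ.+ 11 ℕ.* u) ≈ y ^ e
        period e u = trans (^-homo-* y e (11 ℕ.* u)) (trans (*-congˡ (trans (sym (^-assocʳ y 11 u)) (trans (^-congˡ u y^11≈1) (1^ u)))) (*-identityʳ _))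

      -- On a class modulo 11 the power of y is constant, and since 11 is odd the sign (-1)^(c + 11
      -- j - o) is (-1)^(c - o) (-1)^j; what remains is a series in q alone.
      class-sum : ∀ o → o ≤ 10 → (e p : ℤ → ℕ) → Far p → (r : Fin 11 → ℕ) → (∀ c j → y ^ e (inClass o c j) ≈ y ^ r c) →
                  ∑ℤ (λ j → sgn j * (y ^ e j * q ^ p j)) ≈ ∑ (allFin 11) (λ c → sgn (+ toℕ c ℤ.- + o) * y ^ r c * ∑ℤ (signed (p ∘ inClass o c)))
      class-sum o o≤10 e p far r e≡r = begin
        ∑ℤ f
          ≈⟨ ∑ℤ-residues (λ (c , j) → inClass o c j) (λ i → splitResidue 11 (i ℤ.+ + o)) (class-inverseˡ o) (class-inverseʳ o)
               {f} {λ c j → f (inClass o c j)} f-supported (λ c j N<j → f-supported (inClass o c j) (inClass-far o c j o≤10 N<j)) (λ c j → refl) ⟩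
        ∑ (allFin 11) (λ c → ∑ℤ (λ j → f (inClass o c j)))
          ≈⟨ ∑-cong (allFin 11) (λ c → trans (∑-cong W (step c)) (∑-*ˡ W (sgn (+ toℕ c ℤ.- + o) * y ^ r c) (signed (p ∘ inClass o c)))) ⟩
        ∑ (allFin 11) (λ c → sgn (+ toℕ c ℤ.- + o) * y ^ r c * ∑ℤ (signed (p ∘ inClass o c))) ∎
        where
        f : ℤ → Carrier
        f j = sgn j * (y ^ e j * q ^ p j)
        f-supported : Supported f
        f-supported j N<j = trans (*-congˡ (trans (*-congˡ (vanish (far j N<j))) (zeroʳ _))) (zeroʳ _)
        step : ∀ c j → f (inClass o c j) ≈ sgn (+ toℕ c ℤ.- + o) * y ^ r c * signed (p ∘ inClass o c) j
        step c j = begin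
          sgn (inClass o c j) * (y ^ e (inClass o c j) * q ^ p (inClass o c j))
            ≈⟨ *-cong (trans (sgn-parity (inClass o c j) ((+ toℕ c ℤ.- + o) ℤ.+ j) (+ 5 ℤ.* j)
                 (ℤ-Solver.solve 3 (λ c j o → (c +ᴾ j *ᴾ #ᴾ (+ 11)) -ᴾ o =ᴾ ((c -ᴾ o) +ᴾ j) +ᴾ (#ᴾ (+ 5) *ᴾ j +ᴾ #ᴾ (+ 5) *ᴾ j)) ≡.refl (+ toℕ c) j (+ o)))
                 (sgn-+ (+ toℕ c ℤ.- + o) j)) (*-congʳ (e≡r c j)) ⟩
          sgn (+ toℕ c ℤ.- + o) * sgn j * (y ^ r c * q ^ p (inClass o c j))
            ≈⟨ solve 4 (λ s t a b → s :* t :* (a :* b) := s :* a :* (t :* b)) refl _ _ _ _ ⟩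
          sgn (+ toℕ c ℤ.- + o) * y ^ r c * (sgn j * q ^ p (inClass o c j)) ∎

      -- The difference, with the sign of the classes, of the two powers of y that belong to the
      -- classes 5 + i′ and 5 - i′ with i′ = i + 1.
      α : Fin 5 → Carrier
      α 0F = y ^ 10 - y ^ 4
      α 1F = y ^ 1 - y ^ 2
      α 2F = y ^ 5 - y ^ 9
      α 3F = y ^ 6 - y ^ 8
      α 4F = 1# - y ^ 3

      module Dissected (w : Carrier) (w≈y⁹q : w ≈ y ^ 9 * q) (y²w≈q : y ^ 2 * w ≈ q) where
        open Winquist.OneVariable S q N q^≈0 y w y²w≈q using (A; B; B₁ᶠ; B₂ᶠ; gs; B₂-supported)

        in-q : ∀ k l → mon gs (k ∷ l ∷ []) ≈ y ^ (k ℕ.+ 9 ℕ.* l) * q ^ l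
        in-q k l = begin
          y ^ k * (w ^ l * 1#)              ≈⟨ *-congˡ (*-identityʳ _) ⟩
          y ^ k * w ^ l                     ≈⟨ *-congˡ (trans (^-congˡ l w≈y⁹q) (^-distrib-* (y ^ 9) q l)) ⟩
          y ^ k * ((y ^ 9) ^ l * q ^ l)     ≈⟨ *-congˡ (*-congʳ (^-assocʳ y 9 l)) ⟩
          y ^ k * (y ^ (9 ℕ.* l) * q ^ l)   ≈⟨ *-assoc _ _ _ ⟨
          y ^ k * y ^ (9 ℕ.* l) * q ^ l     ≈⟨ *-congʳ (^-homo-* y k (9 ℕ.* l)) ⟨
          y ^ (k ℕ.+ 9 ℕ.* l) * q ^ l       ∎

        G H : Fin 5 → Carrier
        G i = q ^ E-exp i * Aᵢ-sum i
        H i = q ^ F-exp i * (B₁ᵢ-sum i - B₂ᵢ-sum i)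

        Ω-value : Fin 11 → Carrier
        Ω-value 0F       = - G 4F
        Ω-value 1F       = - G 3F
        Ω-value 2F       = - G 2F
        Ω-value 3F       = - G 1F
        Ω-value 4F       = - G 0F
        Ω-value 5F       = 0#
        Ω-value 6F       = G 0F
        Ω-value 7F       = G 1F
        Ω-value 8F       = G 2F
        Ω-value 9F       = G 3F
        Ω-value (suc 9F) = G 4F

        Ω≈ : ∀ c → Ω c ≈ Ω-value c
        Ω≈ 0F       = Ω-below 4F
        Ω≈ 1F       = Ω-below 3F
        Ω≈ 2F       = Ω-below 2F
        Ω≈ 3F       = Ω-below 1F
        Ω≈ 4F       = Ω-below 0F
        Ω≈ 5F       = Ω-middle
        Ω≈ 6F       = Ω-above 0F
        Ω≈ 7F       = Ω-above 1F
        Ω≈ 8F       = Ω-above 2F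
        Ω≈ 9F       = Ω-above 3F
        Ω≈ (suc 9F) = Ω-above 4F

        A-dissection : A ≈ ∑ (allFin 5) (λ i → α i * G i)
        A-dissection = begin
          A
            ≈⟨ ∑-cong W (λ j → *-congˡ (in-q (3 ℕ.* sq j) (3 ℕ.* tri j))) ⟩
          ∑ℤ (λ j → sgn j * (y ^ Aʸ-exp j * q ^ A-exp j))
            ≈⟨ class-sum 10 10≤10 Aʸ-exp A-exp A-exp-far Aʸ-residue (λ c j → y^-mod (Aʸ-exp (inClass 10 c j)) (Aʸ-residue c) (3 ℕ.* tri j ℕ.+ Aʸ-offset c) (3 ℕ.* tri (inClass 10 c j) ℕ.+ 3 ℕ.* tri (+ 1 ℤ.+ j)) (Aʸ-mod c j)) ⟩
          ∑ (allFin 11) (λ c → sgn (+ toℕ c ℤ.- + 10) * y ^ Aʸ-residue c * Ω c)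
            ≈⟨ ∑-cong (allFin 11) (λ c → *-congˡ {sgn (+ toℕ c ℤ.- + 10) * y ^ Aʸ-residue c} (Ω≈ c)) ⟩
          ∑ (allFin 11) (λ c → sgn (+ toℕ c ℤ.- + 10) * y ^ Aʸ-residue c * Ω-value c)
            ≈⟨ solve 6 (λ y g₁ g₂ g₃ g₄ g₅ →
                 s 10 :* y :^ 3 :* (:- g₅) :+ (s 9 :* y :^ 6 :* (:- g₄) :+ (s 8 :* y :^ 9 :* (:- g₃) :+ (s 7 :* y :^ 1 :* (:- g₂) :+ (s 6 :* y :^ 4 :* (:- g₁) :+
                 (s 5 :* y :^ 7 :* con (+ 0) :+ (s 4 :* y :^ 10 :* g₁ :+ (s 3 :* y :^ 2 :* g₂ :+ (s 2 :* y :^ 5 :* g₃ :+ (s 1 :* y :^ 8 :* g₄ :+ (s 0 :* y :^ 0 :* g₅ :+ con (+ 0)))))))))))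
                 := (y :^ 10 :- y :^ 4) :* g₁ :+ ((y :^ 1 :- y :^ 2) :* g₂ :+ ((y :^ 5 :- y :^ 9) :* g₃ :+ ((y :^ 6 :- y :^ 8) :* g₄ :+ ((con (+ 1) :- y :^ 3) :* g₅ :+ con (+ 0))))))
                 refl y (G 0F) (G 1F) (G 2F) (G 3F) (G 4F) ⟩
          ∑ (allFin 5) (λ i → α i * G i) ∎
          where
          s : ∀ {n} → ℕ → Polynomial n
          s k = (:- con (+ 1)) :^ k

        -- The factor y makes the coefficients equal to those of A. This coincidence is what later
        -- turns the determinant into an antisymmetric expression. The two contributions of the
        -- middle class c = 5 have the same power y⁶ and cancel.
        B-dissection : y * B ≈ ∑ (allFin 5) (λ i → α i * H i)
        B-dissection = begin
          y * (∑ℤ (term gs B₁ᶠ) - ∑ℤ (term gs B₂ᶠ))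
            ≈⟨ *-congˡ (+-cong (trans (∑-cong W (λ j → *-congˡ (in-q (sq j ℕ.+ 4 ℕ.* tri (+ 1 ℤ.+ j)) (tri j ℕ.+ sq j))))
                                      (class-sum 3 3≤10 B₁ʸ-exp B-exp B-exp-far B₁ʸ-residue (λ c j → y^-mod (B₁ʸ-exp (inClass 3 c j)) (B₁ʸ-residue c) (3 ℕ.* tri j ℕ.+ 1) (tri (inClass 3 c j) ℕ.+ sq (inClass 3 c j) ℕ.+ 3 ℕ.* tri (+ 1 ℤ.+ j) ℕ.+ B₁ʸ-offset c) (B₁ʸ-mod c j))))
                               (-‿cong (trans reflected (class-sum 3 3≤10 B₂ʸ-exp B-exp B-exp-far B₂ʸ-residue (λ c j → y^-mod (B₂ʸ-exp (inClass 3 c j)) (B₂ʸ-residue c) (3 ℕ.* tri (+ 1 ℤ.+ j) ℕ.+ 2) (tri (inClass 3 c j) ℕ.+ sq (inClass 3 c j) ℕ.+ 3 ℕ.* tri j ℕ.+ B₂ʸ-offset c) (B₂ʸ-mod c j)))))) ⟩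
          y * (∑ (allFin 11) (λ c → sgn (+ toℕ c ℤ.- + 3) * y ^ B₁ʸ-residue c * Ψ c) - ∑ (allFin 11) (λ c → sgn (+ toℕ c ℤ.- + 3) * y ^ B₂ʸ-residue c * Ψ c))
            ≈⟨ solve 12 (λ y p₀ p₁ p₂ p₃ p₄ p₅ p₆ p₇ p₈ p₉ p₁₀ →
                 y :* ((s 3 :* y :^ 2 :* p₀ :+ (s 2 :* y :^ 5 :* p₁ :+ (s 1 :* y :^ 8 :* p₂ :+ (s 0 :* y :^ 0 :* p₃ :+ (s 1 :* y :^ 3 :* p₄ :+ (s 2 :* y :^ 6 :* p₅ :+ (s 3 :* y :^ 9 :* p₆ :+ (s 4 :* y :^ 1 :* p₇ :+ (s 5 :* y :^ 4 :* p₈ :+ (s 6 :* y :^ 7 :* p₉ :+ (s 7 :* y :^ 10 :* p₁₀ :+ con (+ 0))))))))))))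
                    :- (s 3 :* y :^ 10 :* p₀ :+ (s 2 :* y :^ 7 :* p₁ :+ (s 1 :* y :^ 4 :* p₂ :+ (s 0 :* y :^ 1 :* p₃ :+ (s 1 :* y :^ 9 :* p₄ :+ (s 2 :* y :^ 6 :* p₅ :+ (s 3 :* y :^ 3 :* p₆ :+ (s 4 :* y :^ 0 :* p₇ :+ (s 5 :* y :^ 8 :* p₈ :+ (s 6 :* y :^ 5 :* p₉ :+ (s 7 :* y :^ 2 :* p₁₀ :+ con (+ 0)))))))))))))
                 := (y :^ 10 :- y :^ 4) :* (p₄ :- p₆) :+ ((y :^ 1 :- y :^ 2) :* (p₃ :- p₇) :+ ((y :^ 5 :- y :^ 9) :* (p₂ :- p₈) :+
                    ((y :^ 6 :- y :^ 8) :* (p₁ :- p₉) :+ ((y :^ 11 :- y :^ 3) :* (p₀ :- p₁₀) :+ con (+ 0))))))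
                 refl y (Ψ 0F) (Ψ 1F) (Ψ 2F) (Ψ 3F) (Ψ 4F) (Ψ 5F) (Ψ 6F) (Ψ 7F) (Ψ 8F) (Ψ 9F) (Ψ (suc 9F)) ⟩
          α 0F * (Ψ 4F - Ψ 6F) + (α 1F * (Ψ 3F - Ψ 7F) + (α 2F * (Ψ 2F - Ψ 8F) + (α 3F * (Ψ 1F - Ψ 9F) + ((y ^ 11 - y ^ 3) * (Ψ 0F - Ψ (suc 9F)) + 0#))))
            ≈⟨ +-cong (*-congˡ (pair 0F)) (+-cong (*-congˡ (pair 1F)) (+-cong (*-congˡ (pair 2F)) (+-cong (*-congˡ (pair 3F)) (+-congʳ (*-cong (+-congʳ y^11≈1) (pair 4F)))))) ⟩
          ∑ (allFin 5) (λ i → α i * H i) ∎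
          where
          open Winquist S q N q^≈0 using (term)
          s : ∀ {n} → ℕ → Polynomial n
          s k = (:- con (+ 1)) :^ k
          pair : ∀ i → Ψ (below i) - Ψ (above i) ≈ H i
          pair i = trans (+-cong (Ψ-below i) (-‿cong (Ψ-above i))) (solve 3 (λ q a b → q :* a :- q :* b := q :* (a :- b)) refl (q ^ F-exp i) (B₁ᵢ-sum i) (B₂ᵢ-sum i))
          -- The substitution j ↦ - j gives the second half of B the power of q of the first half,
          -- so that the same sums Ψ serve for both.
          reflected : ∑ℤ (term gs B₂ᶠ) ≈ ∑ℤ (λ j → sgn j * (y ^ B₂ʸ-exp j * q ^ B-exp j))
          reflected = sym (∑ℤ-reflect (λ j N<j → trans (*-congˡ (trans (*-congˡ (vanish (B-exp-far j N<j))) (zeroʳ _))) (zeroʳ _)) B₂-supported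
            (λ j → *-cong (sym (sgn-neg j)) (trans (*-congˡ (^-≡ q (exponents 1 (λ j → △ j ⊕ □ j ≐ △ (#ᴾ (+ 1) +ᴾ -ᴾ j) ⊕ □ (-ᴾ j)) ≡.refl j)))
              (sym (in-q (sq (+ 1 ℤ.+ ℤ.- j) ℕ.+ 4 ℕ.* tri (+ 1 ℤ.+ ℤ.- j)) (tri (+ 1 ℤ.+ ℤ.- j) ℕ.+ sq (ℤ.- j)))))))

open ThetaDissection

-- Winquist's identity in base q^121, read backwards.

module EulerProducts where
  import Data.Nat.Tactic.RingSolver as ℕ-Solver
  open import Data.Fin using (suc)
  open import Data.List using ([]; _∷_; foldr)

  -- Winquist's identity in base q^121 at a = q^(11 (j + d)) and b = q^(11 j).
  factorList : ℕ → ℕ → ℕ → List (ℕ × ℕ)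
  factorList j d e = (j ℕ.+ d , 11) ∷ (j ℕ.+ d ℕ.+ e , 11) ∷ (j , 11) ∷ (j ℕ.+ (d ℕ.+ d) ℕ.+ e , 11) ∷
                     (j ℕ.+ j ℕ.+ d , 11) ∷ (d ℕ.+ e , 11) ∷ (d , 11) ∷ (j ℕ.+ j ℕ.+ d ℕ.+ e , 11) ∷ (11 , 11) ∷ (11 , 11) ∷ []

  module Products (S : CommutativeRing 0ℓ 0ℓ) (q : CommutativeRing.Carrier S) (N : ℕ) (q^≈0 : TruncatedAt S q N) where
    open CommutativeRing S
    open Monomials S
    open IntegerCoefficients S
    open import Relation.Binary.Reasoning.Setoid setoid
    open Nilpotent S q N q^≈0

    L : ℕ
    L = N ℕ.+ (N ℕ.+ 4)

    N≤L : N ≤ L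
    N≤L = ℕₚ.m≤m+n N _

    N<L : N < L
    N<L = ℕₚ.≤-trans (ℕₚ.≤-reflexive (ℕₚ.+-comm 1 N)) (ℕₚ.+-monoʳ-≤ N (ℕₚ.≤-trans (s≤s z≤n) (ℕₚ.m≤n+m 4 N)))

    -- (q^(t a) ; q^(t m))_∞
    euler : ℕ → ℕ × ℕ → Carrier
    euler t (a , m) = ∏ L (λ k → 1# - q ^ (t ℕ.* (a ℕ.+ k ℕ.* m)))

    eulers : ℕ → List (ℕ × ℕ) → Carrier
    eulers t = foldr (λ am r → euler t am * r) 1#

    open ListSum S using (∑; ∑-cong; module Bilateral)
    open Bilateral (N ℕ.+ 4) using (∑ℤ)
    q¹²¹^≈0 : (q ^ 121) ^ suc N ≈ 0#
    q¹²¹^≈0 = trans (^-assocʳ q 121 (suc N)) (vanish (ℕₚ.m≤m+n (suc N) _))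

    module WQ = Winquist S (q ^ 121) N q¹²¹^≈0
    module JQ = JacobiTripleProduct S (q ^ 121) N q¹²¹^≈0
    module NQ = Nilpotent S (q ^ 121) N q¹²¹^≈0

    in-q : ∀ {v w} m n → v ≈ q ^ m → w ≈ q ^ n → ∀ k l → mon (v ∷ w ∷ []) (k ∷ l ∷ []) ≈ q ^ (m ℕ.* k ℕ.+ n ℕ.* l)
    in-q {v} {w} m n v≈ w≈ k l = begin
      v ^ k * (w ^ l * 1#)                 ≈⟨ *-cong (trans (^-congˡ k v≈) (^-assocʳ q m k)) (trans (*-identityʳ _) (trans (^-congˡ l w≈) (^-assocʳ q n l))) ⟩
      q ^ (m ℕ.* k) * q ^ (n ℕ.* l)        ≈⟨ ^-homo-* q (m ℕ.* k) (n ℕ.* l) ⟨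
      q ^ (m ℕ.* k ℕ.+ n ℕ.* l)            ∎

    shifted-factor : ∀ {v} s → v ≈ q ^ (11 ℕ.* s) → ∏ L (λ k → 1# - v * (q ^ 121) ^ k) ≈ euler 11 (s , 11)
    shifted-factor {v} s v≈ = ∏-cong L (λ k → +-congˡ (-‿cong (begin
      v * (q ^ 121) ^ k                    ≈⟨ *-cong v≈ (^-assocʳ q 121 k) ⟩
      q ^ (11 ℕ.* s) * q ^ (121 ℕ.* k)     ≈⟨ ^-homo-* q (11 ℕ.* s) (121 ℕ.* k) ⟨
      q ^ (11 ℕ.* s ℕ.+ 121 ℕ.* k)         ≈⟨ ^-≡ q (arith s k) ⟩
      q ^ (11 ℕ.* (s ℕ.+ k ℕ.* 11))        ∎)))
      where
      arith : ∀ s k → 11 ℕ.* s ℕ.+ 121 ℕ.* k ≡ 11 ℕ.* (s ℕ.+ k ℕ.* 11)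
      arith = ℕ-Solver.solve-∀

    poch-factor : NQ.poch L ≈ euler 11 (11 , 11)
    poch-factor = ∏-cong L (λ k → +-congˡ (-‿cong (trans (^-assocʳ q 121 (suc k)) (^-≡ q (arith k)))))
      where
      arith : ∀ k → 121 ℕ.* suc k ≡ 11 ℕ.* (11 ℕ.+ k ℕ.* 11)
      arith = ℕ-Solver.solve-∀

    θ-euler : ∀ {u v} s s′ → s ℕ.+ s′ ≡ 11 → v ≈ q ^ (11 ℕ.* s) → u ≈ q ^ (11 ℕ.* s′) →
              JQ.θ u v ≈ euler 11 (s , 11) * euler 11 (s′ , 11) * euler 11 (11 , 11)
    θ-euler {u} {v} s s′ s+s′ v≈ u≈ = trans (sym (JQ.θ-product u v uv L ℕₚ.≤-refl))
      (*-cong (*-cong (shifted-factor s v≈) (shifted-factor s′ u≈)) poch-factor)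
      where
      uv : u * v ≈ q ^ 121
      uv = trans (*-cong u≈ v≈) (trans (sym (^-homo-* q (11 ℕ.* s′) (11 ℕ.* s))) (^-≡ q (≡.trans (≡.sym (ℕₚ.*-distribˡ-+ 11 s′ s)) (≡.cong (11 ℕ.*_) (≡.trans (ℕₚ.+-comm s′ s) s+s′)))))

    ∑signed : (ℤ → ℕ) → Carrier
    ∑signed p = ∑ℤ (λ j → sgn j * q ^ p j)

    -- The condition on j, d, e is b² c² w = q^121 for b = q^(11 j), c = q^(11 d), w = q^(11 e),
    -- divided by 11.
    module Specialised (j d e : ℕ) (sum≡11 : j ℕ.+ j ℕ.+ (d ℕ.+ d ℕ.+ e) ≡ 11) where

      private
        b = q ^ (11 ℕ.* j)
        c = q ^ (11 ℕ.* d)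
        w = q ^ (11 ℕ.* e)

        infixr 5 _⟐_
        _⟐_ : ∀ {x y m n} → x ≈ q ^ (11 ℕ.* m) → y ≈ q ^ (11 ℕ.* n) → x * y ≈ q ^ (11 ℕ.* (m ℕ.+ n))
        _⟐_ {m = m} {n} ex ey = trans (*-cong ex ey) (trans (sym (^-homo-* q (11 ℕ.* m) (11 ℕ.* n))) (^-≡ q (≡.sym (ℕₚ.*-distribˡ-+ 11 m n))))

        squared : ∀ m → (q ^ (11 ℕ.* m)) ^ 2 ≈ q ^ (11 ℕ.* (m ℕ.+ m))
        squared m = trans (*-congˡ (*-identityʳ _)) (_⟐_ {m = m} {m} refl refl)

        q^-by : ∀ {x m} n → x ≈ q ^ (11 ℕ.* m) → m ≡ n → x ≈ q ^ (11 ℕ.* n)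
        q^-by n e ≡.refl = e

        bcw : b ^ 2 * (c ^ 2 * w) ≈ q ^ 121
        bcw = q^-by {m = j ℕ.+ j ℕ.+ (d ℕ.+ d ℕ.+ e)} 11 (_⟐_ {m = j ℕ.+ j} {d ℕ.+ d ℕ.+ e} (squared j) (_⟐_ {m = d ℕ.+ d} {e} (squared d) refl)) sum≡11

      module T = WQ.TwoVariables b c w bcw

      -- The identity is solved for its determinant. Each of the four theta functions contains
      -- (q^121; q^121)_∞; two of these cancel the square in front of the determinant, and the other
      -- two are the final entries of `factorList`.
      Y-factor : T.a.A * T.b.B - c * (T.a.B * T.b.A) ≈ eulers 11 (factorList j d e)
      Y-factor = begin
        Y                                        ≈⟨ trans (*-congʳ (trans (*-cong (inverse) (inverse)) (*-identityˡ 1#))) (*-identityˡ Y) ⟨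
        (p⁻¹ * p) * (p⁻¹ * p) * Y                ≈⟨ solve 3 (λ h p y → (h :* p) :* (h :* p) :* y := h :* h :* (p :* p :* y)) refl p⁻¹ p Y ⟩
        p⁻¹ * p⁻¹ * (p * p * Y)                  ≈⟨ *-congˡ (T.winquist L N≤L) ⟨
        p⁻¹ * p⁻¹ * (JQ.θ (b * c * w) (b * c) * JQ.θ (b * (c ^ 2 * w)) b * (JQ.θ (c * w) (b ^ 2 * c) * JQ.θ (b ^ 2 * (c * w)) c))
          ≈⟨ *-congˡ (*-cong (*-cong
               (θ-euler s₁ s₂ (arith₁ j d e sum≡11) (_⟐_ {m = j} {d} refl refl) (_⟐_ {m = j ℕ.+ d} {e} (_⟐_ {m = j} {d} refl refl) refl))
               (θ-euler s₃ s₄ (arith₂ j d e sum≡11) refl (q^-by s₄ (_⟐_ {m = j} {d ℕ.+ d ℕ.+ e} refl (_⟐_ {m = d ℕ.+ d} {e} (squared d) refl)) (≡.sym (ℕₚ.+-assoc j (d ℕ.+ d) e)))))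
               (*-cong
               (θ-euler s₅ s₆ (arith₃ j d e sum≡11) (_⟐_ {m = j ℕ.+ j} {d} (squared j) refl) (_⟐_ {m = d} {e} refl refl))
               (θ-euler s₇ s₈ (arith₄ j d e sum≡11) refl (q^-by s₈ (_⟐_ {m = j ℕ.+ j} {d ℕ.+ e} (squared j) (_⟐_ {m = d} {e} refl refl)) (≡.sym (ℕₚ.+-assoc (j ℕ.+ j) d e)))))) ⟩
        p⁻¹ * p⁻¹ * ((E s₁ * E s₂ * E₁₁) * (E s₃ * E s₄ * E₁₁) * ((E s₅ * E s₆ * E₁₁) * (E s₇ * E s₈ * E₁₁)))
          ≈⟨ solve 10 (λ h e₁ e₂ e₃ e₄ e₅ e₆ e₇ e₈ f →
               h :* h :* ((e₁ :* e₂ :* f) :* (e₃ :* e₄ :* f) :* ((e₅ :* e₆ :* f) :* (e₇ :* e₈ :* f))) :=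
               (h :* f) :* (h :* f) :* (e₁ :* (e₂ :* (e₃ :* (e₄ :* (e₅ :* (e₆ :* (e₇ :* (e₈ :* (f :* (f :* con (+ 1)))))))))))) refl
               p⁻¹ (E s₁) (E s₂) (E s₃) (E s₄) (E s₅) (E s₆) (E s₇) (E s₈) E₁₁ ⟩
        (p⁻¹ * E₁₁) * (p⁻¹ * E₁₁) * eulers 11 (factorList j d e)
          ≈⟨ trans (*-congʳ (trans (*-cong inverse′ inverse′) (*-identityˡ 1#))) (*-identityˡ _) ⟩
        eulers 11 (factorList j d e) ∎
        where
        Y = T.a.A * T.b.B - c * (T.a.B * T.b.A)
        p = NQ.poch L
        p⁻¹ = NQ.poch⁻¹ L
        E₁₁ = euler 11 (11 , 11)
        E : ℕ → Carrier
        E s = euler 11 (s , 11)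
        inverse : p⁻¹ * p ≈ 1#
        inverse = NQ.poch⁻¹-* L
        inverse′ : p⁻¹ * E₁₁ ≈ 1#
        inverse′ = trans (*-congˡ (sym poch-factor)) inverse
        s₁ = j ℕ.+ d
        s₂ = j ℕ.+ d ℕ.+ e
        s₃ = j
        s₄ = j ℕ.+ (d ℕ.+ d) ℕ.+ e
        s₅ = j ℕ.+ j ℕ.+ d
        s₆ = d ℕ.+ e
        s₇ = d
        s₈ = j ℕ.+ j ℕ.+ d ℕ.+ e
        arith₁ : ∀ j d e → j ℕ.+ j ℕ.+ (d ℕ.+ d ℕ.+ e) ≡ 11 → (j ℕ.+ d) ℕ.+ (j ℕ.+ d ℕ.+ e) ≡ 11
        arith₁ j d e h = ≡.trans (r j d e) h
          where
          r : ∀ j d e → (j ℕ.+ d) ℕ.+ (j ℕ.+ d ℕ.+ e) ≡ j ℕ.+ j ℕ.+ (d ℕ.+ d ℕ.+ e)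
          r = ℕ-Solver.solve-∀
        arith₂ : ∀ j d e → j ℕ.+ j ℕ.+ (d ℕ.+ d ℕ.+ e) ≡ 11 → j ℕ.+ (j ℕ.+ (d ℕ.+ d) ℕ.+ e) ≡ 11
        arith₂ j d e h = ≡.trans (r j d e) h
          where
          r : ∀ j d e → j ℕ.+ (j ℕ.+ (d ℕ.+ d) ℕ.+ e) ≡ j ℕ.+ j ℕ.+ (d ℕ.+ d ℕ.+ e)
          r = ℕ-Solver.solve-∀
        arith₃ : ∀ j d e → j ℕ.+ j ℕ.+ (d ℕ.+ d ℕ.+ e) ≡ 11 → (j ℕ.+ j ℕ.+ d) ℕ.+ (d ℕ.+ e) ≡ 11
        arith₃ j d e h = ≡.trans (r j d e) h
          where
          r : ∀ j d e → (j ℕ.+ j ℕ.+ d) ℕ.+ (d ℕ.+ e) ≡ j ℕ.+ j ℕ.+ (d ℕ.+ d ℕ.+ e)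
          r = ℕ-Solver.solve-∀
        arith₄ : ∀ j d e → j ℕ.+ j ℕ.+ (d ℕ.+ d ℕ.+ e) ≡ 11 → d ℕ.+ (j ℕ.+ j ℕ.+ d ℕ.+ e) ≡ 11
        arith₄ j d e h = ≡.trans (r j d e) h
          where
          r : ∀ j d e → d ℕ.+ (j ℕ.+ j ℕ.+ d ℕ.+ e) ≡ j ℕ.+ j ℕ.+ (d ℕ.+ d ℕ.+ e)
          r = ℕ-Solver.solve-∀

      module _ (v-a w-a v-b w-b : ℕ) (va≡ : 11 ℕ.* (j ℕ.+ d) ≡ v-a) (wa≡ : 11 ℕ.* e ≡ w-a) (vb≡ : 11 ℕ.* j ≡ v-b) (wb≡ : 11 ℕ.* (d ℕ.+ d ℕ.+ e) ≡ w-b) where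

        private
          v-a≈ : b * c ≈ q ^ v-a
          v-a≈ = trans (_⟐_ {m = j} {d} refl refl) (^-≡ q va≡)
          w-b≈ : c ^ 2 * w ≈ q ^ w-b
          w-b≈ = trans (_⟐_ {m = d ℕ.+ d} {e} (squared d) refl) (^-≡ q wb≡)

        a-A : T.a.A ≈ ∑signed (λ k → v-a ℕ.* (3 ℕ.* sq k) ℕ.+ w-a ℕ.* (3 ℕ.* tri k))
        a-A = ∑-cong WQ.W (λ k → *-congˡ {sgn k} (in-q v-a w-a v-a≈ (^-≡ q wa≡) (3 ℕ.* sq k) (3 ℕ.* tri k)))

        b-A : T.b.A ≈ ∑signed (λ k → v-b ℕ.* (3 ℕ.* sq k) ℕ.+ w-b ℕ.* (3 ℕ.* tri k))
        b-A = ∑-cong WQ.W (λ k → *-congˡ {sgn k} (in-q v-b w-b (^-≡ q vb≡) w-b≈ (3 ℕ.* sq k) (3 ℕ.* tri k)))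

        a-B : T.a.B ≈ ∑signed (λ k → v-a ℕ.* (sq k ℕ.+ 4 ℕ.* tri (+ 1 ℤ.+ k)) ℕ.+ w-a ℕ.* (tri k ℕ.+ sq k)) -
                      ∑signed (λ k → v-a ℕ.* (sq (+ 1 ℤ.+ k) ℕ.+ 4 ℕ.* tri (+ 1 ℤ.+ k)) ℕ.+ w-a ℕ.* (tri (+ 1 ℤ.+ k) ℕ.+ sq k))
        a-B = +-cong (∑-cong WQ.W (λ k → *-congˡ {sgn k} (in-q v-a w-a v-a≈ (^-≡ q wa≡) (sq k ℕ.+ 4 ℕ.* tri (+ 1 ℤ.+ k)) (tri k ℕ.+ sq k))))
                     (-‿cong (∑-cong WQ.W (λ k → *-congˡ {sgn k} (in-q v-a w-a v-a≈ (^-≡ q wa≡) (sq (+ 1 ℤ.+ k) ℕ.+ 4 ℕ.* tri (+ 1 ℤ.+ k)) (tri (+ 1 ℤ.+ k) ℕ.+ sq k)))))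

        b-B : T.b.B ≈ ∑signed (λ k → v-b ℕ.* (sq k ℕ.+ 4 ℕ.* tri (+ 1 ℤ.+ k)) ℕ.+ w-b ℕ.* (tri k ℕ.+ sq k)) -
                      ∑signed (λ k → v-b ℕ.* (sq (+ 1 ℤ.+ k) ℕ.+ 4 ℕ.* tri (+ 1 ℤ.+ k)) ℕ.+ w-b ℕ.* (tri (+ 1 ℤ.+ k) ℕ.+ sq k))
        b-B = +-cong (∑-cong WQ.W (λ k → *-congˡ {sgn k} (in-q v-b w-b (^-≡ q vb≡) w-b≈ (sq k ℕ.+ 4 ℕ.* tri (+ 1 ℤ.+ k)) (tri k ℕ.+ sq k))))
                     (-‿cong (∑-cong WQ.W (λ k → *-congˡ {sgn k} (in-q v-b w-b (^-≡ q vb≡) w-b≈ (sq (+ 1 ℤ.+ k) ℕ.+ 4 ℕ.* tri (+ 1 ℤ.+ k)) (tri (+ 1 ℤ.+ k) ℕ.+ sq k)))))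

open EulerProducts

-- The ten determinants and their coefficients.

module ResidueComponents where
  open import Data.Fin using (Fin)
  open import Data.Fin.Patterns
  open import Data.List using ([]; _∷_; allFin)

  -- The residues 0, 1, 2, 3, 4, 5, 7, 8, 9, 10 modulo 11, in this order.
  Residue : Set
  Residue = Fin 10

  -- Residue r belongs to the pair a = q^(11 (j + d)), b = q^(11 j) with 2 j + 2 d + e = 11.
  j-of d-of e-of g-of : Residue → ℕ
  j-of r = Vec.lookup (2 ∷ 1 ∷ 3 ∷ 2 ∷ 1 ∷ 3 ∷ 4 ∷ 1 ∷ 2 ∷ 1 ∷ []) r
  d-of r = Vec.lookup (3 ∷ 4 ∷ 2 ∷ 2 ∷ 3 ∷ 1 ∷ 1 ∷ 1 ∷ 1 ∷ 2 ∷ []) r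
  e-of r = Vec.lookup (1 ∷ 1 ∷ 1 ∷ 3 ∷ 3 ∷ 3 ∷ 1 ∷ 7 ∷ 5 ∷ 5 ∷ []) r
  g-of r = Vec.lookup (0 ∷ 1 ∷ 2 ∷ 3 ∷ 4 ∷ 5 ∷ 7 ∷ 19 ∷ 9 ∷ 10 ∷ []) r

  factors-of : Residue → List (ℕ × ℕ)
  factors-of r = factorList (j-of r) (d-of r) (e-of r)

  module Units (S : CommutativeRing 0ℓ 0ℓ) (x : CommutativeRing.Carrier S) where
    open CommutativeRing S
    open Monomials S

    D : Carrier
    D = (1# - x ^ 5) * (1# - x ^ 2) * (1# - x ^ 7) * (1# - x ^ 3)

    -- The element u_r is a solution of κ_r = x² D u_r modulo x¹¹ - 1, where κ_r is the minor of the
    -- dissection coefficients that belongs to r.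
    unit : Residue → Carrier
    unit 0F = 1#
    unit 1F = x ^ 1 + x ^ 10 - 1#
    unit 2F = x ^ 2 + x ^ 9
    unit 3F = 1# + x ^ 3 + x ^ 8
    unit 4F = 1# + x ^ 2 + x ^ 4 + x ^ 7 + x ^ 9
    unit 5F = - (x ^ 2) - x ^ 4 - x ^ 7 - x ^ 9
    unit 6F = x ^ 1 + x ^ 4 + x ^ 7 + x ^ 10
    unit 7F = x ^ 1 + x ^ 3 + x ^ 4 + x ^ 7 + x ^ 8 + x ^ 10
    unit 8F = - 1# - x ^ 4 - x ^ 7
    unit 9F = - (x ^ 3) - x ^ 8

  module Assembly (S : CommutativeRing 0ℓ 0ℓ) (q : CommutativeRing.Carrier S) (N : ℕ) (q^≈0 : TruncatedAt S q N) (halve : NoTwoTorsion S)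
                  (x : CommutativeRing.Carrier S) (x^11≈1 : EleventhRootOfUnity S x) where
    open CommutativeRing S
    open Monomials S
    open IntegerCoefficients S
    open import Relation.Binary.Reasoning.Setoid setoid
    open Nilpotent S q N q^≈0
    open ListSum S using (∑; ∑-cong)
    open Products S q N q^≈0
    open Classes S q N q^≈0 halve

    open Units S x

    α₅ α₂ : Fin 5 → Carrier
    α₅ 0F = x ^ 6 - x ^ 9
    α₅ 1F = x ^ 5 - x ^ 10
    α₅ 2F = x ^ 3 - x ^ 1
    α₅ 3F = x ^ 8 - x ^ 7
    α₅ 4F = 1# - x ^ 4
    α₂ 0F = x ^ 9 - x ^ 8
    α₂ 1F = x ^ 2 - x ^ 4
    α₂ 2F = x ^ 10 - x ^ 7
    α₂ 3F = x ^ 1 - x ^ 5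
    α₂ 4F = 1# - x ^ 6

    -- The 2×2 minors of the matrix with rows α(x⁵) and α(x²), one for each of the ten pairs among
    -- five indices.
    κ : Residue → Carrier
    κ 0F = α₅ 4F * α₂ 1F - α₅ 1F * α₂ 4F
    κ 1F = α₅ 4F * α₂ 0F - α₅ 0F * α₂ 4F
    κ 2F = α₅ 4F * α₂ 2F - α₅ 2F * α₂ 4F
    κ 3F = α₅ 3F * α₂ 1F - α₅ 1F * α₂ 3F
    κ 4F = α₅ 3F * α₂ 0F - α₅ 0F * α₂ 3F
    κ 5F = α₅ 3F * α₂ 2F - α₅ 2F * α₂ 3F
    κ 6F = α₅ 4F * α₂ 3F - α₅ 3F * α₂ 4F
    κ 7F = α₅ 1F * α₂ 0F - α₅ 0F * α₂ 1F
    κ 8F = α₅ 2F * α₂ 1F - α₅ 1F * α₂ 2F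
    κ 9F = α₅ 2F * α₂ 0F - α₅ 0F * α₂ 2F

    reduce : ∀ {a b c} → a ≈ b + (x ^ 11 - 1#) * c → a ≈ b
    reduce {a} {b} {c} e = trans e (trans (+-congˡ (trans (*-congʳ (trans (+-congʳ x^11≈1) (-‿inverseʳ 1#))) (zeroˡ c))) (+-identityʳ b))

    D′ : ∀ {n} → Polynomial n → Polynomial n
    D′ x = (con (+ 1) :- x :^ 5) :* (con (+ 1) :- x :^ 2) :* (con (+ 1) :- x :^ 7) :* (con (+ 1) :- x :^ 3)

    -- Each case is an identity in ℤ[x] with an explicit cofactor of x¹¹ - 1; `reduce` discards the
    -- multiple of x¹¹ - 1.
    κ≈ : ∀ r → κ r ≈ x ^ 2 * D * unit r
    κ≈ 0F = reduce (solve 1 (λ x → (con (+ 1) :- x :^ 4) :* (x :^ 2 :- x :^ 4) :- (x :^ 5 :- x :^ 10) :* (con (+ 1) :- x :^ 6)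
      := (x :^ 2) :* D′ x :* (con (+ 1)) :+ (x :^ 11 :- con (+ 1)) :* (x :^ 6 :- x :^ 8)) refl x)
    κ≈ 1F = reduce (solve 1 (λ x → (con (+ 1) :- x :^ 4) :* (x :^ 9 :- x :^ 8) :- (x :^ 6 :- x :^ 9) :* (con (+ 1) :- x :^ 6)
      := (x :^ 2) :* D′ x :* (x :^ 1 :+ x :^ 10 :- con (+ 1)) :+ (x :^ 11 :- con (+ 1)) :* (:- (x :^ 2) :+ x :^ 3 :+ x :^ 4 :+ x :^ 8 :- con (+ 2) :* x :^ 9 :- x :^ 10 :+ x :^ 15 :+ x :^ 16 :- x :^ 18)) refl x)
    κ≈ 2F = reduce (solve 1 (λ x → (con (+ 1) :- x :^ 4) :* (x :^ 10 :- x :^ 7) :- (x :^ 3 :- x :^ 1) :* (con (+ 1) :- x :^ 6)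
      := (x :^ 2) :* D′ x :* (x :^ 2 :+ x :^ 9) :+ (x :^ 11 :- con (+ 1)) :* (:- (x :^ 1) :+ x :^ 3 :+ x :^ 4 :- x :^ 6 :+ x :^ 7 :- x :^ 9 :- x :^ 10 :+ x :^ 14 :+ x :^ 15 :- x :^ 17)) refl x)
    κ≈ 3F = reduce (solve 1 (λ x → (x :^ 8 :- x :^ 7) :* (x :^ 2 :- x :^ 4) :- (x :^ 5 :- x :^ 10) :* (x :^ 1 :- x :^ 5)
      := (x :^ 2) :* D′ x :* (con (+ 1) :+ x :^ 3 :+ x :^ 8) :+ (x :^ 11 :- con (+ 1)) :* (x :^ 2 :- x :^ 4 :+ x :^ 6 :- x :^ 7 :- x :^ 8 :+ x :^ 9 :- x :^ 11 :+ x :^ 13 :+ x :^ 14 :- x :^ 16)) refl x)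
    κ≈ 4F = reduce (solve 1 (λ x → (x :^ 8 :- x :^ 7) :* (x :^ 9 :- x :^ 8) :- (x :^ 6 :- x :^ 9) :* (x :^ 1 :- x :^ 5)
      := (x :^ 2) :* D′ x :* (con (+ 1) :+ x :^ 2 :+ x :^ 4 :+ x :^ 7 :+ x :^ 9) :+ (x :^ 11 :- con (+ 1)) :* (x :^ 2 :- x :^ 5 :- x :^ 8 :+ x :^ 13 :+ x :^ 14 :- x :^ 17)) refl x)
    κ≈ 5F = reduce (solve 1 (λ x → (x :^ 8 :- x :^ 7) :* (x :^ 10 :- x :^ 7) :- (x :^ 3 :- x :^ 1) :* (x :^ 1 :- x :^ 5)
      := (x :^ 2) :* D′ x :* (:- (x :^ 2) :- x :^ 4 :- x :^ 7 :- x :^ 9) :+ (x :^ 11 :- con (+ 1)) :* (:- (x :^ 2) :+ x :^ 6 :+ x :^ 7 :- x :^ 13 :- x :^ 14 :+ x :^ 17)) refl x)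
    κ≈ 6F = reduce (solve 1 (λ x → (con (+ 1) :- x :^ 4) :* (x :^ 1 :- x :^ 5) :- (x :^ 8 :- x :^ 7) :* (con (+ 1) :- x :^ 6)
      := (x :^ 2) :* D′ x :* (x :^ 1 :+ x :^ 4 :+ x :^ 7 :+ x :^ 10) :+ (x :^ 11 :- con (+ 1)) :* (:- (x :^ 1) :+ x :^ 3 :+ x :^ 5 :- x :^ 7 :- x :^ 9 :+ x :^ 13 :+ x :^ 16 :- x :^ 18)) refl x)
    κ≈ 7F = reduce (solve 1 (λ x → (x :^ 5 :- x :^ 10) :* (x :^ 9 :- x :^ 8) :- (x :^ 6 :- x :^ 9) :* (x :^ 2 :- x :^ 4)
      := (x :^ 2) :* D′ x :* (x :^ 1 :+ x :^ 3 :+ x :^ 4 :+ x :^ 7 :+ x :^ 8 :+ x :^ 10) :+ (x :^ 11 :- con (+ 1)) :* (x :^ 3 :- x :^ 7 :- x :^ 8 :- x :^ 11 :+ con (+ 2) :* x :^ 13 :+ x :^ 14 :- x :^ 18)) refl x)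
    κ≈ 8F = reduce (solve 1 (λ x → (x :^ 3 :- x :^ 1) :* (x :^ 2 :- x :^ 4) :- (x :^ 5 :- x :^ 10) :* (x :^ 10 :- x :^ 7)
      := (x :^ 2) :* D′ x :* (:- con (+ 1) :- x :^ 4 :- x :^ 7) :+ (x :^ 11 :- con (+ 1)) :* (:- (x :^ 2) :+ x :^ 3 :+ x :^ 4 :- x :^ 5 :- x :^ 6 :+ x :^ 7 :+ x :^ 8 :- x :^ 10 :- x :^ 13 :+ x :^ 15)) refl x)
    κ≈ 9F = reduce (solve 1 (λ x → (x :^ 3 :- x :^ 1) :* (x :^ 9 :- x :^ 8) :- (x :^ 6 :- x :^ 9) :* (x :^ 10 :- x :^ 7)
      := (x :^ 2) :* D′ x :* (:- (x :^ 3) :- x :^ 8) :+ (x :^ 11 :- con (+ 1)) :* (:- (x :^ 5) :+ x :^ 7 :+ x :^ 8 :- x :^ 9 :+ x :^ 11 :- x :^ 13 :- x :^ 14 :+ x :^ 16)) refl x)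

    period : ∀ r u → x ^ (r ℕ.+ 11 ℕ.* u) ≈ x ^ r
    period r u = trans (^-homo-* x r (11 ℕ.* u)) (trans (*-congˡ (trans (sym (^-assocʳ x 11 u)) (trans (^-congˡ u x^11≈1) (1^ u)))) (*-identityʳ _))

    yₐ y_b : Carrier
    yₐ  = x ^ 2 * x ^ 3
    y_b = x ^ 2

    yₐ^ : ∀ k r u → 5 ℕ.* k ≡ r ℕ.+ 11 ℕ.* u → yₐ ^ k ≈ x ^ r
    yₐ^ k r u e = trans (^-congˡ k (sym (^-homo-* x 2 3))) (trans (^-assocʳ x 5 k) (trans (^-≡ x e) (period r u)))

    y_b^ : ∀ k r u → 2 ℕ.* k ≡ r ℕ.+ 11 ℕ.* u → y_b ^ k ≈ x ^ r
    y_b^ k r u e = trans (^-assocʳ x 2 k) (trans (^-≡ x e) (period r u))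

    yₐ^11≈1 : yₐ ^ 11 ≈ 1#
    yₐ^11≈1 = yₐ^ 11 0 5 ≡.refl

    y_b^11≈1 : y_b ^ 11 ≈ 1#
    y_b^11≈1 = y_b^ 11 0 2 ≡.refl

    α₅≈ : ∀ i → α yₐ yₐ^11≈1 i ≈ α₅ i
    α₅≈ 0F = +-cong (yₐ^ 10 6 4 ≡.refl) (-‿cong (yₐ^ 4 9 1 ≡.refl))
    α₅≈ 1F = +-cong (yₐ^ 1 5 0 ≡.refl) (-‿cong (yₐ^ 2 10 0 ≡.refl))
    α₅≈ 2F = +-cong (yₐ^ 5 3 2 ≡.refl) (-‿cong (yₐ^ 9 1 4 ≡.refl))
    α₅≈ 3F = +-cong (yₐ^ 6 8 2 ≡.refl) (-‿cong (yₐ^ 8 7 3 ≡.refl))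
    α₅≈ 4F = +-congˡ (-‿cong (yₐ^ 3 4 1 ≡.refl))

    α₂≈ : ∀ i → α y_b y_b^11≈1 i ≈ α₂ i
    α₂≈ 0F = +-cong (y_b^ 10 9 1 ≡.refl) (-‿cong (y_b^ 4 8 0 ≡.refl))
    α₂≈ 1F = +-cong (y_b^ 1 2 0 ≡.refl) (-‿cong (y_b^ 2 4 0 ≡.refl))
    α₂≈ 2F = +-cong (y_b^ 5 10 0 ≡.refl) (-‿cong (y_b^ 9 7 1 ≡.refl))
    α₂≈ 3F = +-cong (y_b^ 6 1 1 ≡.refl) (-‿cong (y_b^ 8 5 1 ≡.refl))
    α₂≈ 4F = +-congˡ (-‿cong (y_b^ 3 6 0 ≡.refl))

    bcw : (x ^ 2) ^ 2 * ((x ^ 3) ^ 2 * (x * q)) ≈ q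
    bcw = trans (solve 2 (λ x q → ((x :^ 2) :^ 2) :* (((x :^ 3) :^ 2) :* (x :* q)) := (x :^ 11) :* q) refl x q) (trans (*-congʳ x^11≈1) (*-identityˡ q))

    module W₁ = Winquist.TwoVariables S q N q^≈0 (x ^ 2) (x ^ 3) (x * q) bcw

    w₁ : Carrier
    w₁ = W₁.a.A * W₁.b.B - x ^ 3 * (W₁.a.B * W₁.b.A)

    -- The dissection needs w = y⁹ q. For y = x⁵ this is x q because 45 ≡ 1, and for y = x² it is x⁷
    -- q because 18 ≡ 7 modulo 11.
    module Dₐ  = Dissected yₐ yₐ^11≈1 (x * q) (*-congʳ (trans (sym (*-identityʳ x)) (sym (yₐ^ 9 1 4 ≡.refl)))) W₁.w-bc
    module D_b = Dissected y_b y_b^11≈1 ((x ^ 3) ^ 2 * (x * q)) (trans (solve 2 (λ x q → ((x :^ 3) :^ 2) :* (x :* q) := (x :^ 7) :* q) refl x q) (*-congʳ (sym (y_b^ 9 7 1 ≡.refl)))) bcw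

    G H : Fin 5 → Carrier
    G i = q ^ E-exp i * Aᵢ-sum i
    H i = q ^ F-exp i * (B₁ᵢ-sum i - B₂ᵢ-sum i)

    i-of j′-of : Residue → Fin 5
    i-of r = Vec.lookup (4F ∷ 4F ∷ 4F ∷ 3F ∷ 3F ∷ 3F ∷ 4F ∷ 1F ∷ 2F ∷ 2F ∷ []) r
    j′-of r = Vec.lookup (1F ∷ 0F ∷ 2F ∷ 1F ∷ 0F ∷ 2F ∷ 3F ∷ 0F ∷ 1F ∷ 0F ∷ []) r

    -- The factor x² is y at the point b, and x² x³ = x⁵ is y at the point a, so both occurrences of
    -- B become y B. As A and y B then have equal coefficients α, the terms with i = j cancel and
    -- the others combine into ten products of minors.
    x²w₁-expansion : x ^ 2 * w₁ ≈ ∑ (allFin 10) (λ r → κ r * (G (i-of r) * H (j′-of r) - H (i-of r) * G (j′-of r)))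
    x²w₁-expansion = begin
      x ^ 2 * w₁
        ≈⟨ solve 6 (λ x A B A′ B′ y → y :* (A :* B′ :- (x :^ 3) :* (B :* A′)) := A :* (y :* B′) :- (y :* (x :^ 3)) :* B :* A′) refl x W₁.a.A W₁.a.B W₁.b.A W₁.b.B (x ^ 2) ⟩
      W₁.a.A * (y_b * W₁.b.B) - yₐ * W₁.a.B * W₁.b.A
        ≈⟨ +-cong (*-cong (trans Dₐ.A-dissection (∑-cong (allFin 5) (λ i → *-congʳ {G i} (α₅≈ i)))) (trans D_b.B-dissection (∑-cong (allFin 5) (λ i → *-congʳ {H i} (α₂≈ i)))))
             (-‿cong (*-cong (trans Dₐ.B-dissection (∑-cong (allFin 5) (λ i → *-congʳ {H i} (α₅≈ i)))) (trans D_b.A-dissection (∑-cong (allFin 5) (λ i → *-congʳ {G i} (α₂≈ i)))))) ⟩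
      ∑ (allFin 5) (λ i → α₅ i * G i) * ∑ (allFin 5) (λ i → α₂ i * H i) - ∑ (allFin 5) (λ i → α₅ i * H i) * ∑ (allFin 5) (λ i → α₂ i * G i)
        ≈⟨ antisymmetrise (α₅ 0F) (α₅ 1F) (α₅ 2F) (α₅ 3F) (α₅ 4F) (α₂ 0F) (α₂ 1F) (α₂ 2F) (α₂ 3F) (α₂ 4F) (G 0F) (G 1F) (G 2F) (G 3F) (G 4F) (H 0F) (H 1F) (H 2F) (H 3F) (H 4F) ⟩
      ∑ (allFin 10) (λ r → κ r * (G (i-of r) * H (j′-of r) - H (i-of r) * G (j′-of r))) ∎
      where
      antisymmetrise : ∀ a₁ a₂ a₃ a₄ a₅ b₁ b₂ b₃ b₄ b₅ g₁ g₂ g₃ g₄ g₅ h₁ h₂ h₃ h₄ h₅ →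
        (a₁ * g₁ + (a₂ * g₂ + (a₃ * g₃ + (a₄ * g₄ + (a₅ * g₅ + 0#))))) * (b₁ * h₁ + (b₂ * h₂ + (b₃ * h₃ + (b₄ * h₄ + (b₅ * h₅ + 0#))))) - (a₁ * h₁ + (a₂ * h₂ + (a₃ * h₃ + (a₄ * h₄ + (a₅ * h₅ + 0#))))) * (b₁ * g₁ + (b₂ * g₂ + (b₃ * g₃ + (b₄ * g₄ + (b₅ * g₅ + 0#))))) ≈
        ((a₅ * b₂ - a₂ * b₅) * (g₅ * h₂ - h₅ * g₂)) + (((a₅ * b₁ - a₁ * b₅) * (g₅ * h₁ - h₅ * g₁)) + (((a₅ * b₃ - a₃ * b₅) * (g₅ * h₃ - h₅ * g₃)) + (((a₄ * b₂ - a₂ * b₄) * (g₄ * h₂ - h₄ * g₂)) + (((a₄ * b₁ - a₁ * b₄) * (g₄ * h₁ - h₄ * g₁)) + (((a₄ * b₃ - a₃ * b₄) * (g₄ * h₃ - h₄ * g₃)) + (((a₅ * b₄ - a₄ * b₅) * (g₅ * h₄ - h₅ * g₄)) + (((a₂ * b₁ - a₁ * b₂) * (g₂ * h₁ - h₂ * g₁)) + (((a₃ * b₂ - a₂ * b₃) * (g₃ * h₂ - h₃ * g₂)) + (((a₃ * b₁ - a₁ * b₃) * (g₃ * h₁ - h₃ * g₁)) + 0#)))))))))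
      antisymmetrise = solve 20 (λ a₁ a₂ a₃ a₄ a₅ b₁ b₂ b₃ b₄ b₅ g₁ g₂ g₃ g₄ g₅ h₁ h₂ h₃ h₄ h₅ →
        (a₁ :* g₁ :+ (a₂ :* g₂ :+ (a₃ :* g₃ :+ (a₄ :* g₄ :+ (a₅ :* g₅ :+ con (+ 0)))))) :* (b₁ :* h₁ :+ (b₂ :* h₂ :+ (b₃ :* h₃ :+ (b₄ :* h₄ :+ (b₅ :* h₅ :+ con (+ 0)))))) :- (a₁ :* h₁ :+ (a₂ :* h₂ :+ (a₃ :* h₃ :+ (a₄ :* h₄ :+ (a₅ :* h₅ :+ con (+ 0)))))) :* (b₁ :* g₁ :+ (b₂ :* g₂ :+ (b₃ :* g₃ :+ (b₄ :* g₄ :+ (b₅ :* g₅ :+ con (+ 0)))))) :=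
        ((a₅ :* b₂ :- a₂ :* b₅) :* (g₅ :* h₂ :- h₅ :* g₂)) :+ (((a₅ :* b₁ :- a₁ :* b₅) :* (g₅ :* h₁ :- h₅ :* g₁)) :+ (((a₅ :* b₃ :- a₃ :* b₅) :* (g₅ :* h₃ :- h₅ :* g₃)) :+ (((a₄ :* b₂ :- a₂ :* b₄) :* (g₄ :* h₂ :- h₄ :* g₂)) :+ (((a₄ :* b₁ :- a₁ :* b₄) :* (g₄ :* h₁ :- h₄ :* g₁)) :+ (((a₄ :* b₃ :- a₃ :* b₄) :* (g₄ :* h₃ :- h₄ :* g₃)) :+ (((a₅ :* b₄ :- a₄ :* b₅) :* (g₅ :* h₄ :- h₅ :* g₄)) :+ (((a₂ :* b₁ :- a₁ :* b₂) :* (g₂ :* h₁ :- h₂ :* g₁)) :+ (((a₃ :* b₂ :- a₂ :* b₃) :* (g₃ :* h₂ :- h₃ :* g₂)) :+ (((a₃ :* b₁ :- a₁ :* b₃) :* (g₃ :* h₁ :- h₃ :* g₁)) :+ con (+ 0))))))))))) refl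

open ResidueComponents

-- The cyclotomic identity, and the dissection of the crank generating function.

module CrankDissection where
  open import Data.Fin using (zero; suc)
  open import Data.Fin.Properties using (all?)
  open import Data.List using (allFin)
  open import Relation.Nullary.Decidable using (from-yes)

  module Cyclotomic (S : CommutativeRing 0ℓ 0ℓ) (x : CommutativeRing.Carrier S) where
    open CommutativeRing S
    open Monomials S
    open IntegerCoefficients S
    open import Relation.Binary.Reasoning.Setoid setoid

    -- ∏_{t < n} (1 - x^t y) = ∑_k c n k y^k
    c : ℕ → ℕ → Carrier
    c zero    zero    = 1#
    c zero    (suc k) = 0#
    c (suc n) zero    = c n 0
    c (suc n) (suc k) = c n (suc k) - x ^ n * c n k

    c-above : ∀ n k → n < k → c n k ≈ 0#
    c-above zero    (suc k) _         = refl
    c-above (suc n) (suc k) (s≤s n<k) = trans (+-cong (c-above n (suc k) (ℕₚ.m≤n⇒m≤1+n n<k)) (-‿cong (trans (*-congˡ (c-above n k n<k)) (zeroʳ _)))) (-‿inverseʳ 0#)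

    c-zero : ∀ n → c n 0 ≈ 1#
    c-zero zero    = refl
    c-zero (suc n) = c-zero n

    c-top : ∀ n → c (suc n) (suc n) ≈ - (x ^ n * c n n)
    c-top n = trans (+-congʳ (c-above n (suc n) ℕₚ.≤-refl)) (+-identityˡ _)

    c-product : ∀ n y → ∏ n (λ t → 1# - x ^ t * y) ≈ ⨁ (suc n) (λ k → c n k * y ^ k)
    c-product zero    y = solve 0 (con (+ 1) := con (+ 1) :* con (+ 1) :+ con (+ 0)) refl
    c-product (suc n) y = begin
      (1# - x ^ n * y) * ∏ n (λ t → 1# - x ^ t * y)         ≈⟨ *-congˡ (c-product n y) ⟩
      (1# - x ^ n * y) * ⨁ (suc n) (λ k → c n k * y ^ k)    ≈⟨ step (suc n) ⟩
      ⨁ (suc n) (λ k → c (suc n) k * y ^ k) - x ^ n * (c n n * y ^ suc n)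
        ≈⟨ +-comm _ _ ⟩
      - (x ^ n * (c n n * y ^ suc n)) + ⨁ (suc n) (λ k → c (suc n) k * y ^ k)
        ≈⟨ +-congʳ (trans (solve 3 (λ u v w → :- (u :* (v :* w)) := :- (u :* v) :* w) refl _ _ _) (*-congʳ (sym (c-top n)))) ⟩
      ⨁ (suc (suc n)) (λ k → c (suc n) k * y ^ k) ∎
      where
      last : ℕ → Carrier
      last zero    = 0#
      last (suc m) = c n m * y ^ suc m
      step : ∀ m → (1# - x ^ n * y) * ⨁ m (λ k → c n k * y ^ k) ≈ ⨁ m (λ k → c (suc n) k * y ^ k) - x ^ n * last m
      step zero          = solve 2 (λ a b → a :* con (+ 0) := con (+ 0) :- b :* con (+ 0)) refl _ (x ^ n)
      step (suc zero)    = solve 3 (λ u y c → (con (+ 1) :- u :* y) :* (c :* con (+ 1) :+ con (+ 0)) := (c :* con (+ 1) :+ con (+ 0)) :- u :* (c :* (y :* con (+ 1)))) refl (x ^ n) y (c n 0)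
      step (suc (suc m)) = begin
        (1# - x ^ n * y) * (c n (suc m) * y ^ suc m + s)
          ≈⟨ distribˡ _ _ _ ⟩
        (1# - x ^ n * y) * (c n (suc m) * y ^ suc m) + (1# - x ^ n * y) * s
          ≈⟨ +-congˡ (step (suc m)) ⟩
        (1# - x ^ n * y) * (c n (suc m) * y ^ suc m) + (s′ - x ^ n * (c n m * y ^ suc m))
          ≈⟨ solve 6 (λ u y c v c′ s → (con (+ 1) :- u :* y) :* (c :* v) :+ (s :- u :* (c′ :* v)) := ((c :- u :* c′) :* v :+ s) :- u :* (c :* (y :* v))) refl (x ^ n) y (c n (suc m)) (y ^ suc m) (c n m) s′ ⟩
        (c (suc n) (suc m) * y ^ suc m + s′) - x ^ n * (c n (suc m) * y ^ suc (suc m)) ∎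
        where
        s = ⨁ (suc m) (λ k → c n k * y ^ k)
        s′ = ⨁ (suc m) (λ k → c (suc n) k * y ^ k)

    -- The c n k are signed Gaussian binomial coefficients times powers of x. Their consecutive
    -- ratio is cross-multiplied because 1 - x^(k+1) may be a zero divisor.
    c-ratio : ∀ n k → (1# - x ^ suc k) * c n (suc k) ≈ (x ^ n - x ^ k) * c n k
    c-ratio zero    zero    = solve 1 (λ a → a :* con (+ 0) := (con (+ 1) :- con (+ 1)) :* con (+ 1)) refl _
    c-ratio zero    (suc k) = trans (zeroʳ _) (sym (zeroʳ _))
    c-ratio (suc n) zero    = begin
      (1# - x ^ 1) * (c n 1 - x ^ n * c n 0)                     ≈⟨ solve 4 (λ y a u b → y :* (a :- u :* b) := y :* a :- y :* (u :* b)) refl (1# - x ^ 1) (c n 1) (x ^ n) (c n 0) ⟩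
      (1# - x ^ 1) * c n 1 - (1# - x ^ 1) * (x ^ n * c n 0)      ≈⟨ +-congʳ (c-ratio n 0) ⟩
      (x ^ n - x ^ 0) * c n 0 - (1# - x ^ 1) * (x ^ n * c n 0)   ≈⟨ solve 3 (λ u b x → (u :- con (+ 1)) :* b :- (con (+ 1) :- x :* con (+ 1)) :* (u :* b) := (x :* u :- con (+ 1)) :* b) refl (x ^ n) (c n 0) x ⟩
      (x ^ suc n - x ^ 0) * c n 0                                ∎
    c-ratio (suc n) (suc k) = begin
      (1# - v′) * (c n (2 ℕ.+ k) - u * c n (suc k))                     ≈⟨ solve 4 (λ y a u b → y :* (a :- u :* b) := y :* a :- y :* (u :* b)) refl (1# - v′) (c n (2 ℕ.+ k)) u (c n (suc k)) ⟩
      (1# - v′) * c n (2 ℕ.+ k) - (1# - v′) * (u * c n (suc k))         ≈⟨ +-congʳ (c-ratio n (suc k)) ⟩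
      (u - x * v) * c n (suc k) - (1# - x * (x * v)) * (u * c n (suc k))
        ≈⟨ solve 5 (λ u v x a b → (u :- x :* v) :* a :- (con (+ 1) :- x :* (x :* v)) :* (u :* a) := (x :* u :- x :* v) :* a :- x :* u :* ((con (+ 1) :- x :* v) :* a)) refl u v x (c n (suc k)) (c n k) ⟩
      (x * u - x * v) * c n (suc k) - x * u * ((1# - x * v) * c n (suc k))
        ≈⟨ +-congˡ (-‿cong (*-congˡ (c-ratio n k))) ⟩
      (x * u - x * v) * c n (suc k) - x * u * ((u - v) * c n k)
        ≈⟨ solve 5 (λ u v x a b → (x :* u :- x :* v) :* a :- x :* u :* ((u :- v) :* b) := (x :* u :- x :* v) :* (a :- u :* b)) refl u v x (c n (suc k)) (c n k) ⟩
      (x ^ suc n - x ^ suc k) * (c n (suc k) - u * c n k) ∎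
      where
      u = x ^ n
      v = x ^ k
      v′ = x ^ suc (suc k)

    module _ (x^11≈1 : x ^ 11 ≈ 1#) where

      -- For n = 11 and x¹¹ = 1 the ratio reads (1 - x^(k+1)) c_(k+1) = (1 - x^k) c_k, so all these
      -- products equal the one at k = 0, which is 0.
      killed : ∀ k → (1# - x ^ k) * c 11 k ≈ 0#
      killed zero    = solve 1 (λ a → (con (+ 1) :- con (+ 1)) :* a := con (+ 0)) refl _
      killed (suc k) = trans (c-ratio 11 k) (trans (*-congʳ (+-congʳ x^11≈1)) (killed k))

      multiple : ∀ k m u {g} → k ℕ.* m ≡ 1 ℕ.+ 11 ℕ.* u → g * (1# - x ^ k) ≈ 1# - (x ^ k) ^ m → (1# - x) * c 11 k ≈ 0#
      multiple k m u {g} e geo = begin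
        (1# - x) * c 11 k                ≈⟨ *-congʳ (+-congˡ (-‿cong power)) ⟨
        (1# - (x ^ k) ^ m) * c 11 k      ≈⟨ *-congʳ geo ⟨
        g * (1# - x ^ k) * c 11 k        ≈⟨ *-assoc _ _ _ ⟩
        g * ((1# - x ^ k) * c 11 k)      ≈⟨ trans (*-congˡ (killed k)) (zeroʳ g) ⟩
        0#                               ∎
        where
        power : (x ^ k) ^ m ≈ x
        power = begin
          (x ^ k) ^ m            ≈⟨ trans (^-assocʳ x k m) (^-≡ x e) ⟩
          x * x ^ (11 ℕ.* u)     ≈⟨ *-congˡ (trans (sym (^-assocʳ x 11 u)) (trans (^-congˡ u x^11≈1) (1^ u))) ⟩
          x * 1#                 ≈⟨ *-identityʳ x ⟩
          x                      ∎

      -- If k m ≡ 1 modulo 11, then 1 - x = 1 - (x^k)^m is a multiple of 1 - x^k by a geometric sum,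
      -- and `killed` applies.
      geometric-killed : ∀ k m u → k ℕ.* m ≡ 1 ℕ.+ 11 ℕ.* u → (1# - x) * c 11 k ≈ 0#
      geometric-killed k m u e = multiple k m u {⨁ m (λ i → (x ^ k) ^ i)} e (geo (x ^ k) m)
        where
        geo : ∀ y n → ⨁ n (λ i → y ^ i) * (1# - y) ≈ 1# - y ^ n
        geo y zero    = trans (zeroˡ _) (sym (-‿inverseʳ 1#))
        geo y (suc n) = trans (distribʳ _ _ _) (trans (+-congˡ (geo y n)) (solve 2 (λ y z → z :* (con (+ 1) :- y) :+ (con (+ 1) :- z) := con (+ 1) :- y :* z) refl y (y ^ n)))

      -- The top coefficient is the product of the - xᵗ for t < 11: eleven signs, and the exponent 0
      -- + 1 + ⋯ + 10 = 55, a multiple of 11.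
      c-11 : c 11 11 ≈ - 1#
      c-11 = begin
        c 11 11
          ≈⟨ unfold 10 (unfold 9 (unfold 8 (unfold 7 (unfold 6 (unfold 5 (unfold 4 (unfold 3 (unfold 2 (unfold 1 (unfold 0 refl)))))))))) ⟩
        - (x ^ 10 * - (x ^ 9 * - (x ^ 8 * - (x ^ 7 * - (x ^ 6 * - (x ^ 5 * - (x ^ 4 * - (x ^ 3 * - (x ^ 2 * - (x ^ 1 * - (x ^ 0 * 1#)))))))))))
          ≈⟨ solve 1 (λ x → :- (x :^ 10 :* :- (x :^ 9 :* :- (x :^ 8 :* :- (x :^ 7 :* :- (x :^ 6 :* :- (x :^ 5 :* :- (x :^ 4 :* :- (x :^ 3 :* :- (x :^ 2 :* :- (x :^ 1 :* :- (x :^ 0 :* con (+ 1))))))))))))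
               := :- ((x :^ 11) :^ 5)) refl x ⟩
        - ((x ^ 11) ^ 5)
          ≈⟨ -‿cong (trans (^-congˡ 5 x^11≈1) (1^ 5)) ⟩
        - 1# ∎
        where
        unfold : ∀ n {z} → c n n ≈ z → c (suc n) (suc n) ≈ - (x ^ n * z)
        unfold n e = trans (c-top n) (-‿cong (*-congˡ e))

      -- The inner coefficients are annihilated by 1 - x, and only the ends 1 and - y¹¹ survive. The
      -- factor 1 - x cannot be dropped: at x = 1 the product is (1 - y)¹¹.
      cyclotomic : ∀ y → (1# - x) * ∏ 11 (λ t → 1# - x ^ t * y) ≈ (1# - x) * (1# - y ^ 11)
      cyclotomic y = begin
        (1# - x) * ∏ 11 (λ t → 1# - x ^ t * y)
          ≈⟨ *-congˡ (c-product 11 y) ⟩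
        (1# - x) * (c 11 11 * y ^ 11 + ⨁ 11 f)
          ≈⟨ *-congˡ (+-cong (*-congʳ c-11) (⨁-head 10 f)) ⟩
        (1# - x) * (- 1# * y ^ 11 + (c 11 0 * 1# + ⨁ 10 (λ k → f (suc k))))
          ≈⟨ solve 4 (λ x y c s → (con (+ 1) :- x) :* (:- con (+ 1) :* y :+ (c :* con (+ 1) :+ s)) := (con (+ 1) :- x) :* (c :- y) :+ (con (+ 1) :- x) :* s) refl x (y ^ 11) (c 11 0) _ ⟩
        (1# - x) * (c 11 0 - y ^ 11) + (1# - x) * ⨁ 10 (λ k → f (suc k))
          ≈⟨ +-cong (*-congˡ (+-congʳ (c-zero 11))) middle ⟩
        (1# - x) * (1# - y ^ 11) + 0#
          ≈⟨ +-identityʳ _ ⟩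
        (1# - x) * (1# - y ^ 11) ∎
        where
        f : ℕ → Carrier
        f k = c 11 k * y ^ k
        add : ∀ k {s} → (1# - x) * c 11 k ≈ 0# → (1# - x) * s ≈ 0# → (1# - x) * (f k + s) ≈ 0#
        add k {s} e e′ = begin
          (1# - x) * (c 11 k * y ^ k + s)            ≈⟨ solve 4 (λ x c y s → x :* (c :* y :+ s) := x :* c :* y :+ x :* s) refl (1# - x) (c 11 k) (y ^ k) s ⟩
          (1# - x) * c 11 k * y ^ k + (1# - x) * s   ≈⟨ +-cong (trans (*-congʳ e) (zeroˡ _)) e′ ⟩
          0# + 0#                                    ≈⟨ +-identityˡ 0# ⟩
          0#                                         ∎
        middle : (1# - x) * ⨁ 10 (λ k → f (suc k)) ≈ 0#
        middle =
          add 10 (geometric-killed 10 10 9 ≡.refl) (add 9 (geometric-killed 9 5 4 ≡.refl) (add 8 (geometric-killed 8 7 5 ≡.refl) (add 7 (geometric-killed 7 8 5 ≡.refl)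
          (add 6 (geometric-killed 6 2 1 ≡.refl) (add 5 (geometric-killed 5 9 4 ≡.refl) (add 4 (geometric-killed 4 3 1 ≡.refl) (add 3 (geometric-killed 3 4 1 ≡.refl)
          (add 2 (geometric-killed 2 6 1 ≡.refl) (add 1 (geometric-killed 1 1 0 ≡.refl) (zeroʳ _))))))))))

      ∏-swap : ∀ m n (f : ℕ → ℕ → Carrier) → ∏ m (λ t → ∏ n (f t)) ≈ ∏ n (λ k → ∏ m (λ t → f t k))
      ∏-swap zero    n f = sym (∏-1 n (λ _ → refl))
      ∏-swap (suc m) n f = trans (*-congˡ (∏-swap m n f)) (sym (∏-* n (f m) _))

      -- A single z pays for all replacements, since it is still present after each of them.
      ∏-absorb : ∀ {z} n {f g} → (∀ k → z * f k ≈ z * g k) → z * ∏ n f ≈ z * ∏ n g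
      ∏-absorb zero    e = refl
      ∏-absorb {z} (suc n) {f} {g} e = begin
        z * (f n * ∏ n f)      ≈⟨ solve 3 (λ z a b → z :* (a :* b) := z :* a :* b) refl z (f n) (∏ n f) ⟩
        z * f n * ∏ n f        ≈⟨ *-congʳ (e n) ⟩
        z * g n * ∏ n f        ≈⟨ solve 3 (λ z a b → z :* a :* b := a :* (z :* b)) refl z (g n) (∏ n f) ⟩
        g n * (z * ∏ n f)      ≈⟨ *-congˡ (∏-absorb n e) ⟩
        g n * (z * ∏ n g)      ≈⟨ solve 3 (λ z a b → a :* (z :* b) := z :* (a :* b)) refl z (g n) (∏ n g) ⟩
        z * (g n * ∏ n g)      ∎

  module Annihilation (S : CommutativeRing 0ℓ 0ℓ) (q : CommutativeRing.Carrier S) (N : ℕ) (q^≈0 : TruncatedAt S q N) (halve : NoTwoTorsion S)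
                      (x : CommutativeRing.Carrier S) (x^11≈1 : EleventhRootOfUnity S x)
                      (C : CommutativeRing.Carrier S) (crank-product : CrankGeneratingFunction S x (Monomials._^_ S x 10) q N C) where
    open CommutativeRing S
    open Monomials S
    open IntegerCoefficients S
    open import Algebra.Properties.Ring ring using (-0#≈0#)
    open import Relation.Binary.Reasoning.Setoid setoid
    open Nilpotent S q N q^≈0
    open ListSum S using (∑; ∑-cong; ∑-*ˡ)
    open Products S q N q^≈0
    open Classes S q N q^≈0 halve
    open Units S x
    open Assembly S q N q^≈0 halve x x^11≈1
    open Cyclotomic S x using (cyclotomic; ∏-swap; ∏-absorb)
    open JacobiTripleProduct S q N q^≈0 using (θ; θ-product)

    bracket : ℕ → Carrier
    bracket t = ∏ L (λ k → 1# - x ^ t * q ^ suc k)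

    from-1 : ∀ v → ∏ L (λ k → 1# - v * q ^ k) ≈ (1# - v) * ∏ L (λ k → 1# - v * q ^ suc k)
    from-1 v = begin
      ∏ L (λ k → 1# - v * q ^ k)                          ≈⟨ trans (*-congʳ last≈1) (*-identityˡ _) ⟨
      (1# - v * q ^ L) * ∏ L (λ k → 1# - v * q ^ k)       ≈⟨ ∏-head L (λ k → 1# - v * q ^ k) ⟩
      (1# - v * 1#) * ∏ L (λ k → 1# - v * q ^ suc k)      ≈⟨ *-congʳ (+-congˡ (-‿cong (*-identityʳ v))) ⟩
      (1# - v) * ∏ L (λ k → 1# - v * q ^ suc k)           ∎
      where
      last≈1 : 1# - v * q ^ L ≈ 1#
      last≈1 = trans (+-congˡ (trans (-‿cong (trans (*-congˡ (vanish N<L)) (zeroʳ v))) -0#≈0#)) (+-identityʳ 1#)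

    θ-bracket : ∀ {u v} s t → v ≈ x ^ s → u ≈ x ^ t * q → u * v ≈ q → θ u v ≈ (1# - x ^ s) * bracket s * bracket t * poch L
    θ-bracket {u} {v} s t v≈ u≈ uv = trans (sym (θ-product u v uv L ℕₚ.≤-refl))
      (*-congʳ (*-cong (trans (∏-cong L (λ k → +-congˡ (-‿cong (*-congʳ v≈)))) (from-1 (x ^ s)))
                       (∏-cong L (λ k → +-congˡ (-‿cong (trans (*-congʳ u≈) (*-assoc _ _ _)))))))

    exponent-sum : ∀ s t → s ℕ.+ t ≡ 11 → (x ^ t * q) * x ^ s ≈ q
    exponent-sum s t e = begin
      x ^ t * q * x ^ s      ≈⟨ solve 3 (λ a q b → a :* q :* b := (b :* a) :* q) refl (x ^ t) q (x ^ s) ⟩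
      (x ^ s * x ^ t) * q    ≈⟨ *-congʳ (trans (sym (^-homo-* x s t)) (trans (^-≡ x e) x^11≈1)) ⟩
      1# * q                 ≈⟨ *-identityˡ q ⟩
      q                      ∎

    θ-bracket′ : ∀ {u v} s t → s ℕ.+ t ≡ 11 → v ≈ x ^ s → u ≈ x ^ t * q → θ u v ≈ (1# - x ^ s) * bracket s * bracket t * poch L
    θ-bracket′ s t e v≈ u≈ = θ-bracket s t v≈ u≈ (trans (*-cong u≈ v≈) (exponent-sum s t e))

    brackets : Carrier
    brackets = bracket 5 * bracket 6 * (bracket 2 * bracket 9) * (bracket 7 * bracket 4 * (bracket 3 * bracket 8))

    -- The four arguments are a = x⁵, b = x², a b = x⁷ and a / b = x³. The factors of the products
    -- (v; q)_∞ without q make up D.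
    w₁-product : w₁ ≈ D * (poch L * poch L * brackets)
    w₁-product = begin
      w₁
        ≈⟨ trans (*-congʳ (trans (*-cong (poch⁻¹-* L) (poch⁻¹-* L)) (*-identityˡ 1#))) (*-identityˡ w₁) ⟨
      (h * p) * (h * p) * w₁
        ≈⟨ solve 3 (λ h p y → (h :* p) :* (h :* p) :* y := h :* h :* (p :* p :* y)) refl h p w₁ ⟩
      h * h * (p * p * w₁)
        ≈⟨ *-congˡ (W₁.winquist L N≤L) ⟨
      h * h * (θ (b * c * w) (b * c) * θ (b * (c ^ 2 * w)) b * (θ (c * w) (b ^ 2 * c) * θ (b ^ 2 * (c * w)) c))
        ≈⟨ *-congˡ (*-cong
             (*-cong (θ-bracket′ 5 6 ≡.refl (solve 1 (λ x → x :^ 2 :* x :^ 3 := x :^ 5) refl x) (solve 2 (λ x q → x :^ 2 :* x :^ 3 :* (x :* q) := x :^ 6 :* q) refl x q))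
                     (θ-bracket′ 2 9 ≡.refl refl (solve 2 (λ x q → x :^ 2 :* ((x :^ 3) :^ 2 :* (x :* q)) := x :^ 9 :* q) refl x q)))
             (*-cong (θ-bracket′ 7 4 ≡.refl (solve 1 (λ x → (x :^ 2) :^ 2 :* x :^ 3 := x :^ 7) refl x) (solve 2 (λ x q → x :^ 3 :* (x :* q) := x :^ 4 :* q) refl x q))
                     (θ-bracket′ 3 8 ≡.refl refl (solve 2 (λ x q → (x :^ 2) :^ 2 :* (x :^ 3 :* (x :* q)) := x :^ 8 :* q) refl x q)))) ⟩
      h * h * (((1# - x ^ 5) * bracket 5 * bracket 6 * p) * ((1# - x ^ 2) * bracket 2 * bracket 9 * p) *
               (((1# - x ^ 7) * bracket 7 * bracket 4 * p) * ((1# - x ^ 3) * bracket 3 * bracket 8 * p)))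
        ≈⟨ solve 14 (λ h p d₅ d₂ d₇ d₃ b₅ b₆ b₂ b₉ b₇ b₄ b₃ b₈ →
             h :* h :* ((d₅ :* b₅ :* b₆ :* p) :* (d₂ :* b₂ :* b₉ :* p) :* ((d₇ :* b₇ :* b₄ :* p) :* (d₃ :* b₃ :* b₈ :* p)))
             := (h :* p) :* (h :* p) :* (d₅ :* d₂ :* d₇ :* d₃ :* (p :* p :* (b₅ :* b₆ :* (b₂ :* b₉) :* (b₇ :* b₄ :* (b₃ :* b₈)))))) refl
             h p (1# - x ^ 5) (1# - x ^ 2) (1# - x ^ 7) (1# - x ^ 3) (bracket 5) (bracket 6) (bracket 2) (bracket 9) (bracket 7) (bracket 4) (bracket 3) (bracket 8) ⟩
      (h * p) * (h * p) * (D * (p * p * brackets))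
        ≈⟨ trans (*-congʳ (trans (*-cong (poch⁻¹-* L) (poch⁻¹-* L)) (*-identityˡ 1#))) (*-identityˡ _) ⟩
      D * (p * p * brackets) ∎
      where
      h = poch⁻¹ L
      p = poch L
      b = x ^ 2
      c = x ^ 3
      w = x * q

    all-brackets : (1# - x) * ∏ 11 bracket ≈ (1# - x) * euler 11 (1 , 1)
    all-brackets = begin
      (1# - x) * ∏ 11 bracket                                        ≈⟨ *-congˡ (∏-swap x^11≈1 11 L (λ t k → 1# - x ^ t * q ^ suc k)) ⟩
      (1# - x) * ∏ L (λ k → ∏ 11 (λ t → 1# - x ^ t * q ^ suc k))     ≈⟨ ∏-absorb x^11≈1 L (λ k → cyclotomic x^11≈1 (q ^ suc k)) ⟩
      (1# - x) * ∏ L (λ k → 1# - (q ^ suc k) ^ 11)                   ≈⟨ *-congˡ (∏-cong L (λ k → +-congˡ (-‿cong (trans (^-assocʳ q (suc k) 11) (^-≡ q (arith k)))))) ⟩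
      (1# - x) * euler 11 (1 , 1)                                    ∎
      where
      arith : ∀ k → suc k ℕ.* 11 ≡ 11 ℕ.* (1 ℕ.+ k ℕ.* 1)
      arith k = ≡.trans (ℕₚ.*-comm (suc k) 11) (≡.cong (λ m → 11 ℕ.* suc m) (≡.sym (ℕₚ.*-identityʳ k)))

    -- One factor (q; q)_∞ is the bracket for t = 0, and the other is replaced by the brackets for t
    -- = 1 and t = 10 times C, so that all eleven brackets are present. The factor 1 - x that
    -- `cyclotomic` demands is split off from 1 - x⁵ in D.
    w₁-crank : w₁ ≈ D * (C * euler 11 (1 , 1))
    w₁-crank = begin
      w₁                                    ≈⟨ w₁-product ⟩
      D * (poch L * poch L * brackets)      ≈⟨ *-congˡ (*-congʳ (*-cong bracket₀ (sym (crank-product L N≤L)))) ⟩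
      D * (bracket 0 * (∏ L (λ k → 1# - x * q ^ suc k) * bracket 10 * C) * brackets)
        ≈⟨ *-congˡ (*-congʳ (*-congˡ (*-congʳ (*-congʳ (∏-cong L (λ k → +-congˡ (-‿cong (*-congʳ (sym (*-identityʳ x)))))))))) ⟩
      D * (bracket 0 * (bracket 1 * bracket 10 * C) * brackets)
        ≈⟨ solve 16 (λ x d₂ d₇ d₃ C b₀ b₁ b₂ b₃ b₄ b₅ b₆ b₇ b₈ b₉ b₁₀ →
             (con (+ 1) :- x :^ 5) :* d₂ :* d₇ :* d₃ :* (b₀ :* (b₁ :* b₁₀ :* C) :* (b₅ :* b₆ :* (b₂ :* b₉) :* (b₇ :* b₄ :* (b₃ :* b₈))))
             := (con (+ 1) :+ x :+ x :^ 2 :+ x :^ 3 :+ x :^ 4) :* d₂ :* d₇ :* d₃ :* C :*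
                ((con (+ 1) :- x) :* (b₁₀ :* (b₉ :* (b₈ :* (b₇ :* (b₆ :* (b₅ :* (b₄ :* (b₃ :* (b₂ :* (b₁ :* (b₀ :* con (+ 1))))))))))))) ) refl
             x (1# - x ^ 2) (1# - x ^ 7) (1# - x ^ 3) C (bracket 0) (bracket 1) (bracket 2) (bracket 3) (bracket 4) (bracket 5) (bracket 6) (bracket 7) (bracket 8) (bracket 9) (bracket 10) ⟩
      (1# + x + x ^ 2 + x ^ 3 + x ^ 4) * (1# - x ^ 2) * (1# - x ^ 7) * (1# - x ^ 3) * C * ((1# - x) * ∏ 11 bracket)
        ≈⟨ *-congˡ all-brackets ⟩
      (1# + x + x ^ 2 + x ^ 3 + x ^ 4) * (1# - x ^ 2) * (1# - x ^ 7) * (1# - x ^ 3) * C * ((1# - x) * euler 11 (1 , 1))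
        ≈⟨ solve 6 (λ x d₂ d₇ d₃ C e → (con (+ 1) :+ x :+ x :^ 2 :+ x :^ 3 :+ x :^ 4) :* d₂ :* d₇ :* d₃ :* C :* ((con (+ 1) :- x) :* e)
             := (con (+ 1) :- x :^ 5) :* d₂ :* d₇ :* d₃ :* (C :* e)) refl x (1# - x ^ 2) (1# - x ^ 7) (1# - x ^ 3) C (euler 11 (1 , 1)) ⟩
      D * (C * euler 11 (1 , 1)) ∎
      where
      bracket₀ : poch L ≈ bracket 0
      bracket₀ = ∏-cong L (λ k → +-congˡ (-‿cong (sym (*-identityˡ _))))

    sum-11 : ∀ r → j-of r ℕ.+ j-of r ℕ.+ (d-of r ℕ.+ d-of r ℕ.+ e-of r) ≡ 11
    sum-11 = from-yes (all? λ r → j-of r ℕ.+ j-of r ℕ.+ (d-of r ℕ.+ d-of r ℕ.+ e-of r) ℕ.≟ 11)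

    i-vExp : ∀ r → 11 ℕ.* (j-of r ℕ.+ d-of r) ≡ vExp (i-of r)
    i-vExp = from-yes (all? λ r → 11 ℕ.* (j-of r ℕ.+ d-of r) ℕ.≟ vExp (i-of r))

    i-wExp : ∀ r → 11 ℕ.* e-of r ≡ wExp (i-of r)
    i-wExp = from-yes (all? λ r → 11 ℕ.* e-of r ℕ.≟ wExp (i-of r))

    j-vExp : ∀ r → 11 ℕ.* j-of r ≡ vExp (j′-of r)
    j-vExp = from-yes (all? λ r → 11 ℕ.* j-of r ℕ.≟ vExp (j′-of r))

    j-wExp : ∀ r → 11 ℕ.* (d-of r ℕ.+ d-of r ℕ.+ e-of r) ≡ wExp (j′-of r)
    j-wExp = from-yes (all? λ r → 11 ℕ.* (d-of r ℕ.+ d-of r ℕ.+ e-of r) ℕ.≟ wExp (j′-of r))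

    E+F : ∀ r → E-exp (i-of r) ℕ.+ F-exp (j′-of r) ≡ g-of r
    E+F = from-yes (all? λ r → E-exp (i-of r) ℕ.+ F-exp (j′-of r) ℕ.≟ g-of r)

    F+E : ∀ r → F-exp (i-of r) ℕ.+ E-exp (j′-of r) ≡ g-of r ℕ.+ 11 ℕ.* d-of r
    F+E = from-yes (all? λ r → F-exp (i-of r) ℕ.+ E-exp (j′-of r) ℕ.≟ g-of r ℕ.+ 11 ℕ.* d-of r)

    -- The exponents E_i + F_j and F_i + E_j differ by 11 d. This is exactly the power c = q^(11 d)
    -- in Winquist's determinant, so a common q^g can be taken out.
    component : ∀ r → G (i-of r) * H (j′-of r) - H (i-of r) * G (j′-of r) ≈ q ^ g-of r * eulers 11 (factors-of r)
    component r = begin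
      (q ^ Ei * Ai) * (q ^ Fj * Bj) - (q ^ Fi * Bi) * (q ^ Ej * Aj)
        ≈⟨ solve 8 (λ e A f B f′ B′ e′ A′ → (e :* A) :* (f :* B) :- (f′ :* B′) :* (e′ :* A′) := (e :* f) :* (A :* B) :- (f′ :* e′) :* (B′ :* A′)) refl _ _ _ _ _ _ _ _ ⟩
      q ^ Ei * q ^ Fj * (Ai * Bj) - q ^ Fi * q ^ Ej * (Bi * Aj)
        ≈⟨ +-cong (*-congʳ (trans (sym (^-homo-* q Ei Fj)) (^-≡ q (E+F r))))
                  (-‿cong (*-congʳ (trans (sym (^-homo-* q Fi Ej)) (trans (^-≡ q (F+E r)) (^-homo-* q (g-of r) (11 ℕ.* d-of r)))))) ⟩
      q ^ g-of r * (Ai * Bj) - q ^ g-of r * q ^ (11 ℕ.* d-of r) * (Bi * Aj)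
        ≈⟨ solve 4 (λ g a d b → g :* a :- g :* d :* b := g :* (a :- d :* b)) refl _ _ _ _ ⟩
      q ^ g-of r * (Ai * Bj - q ^ (11 ℕ.* d-of r) * (Bi * Aj))
        ≈⟨ *-congˡ (+-cong (*-cong a-A′ b-B′) (-‿cong (*-congˡ (*-cong a-B′ b-A′)))) ⟨
      q ^ g-of r * (T.a.A * T.b.B - q ^ (11 ℕ.* d-of r) * (T.a.B * T.b.A))
        ≈⟨ *-congˡ Y-factor ⟩
      q ^ g-of r * eulers 11 (factors-of r) ∎
      where
      open Specialised (j-of r) (d-of r) (e-of r) (sum-11 r)
      Ei = E-exp (i-of r)
      Fj = F-exp (j′-of r)
      Fi = F-exp (i-of r)
      Ej = E-exp (j′-of r)
      Ai = Aᵢ-sum (i-of r)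
      Aj = Aᵢ-sum (j′-of r)
      Bi = B₁ᵢ-sum (i-of r) - B₂ᵢ-sum (i-of r)
      Bj = B₁ᵢ-sum (j′-of r) - B₂ᵢ-sum (j′-of r)
      a-A′ : T.a.A ≈ Ai
      a-A′ = a-A (vExp (i-of r)) (wExp (i-of r)) (vExp (j′-of r)) (wExp (j′-of r)) (i-vExp r) (i-wExp r) (j-vExp r) (j-wExp r)
      b-A′ : T.b.A ≈ Aj
      b-A′ = b-A (vExp (i-of r)) (wExp (i-of r)) (vExp (j′-of r)) (wExp (j′-of r)) (i-vExp r) (i-wExp r) (j-vExp r) (j-wExp r)
      a-B′ : T.a.B ≈ Bi
      a-B′ = a-B (vExp (i-of r)) (wExp (i-of r)) (vExp (j′-of r)) (wExp (j′-of r)) (i-vExp r) (i-wExp r) (j-vExp r) (j-wExp r)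
      b-B′ : T.b.B ≈ Bj
      b-B′ = b-B (vExp (i-of r)) (wExp (i-of r)) (vExp (j′-of r)) (wExp (j′-of r)) (i-vExp r) (i-wExp r) (j-vExp r) (j-wExp r)

    components : Carrier
    components = ∑ (allFin 10) (λ r → unit r * (q ^ g-of r * eulers 11 (factors-of r)))

    -- Both terms of the difference, multiplied by x² D, are equal to x² `w₁`: one by the product
    -- side, the other by the dissection.
    annihilated : x ^ 2 * D * (C * euler 11 (1 , 1) - components) ≈ 0#
    annihilated = begin
      x ^ 2 * D * (C * euler 11 (1 , 1) - components)
        ≈⟨ solve 5 (λ x d c e s → x :* d :* (c :* e :- s) := x :* (d :* (c :* e)) :- x :* d :* s) refl (x ^ 2) D C (euler 11 (1 , 1)) components ⟩
      x ^ 2 * (D * (C * euler 11 (1 , 1))) - x ^ 2 * D * components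
        ≈⟨ +-cong (*-congˡ (sym w₁-crank)) (-‿cong (sym (∑-*ˡ (allFin 10) (x ^ 2 * D) (λ r → unit r * (q ^ g-of r * eulers 11 (factors-of r)))))) ⟩
      x ^ 2 * w₁ - ∑ (allFin 10) (λ r → x ^ 2 * D * (unit r * (q ^ g-of r * eulers 11 (factors-of r))))
        ≈⟨ +-cong x²w₁-expansion (-‿cong (∑-cong (allFin 10) (λ r → trans (sym (*-assoc _ _ _)) (*-cong (sym (κ≈ r)) (sym (component r)))))) ⟩
      ∑ (allFin 10) (λ r → κ r * (G (i-of r) * H (j′-of r) - H (i-of r) * G (j′-of r))) - ∑ (allFin 10) (λ r → κ r * (G (i-of r) * H (j′-of r) - H (i-of r) * G (j′-of r)))
        ≈⟨ -‿inverseʳ _ ⟩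
      0# ∎

open CrankDissection

-- The annihilator of x² D, and the moments modulo 11.

module Moments where
  open GroupRing
  open import Data.Integer.Divisibility.Signed as ∣ₛ using (_∣_; divides)
  open import Data.Integer.Solver renaming (module +-*-Solver to ℤ-Solver)
  open import Data.Fin using (Fin; zero; suc; toℕ; _≟_)
  open import Data.Fin.Patterns
  open import Data.Fin.Properties using (all?)
  open import Relation.Binary.PropositionalEquality using (refl; cong; cong₂; sym; trans)
  open import Relation.Nullary.Decidable using (from-yes)
  open import Algebra.Properties.Semiring.Sum ℤₚ.+-*-semiring using (sum; sum-cong-≗; ∑-distrib-+; sum-permute; *-distribʳ-sum; sum-replicate-zero)

  infix 4 _≈₁₁_

  -- A record, because i and j could not be recovered from their difference alone.
  record _≈₁₁_ (i j : ℤ) : Set where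
    constructor congruent
    field
      11∣difference : + 11 ∣ (i ℤ.- j)

  open _≈₁₁_

  ℤ₁₁ : CommutativeRing 0ℓ 0ℓ
  ℤ₁₁ = record
    { Carrier = ℤ
    ; _≈_ = _≈₁₁_
    ; _+_ = ℤ._+_
    ; _*_ = ℤ._*_
    ; -_  = ℤ.-_
    ; 0#  = + 0
    ; 1#  = + 1
    ; isCommutativeRing = record
      { isRing = record
        { +-isAbelianGroup = record
          { isGroup = record
            { isMonoid = record
              { isSemigroup = record
                { isMagma = record
                  { isEquivalence = record { refl = λ {i} → exact {i} refl ; sym = λ {i} {j} → symmetric i j ; trans = λ {i} {j} {k} → transitive i j k }
                  ; ∙-cong = λ {i} {i′} {j} {j′} → +-congruent i i′ j j′ }
                ; assoc = λ i j k → exact (ℤₚ.+-assoc i j k) }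
              ; identity = (λ i → exact (ℤₚ.+-identityˡ i)) , (λ i → exact (ℤₚ.+-identityʳ i)) }
            ; inverse = (λ i → exact (ℤₚ.+-inverseˡ i)) , (λ i → exact (ℤₚ.+-inverseʳ i))
            ; ⁻¹-cong = λ {i} {j} → neg-congruent i j }
          ; comm = λ i j → exact (ℤₚ.+-comm i j) }
        ; *-cong = λ {i} {i′} {j} {j′} → *-congruent i i′ j j′
        ; *-assoc = λ i j k → exact (ℤₚ.*-assoc i j k)
        ; *-identity = (λ i → exact (ℤₚ.*-identityˡ i)) , (λ i → exact (ℤₚ.*-identityʳ i))
        ; distrib = (λ i j k → exact (ℤₚ.*-distribˡ-+ i j k)) , (λ i j k → exact (ℤₚ.*-distribʳ-+ i j k)) }
      ; *-comm = λ i j → exact (ℤₚ.*-comm i j) } }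
    where
    open ℤ-Solver
    exact : ∀ {i j} → i ≡ j → i ≈₁₁ j
    exact {i} refl = congruent (divides (+ 0) (ℤₚ.+-inverseʳ i))
    by : ∀ {i j} → i ≡ j → + 11 ∣ i → + 11 ∣ j
    by refl d = d
    symmetric : ∀ i j → i ≈₁₁ j → j ≈₁₁ i
    symmetric i j (congruent d) = congruent (by (solve 2 (λ i j → :- (i :- j) := j :- i) refl i j) (∣ₛ.∣m⇒∣-m d))
    transitive : ∀ i j k → i ≈₁₁ j → j ≈₁₁ k → i ≈₁₁ k
    transitive i j k (congruent d) (congruent e) = congruent (by (solve 3 (λ i j k → (i :- j) :+ (j :- k) := i :- k) refl i j k) (∣ₛ.∣m∣n⇒∣m+n d e))
    +-congruent : ∀ i i′ j j′ → i ≈₁₁ i′ → j ≈₁₁ j′ → (i ℤ.+ j) ≈₁₁ (i′ ℤ.+ j′)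
    +-congruent i i′ j j′ (congruent d) (congruent e) = congruent (by (solve 4 (λ i i′ j j′ → (i :- i′) :+ (j :- j′) := (i :+ j) :- (i′ :+ j′)) refl i i′ j j′) (∣ₛ.∣m∣n⇒∣m+n d e))
    neg-congruent : ∀ i j → i ≈₁₁ j → (ℤ.- i) ≈₁₁ (ℤ.- j)
    neg-congruent i j (congruent d) = congruent (by (solve 2 (λ i j → :- (i :- j) := :- i :- :- j) refl i j) (∣ₛ.∣m⇒∣-m d))
    *-congruent : ∀ i i′ j j′ → i ≈₁₁ i′ → j ≈₁₁ j′ → (i ℤ.* j) ≈₁₁ (i′ ℤ.* j′)
    *-congruent i i′ j j′ (congruent d) (congruent e) = congruent (by (solve 4 (λ i i′ j j′ → (i :- i′) :* j :+ i′ :* (j :- j′) := i :* j :- i′ :* j′) refl i i′ j j′)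
      (∣ₛ.∣m∣n⇒∣m+n (∣ₛ.∣m⇒∣m*n j d) (∣ₛ.∣n⇒∣m*n i′ e)))

  open CommutativeRing groupRing using () renaming (_≈_ to _≈ᴬ_; _-_ to _-ᴬ_; _+_ to _+ᴬ_; -_ to -ᴬ_; 1# to 1ᴬ; 0# to 0ᴬ)
  module A = CommutativeRing groupRing
  module A^ = Monomials groupRing
  open A^ using (_^_)

  x : Element
  x = basis 1F

  next : ℤ/11 → ℤ/11
  next c = c ⊟ suc 9F

  class : ℕ → ℤ/11
  class zero    = 0F
  class (suc n) = next (class n)

  x✶basis : ∀ c k → basis c (k ⊟ 1F) ≡ basis (next c) k
  x✶basis = from-yes (all? λ c → all? λ k → basis c (k ⊟ 1F) ℤ.≟ basis (next c) k)

  x^≈basis : ∀ n → x ^ n ≈ᴬ basis (class n)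
  x^≈basis zero    k = refl
  x^≈basis (suc n) k = trans (basis-✶ 1F (x ^ n) k) (trans (x^≈basis n (k ⊟ 1F)) (x✶basis (class n) k))

  x^11≈1 : x ^ 11 ≈ᴬ 1ᴬ
  x^11≈1 = x^≈basis 11

  1-x^-✶ : ∀ n f k → ((1ᴬ -ᴬ x ^ n) ✶ f) k ≡ f k ℤ.- f (k ⊟ class n)
  1-x^-✶ n f k = trans (A.distribʳ f 1ᴬ (-ᴬ (x ^ n)) k) (cong₂ ℤ._+_ (A.*-identityˡ f k)
    (trans (sym (-‿distribˡ-* (x ^ n) f k)) (cong ℤ.-_ (trans (A.*-congʳ {f} (x^≈basis n) k) (basis-✶ (class n) f k)))))
    where open import Algebra.Properties.Ring A.ring using (-‿distribˡ-*)

  Constant : Element → Set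
  Constant f = ∀ k → f k ≡ f 0F

  iterate : ℕ → ℤ/11 → ℤ/11 → ℤ/11
  iterate zero    c k = k
  iterate (suc n) c k = iterate n c (k ⊟ c)

  -- The numbers 6, 4, 9, 8 are the inverses of 2, 3, 5, 7 modulo 11, so that many times k steps of
  -- the given length lead from k back to 0.
  reach : ∀ k → iterate (toℕ k ℕ.* 6) 2F k ≡ 0F × iterate (toℕ k ℕ.* 4) 3F k ≡ 0F × iterate (toℕ k ℕ.* 9) 5F k ≡ 0F × iterate (toℕ k ℕ.* 8) 7F k ≡ 0F
  reach k = r₂ k , r₃ k , r₅ k , r₇ k
    where
    r₂ : ∀ k → iterate (toℕ k ℕ.* 6) 2F k ≡ 0F
    r₂ = from-yes (all? λ k → iterate (toℕ k ℕ.* 6) 2F k ≟ 0F)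
    r₃ : ∀ k → iterate (toℕ k ℕ.* 4) 3F k ≡ 0F
    r₃ = from-yes (all? λ k → iterate (toℕ k ℕ.* 4) 3F k ≟ 0F)
    r₅ : ∀ k → iterate (toℕ k ℕ.* 9) 5F k ≡ 0F
    r₅ = from-yes (all? λ k → iterate (toℕ k ℕ.* 9) 5F k ≟ 0F)
    r₇ : ∀ k → iterate (toℕ k ℕ.* 8) 7F k ≡ 0F
    r₇ = from-yes (all? λ k → iterate (toℕ k ℕ.* 8) 7F k ≟ 0F)

  invariant⇒constant : ∀ c m {f : Element} → (∀ k → iterate (toℕ k ℕ.* m) c k ≡ 0F) → (∀ k → f k ≡ f (k ⊟ c)) → Constant f
  invariant⇒constant c m {f} r inv k = trans (go (toℕ k ℕ.* m) k) (cong f (r k))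
    where
    go : ∀ n k → f k ≡ f (iterate n c k)
    go zero    k = refl
    go (suc n) k = trans (inv k) (go n (k ⊟ c))

  killed⇒constant : ∀ n m {f} → (∀ k → iterate (toℕ k ℕ.* m) (class n) k ≡ 0F) → (1ᴬ -ᴬ x ^ n) ✶ f ≈ᴬ 0ᴬ → Constant f
  killed⇒constant n m {f} r e = invariant⇒constant (class n) m r (λ k → ℤₚ.i-j≡0⇒i≡j (f k) (f (k ⊟ class n)) (trans (sym (1-x^-✶ n f k)) (e k)))

  sum-killed : ∀ n f → sum ((1ᴬ -ᴬ x ^ n) ✶ f) ≡ + 0
  sum-killed n f = begin
    sum ((1ᴬ -ᴬ x ^ n) ✶ f)                                  ≡⟨ sum-cong-≗ {11} (1-x^-✶ n f) ⟩
    sum (λ k → f k ℤ.+ (ℤ.- f (k ⊟ class n)))                ≡⟨ ∑-distrib-+ f (λ k → ℤ.- f (k ⊟ class n)) ⟩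
    sum f ℤ.+ sum (λ k → ℤ.- f (k ⊟ class n))                ≡⟨ cong (λ s → sum f ℤ.+ s) (sym (sum-permute (λ k → ℤ.- f k) (translation (class n)))) ⟩
    sum f ℤ.+ sum (λ k → ℤ.- f k)                            ≡⟨ ∑-distrib-+ f (λ k → ℤ.- f k) ⟨
    sum (λ k → f k ℤ.+ (ℤ.- f k))                            ≡⟨ sum-cong-≗ {11} (λ k → ℤₚ.+-inverseʳ (f k)) ⟩
    + 0                                                      ∎
    where open ≡.≡-Reasoning

  -- The coefficients of a multiple of 1 - x^n sum to 0; if they are all equal to m, then 11 m = 0.
  constant-killed : ∀ n f → Constant ((1ᴬ -ᴬ x ^ n) ✶ f) → (1ᴬ -ᴬ x ^ n) ✶ f ≈ᴬ 0ᴬ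
  constant-killed n f const k = trans (const k) (ℤₚ.*-cancelˡ-≡ (+ 11) m (+ 0) (begin
    + 11 ℤ.* m             ≡⟨ ℤ-Solver.solve 1 (λ m → con (+ 11) :* m := m :+ (m :+ (m :+ (m :+ (m :+ (m :+ (m :+ (m :+ (m :+ (m :+ (m :+ con (+ 0)))))))))))) refl m ⟩
    sum {11} (λ _ → m)     ≡⟨ sum-cong-≗ {11} const ⟨
    sum g                  ≡⟨ sum-killed n f ⟩
    + 0                    ∎))
    where
    open ≡.≡-Reasoning
    open ℤ-Solver using (con; _:*_; _:+_; _:=_)
    g = (1ᴬ -ᴬ x ^ n) ✶ f
    m = g 0F

  D₀ : Element
  D₀ = (1ᴬ -ᴬ x ^ 5) ✶ (1ᴬ -ᴬ x ^ 2) ✶ (1ᴬ -ᴬ x ^ 7) ✶ (1ᴬ -ᴬ x ^ 3)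

  -- The factors of D are stripped one at a time. An element killed by 1 - x^n, with n prime to 11,
  -- is constant; being also a multiple of the next factor it is 0. After the last factor no further
  -- multiple is at hand, and f itself is only known to be constant.
  annihilator : ∀ f → (x ^ 2 ✶ D₀) ✶ f ≈ᴬ 0ᴬ → Constant f
  annihilator f e = killed⇒constant 3 4 {f} (λ k → proj₁ (proj₂ (reach k))) zero₃
    where
    f₃ f₇ f₂ : Element
    f₃ = (1ᴬ -ᴬ x ^ 3) ✶ f
    f₇ = (1ᴬ -ᴬ x ^ 7) ✶ f₃
    f₂ = (1ᴬ -ᴬ x ^ 2) ✶ f₇
    zero₅ : (1ᴬ -ᴬ x ^ 5) ✶ f₂ ≈ᴬ 0ᴬ
    zero₅ = A^.cancel-x² x (1ᴬ -ᴬ x ^ 5) (1ᴬ -ᴬ x ^ 2) (1ᴬ -ᴬ x ^ 7) (1ᴬ -ᴬ x ^ 3) f x^11≈1 e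
    zero₂ : f₂ ≈ᴬ 0ᴬ
    zero₂ = constant-killed 2 f₇ (killed⇒constant 5 9 {f₂} (λ k → proj₁ (proj₂ (proj₂ (reach k)))) zero₅)
    zero₇ : f₇ ≈ᴬ 0ᴬ
    zero₇ = constant-killed 7 f₃ (killed⇒constant 2 6 {f₇} (λ k → proj₁ (reach k)) zero₂)
    zero₃ : f₃ ≈ᴬ 0ᴬ
    zero₃ = constant-killed 3 f (killed⇒constant 7 8 {f₃} (λ k → proj₂ (proj₂ (proj₂ (reach k)))) zero₇)

  moment : ℕ → Element → ℤ
  moment k f = sum (λ c → (+ toℕ c) ℤ.^ k ℤ.* f c)

  moment-cong : ∀ k {f g} → f ≈ᴬ g → moment k f ≡ moment k g
  moment-cong k e = sum-cong-≗ {11} (λ c → cong ((+ toℕ c) ℤ.^ k ℤ.*_) (e c))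

  moment-+ : ∀ k f g → moment k (f +ᴬ g) ≡ moment k f ℤ.+ moment k g
  moment-+ k f g = trans (sum-cong-≗ {11} (λ c → ℤₚ.*-distribˡ-+ ((+ toℕ c) ℤ.^ k) (f c) (g c))) (∑-distrib-+ (λ c → (+ toℕ c) ℤ.^ k ℤ.* f c) (λ c → (+ toℕ c) ℤ.^ k ℤ.* g c))

  moment-0 : ∀ k → moment k 0ᴬ ≡ + 0
  moment-0 k = trans (sum-cong-≗ {11} (λ c → ℤₚ.*-zeroʳ ((+ toℕ c) ℤ.^ k))) (sum-replicate-zero 11)

  moment-neg : ∀ k f → moment k (-ᴬ f) ≡ ℤ.- moment k f
  moment-neg k f = ℤₚ.i-j≡0⇒i≡j (moment k (-ᴬ f)) (ℤ.- moment k f) (begin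
    moment k (-ᴬ f) ℤ.- (ℤ.- moment k f)   ≡⟨ cong (λ s → moment k (-ᴬ f) ℤ.+ s) (ℤₚ.neg-involutive (moment k f)) ⟩
    moment k (-ᴬ f) ℤ.+ moment k f         ≡⟨ moment-+ k (-ᴬ f) f ⟨
    moment k (-ᴬ f +ᴬ f)                   ≡⟨ moment-cong k (λ c → ℤₚ.+-inverseˡ (f c)) ⟩
    moment k 0ᴬ                            ≡⟨ moment-0 k ⟩
    + 0                                    ∎)
    where open ≡.≡-Reasoning

  module Z = CommutativeRing ℤ₁₁

  ≡⇒≈₁₁ : ∀ {i j} → i ≡ j → i ≈₁₁ j
  ≡⇒≈₁₁ = Z.reflexive

  moment-basis : ∀ k c → moment k (basis c) ≡ (+ toℕ c) ℤ.^ k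
  moment-basis k c = trans (sum-cong-≗ {11} (λ i → ℤₚ.*-comm ((+ toℕ i) ℤ.^ k) (basis c i))) (sum-pick c (λ i → (+ toℕ i) ℤ.^ k))

  Even : Set
  Even = Fin 4

  exponent : Even → ℕ
  exponent e = 2 ℕ.* suc (toℕ e)

  -- The sum of c^k over the residues modulo 11 is divisible by 11 for k = 2, 4, 6, 8. It fails at k
  -- = 10, where the sum is 10 modulo 11.
  moment-constant : ∀ e f → Constant f → moment (exponent e) f ≈₁₁ + 0
  moment-constant e f const = Z.trans (≡⇒≈₁₁ (begin
    moment k f                                   ≡⟨ sum-cong-≗ {11} (λ c → cong ((+ toℕ c) ℤ.^ k ℤ.*_) (const c)) ⟩
    sum {11} (λ c → (+ toℕ c) ℤ.^ k ℤ.* m)       ≡⟨ *-distribʳ-sum {11} m (λ c → (+ toℕ c) ℤ.^ k) ⟨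
    sum {11} (λ c → (+ toℕ c) ℤ.^ k) ℤ.* m       ∎)) (Z.trans (Z.*-congʳ {m} (powers e)) (≡⇒≈₁₁ (ℤₚ.*-zeroˡ m)))
    where
    open ≡.≡-Reasoning
    k = exponent e
    m = f 0F
    powers : ∀ e → sum {11} (λ c → (+ toℕ c) ℤ.^ exponent e) ≈₁₁ + 0
    powers e = congruent (from-yes (all? λ e → + 11 ∣ₛ.∣? (sum {11} (λ c → (+ toℕ c) ℤ.^ exponent e) ℤ.- + 0)) e)

  ^-cong₁₁ : ∀ k {i j} → i ≈₁₁ j → i ℤ.^ k ≈₁₁ j ℤ.^ k
  ^-cong₁₁ zero    e = Z.refl
  ^-cong₁₁ (suc k) e = Z.*-cong e (^-cong₁₁ k e)

  class≈ : ∀ n → + toℕ (class n) ≈₁₁ + n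
  class≈ zero    = Z.refl
  class≈ (suc n) = Z.trans (next≈ (class n)) (Z.+-congˡ {+ 1} (class≈ n))
    where
    next≈ : ∀ c → + toℕ (next c) ≈₁₁ + suc (toℕ c)
    next≈ c = congruent (from-yes (all? λ c → + 11 ∣ₛ.∣? (+ toℕ (next c) ℤ.- + suc (toℕ c))) c)

  moment-x^ : ∀ k n → moment k (x ^ n) ≈₁₁ (+ n) ℤ.^ k
  moment-x^ k n = Z.trans (≡⇒≈₁₁ (trans (moment-cong k (x^≈basis n)) (moment-basis k (class n)))) (^-cong₁₁ k (class≈ n))

-- Ring homomorphisms, additive maps and extraction of residue classes.

module Transport where
  import Data.Nat.Tactic.RingSolver as ℕ-Solver
  open import Data.Fin.Patterns
  open import Data.List using ([]; _∷_; allFin)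

  record RingHomomorphism (R S : CommutativeRing 0ℓ 0ℓ) : Set where
    private
      module R = CommutativeRing R
      module S = CommutativeRing S
    open S using (_≈_)
    field
      ι      : R.Carrier → S.Carrier
      ι-cong : ∀ {a b} → a R.≈ b → ι a ≈ ι b
      ι-+    : ∀ a b → ι (a R.+ b) ≈ ι a S.+ ι b
      ι-*    : ∀ a b → ι (a R.* b) ≈ ι a S.* ι b
      ι-neg  : ∀ a → ι (R.- a) ≈ S.- ι a
      ι-1    : ι R.1# ≈ S.1#

  module HomomorphicImages (R S : CommutativeRing 0ℓ 0ℓ) (φ : RingHomomorphism R S) (x : CommutativeRing.Carrier R) where
    private
      module R = CommutativeRing R
      module S = CommutativeRing S
      module R^ = Monomials R
      module S^ = Monomials S
    open S using (_≈_; trans)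
    open RingHomomorphism φ

    private
      module UR = Units R x
      module US = Units S (ι x)

    ι-^ : ∀ n → ι (x R^.^ n) ≈ ι x S^.^ n
    ι-^ zero    = ι-1
    ι-^ (suc n) = trans (ι-* x (x R^.^ n)) (S.*-congˡ {ι x} (ι-^ n))

    private
      infixl 6 _⟨+⟩_ _⟨-⟩_
      infixl 7 _⟨*⟩_
      _⟨+⟩_ : ∀ {a b a′ b′} → ι a ≈ a′ → ι b ≈ b′ → ι (a R.+ b) ≈ a′ S.+ b′
      _⟨+⟩_ {a} {b} e f = trans (ι-+ a b) (S.+-cong e f)
      _⟨*⟩_ : ∀ {a b a′ b′} → ι a ≈ a′ → ι b ≈ b′ → ι (a R.* b) ≈ a′ S.* b′
      _⟨*⟩_ {a} {b} e f = trans (ι-* a b) (S.*-cong e f)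
      ⟨-⟩_ : ∀ {a a′} → ι a ≈ a′ → ι (R.- a) ≈ S.- a′
      ⟨-⟩_ {a} e = trans (ι-neg a) (S.-‿cong e)
      _⟨-⟩_ : ∀ {a b a′ b′} → ι a ≈ a′ → ι b ≈ b′ → ι (a R.- b) ≈ a′ S.- b′
      e ⟨-⟩ f = e ⟨+⟩ (⟨-⟩ f)

    ι-x²D : ι (x R^.^ 2 R.* UR.D) ≈ ι x S^.^ 2 S.* US.D
    ι-x²D = ι-^ 2 ⟨*⟩ ((ι-1 ⟨-⟩ ι-^ 5) ⟨*⟩ (ι-1 ⟨-⟩ ι-^ 2) ⟨*⟩ (ι-1 ⟨-⟩ ι-^ 7) ⟨*⟩ (ι-1 ⟨-⟩ ι-^ 3))

    ι-unit : ∀ r → ι (UR.unit r) ≈ US.unit r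
    ι-unit 0F = ι-1
    ι-unit 1F = ι-^ 1 ⟨+⟩ ι-^ 10 ⟨-⟩ ι-1
    ι-unit 2F = ι-^ 2 ⟨+⟩ ι-^ 9
    ι-unit 3F = ι-1 ⟨+⟩ ι-^ 3 ⟨+⟩ ι-^ 8
    ι-unit 4F = ι-1 ⟨+⟩ ι-^ 2 ⟨+⟩ ι-^ 4 ⟨+⟩ ι-^ 7 ⟨+⟩ ι-^ 9
    ι-unit 5F = ⟨-⟩ ι-^ 2 ⟨-⟩ ι-^ 4 ⟨-⟩ ι-^ 7 ⟨-⟩ ι-^ 9
    ι-unit 6F = ι-^ 1 ⟨+⟩ ι-^ 4 ⟨+⟩ ι-^ 7 ⟨+⟩ ι-^ 10
    ι-unit 7F = ι-^ 1 ⟨+⟩ ι-^ 3 ⟨+⟩ ι-^ 4 ⟨+⟩ ι-^ 7 ⟨+⟩ ι-^ 8 ⟨+⟩ ι-^ 10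
    ι-unit 8F = ⟨-⟩ ι-1 ⟨-⟩ ι-^ 4 ⟨-⟩ ι-^ 7
    ι-unit 9F = ⟨-⟩ ι-^ 3 ⟨-⟩ ι-^ 8

  -- The map h is merely additive. This suffices because the products are given as shifts and
  -- subtractions.
  module Coefficientwise (R S : CommutativeRing 0ℓ 0ℓ) where
    private
      module R = CommutativeRing R
      module S = CommutativeRing S
      module PR = PowerSeries R
      module P = PowerSeries S
    open S using (_≈_; trans; refl)

    module _ (h : R.Carrier → S.Carrier)
             (h-+ : ∀ a b → h (a R.+ b) ≈ h a S.+ h b) (h-neg : ∀ a → h (R.- a) ≈ S.- h a) (h-0 : h R.0# ≈ S.0#) where

      h-shift : ∀ e f n → h (PR.shift e f n) ≈ P.shift e (λ m → h (f m)) n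
      h-shift zero    f n       = refl
      h-shift (suc e) f zero    = h-0
      h-shift (suc e) f (suc n) = h-shift e f n

      h-const : ∀ c n → h (PR.const c n) ≈ P.const (h c) n
      h-const c zero    = refl
      h-const c (suc n) = h-0

      h-times : ∀ e f n → h (PR.times e f n) ≈ P.times e (λ m → h (f m)) n
      h-times e f n = trans (h-+ (f n) (R.- PR.shift e f n)) (S.+-congˡ {h (f n)} (trans (h-neg (PR.shift e f n)) (S.-‿cong (h-shift e f n))))

      h-times-all : ∀ L e f n → h (PR.times-all L e f n) ≈ P.times-all L e (λ m → h (f m)) n
      h-times-all zero    e f n = refl
      h-times-all (suc L) e f n = trans (h-times (e L) (PR.times-all L e f) n) (P.times-cong (e L) (h-times-all L e f) n)

      h-times-eulers : ∀ L t l f n → h (PR.times-eulers L t l f n) ≈ P.times-eulers L t l (λ m → h (f m)) n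
      h-times-eulers L t []            f n = refl
      h-times-eulers L t ((a , m) ∷ l) f n =
        trans (h-times-all L _ (PR.times-eulers L t l f) n) (P.times-all-cong L _ (h-times-eulers L t l f) n)

  module Decimation (R : CommutativeRing 0ℓ 0ℓ) where
    open CommutativeRing R
    open PowerSeries R
    open import Algebra.Properties.Ring ring using (-0#≈0#)
    open import Relation.Binary.Reasoning.Setoid setoid

    shift-above : ∀ e f n → shift e f (e ℕ.+ n) ≈ f n
    shift-above zero    f n = refl
    shift-above (suc e) f n = shift-above e f n

    shift-const-on : ∀ e c → shift e (const c) e ≈ c
    shift-const-on zero    c = refl
    shift-const-on (suc e) c = shift-const-on e c

    shift-const-off : ∀ e c n → ¬ n ≡ e → shift e (const c) n ≈ 0#
    shift-const-off zero    c zero    n≢e with () ← n≢e ≡.refl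
    shift-const-off zero    c (suc n) n≢e = refl
    shift-const-off (suc e) c zero    n≢e = refl
    shift-const-off (suc e) c (suc n) n≢e = shift-const-off e c n (λ e → n≢e (≡.cong suc e))

    -- This collects the exponents congruent to s modulo 11 (for s < 11) and replaces q¹¹ by q.
    decimate : ℕ → PS → PS
    decimate s f n = f (11 ℕ.* n ℕ.+ s)

    decimate-shift : ∀ {s} → s < 11 → ∀ e f n → shift (11 ℕ.* e) f (11 ℕ.* n ℕ.+ s) ≈ shift e (decimate s f) n
    decimate-shift {s} s<11 e f n with e ℕ.≤? n
    ... | yes e≤n = begin
      shift (11 ℕ.* e) f (11 ℕ.* n ℕ.+ s)                         ≡⟨ ≡.cong (λ n → shift (11 ℕ.* e) f (11 ℕ.* n ℕ.+ s)) (ℕₚ.m+[n∸m]≡n e≤n) ⟨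
      shift (11 ℕ.* e) f (11 ℕ.* (e ℕ.+ m) ℕ.+ s)                 ≡⟨ ≡.cong (shift (11 ℕ.* e) f) (arith e m s) ⟩
      shift (11 ℕ.* e) f (11 ℕ.* e ℕ.+ (11 ℕ.* m ℕ.+ s))          ≈⟨ shift-above (11 ℕ.* e) f (11 ℕ.* m ℕ.+ s) ⟩
      decimate s f m                                              ≈⟨ shift-above e (decimate s f) m ⟨
      shift e (decimate s f) (e ℕ.+ m)                            ≡⟨ ≡.cong (shift e (decimate s f)) (ℕₚ.m+[n∸m]≡n e≤n) ⟩
      shift e (decimate s f) n                                    ∎
      where
      m = n ℕ.∸ e
      arith : ∀ e m s → 11 ℕ.* (e ℕ.+ m) ℕ.+ s ≡ 11 ℕ.* e ℕ.+ (11 ℕ.* m ℕ.+ s)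
      arith = ℕ-Solver.solve-∀
    ... | no e≰n = trans (shift-below (11 ℕ.* e) f (11 ℕ.* n ℕ.+ s) s-below) (sym (shift-below e (decimate s f) n (ℕₚ.≰⇒> e≰n)))
      where
      arith : ∀ n → 11 ℕ.* n ℕ.+ 11 ≡ 11 ℕ.* suc n
      arith = ℕ-Solver.solve-∀
      s-below : 11 ℕ.* n ℕ.+ s < 11 ℕ.* e
      s-below = ℕₚ.<-≤-trans (ℕₚ.+-monoʳ-< (11 ℕ.* n) s<11) (ℕₚ.≤-trans (ℕₚ.≤-reflexive (arith n)) (ℕₚ.*-monoʳ-≤ 11 (ℕₚ.≰⇒> e≰n)))

    module _ {s} (s<11 : s < 11) where

      -- A shift by a multiple of 11 preserves residue classes, so it passes to the extracted
      -- series. The factor 1 on the right is the scale t of `times-eulers`, which drops from 11 to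
      -- 1.
      decimate-times : ∀ e f → decimate s (times (11 ℕ.* e) f) ≋ times (1 ℕ.* e) (decimate s f)
      decimate-times e f n = +-congˡ (-‿cong (trans (decimate-shift s<11 e f n)
        (reflexive (≡.cong (λ e → shift e (decimate s f) n) (≡.sym (ℕₚ.*-identityˡ e))))))

      decimate-times-all : ∀ L (e : ℕ → ℕ) f → decimate s (times-all L (λ k → 11 ℕ.* e k) f) ≋ times-all L (λ k → 1 ℕ.* e k) (decimate s f)
      decimate-times-all zero    e f n = refl
      decimate-times-all (suc L) e f n = trans (decimate-times (e L) (times-all L (λ k → 11 ℕ.* e k) f) n) (times-cong (1 ℕ.* e L) (decimate-times-all L e f) n)

      decimate-times-eulers : ∀ L l f → decimate s (times-eulers L 11 l f) ≋ times-eulers L 1 l (decimate s f)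
      decimate-times-eulers L []            f n = refl
      decimate-times-eulers L ((a , m) ∷ l) f n =
        trans (decimate-times-all L (λ k → a ℕ.+ k ℕ.* m) (times-eulers L 11 l f) n) (times-all-cong L _ (decimate-times-eulers L l f) n)

      decimate-const : ∀ t c → decimate s (shift (11 ℕ.* t ℕ.+ s) (const c)) ≋ shift t (const c)
      decimate-const t c n with n ℕ.≟ t
      ... | yes ≡.refl = trans (shift-const-on (11 ℕ.* t ℕ.+ s) c) (sym (shift-const-on t c))
      ... | no n≢t     = trans (shift-const-off (11 ℕ.* t ℕ.+ s) c _ (λ e → n≢t (ℕₚ.*-cancelˡ-≡ n t 11 (ℕₚ.+-cancelʳ-≡ s _ _ e)))) (sym (shift-const-off t c n n≢t))

    times-0 : ∀ e {f} → (∀ n → f n ≈ 0#) → ∀ n → times e f n ≈ 0#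
    times-0 e {f} f≈0 n = trans (+-cong (f≈0 n) (trans (-‿cong (shift-0 e f≈0 n)) -0#≈0#)) (+-identityˡ 0#)
      where
      shift-0 : ∀ e {f} → (∀ n → f n ≈ 0#) → ∀ n → shift e f n ≈ 0#
      shift-0 zero    f≈0 n       = f≈0 n
      shift-0 (suc e) f≈0 zero    = refl
      shift-0 (suc e) f≈0 (suc n) = shift-0 e f≈0 n

    times-all-0 : ∀ L e {f} → (∀ n → f n ≈ 0#) → ∀ n → times-all L e f n ≈ 0#
    times-all-0 zero    e f≈0 = f≈0
    times-all-0 (suc L) e f≈0 = times-0 (e L) (times-all-0 L e f≈0)

    times-eulers-0 : ∀ L t l {f} → (∀ n → f n ≈ 0#) → ∀ n → times-eulers L t l f n ≈ 0#
    times-eulers-0 L t []            f≈0 = f≈0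
    times-eulers-0 L t ((a , m) ∷ l) f≈0 = times-all-0 L _ (times-eulers-0 L t l f≈0)

  module Transported (R S : CommutativeRing 0ℓ 0ℓ) (φ : RingHomomorphism R S) (x : CommutativeRing.Carrier R) (x^11≈1 : EleventhRootOfUnity R x)
                     (q : CommutativeRing.Carrier S) (N : ℕ) (q^≈0 : TruncatedAt S q N) (halve : NoTwoTorsion S) (C : CommutativeRing.Carrier S)
                     (crank-product : CrankGeneratingFunction S (RingHomomorphism.ι φ x) (RingHomomorphism.ι φ (Monomials._^_ R x 10)) q N C) where
    private
      module R = CommutativeRing R
      module R^ = Monomials R
    open CommutativeRing S
    open Monomials S
    open IntegerCoefficients S
    open ListSum S using (∑; ∑-cong)
    open RingHomomorphism φ
    open HomomorphicImages R S φ x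

    private
      module Ann = Annihilation S q N q^≈0 halve (ι x) (trans (sym (ι-^ 11)) (trans (ι-cong x^11≈1) ι-1)) C
        (λ L N≤L → trans (*-congʳ (*-congˡ (∏-cong L (λ k → +-congˡ (-‿cong (*-congʳ (sym (ι-^ 10)))))))) (crank-product L N≤L))

    open Products S q N q^≈0 using (euler; eulers)

    components : Carrier
    components = ∑ (allFin 10) (λ r → eulers 11 (factors-of r) * (q ^ g-of r * ι (Units.unit R x r)))

    -- The annihilating factor appears as the image of one element of R. When the homomorphism is
    -- the embedding of constants into power series, the relation can then be read off in each
    -- coefficient separately.
    annihilated : ι (x R^.^ 2 R.* Units.D R x) * (euler 11 (1 , 1) * C - components) ≈ 0#
    annihilated = trans (*-cong ι-x²D (+-cong (*-comm _ _) (-‿cong (∑-cong (allFin 10) (λ r → reorder (ι-unit r) (q ^ g-of r) (eulers 11 (factors-of r))))))) Ann.annihilated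
      where
      reorder : ∀ {u v} → v ≈ u → ∀ g e → e * (g * v) ≈ u * (g * e)
      reorder {u} {v} v≈u g e = trans (solve 3 (λ v g e → e :* (g :* v) := v :* (g :* e)) refl v g e) (*-congʳ v≈u)

open Transport

-- Moments of the crank generating function.

module CrankMoments where
  open import Defs
  open GroupRing
  open BoundedPartitions
  open Moments
  open import Data.Integer.Divisibility.Signed as ∣ₛ using (_∣_; divides)
  open import Data.Integer.Solver renaming (module +-*-Solver to ℤ-Solver)
  open import Data.Fin as Fin using (Fin; suc; toℕ; fromℕ<)
  import Data.Fin.Properties as Finₚ
  open import Data.Bool using (if_then_else_)
  open import Data.List using ([]; _∷_; filter; length)
  open import Data.List.Membership.Propositional using (_∈_)
  open import Data.List.Relation.Unary.Any using (here; there)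
  open import Data.Product using (∃)
  open import Relation.Binary.PropositionalEquality using (refl; cong; cong₂; sym; trans)
  open import Relation.Nullary.Decidable using (from-yes; dec-true; dec-false)
  open import Algebra.Properties.Semiring.Sum ℤₚ.+-*-semiring using (sum; sum-cong-≗; ∑-distrib-+; sum-replicate-zero)
  open import Algebra.Properties.AbelianGroup ℤₚ.+-0-abelianGroup using (∙-cancelʳ)

  open A^ using (_^_)

  x⁻¹ : Element
  x⁻¹ = x ^ 10

  open CrankSeries groupRing x x⁻¹ using (crankSeries; x^ℤ)
  module ΣA = ListSum groupRing
  module ΣZ = ListSum ℤ₁₁

  -- Negative powers cause no trouble: x⁻¹ is x¹⁰, and 10 ≡ -1 modulo 11.
  moment-x^ℤ : ∀ k i → moment k (x^ℤ i) ≈₁₁ i ℤ.^ k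
  moment-x^ℤ k (+ n)    = moment-x^ k n
  moment-x^ℤ k -[1+ n ] = Z.trans (≡⇒≈₁₁ (moment-cong k (A^.^-assocʳ x 10 (suc n)))) (Z.trans (moment-x^ k (10 ℕ.* suc n)) (^-cong₁₁ k ten))
    where
    ten : + (10 ℕ.* suc n) ≈₁₁ -[1+ n ]
    ten = congruent (divides (+ suc n) (trans (cong (ℤ._+ + suc n) (ℤₚ.pos-* 10 (suc n)))
      (ℤ-Solver.solve 1 (λ m → ℤ-Solver.con (+ 10) ℤ-Solver.:* m ℤ-Solver.:+ m ℤ-Solver.:= m ℤ-Solver.:* ℤ-Solver.con (+ 11)) refl (+ suc n))))

  moment-∑ : ∀ k {I : Set} (L : List I) f → moment k (ΣA.∑ L f) ≈₁₁ ΣZ.∑ L (λ i → moment k (f i))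
  moment-∑ k []      f = ≡⇒≈₁₁ (moment-0 k)
  moment-∑ k (i ∷ L) f = Z.trans (≡⇒≈₁₁ (moment-+ k (f i) (ΣA.∑ L f))) (Z.+-congˡ {moment k (f i)} (moment-∑ k L f))

  index : ∀ n i → ∣ i ∣ ≤ n → ∃ λ (c : Fin (suc (n ℕ.+ n))) → toℕ c ⊖ n ≡ i
  index n (+ m) m≤n = fromℕ< bound , trans (cong (_⊖ n) (Finₚ.toℕ-fromℕ< bound)) (trans (ℤₚ.⊖-≥ (ℕₚ.m≤n+m n m)) (cong +_ (ℕₚ.m+n∸n≡m m n)))
    where
    bound : m ℕ.+ n < suc (n ℕ.+ n)
    bound = s≤s (ℕₚ.+-monoˡ-≤ n m≤n)
  index n -[1+ m ] m<n = fromℕ< bound , trans (cong (_⊖ n) (Finₚ.toℕ-fromℕ< bound)) (trans (ℤₚ.⊖-≤ (ℕₚ.m∸n≤m n (suc m))) (cong (λ l → ℤ.- (+ l)) (ℕₚ.m∸[m∸n]≡n m<n)))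
    where
    bound : n ℕ.∸ suc m < suc (n ℕ.+ n)
    bound = s≤s (ℕₚ.≤-trans (ℕₚ.m∸n≤m n (suc m)) (ℕₚ.m≤m+n n n))

  ⊖-injective : ∀ {m n} l → m ⊖ l ≡ n ⊖ l → m ≡ n
  ⊖-injective {m} {n} l e = ℤₚ.+-injective (∙-cancelʳ (ℤ.- (+ l)) (+ m) (+ n) (trans (ℤₚ.m-n≡m⊖n m l) (trans e (sym (ℤₚ.m-n≡m⊖n n l)))))

  -- A partition is counted for exactly one value of the summation index, its crank, which the bound
  -- places in the range from -n to n.
  power-sum : ∀ k n ps → (∀ {π} → π ∈ ps → ∣ crank π ∣ ≤ n) →
              sum {suc (n ℕ.+ n)} (λ i → (toℕ i ⊖ n) ℤ.^ k ℤ.* + length (filter (λ π → crank π ℤ.≟ (toℕ i ⊖ n)) ps)) ≡ ΣZ.∑ ps (λ π → crank π ℤ.^ k)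
  power-sum k n []       _     = trans (sum-cong-≗ {suc (n ℕ.+ n)} (λ i → ℤₚ.*-zeroʳ ((toℕ i ⊖ n) ℤ.^ k))) (sum-replicate-zero (suc (n ℕ.+ n)))
  power-sum k n (π ∷ ps) bound with index n (crank π) (bound (here refl))
  ... | c , c⊖n≡ = begin
    sum {suc (n ℕ.+ n)} (λ i → v i ℤ.* + length (filter (λ π → crank π ℤ.≟ (toℕ i ⊖ n)) (π ∷ ps)))
      ≡⟨ sum-cong-≗ {suc (n ℕ.+ n)} first ⟩
    sum {suc (n ℕ.+ n)} (λ i → δ i ℤ.* v i ℤ.+ v i ℤ.* count i)
      ≡⟨ ∑-distrib-+ (λ i → δ i ℤ.* v i) (λ i → v i ℤ.* count i) ⟩
    sum {suc (n ℕ.+ n)} (λ i → δ i ℤ.* v i) ℤ.+ sum {suc (n ℕ.+ n)} (λ i → v i ℤ.* count i)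
      ≡⟨ cong₂ ℤ._+_ (trans (sum-pick c v) (cong (ℤ._^ k) c⊖n≡)) (power-sum k n ps (λ π∈ → bound (there π∈))) ⟩
    crank π ℤ.^ k ℤ.+ ΣZ.∑ ps (λ π → crank π ℤ.^ k) ∎
    where
    open ≡.≡-Reasoning
    v δ count : Fin (suc (n ℕ.+ n)) → ℤ
    v i = (toℕ i ⊖ n) ℤ.^ k
    δ i = if does (i Fin.≟ c) then + 1 else + 0
    count i = + length (filter (λ π → crank π ℤ.≟ (toℕ i ⊖ n)) ps)
    first : ∀ i → v i ℤ.* + length (filter (λ π → crank π ℤ.≟ (toℕ i ⊖ n)) (π ∷ ps)) ≡ δ i ℤ.* v i ℤ.+ v i ℤ.* count i
    first i with i Fin.≟ c
    ... | yes refl rewrite dec-true (crank π ℤ.≟ (toℕ c ⊖ n)) (sym c⊖n≡) =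
      ℤ-Solver.solve 2 (λ v l → v ℤ-Solver.:* (ℤ-Solver.con (+ 1) ℤ-Solver.:+ l) ℤ-Solver.:= ℤ-Solver.con (+ 1) ℤ-Solver.:* v ℤ-Solver.:+ v ℤ-Solver.:* l) refl (v c) (count c)
    ... | no i≢c rewrite dec-false (crank π ℤ.≟ (toℕ i ⊖ n)) (λ e → i≢c (Finₚ.toℕ-injective (⊖-injective n (trans (sym e) (sym c⊖n≡))))) =
      sym (trans (cong (ℤ._+ v i ℤ.* count i) (ℤₚ.*-zeroˡ (v i))) (ℤₚ.+-identityˡ _))

  moment-crankSeries : ∀ e n → moment (exponent e) (crankSeries n) ≈₁₁ Mₖ (exponent e) n
  moment-crankSeries e 0 = congruent (from-yes (Finₚ.all? λ e → + 11 ∣ₛ.∣? (moment (exponent e) A.1# ℤ.- Mₖ (exponent e) 0)) e)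
  -- The coefficient x + x⁻¹ - 1 encodes the three conventional values of M at n = 1.
  moment-crankSeries e 1 = Z.trans
    (≡⇒≈₁₁ (trans (moment-+ k (x A.+ x⁻¹) (A.- A.1#)) (cong₂ ℤ._+_ (moment-+ k x x⁻¹) (moment-neg k A.1#))))
    (Z.trans (Z.+-congʳ { ℤ.- moment k A.1# } (Z.+-congˡ {moment k x} (moment-x^ k 10)))
             (congruent (from-yes (Finₚ.all? λ e → + 11 ∣ₛ.∣? (moment (exponent e) x ℤ.+ (+ 10) ℤ.^ exponent e ℤ.+ (ℤ.- moment (exponent e) A.1#) ℤ.- Mₖ (exponent e) 1)) e)))
    where k = exponent e
  moment-crankSeries e n@(suc (suc _)) = Z.trans (moment-∑ k (partitions n) (λ ps → x^ℤ (crank ps)))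
    (Z.trans (ΣZ.∑-cong (partitions n) (λ ps → moment-x^ℤ k (crank ps)))
             (≡⇒≈₁₁ (sym (power-sum k n (partitions n) (λ π∈ → crank-bound (∈-partitions⁻ n π∈))))))
    where k = exponent e

-- Division by (q; q)_∞ and the resulting theta quotients.

module ThetaQuotients where
  import Data.Nat.Tactic.RingSolver as ℕ-Solver
  open import Data.Fin.Patterns
  open import Data.List using ([]; _∷_; foldr)

  -- The quotient of the exponent g by 11. Only residue 8 has g = 19 > 10, which is the origin of
  -- the factor q in its theta quotient.
  t-of : Residue → ℕ
  t-of r = Vec.lookup (0 ∷ 0 ∷ 0 ∷ 0 ∷ 0 ∷ 0 ∷ 0 ∷ 1 ∷ 0 ∷ 0 ∷ []) r

  module Quotients (S : CommutativeRing 0ℓ 0ℓ) (q : CommutativeRing.Carrier S) (N : ℕ) (q^≈0 : TruncatedAt S q N) (L : ℕ) (N≤L : N ≤ L) where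
    open CommutativeRing S
    open Monomials S
    open IntegerCoefficients S
    open import Relation.Binary.Reasoning.Setoid setoid
    open Nilpotent S q N q^≈0

    E : ℕ → Carrier
    E s = ∏ L (λ k → 1# - q ^ (1 ℕ.* (s ℕ.+ k ℕ.* 11)))

    total : Carrier
    total = ∏ L (λ k → 1# - q ^ (1 ℕ.* (1 ℕ.+ k ℕ.* 1)))

    total≈poch : total ≈ poch L
    total≈poch = ∏-cong L (λ k → +-congˡ (-‿cong (^-≡ q (arith k))))
      where
      arith : ∀ k → 1 ℕ.* (1 ℕ.+ k ℕ.* 1) ≡ suc k
      arith = ℕ-Solver.solve-∀

    cancel-total : ∀ {f g} → total * f ≈ total * g → f ≈ g
    cancel-total {f} {g} e = trans (sym (inverse f)) (trans (*-congˡ e) (inverse g))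
      where
      inverse : ∀ f → poch⁻¹ L * (total * f) ≈ f
      inverse f = trans (sym (*-assoc _ _ _)) (trans (*-congʳ (trans (*-congˡ total≈poch) (poch⁻¹-* L))) (*-identityˡ f))

    ∏-+ : ∀ m n F → ∏ (m ℕ.+ n) F ≈ ∏ m (λ c → F (c ℕ.+ n)) * ∏ n F
    ∏-+ zero    n F = sym (*-identityˡ _)
    ∏-+ (suc m) n F = trans (*-congˡ (∏-+ m n F)) (sym (*-assoc _ _ _))

    ∏-blocks : ∀ L b F → ∏ (L ℕ.* b) F ≈ ∏ b (λ c → ∏ L (λ k → F (c ℕ.+ k ℕ.* b)))
    ∏-blocks zero    b F = sym (∏-1 b (λ _ → refl))
    ∏-blocks (suc L) b F = trans (∏-+ b (L ℕ.* b) F) (trans (*-congˡ (∏-blocks L b F)) (sym (∏-* b _ _)))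

    -- With 11 L factors instead of L the product is unchanged, as both numbers are at least N; its
    -- factors are then sorted by the exponent modulo 11.
    total-split : total ≈ ∏ 11 (λ c → E (suc c))
    total-split = begin
      total                                               ≈⟨ total≈poch ⟩
      poch L                                              ≈⟨ poch-stable N≤L (ℕₚ.≤-trans N≤L (ℕₚ.m≤m*n L 11)) ⟩
      poch (L ℕ.* 11)                                     ≈⟨ ∏-blocks L 11 (λ k → 1# - q ^ suc k) ⟩
      ∏ 11 (λ c → ∏ L (λ k → 1# - q ^ suc (c ℕ.+ k ℕ.* 11)))
        ≈⟨ ∏-cong 11 (λ c → ∏-cong L (λ k → +-congˡ {1#} (-‿cong (^-≡ q (≡.sym (ℕₚ.+-identityʳ (suc (c ℕ.+ k ℕ.* 11)))))))) ⟩
      ∏ 11 (λ c → E (suc c))                              ∎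

    P′ : ℕ → Carrier
    P′ a = E a * E (11 ℕ.∸ a) * E 11

    J′ : Carrier
    J′ = E 11 * E 11

    -- Residue 0 has a quotient too; it disappears from the result because the k-th moment of its
    -- element 1 is 0^k = 0.
    numerator denominator : Residue → Carrier
    numerator 0F = J′
    numerator 1F = J′ * P′ 5
    numerator 2F = J′ * P′ 3
    numerator 3F = J′ * P′ 2
    numerator 4F = J′
    numerator 5F = J′ * P′ 4
    numerator 6F = J′
    numerator 7F = q ^ 1 * J′ * P′ 1
    numerator 8F = J′
    numerator 9F = J′
    denominator 0F = P′ 1
    denominator 1F = P′ 2 * P′ 3
    denominator 2F = P′ 1 * P′ 4
    denominator 3F = P′ 1 * P′ 3
    denominator 4F = P′ 2
    denominator 5F = P′ 2 * P′ 5
    denominator 6F = P′ 3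
    denominator 7F = P′ 4 * P′ 5
    denominator 8F = P′ 4
    denominator 9F = P′ 5

    product : List (ℕ × ℕ) → Carrier
    product = foldr (λ (a , m) p → ∏ L (λ k → 1# - q ^ (1 ℕ.* (a ℕ.+ k ℕ.* m))) * p) 1#

    factors : Residue → Carrier
    factors r = product (factors-of r)

    -- Once (q; q)_∞ is split into `E 1`, ..., `E 11`, both sides are the same monomial in them. The
    -- letters a to j stand for `E 1` to `E 10` and z for `E 11`; `T` is (q; q)_∞, and the arguments
    -- of `F` list the factors of `factorList` in order.
    clear-denominator : ∀ r → total * numerator r ≈ factors r * q ^ t-of r * denominator r
    clear-denominator r = trans (*-congʳ total-split) (cleared r)
      where
      𝟏 : ∀ {n} → Polynomial n
      𝟏 = con (+ 1)
      T : ∀ {n} → (a b c d e f g h i j k : Polynomial n) → Polynomial n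
      T a b c d e f g h i j k = k :* (j :* (i :* (h :* (g :* (f :* (e :* (d :* (c :* (b :* (a :* 𝟏))))))))))
      F : ∀ {n} → (a b c d e f g h z : Polynomial n) → Polynomial n
      F a b c d e f g h z = a :* (b :* (c :* (d :* (e :* (f :* (g :* (h :* (z :* (z :* 𝟏)))))))))
      cleared : ∀ r → ∏ 11 (λ c → E (suc c)) * numerator r ≈ factors r * q ^ t-of r * denominator r
      cleared 0F = solve 11 (λ a b c d e f g h i j z → T a b c d e f g h i j z :* (z :* z)
        := F e f b i g d c h z :* 𝟏 :* (a :* j :* z)) refl (E 1) (E 2) (E 3) (E 4) (E 5) (E 6) (E 7) (E 8) (E 9) (E 10) (E 11)
      cleared 1F = solve 11 (λ a b c d e f g h i j z → T a b c d e f g h i j z :* (z :* z :* (e :* f :* z))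
        := F e f a j f e d g z :* 𝟏 :* ((b :* i :* z) :* (c :* h :* z))) refl (E 1) (E 2) (E 3) (E 4) (E 5) (E 6) (E 7) (E 8) (E 9) (E 10) (E 11)
      cleared 2F = solve 11 (λ a b c d e f g h i j z → T a b c d e f g h i j z :* (z :* z :* (c :* h :* z))
        := F e f c h h c b i z :* 𝟏 :* ((a :* j :* z) :* (d :* g :* z))) refl (E 1) (E 2) (E 3) (E 4) (E 5) (E 6) (E 7) (E 8) (E 9) (E 10) (E 11)
      cleared 3F = solve 11 (λ a b c d e f g h i j z → T a b c d e f g h i j z :* (z :* z :* (b :* i :* z))
        := F d g b i f e b i z :* 𝟏 :* ((a :* j :* z) :* (c :* h :* z))) refl (E 1) (E 2) (E 3) (E 4) (E 5) (E 6) (E 7) (E 8) (E 9) (E 10) (E 11)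
      cleared 4F = solve 11 (λ a b c d e f g h i j z → T a b c d e f g h i j z :* (z :* z)
        := F d g a j e f c h z :* 𝟏 :* (b :* i :* z)) refl (E 1) (E 2) (E 3) (E 4) (E 5) (E 6) (E 7) (E 8) (E 9) (E 10) (E 11)
      cleared 5F = solve 11 (λ a b c d e f g h i j z → T a b c d e f g h i j z :* (z :* z :* (d :* g :* z))
        := F d g c h g d a j z :* 𝟏 :* ((b :* i :* z) :* (e :* f :* z))) refl (E 1) (E 2) (E 3) (E 4) (E 5) (E 6) (E 7) (E 8) (E 9) (E 10) (E 11)
      cleared 6F = solve 11 (λ a b c d e f g h i j z → T a b c d e f g h i j z :* (z :* z)
        := F e f d g i b a j z :* 𝟏 :* (c :* h :* z)) refl (E 1) (E 2) (E 3) (E 4) (E 5) (E 6) (E 7) (E 8) (E 9) (E 10) (E 11)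
      cleared 7F = solve 12 (λ a b c d e f g h i j z q → T a b c d e f g h i j z :* (q :* (z :* z) :* (a :* j :* z))
        := F b i a j c h a j z :* q :* ((d :* g :* z) :* (e :* f :* z))) refl (E 1) (E 2) (E 3) (E 4) (E 5) (E 6) (E 7) (E 8) (E 9) (E 10) (E 11) (q ^ 1)
      cleared 8F = solve 11 (λ a b c d e f g h i j z → T a b c d e f g h i j z :* (z :* z)
        := F c h b i e f a j z :* 𝟏 :* (d :* g :* z)) refl (E 1) (E 2) (E 3) (E 4) (E 5) (E 6) (E 7) (E 8) (E 9) (E 10) (E 11)
      cleared 9F = solve 11 (λ a b c d e f g h i j z → T a b c d e f g h i j z :* (z :* z)
        := F c h a j d g b i z :* 𝟏 :* (e :* f :* z)) refl (E 1) (E 2) (E 3) (E 4) (E 5) (E 6) (E 7) (E 8) (E 9) (E 10) (E 11)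

    divide : ∀ r {C c n d d⁻¹} → total * C ≈ factors r * (q ^ t-of r * c) → n ≈ numerator r → d ≈ denominator r → d * d⁻¹ ≈ 1# → C ≈ c * (n * d⁻¹)
    divide r {C} {c} {n} {d} {d⁻¹} e n≈ d≈ inverse = cancel-total (begin
      total * C                                                          ≈⟨ e ⟩
      factors r * (q ^ t-of r * c)                                       ≈⟨ trans (*-congˡ inverse) (*-identityʳ _) ⟨
      factors r * (q ^ t-of r * c) * (d * d⁻¹)                           ≈⟨ solve 5 (λ f t c d y → f :* (t :* c) :* (d :* y) := f :* t :* d :* (c :* y)) refl (factors r) (q ^ t-of r) c d d⁻¹ ⟩
      factors r * q ^ t-of r * d * (c * d⁻¹)                             ≈⟨ *-congʳ (trans (*-congˡ d≈) (sym (clear-denominator r))) ⟩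
      total * numerator r * (c * d⁻¹)                                    ≈⟨ *-congʳ (*-congˡ n≈) ⟨
      total * n * (c * d⁻¹)                                              ≈⟨ solve 4 (λ t n c y → t :* n :* (c :* y) := t :* (c :* (n :* y))) refl total n c d⁻¹ ⟩
      total * (c * (n * d⁻¹))                                            ∎)

open ThetaQuotients

-- Congruences modulo 11 between the products, one for each residue.

module MomentTransfer where
  open import Defs using (Mₖ)
  open GroupRing
  open Moments
  open CrankMoments
  import Data.Nat.DivMod as DM
  open import Data.Fin as Fin using (Fin)
  open import Data.Fin.Properties using (all?)
  open import Data.List using ([]; _∷_; allFin)
  open import Relation.Binary.PropositionalEquality using (refl; cong; cong₂; sym; trans)
  open import Data.List.Membership.Propositional.Properties using (∈-allFin)
  open import Data.List.Relation.Unary.Any using (here)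
  open import Data.List.Relation.Unary.All using ([])
  open import Data.List.Relation.Unary.AllPairs using ([]; _∷_)
  import Data.List.Relation.Unary.Unique.Propositional.Properties as Uniqueₚ
  open import Relation.Nullary.Decidable using (from-yes; _→-dec_)

  open A^ using (_^_)

  module PA = PowerSeries groupRing
  module PZ = PowerSeries ℤ₁₁

  u₀ : Residue → Element
  u₀ = Units.unit groupRing x

  residue : Residue → ℕ
  residue r = Vec.lookup (0 ∷ 1 ∷ 2 ∷ 3 ∷ 4 ∷ 5 ∷ 7 ∷ 8 ∷ 9 ∷ 10 ∷ []) r

  g≡ : ∀ r → g-of r ≡ 11 ℕ.* t-of r ℕ.+ residue r
  g≡ = from-yes (all? λ r → g-of r ℕ.≟ 11 ℕ.* t-of r ℕ.+ residue r)

  residue<11 : ∀ r → residue r < 11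
  residue<11 = from-yes (all? λ r → residue r ℕ.<? 11)

  residue-injective : ∀ r s → residue r ≡ residue s → r ≡ s
  residue-injective = from-yes (all? λ r → all? λ s → (residue r ℕ.≟ residue s) →-dec (r Fin.≟ s))

  module Transfer (N₁ : ℕ) where
    open PA.Truncated N₁ using (X-nilpotent; const-*; const-cong; const-+; const-neg; eulers-⊛; ∏-⊛; X^-⊛)
    private
      S = PA.truncated N₁
      module S = CommutativeRing S
      open CrankSeries groupRing x x⁻¹ using (crankSeries)
      open Monomials S using () renaming (_^_ to _^ˢ_)

      halve : ∀ f → f S.+ f S.≈ S.0# → f S.≈ S.0#
      halve f e n n≤ k = ℤₚ.*-cancelˡ-≡ (+ 2) (f n k) (+ 0) (trans (2*≡ (f n k)) (e n n≤ k))
        where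
        2*≡ : ∀ i → + 2 ℤ.* i ≡ i ℤ.+ i
        2*≡ i = trans (ℤₚ.*-distribʳ-+ i (+ 1) (+ 1)) (cong₂ ℤ._+_ (ℤₚ.*-identityˡ i) (ℤₚ.*-identityˡ i))

      constants : RingHomomorphism groupRing S
      constants = record { ι = PA.const ; ι-cong = const-cong ; ι-+ = const-+ ; ι-* = const-* ; ι-neg = const-neg ; ι-1 = λ _ _ _ → refl }

      module Tr = Transported groupRing S constants x x^11≈1 PA.X N₁ X-nilpotent halve crankSeries
        (CrankProduct.crank-product groupRing x x⁻¹ x^11≈1 N₁)
      module Pr = Products S PA.X N₁ X-nilpotent

    L : ℕ
    L = N₁ ℕ.+ (N₁ ℕ.+ 4)

    private
      remainder : S.Carrier
      remainder = Pr.euler 11 (1 , 1) S.* crankSeries S.- Tr.components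

      -- The annihilating factor is a constant series, so it kills every coefficient up to the
      -- truncation order, and `annihilator` applies in the group ring.
      remainder-constant : ∀ n → n ≤ N₁ → Constant (remainder n)
      remainder-constant n n≤N₁ = annihilator (remainder n) (A.trans {(x ^ 2 ✶ D₀) ✶ remainder n} {(PA.const (x ^ 2 ✶ D₀) PA.⊛ remainder) n} {A.0#}
        (A.sym {(PA.const (x ^ 2 ✶ D₀) PA.⊛ remainder) n} (PA.const-⊛ (x ^ 2 ✶ D₀) remainder n)) (Tr.annihilated n n≤N₁))

      open Coefficientwise groupRing ℤ₁₁
      open Decimation ℤ₁₁

      multiples : ℕ → ℕ
      multiples k = 11 ℕ.* (1 ℕ.+ k ℕ.* 1)

      ∑-coefficient : ∀ {I : Set} (l : List I) f n → ListSum.∑ S l f n ≡ ΣA.∑ l (λ i → f i n)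
      ∑-coefficient []      f n = refl
      ∑-coefficient (i ∷ l) f n = cong (f i n A.+_) (∑-coefficient l f n)

      product-coefficient : ∀ l g c n → (Pr.eulers 11 l S.* ((PA.X ^ˢ g) S.* c)) n A.≈ PA.times-eulers L 11 l (PA.shift g c) n
      product-coefficient l g c n = A.trans {(Pr.eulers 11 l S.* ((PA.X ^ˢ g) S.* c)) n} {PA.times-eulers L 11 l ((PA.X ^ˢ g) S.* c) n}
        (eulers-⊛ L 11 l ((PA.X ^ˢ g) S.* c) n) (PA.times-eulers-cong L 11 l {(PA.X ^ˢ g) S.* c} {PA.shift g c} (X^-⊛ g c) n)

      component-coefficient : ∀ r n → (Pr.eulers 11 (factors-of r) S.* ((PA.X ^ˢ g-of r) S.* PA.const (u₀ r))) n A.≈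
                                      PA.times-eulers L 11 (factors-of r) (PA.shift (g-of r) (PA.const (u₀ r))) n
      component-coefficient r n = product-coefficient (factors-of r) (g-of r) (PA.const (u₀ r)) n

      module _ (e : Even) where
        k : ℕ
        k = exponent e

        h-+ : ∀ f g → moment k (f A.+ g) ≈₁₁ moment k f ℤ.+ moment k g
        h-+ f g = ≡⇒≈₁₁ (moment-+ k f g)
        h-neg : ∀ f → moment k (A.- f) ≈₁₁ ℤ.- moment k f
        h-neg f = ≡⇒≈₁₁ (moment-neg k f)
        h-zero : moment k A.0# ≈₁₁ + 0
        h-zero = ≡⇒≈₁₁ (moment-0 k)

        moment-left : ∀ n → moment k ((Pr.euler 11 (1 , 1) S.* crankSeries) n) ≈₁₁ PZ.times-all L multiples (Mₖ k) n
        moment-left n = Z.trans (≡⇒≈₁₁ (moment-cong k {(Pr.euler 11 (1 , 1) S.* crankSeries) n} {PA.times-all L multiples crankSeries n} (∏-⊛ L multiples crankSeries n)))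
          (Z.trans (h-times-all (moment k) h-+ h-neg h-zero L multiples crankSeries n)
                   (PZ.times-all-cong L multiples (moment-crankSeries e) n))

        moment-component : ∀ r n → moment k (PA.times-eulers L 11 (factors-of r) (PA.shift (g-of r) (PA.const (u₀ r))) n) ≈₁₁
                                   PZ.times-eulers L 11 (factors-of r) (PZ.shift (g-of r) (PZ.const (moment k (u₀ r)))) n
        moment-component r n = Z.trans (h-times-eulers (moment k) h-+ h-neg h-zero L 11 (factors-of r) (PA.shift (g-of r) (PA.const (u₀ r))) n)
          (PZ.times-eulers-cong L 11 (factors-of r) (λ m → Z.trans (h-shift (moment k) h-+ h-neg h-zero (g-of r) (PA.const (u₀ r)) m)
            (PZ.shift-cong (g-of r) (h-const (moment k) h-+ h-neg h-zero (u₀ r)) m)) n)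

        moment-right : ∀ n → moment k (Tr.components n) ≈₁₁ ΣZ.∑ (allFin 10) (λ r → PZ.times-eulers L 11 (factors-of r) (PZ.shift (g-of r) (PZ.const (moment k (u₀ r)))) n)
        moment-right n = Z.trans (≡⇒≈₁₁ (cong (moment k) (∑-coefficient (allFin 10) (λ r → Pr.eulers 11 (factors-of r) S.* ((PA.X ^ˢ g-of r) S.* PA.const (u₀ r))) n)))
          (Z.trans (moment-∑ k (allFin 10) (λ r → (Pr.eulers 11 (factors-of r) S.* ((PA.X ^ˢ g-of r) S.* PA.const (u₀ r))) n))
          (ΣZ.∑-cong (allFin 10) (λ r → Z.trans (≡⇒≈₁₁ (moment-cong k {(Pr.eulers 11 (factors-of r) S.* ((PA.X ^ˢ g-of r) S.* PA.const (u₀ r))) n} {PA.times-eulers L 11 (factors-of r) (PA.shift (g-of r) (PA.const (u₀ r))) n} (component-coefficient r n)))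
                                                (moment-component r n))))

        balance : ∀ n → n ≤ N₁ → moment k ((Pr.euler 11 (1 , 1) S.* crankSeries) n) ≈₁₁ moment k (Tr.components n)
        balance n n≤N₁ = difference-0 (Z.trans (Z.sym (Z.trans (h-+ a (A.- b)) (Z.+-congˡ {moment k a} (h-neg b)))) (moment-constant e (remainder n) (remainder-constant n n≤N₁)))
          where
          a = (Pr.euler 11 (1 , 1) S.* crankSeries) n
          b = Tr.components n
          open import Algebra.Properties.Group Z.+-group using (x∙y⁻¹≈ε⇒x≈y)
          difference-0 : ∀ {i j} → i ℤ.- j ≈₁₁ + 0 → i ≈₁₁ j
          difference-0 {i} {j} = x∙y⁻¹≈ε⇒x≈y i j

        -- The single nonzero exponent g is congruent to the residue of r, and distinct indices have
        -- distinct residues modulo 11.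
        off : ∀ r s → ¬ r ≡ s → ∀ c n → decimate (residue s) (PZ.shift (g-of r) (PZ.const c)) n ≈₁₁ + 0
        off r s r≢s c n = shift-const-off (g-of r) c (11 ℕ.* n ℕ.+ residue s) (λ eq → r≢s (residue-injective r s
          (trans (sym (remainder-of (t-of r) r)) (trans (cong (DM._% 11) (trans (sym (g≡ r)) (sym eq))) (remainder-of n s)))))
          where
          remainder-of : ∀ n r → (11 ℕ.* n ℕ.+ residue r) DM.% 11 ≡ residue r
          remainder-of n r = trans (cong (DM._% 11) (trans (ℕₚ.+-comm (11 ℕ.* n) (residue r)) (cong (residue r ℕ.+_) (ℕₚ.*-comm 11 n))))
            (trans (DM.[m+kn]%n≡m%n (residue r) n 11) (DM.m<n⇒m%n≡m (residue<11 r)))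

    -- Each component is q^g times a series in q¹¹, so extracting the exponents in the class of s
    -- retains exactly the component r = s and turns its q^g into q^t.
    transfer : ∀ e s n → 11 ℕ.* n ℕ.+ residue s ≤ N₁ →
               PZ.times-all L (λ k → 1 ℕ.* (1 ℕ.+ k ℕ.* 1)) (λ m → Mₖ (exponent e) (11 ℕ.* m ℕ.+ residue s)) n ≈₁₁
               PZ.times-eulers L 1 (factors-of s) (PZ.shift (t-of s) (PZ.const (moment (exponent e) (u₀ s)))) n
    transfer e s n n≤ = begin
      PZ.times-all L (λ k → 1 ℕ.* (1 ℕ.+ k ℕ.* 1)) (decimate (residue s) (Mₖ (exponent e))) n
        ≈⟨ decimate-times-all (residue<11 s) L (λ k → 1 ℕ.+ k ℕ.* 1) (Mₖ (exponent e)) n ⟨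
      PZ.times-all L multiples (Mₖ (exponent e)) n′
        ≈⟨ moment-left e n′ ⟨
      moment (exponent e) ((Pr.euler 11 (1 , 1) S.* crankSeries) n′)
        ≈⟨ balance e n′ n≤ ⟩
      moment (exponent e) (Tr.components n′)
        ≈⟨ moment-right e n′ ⟩
      ΣZ.∑ (allFin 10) (λ r → PZ.times-eulers L 11 (factors-of r) (δ r) n′)
        ≈⟨ ΣZ.∑-support Fin._≟_ (λ r → PZ.times-eulers L 11 (factors-of r) (δ r) n′) (Uniqueₚ.allFin⁺ 10) ([] ∷ []) (λ r r∉ → contradiction (∈-allFin r) r∉)
             (λ r r∉ → Z.trans (decimate-times-eulers (residue<11 s) L (factors-of r) (δ r) n) (times-eulers-0 L 1 (factors-of r) (off e r s (λ r≡s → r∉ (here r≡s)) _) n)) ⟩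
      PZ.times-eulers L 11 (factors-of s) (δ s) n′ ℤ.+ + 0
        ≈⟨ Z.+-identityʳ (PZ.times-eulers L 11 (factors-of s) (δ s) n′) ⟩
      PZ.times-eulers L 11 (factors-of s) (δ s) n′
        ≈⟨ decimate-times-eulers (residue<11 s) L (factors-of s) (δ s) n ⟩
      PZ.times-eulers L 1 (factors-of s) (decimate (residue s) (δ s)) n
        ≈⟨ PZ.times-eulers-cong L 1 (factors-of s) (λ m → Z.trans (≡⇒≈₁₁ (cong (λ g → PZ.shift g (PZ.const (moment (exponent e) (u₀ s))) (11 ℕ.* m ℕ.+ residue s)) (g≡ s)))
             (decimate-const (residue<11 s) (t-of s) (moment (exponent e) (u₀ s)) m)) n ⟩
      PZ.times-eulers L 1 (factors-of s) (PZ.shift (t-of s) (PZ.const (moment (exponent e) (u₀ s)))) n ∎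
      where
      open import Relation.Binary.Reasoning.Setoid Z.setoid
      n′ = 11 ℕ.* n ℕ.+ residue s
      δ : Residue → ℕ → ℤ
      δ r = PZ.shift (g-of r) (PZ.const (moment (exponent e) (u₀ r)))

-- Identification with the theta quotients of formal power series.

module SeriesQuotients where
  open import Defs
  open GroupRing
  open Moments
  open CrankMoments
  open MomentTransfer
  open import Data.Fin using (zero; suc)
  open import Data.Fin.Patterns
  open import Data.Fin.Properties using (all?)
  open import Relation.Binary.PropositionalEquality using (refl; cong; sym; trans)
  open import Relation.Nullary.Decidable using (from-yes; dec-true; dec-false)

  numeratorₛ denominatorₛ : Residue → Series
  numeratorₛ 0F = J₁₁²
  numeratorₛ 1F = J₁₁² ⊛ P 5
  numeratorₛ 2F = J₁₁² ⊛ P 3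
  numeratorₛ 3F = J₁₁² ⊛ P 2
  numeratorₛ 4F = J₁₁²
  numeratorₛ 5F = J₁₁² ⊛ P 4
  numeratorₛ 6F = J₁₁²
  numeratorₛ 7F = q^ 1 ⊛ J₁₁² ⊛ P 1
  numeratorₛ 8F = J₁₁²
  numeratorₛ 9F = J₁₁²
  denominatorₛ 0F = P 1
  denominatorₛ 1F = P 2 ⊛ P 3
  denominatorₛ 2F = P 1 ⊛ P 4
  denominatorₛ 3F = P 1 ⊛ P 3
  denominatorₛ 4F = P 2
  denominatorₛ 5F = P 2 ⊛ P 5
  denominatorₛ 6F = P 3
  denominatorₛ 7F = P 4 ⊛ P 5
  denominatorₛ 8F = P 4
  denominatorₛ 9F = P 5

  quotient : Residue → Series
  quotient r = numeratorₛ r ⊘ denominatorₛ r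

  denominator-constant : ∀ r → denominatorₛ r 0 ≡ + 1
  denominator-constant = from-yes (all? λ r → denominatorₛ r 0 ℤ.≟ + 1)

  module Truncation (N : ℕ) where
    private
      -- Every exponent 11 n + r with n ≤ N and r ≤ 10 has to lie below this order.
      N₁ = 11 ℕ.* N ℕ.+ 10
      S = PZ.truncated N
      module S = CommutativeRing S
      module S^ = Monomials S
      open PZ.Truncated N using (X-nilpotent; X^-⊛; ∏-⊛; eulers-⊛)
      open Decimation ℤ₁₁ using (shift-const-on; shift-const-off)
      module Tr = Transfer N₁

      N<L : N < Tr.L
      N<L = ℕₚ.≤-trans (ℕₚ.≤-reflexive (ℕₚ.+-comm 1 N))
        (ℕₚ.≤-trans (ℕₚ.+-mono-≤ (ℕₚ.m≤n*m N 11) (s≤s {0} {9} z≤n)) (ℕₚ.m≤m+n N₁ (N₁ ℕ.+ 4)))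

      module Q = Quotients S PZ.X N X-nilpotent Tr.L (ℕₚ.<⇒≤ N<L)

      q^≈X^ : ∀ e → (q^ e) S.≈ PZ.X S^.^ e
      q^≈X^ e n _ = Z.trans (Z.trans (delta e n) (Z.sym (X^-⊛ e (PZ.const (+ 1)) n)))
        (Z.trans (PZ.⊛-comm (PZ.X S^.^ e) (PZ.const (+ 1)) n) (PZ.⊛-identityˡ (PZ.X S^.^ e) n))
        where
        delta : ∀ e n → (q^ e) n ≈₁₁ PZ.shift e (PZ.const (+ 1)) n
        delta e n with n ℕ.≟ e
        ... | yes refl rewrite dec-true (n ℕ.≟ n) refl = Z.sym (shift-const-on n (+ 1))
        ... | no n≢e rewrite dec-false (n ℕ.≟ e) n≢e = Z.sym (shift-const-off e (+ 1) n n≢e)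

      factor≈ : ∀ a k → pochFactor a 11 k S.≈ S.1# S.- PZ.X S^.^ (1 ℕ.* (a ℕ.+ k ℕ.* 11))
      factor≈ a k n n≤N = Z.+-cong (q^≈X^ 0 n n≤N) (Z.-‿cong (Z.trans (q^≈X^ (a ℕ.+ k ℕ.* 11) n n≤N)
        (≡⇒≈₁₁ (cong (λ e → (PZ.X S^.^ e) n) (sym (ℕₚ.*-identityˡ (a ℕ.+ k ℕ.* 11)))))))

      ∏<≈ : ∀ a L → ∏< L (pochFactor a 11) S.≈ S^.∏ L (λ k → S.1# S.- PZ.X S^.^ (1 ℕ.* (a ℕ.+ k ℕ.* 11)))
      ∏<≈ a zero    = q^≈X^ 0
      ∏<≈ a (suc L) = S.*-cong {pochFactor a 11 L} {S.1# S.- PZ.X S^.^ (1 ℕ.* (a ℕ.+ L ℕ.* 11))} {∏< L (pochFactor a 11)} (factor≈ a L) (∏<≈ a L)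

      -- The coefficient of q^n is defined through n + 1 factors; stability extends them to a number
      -- of factors that is common to all n ≤ N.
      poch≈ : ∀ a → 1 ≤ a → poch a 11 S.≈ Q.E a
      poch≈ a 1≤a n n≤N = Z.trans (≡⇒≈₁₁ (trans (sym (poch-stable a 11 1≤a (s≤s z≤n) n (Tr.L ℕ.∸ suc n)))
        (cong (λ L → ∏< L (pochFactor a 11) n) (ℕₚ.m∸n+n≡m (ℕₚ.≤-trans (s≤s n≤N) N<L))))) (∏<≈ a Tr.L n n≤N)

      infixl 7 _⟨*⟩_
      _⟨*⟩_ : ∀ {f g f′ g′} → f S.≈ f′ → g S.≈ g′ → (f ⊛ g) S.≈ (f′ S.* g′)
      _⟨*⟩_ {f} {g} {f′} {g′} e e′ = S.*-cong {f} {f′} {g} {g′} e e′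

      P≈ : ∀ a → 1 ≤ a → 1 ≤ 11 ℕ.∸ a → P a S.≈ Q.P′ a
      P≈ a 1≤a 1≤11-a = poch≈ a 1≤a ⟨*⟩ poch≈ (11 ℕ.∸ a) 1≤11-a ⟨*⟩ poch≈ 11 (s≤s z≤n)

      J≈ : J₁₁² S.≈ Q.J′
      J≈ = poch≈ 11 (s≤s z≤n) ⟨*⟩ poch≈ 11 (s≤s z≤n)

      P₁≈ : P 1 S.≈ Q.P′ 1
      P₁≈ = P≈ 1 (s≤s z≤n) (s≤s z≤n)
      P₂≈ : P 2 S.≈ Q.P′ 2
      P₂≈ = P≈ 2 (s≤s z≤n) (s≤s z≤n)
      P₃≈ : P 3 S.≈ Q.P′ 3
      P₃≈ = P≈ 3 (s≤s z≤n) (s≤s z≤n)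
      P₄≈ : P 4 S.≈ Q.P′ 4
      P₄≈ = P≈ 4 (s≤s z≤n) (s≤s z≤n)
      P₅≈ : P 5 S.≈ Q.P′ 5
      P₅≈ = P≈ 5 (s≤s z≤n) (s≤s z≤n)

      numerator≈ : ∀ r → numeratorₛ r S.≈ Q.numerator r
      numerator≈ 0F = J≈
      numerator≈ 1F = J≈ ⟨*⟩ P₅≈
      numerator≈ 2F = J≈ ⟨*⟩ P₃≈
      numerator≈ 3F = J≈ ⟨*⟩ P₂≈
      numerator≈ 4F = J≈
      numerator≈ 5F = J≈ ⟨*⟩ P₄≈
      numerator≈ 6F = J≈
      numerator≈ 7F = q^≈X^ 1 ⟨*⟩ J≈ ⟨*⟩ P₁≈
      numerator≈ 8F = J≈
      numerator≈ 9F = J≈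

      denominator≈ : ∀ r → denominatorₛ r S.≈ Q.denominator r
      denominator≈ 0F = P₁≈
      denominator≈ 1F = P₂≈ ⟨*⟩ P₃≈
      denominator≈ 2F = P₁≈ ⟨*⟩ P₄≈
      denominator≈ 3F = P₁≈ ⟨*⟩ P₃≈
      denominator≈ 4F = P₂≈
      denominator≈ 5F = P₂≈ ⟨*⟩ P₅≈
      denominator≈ 6F = P₃≈
      denominator≈ 7F = P₄≈ ⟨*⟩ P₅≈
      denominator≈ 8F = P₄≈
      denominator≈ 9F = P₅≈

      inverse : ∀ r → (denominatorₛ r S.* inv (denominatorₛ r)) S.≈ S.1#
      inverse r n n≤N = Z.trans (≡⇒≈₁₁ (⊛-inv (denominatorₛ r) (denominator-constant r) n)) (q^≈X^ 0 n n≤N)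

      left : ∀ f n → n ≤ N → (Q.total S.* f) n ≈₁₁ PZ.times-all Tr.L (λ k → 1 ℕ.* (1 ℕ.+ k ℕ.* 1)) f n
      left f n _ = ∏-⊛ Tr.L (λ k → 1 ℕ.* (1 ℕ.+ k ℕ.* 1)) f n

      right : ∀ l t c n → n ≤ N → PZ.times-eulers Tr.L 1 l (PZ.shift t c) n ≈₁₁ (Q.product l S.* ((PZ.X S^.^ t) S.* c)) n
      right l t c n _ = Z.trans (PZ.times-eulers-cong Tr.L 1 l (λ n → Z.sym (X^-⊛ t c n)) n)
                 (Z.sym (eulers-⊛ Tr.L 1 l ((PZ.X S^.^ t) S.* c) n))

      equation : ∀ e r → (Q.total S.* Tᶜ (exponent e) (residue r)) S.≈ (Q.factors r S.* ((PZ.X S^.^ t-of r) S.* PZ.const (moment (exponent e) (u₀ r))))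
      equation e r n n≤N = Z.trans (left (Tᶜ (exponent e) (residue r)) n n≤N)
        (Z.trans (Tr.transfer e r n (ℕₚ.+-mono-≤ (ℕₚ.*-monoʳ-≤ 11 n≤N) (ℕₚ.≤-pred (residue<11 r))))
                 (right (factors-of r) (t-of r) (PZ.const (moment (exponent e) (u₀ r))) n n≤N))

      divided : ∀ e r → Tᶜ (exponent e) (residue r) S.≈ (PZ.const (moment (exponent e) (u₀ r)) S.* (numeratorₛ r S.* inv (denominatorₛ r)))
      divided e r = Q.divide r {Tᶜ (exponent e) (residue r)} {PZ.const (moment (exponent e) (u₀ r))} {numeratorₛ r} {denominatorₛ r} {inv (denominatorₛ r)}
        (equation e r) (numerator≈ r) (denominator≈ r) (inverse r)

    -- The truncation order is taken to be the very coefficient that is read off, so the congruence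
    -- holds for the untruncated series.
    crank-moments : ∀ e r → Tᶜ (exponent e) (residue r) N ≈₁₁ moment (exponent e) (u₀ r) ℤ.* quotient r N
    crank-moments e r = Z.trans (divided e r N ℕₚ.≤-refl) (PZ.const-⊛ (moment (exponent e) (u₀ r)) (numeratorₛ r S.* inv (denominatorₛ r)) N)

-- Explicit multipliers and the assembly of chains.

module Normalisation where
  open import Defs
  open GroupRing
  open Moments
  open CrankMoments
  open MomentTransfer
  open SeriesQuotients
  import Data.Integer.Divisibility.Signed as ∣ₛ
  open import Data.Fin.Patterns
  open import Data.Fin.Properties using (all?)
  open import Data.List using ([]; _∷_)
  open import Data.List.Relation.Unary.Linked using ([]; [-]; _∷_)
  open import Relation.Binary.PropositionalEquality using (refl)
  open import Relation.Nullary.Decidable using (from-yes)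

  open A^ using (_^_)

  -- A record, so that f can be inferred.
  record HasMoment (k : ℕ) (f : Element) (i : ℤ) : Set where
    constructor has-moment
    field moment≈ : moment k f ≈₁₁ i

  open HasMoment

  module _ (k : ℕ) where
    private
      p : ℕ → ℤ
      p n = (+ n) ℤ.^ k
      m : ∀ n → HasMoment k (x ^ n) (p n)
      m n = has-moment (moment-x^ k n)
      infixl 6 _⟨+⟩_ _⟨-⟩_
      _⟨+⟩_ : ∀ {f g i j} → HasMoment k f i → HasMoment k g j → HasMoment k (f A.+ g) (i ℤ.+ j)
      _⟨+⟩_ {f} {g} (has-moment e) (has-moment e′) = has-moment (Z.trans (≡⇒≈₁₁ (moment-+ k f g)) (Z.+-cong e e′))
      ⟨-⟩_ : ∀ {f i} → HasMoment k f i → HasMoment k (A.- f) (ℤ.- i)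
      ⟨-⟩_ {f} (has-moment e) = has-moment (Z.trans (≡⇒≈₁₁ (moment-neg k f)) (Z.-‿cong e))
      _⟨-⟩_ : ∀ {f g i j} → HasMoment k f i → HasMoment k g j → HasMoment k (f A.- g) (i ℤ.- j)
      e ⟨-⟩ e′ = e ⟨+⟩ (⟨-⟩ e′)

    unit-moment : Residue → ℤ
    unit-moment 0F = p 0
    unit-moment 1F = p 1 ℤ.+ p 10 ℤ.- p 0
    unit-moment 2F = p 2 ℤ.+ p 9
    unit-moment 3F = p 0 ℤ.+ p 3 ℤ.+ p 8
    unit-moment 4F = p 0 ℤ.+ p 2 ℤ.+ p 4 ℤ.+ p 7 ℤ.+ p 9
    unit-moment 5F = ℤ.- p 2 ℤ.- p 4 ℤ.- p 7 ℤ.- p 9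
    unit-moment 6F = p 1 ℤ.+ p 4 ℤ.+ p 7 ℤ.+ p 10
    unit-moment 7F = p 1 ℤ.+ p 3 ℤ.+ p 4 ℤ.+ p 7 ℤ.+ p 8 ℤ.+ p 10
    unit-moment 8F = ℤ.- p 0 ℤ.- p 4 ℤ.- p 7
    unit-moment 9F = ℤ.- p 3 ℤ.- p 8

    moment-unit : ∀ r → HasMoment k (u₀ r) (unit-moment r)
    moment-unit 0F = m 0
    moment-unit 1F = m 1 ⟨+⟩ m 10 ⟨-⟩ m 0
    moment-unit 2F = m 2 ⟨+⟩ m 9
    moment-unit 3F = m 0 ⟨+⟩ m 3 ⟨+⟩ m 8
    moment-unit 4F = m 0 ⟨+⟩ m 2 ⟨+⟩ m 4 ⟨+⟩ m 7 ⟨+⟩ m 9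
    moment-unit 5F = ⟨-⟩ m 2 ⟨-⟩ m 4 ⟨-⟩ m 7 ⟨-⟩ m 9
    moment-unit 6F = m 1 ⟨+⟩ m 4 ⟨+⟩ m 7 ⟨+⟩ m 10
    moment-unit 7F = m 1 ⟨+⟩ m 3 ⟨+⟩ m 4 ⟨+⟩ m 7 ⟨+⟩ m 8 ⟨+⟩ m 10
    moment-unit 8F = ⟨-⟩ m 0 ⟨-⟩ m 4 ⟨-⟩ m 7
    moment-unit 9F = ⟨-⟩ m 3 ⟨-⟩ m 8

  -- The moment of the element 1 is 0^k = 0, and that of x + x¹⁰ - 1 is 1 + (-1)^k = 2 modulo 11 for
  -- even k, which explains the first two values.
  target : Residue → ℤ
  target 0F = + 0
  target 1F = + 2
  target _  = + 1

  -- Rows are residues, columns the exponents 2, 4, 6, 8. From the third row on the entries are the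
  -- inverses modulo 11 of the moments of u_r.
  multiplier : Residue → Even → ℤ
  multiplier r = Vec.lookup (Vec.map +_ (Vec.lookup
    ((1 ∷ 1 ∷ 1 ∷ 1 ∷ []) ∷ (1 ∷ 1 ∷ 1 ∷ 1 ∷ []) ∷ (7 ∷ 10 ∷ 8 ∷ 2 ∷ []) ∷ (8 ∷ 7 ∷ 2 ∷ 10 ∷ []) ∷ (8 ∷ 9 ∷ 3 ∷ 6 ∷ []) ∷
     (3 ∷ 2 ∷ 8 ∷ 5 ∷ []) ∷ (1 ∷ 7 ∷ 10 ∷ 5 ∷ []) ∷ (7 ∷ 9 ∷ 9 ∷ 7 ∷ []) ∷ (1 ∷ 9 ∷ 4 ∷ 3 ∷ []) ∷ (3 ∷ 4 ∷ 9 ∷ 1 ∷ []) ∷ []) r))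

  normalise : ∀ r e → multiplier r e ℤ.* unit-moment (exponent e) r ≈₁₁ target r
  normalise r e = congruent (from-yes (all? λ r → all? λ e → + 11 ∣ₛ.∣? (multiplier r e ℤ.* unit-moment (exponent e) r ℤ.- target r)) r e)

  congruence : ∀ r e n → multiplier r e ℤ.* Tᶜ (exponent e) (residue r) n ≈₁₁ target r ℤ.* quotient r n
  congruence r e n = begin
    c ℤ.* Tᶜ (exponent e) (residue r) n                    ≈⟨ Z.*-congˡ {c} (Truncation.crank-moments n e r) ⟩
    c ℤ.* (moment (exponent e) (u₀ r) ℤ.* quotient r n)    ≈⟨ Z.*-assoc c (moment (exponent e) (u₀ r)) (quotient r n) ⟨
    c ℤ.* moment (exponent e) (u₀ r) ℤ.* quotient r n      ≈⟨ Z.*-congʳ {quotient r n} (Z.*-congˡ {c} (moment≈ (moment-unit (exponent e) r))) ⟩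
    c ℤ.* unit-moment (exponent e) r ℤ.* quotient r n      ≈⟨ Z.*-congʳ {quotient r n} (normalise r e) ⟩
    target r ℤ.* quotient r n                              ∎
    where
    c = multiplier r e
    open import Relation.Binary.Reasoning.Setoid Z.setoid

  link : ∀ {f g} → (∀ n → f n ≈₁₁ g n) → CongruentMod (+ 11) f g
  link e n = ∣ₛ.∣⇒∣ᵤ (_≈₁₁_.11∣difference (e n))

  chain : ∀ {f₁ f₂ f₃ f₄ g} → (∀ n → f₁ n ≈₁₁ g n) → (∀ n → f₂ n ≈₁₁ g n) → (∀ n → f₃ n ≈₁₁ g n) → (∀ n → f₄ n ≈₁₁ g n) →
          Chain₁₁ (f₁ ∷ f₂ ∷ f₃ ∷ f₄ ∷ g ∷ [])
  chain {f₁} {f₂} {f₃} {f₄} {g} e₁ e₂ e₃ e₄ = link {f₁} {f₂} (λ n → Z.trans (e₁ n) (Z.sym (e₂ n))) ∷ link {f₂} {f₃} (λ n → Z.trans (e₂ n) (Z.sym (e₃ n))) ∷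
    link {f₃} {f₄} (λ n → Z.trans (e₃ n) (Z.sym (e₄ n))) ∷ link {f₄} {g} e₄ ∷ [-]

  -- The equations let the numerals of the theorem be matched without unfolding Tᶜ.
  scaled : ∀ r e k s c → exponent e ≡ k → residue r ≡ s → multiplier r e ≡ c → ∀ n → (c · Tᶜ k s) n ≈₁₁ target r ℤ.* quotient r n
  scaled r e _ _ _ refl refl refl = congruence r e

  unscaled : ∀ r e k s → exponent e ≡ k → residue r ≡ s → multiplier r e ≡ + 1 → ∀ n → Tᶜ k s n ≈₁₁ target r ℤ.* quotient r n
  unscaled r e k s k≡ s≡ c≡1 n = Z.trans (Z.sym (Z.*-identityˡ (Tᶜ k s n))) (scaled r e k s (+ 1) k≡ s≡ c≡1 n)

-- The ten chains of congruences.

open import Defs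
open import Data.List using ([]; _∷_)
open import Data.Fin.Patterns
open import Relation.Binary.PropositionalEquality using (refl)
open Moments
open MomentTransfer using (residue)
open SeriesQuotients using (quotient)
open Normalisation

theorem2p9 :
    Chain₁₁ (Tᶜ 2 0 ∷ Tᶜ 4 0 ∷ Tᶜ 6 0 ∷ Tᶜ 8 0 ∷ 0ₛ ∷ [])
    × Chain₁₁ (Tᶜ 2 1 ∷ Tᶜ 4 1 ∷ Tᶜ 6 1 ∷ Tᶜ 8 1 ∷ + 2 · (J₁₁² ⊛ P 5 ⊘ (P 2 ⊛ P 3)) ∷ [])
    × Chain₁₁ (+ 7 · Tᶜ 2 2 ∷ + 10 · Tᶜ 4 2 ∷ + 8 · Tᶜ 6 2 ∷ + 2 · Tᶜ 8 2 ∷ J₁₁² ⊛ P 3 ⊘ (P 1 ⊛ P 4) ∷ [])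
    × Chain₁₁ (+ 8 · Tᶜ 2 3 ∷ + 7 · Tᶜ 4 3 ∷ + 2 · Tᶜ 6 3 ∷ + 10 · Tᶜ 8 3 ∷ J₁₁² ⊛ P 2 ⊘ (P 1 ⊛ P 3) ∷ [])
    × Chain₁₁ (+ 8 · Tᶜ 2 4 ∷ + 9 · Tᶜ 4 4 ∷ + 3 · Tᶜ 6 4 ∷ + 6 · Tᶜ 8 4 ∷ J₁₁² ⊘ P 2 ∷ [])
    × Chain₁₁ (+ 3 · Tᶜ 2 5 ∷ + 2 · Tᶜ 4 5 ∷ + 8 · Tᶜ 6 5 ∷ + 5 · Tᶜ 8 5 ∷ J₁₁² ⊛ P 4 ⊘ (P 2 ⊛ P 5) ∷ [])
    × Chain₁₁ (Tᶜ 2 7 ∷ + 7 · Tᶜ 4 7 ∷ + 10 · Tᶜ 6 7 ∷ + 5 · Tᶜ 8 7 ∷ J₁₁² ⊘ P 3 ∷ [])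
    × Chain₁₁ (+ 7 · Tᶜ 2 8 ∷ + 9 · Tᶜ 4 8 ∷ + 9 · Tᶜ 6 8 ∷ + 7 · Tᶜ 8 8 ∷ q^ 1 ⊛ J₁₁² ⊛ P 1 ⊘ (P 4 ⊛ P 5) ∷ [])
    × Chain₁₁ (Tᶜ 2 9 ∷ + 9 · Tᶜ 4 9 ∷ + 4 · Tᶜ 6 9 ∷ + 3 · Tᶜ 8 9 ∷ J₁₁² ⊘ P 4 ∷ [])
    × Chain₁₁ (+ 3 · Tᶜ 2 10 ∷ + 4 · Tᶜ 4 10 ∷ + 9 · Tᶜ 6 10 ∷ Tᶜ 8 10 ∷ J₁₁² ⊘ P 5 ∷ [])
theorem2p9 =
    chain (vanishing 0F 2 refl refl) (vanishing 1F 4 refl refl) (vanishing 2F 6 refl refl) (vanishing 3F 8 refl refl)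
  , chain (unscaled 1F 0F 2 1 refl refl refl) (unscaled 1F 1F 4 1 refl refl refl) (unscaled 1F 2F 6 1 refl refl refl) (unscaled 1F 3F 8 1 refl refl refl)
  , all-scaled 2F 2 (+ 7) (+ 10) (+ 8) (+ 2) refl refl refl refl refl refl
  , all-scaled 3F 3 (+ 8) (+ 7) (+ 2) (+ 10) refl refl refl refl refl refl
  , all-scaled 4F 4 (+ 8) (+ 9) (+ 3) (+ 6) refl refl refl refl refl refl
  , all-scaled 5F 5 (+ 3) (+ 2) (+ 8) (+ 5) refl refl refl refl refl refl
  , chain (monic 6F refl (unscaled 6F 0F 2 7 refl refl refl)) (monic 6F refl (scaled 6F 1F 4 7 (+ 7) refl refl refl))
          (monic 6F refl (scaled 6F 2F 6 7 (+ 10) refl refl refl)) (monic 6F refl (scaled 6F 3F 8 7 (+ 5) refl refl refl))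
  , all-scaled 7F 8 (+ 7) (+ 9) (+ 9) (+ 7) refl refl refl refl refl refl
  , chain (monic 8F refl (unscaled 8F 0F 2 9 refl refl refl)) (monic 8F refl (scaled 8F 1F 4 9 (+ 9) refl refl refl))
          (monic 8F refl (scaled 8F 2F 6 9 (+ 4) refl refl refl)) (monic 8F refl (scaled 8F 3F 8 9 (+ 3) refl refl refl))
  , chain (monic 9F refl (scaled 9F 0F 2 10 (+ 3) refl refl refl)) (monic 9F refl (scaled 9F 1F 4 10 (+ 4) refl refl refl))
          (monic 9F refl (scaled 9F 2F 6 10 (+ 9) refl refl refl)) (monic 9F refl (unscaled 9F 3F 8 10 refl refl refl))
  where
  -- The moment 0 of residue 0 annihilates its quotient.
  vanishing : ∀ e k → exponent e ≡ k → multiplier 0F e ≡ + 1 → ∀ n → Tᶜ k 0 n ≈₁₁ + 0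
  vanishing e k k≡ c≡1 n = Z.trans (unscaled 0F e k 0 k≡ refl c≡1 n) (Z.zeroˡ (quotient 0F n))
  monic : ∀ r {f : Series} → target r ≡ + 1 → (∀ n → f n ≈₁₁ target r ℤ.* quotient r n) → ∀ n → f n ≈₁₁ quotient r n
  monic r t≡1 e n = Z.trans (e n) (Z.trans (Z.*-congʳ {quotient r n} (≡⇒≈₁₁ t≡1)) (Z.*-identityˡ (quotient r n)))
  all-scaled : ∀ r s c₂ c₄ c₆ c₈ → target r ≡ + 1 → residue r ≡ s →
               multiplier r 0F ≡ c₂ → multiplier r 1F ≡ c₄ → multiplier r 2F ≡ c₆ → multiplier r 3F ≡ c₈ →
               Chain₁₁ (c₂ · Tᶜ 2 s ∷ c₄ · Tᶜ 4 s ∷ c₆ · Tᶜ 6 s ∷ c₈ · Tᶜ 8 s ∷ quotient r ∷ [])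
  all-scaled r s c₂ c₄ c₆ c₈ t≡1 s≡ e₂ e₄ e₆ e₈ =
    chain (monic r t≡1 (scaled r 0F 2 s c₂ refl s≡ e₂)) (monic r t≡1 (scaled r 1F 4 s c₄ refl s≡ e₄))
          (monic r t≡1 (scaled r 2F 6 s c₆ refl s≡ e₆)) (monic r t≡1 (scaled r 3F 8 s c₈ refl s≡ e₈))
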